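{- Let $G$ be a subgroup of the ring automorphism group $\mathrm{Aut}(\mathcal O)$ isomorphic to $D_n$ for some $n\in\{1,2,3,4,6\}$, and let $G$ act on $\mathcal O/N\mathcal O$ via reduction for integers $N\geq1$. (a) If $N$ is coprime to $2$ and $3$, then $(\mathcal O/N\mathcal O)^G\simeq(\mathbb Z/N\mathbb Z)^2$ if $G\simeq D_1$, and $(\mathcal O/N\mathcal O)^G\simeq \mathbb Z/N\mathbb Z$ if $G\simeq D_2,D_3,D_4$ or $D_6$. (b) $(\mathcal O/3\mathcal O)^G$ is isomorphic to $(\mathbb Z/3\mathbb Z)^2$ if $G\simeq D_1$; to $\mathbb Z/3\mathbb Z$ if $G\simeq D_2,D_4,D_6$; and to $\mathbb Z/3\mathbb Z$ or $(\mathbb Z/3\mathbb Z)^2$ if $G\simeq D_3$. (c) $(\mathcal O/2\mathcal O)^G$ is isomorphic to $(\mathbb Z/2\mathbb Z)^2$, $(\mathbb Z/2\mathbb Z)^3$ or $(\mathbb Z/2\mathbb Z)^4$ if $G\simeq D_1$; to $(\mathbb Z/2\mathbb Z)^2$ or $(\mathbb Z/2\mathbb Z)^3$ if $G\simeq D_2$; to $(\mathbb Z/2\mathbb Z)^2$ if $G\simeq D_4$; and to $\mathbb Z/2\mathbb Z$ if $G\simeq D_3$ or $D_6$.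
   Context: Let $B$ be an indefinite quaternion algebra over $\mathbb Q$ (i.e. $B\otimes\mathbb R\simeq\mathrm{Mat}_2(\mathbb R)$) which is a division algebra, and let $\mathcal O$ be a maximal order of $B$. $D_n$ denotes the dihedral group of order $2n$ (so $D_1\simeq C_2$ and $D_2\simeq C_2\times C_2$). For a group $G$ acting on a set $X$, $X^G$ denotes the set of $G$-fixed points. -}

module Defs where

open import Level using (Level; 0ℓ; suc)
open import Data.Nat as ℕ using (ℕ; NonZero; _%_)
open import Data.Nat.DivMod using (m%n<n)
open import Data.Integer as ℤ using (ℤ; +_)
open import Data.Integer.Divisibility as ℤD using ()
open import Data.Rational as ℚ using (ℚ; 0ℚ; 1ℚ; _/_)
open import Data.Fin as Fin using (Fin; toℕ; fromℕ<)
open import Data.Bool using (Bool; true; false; _xor_)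
open import Data.Product using (Σ; ∃; _×_; _,_)
open import Relation.Binary.PropositionalEquality using (_≡_; _≢_)
open import Function using (_⇔_)

-- Quaternion algebras over ℚ in Hilbert presentation B = (a,b)_ℚ:
-- basis 1, i, j, k = ij with i² = a, j² = b, ij = -ji.
-- Every quaternion algebra over ℚ is of this form.

record Quat : Set where
  constructor quat
  field
    q0 q1 q2 q3 : ℚ

fromℚ : ℚ → Quat
fromℚ r = quat r 0ℚ 0ℚ 0ℚ

zeroQ oneQ : Quat
zeroQ = fromℚ 0ℚ
oneQ  = fromℚ 1ℚ

ℤtoℚ : ℤ → ℚ
ℤtoℚ z = z / 1

_+Q_ : Quat → Quat → Quat
quat x0 x1 x2 x3 +Q quat y0 y1 y2 y3 =
  quat (x0 ℚ.+ y0) (x1 ℚ.+ y1) (x2 ℚ.+ y2) (x3 ℚ.+ y3)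

-Q_ : Quat → Quat
-Q quat x0 x1 x2 x3 = quat (ℚ.- x0) (ℚ.- x1) (ℚ.- x2) (ℚ.- x3)

_-Q_ : Quat → Quat → Quat
x -Q y = x +Q (-Q y)

_·Q_ : ℚ → Quat → Quat
r ·Q quat x0 x1 x2 x3 = quat (r ℚ.* x0) (r ℚ.* x1) (r ℚ.* x2) (r ℚ.* x3)

mulQ : (a b : ℚ) → Quat → Quat → Quat
mulQ a b (quat x0 x1 x2 x3) (quat y0 y1 y2 y3) = quat
  (x0 ℚ.* y0 ℚ.+ a ℚ.* x1 ℚ.* y1 ℚ.+ b ℚ.* x2 ℚ.* y2 ℚ.- a ℚ.* b ℚ.* x3 ℚ.* y3)
  (x0 ℚ.* y1 ℚ.+ x1 ℚ.* y0 ℚ.- b ℚ.* x2 ℚ.* y3 ℚ.+ b ℚ.* x3 ℚ.* y2)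
  (x0 ℚ.* y2 ℚ.+ x2 ℚ.* y0 ℚ.+ a ℚ.* x1 ℚ.* y3 ℚ.- a ℚ.* x3 ℚ.* y1)
  (x0 ℚ.* y3 ℚ.+ x3 ℚ.* y0 ℚ.+ x1 ℚ.* y2 ℚ.- x2 ℚ.* y1)

lincomb : (Fin 4 → ℚ) → (Fin 4 → Quat) → Quat
lincomb c e = ((c Fin.zero ·Q e Fin.zero) +Q (c (Fin.suc Fin.zero) ·Q e (Fin.suc Fin.zero)))
  +Q ((c (Fin.suc (Fin.suc Fin.zero)) ·Q e (Fin.suc (Fin.suc Fin.zero)))
  +Q (c (Fin.suc (Fin.suc (Fin.suc Fin.zero))) ·Q e (Fin.suc (Fin.suc (Fin.suc Fin.zero)))))

IsDivisionAlgebra : (a b : ℚ) → Set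
IsDivisionAlgebra a b =
  ∀ x → x ≢ zeroQ → ∃ λ y → mulQ a b x y ≡ oneQ × mulQ a b y x ≡ oneQ

-- (a,b)_ℚ ⊗ ℝ ≅ Mat₂(ℝ)  ⟺  (a,b)_ℝ is split  ⟺  a > 0 or b > 0
-- (ℝ is not available).
data IsIndefinite (a b : ℚ) : Set where
  a-pos : a ℚ.> 0ℚ → IsIndefinite a b
  b-pos : b ℚ.> 0ℚ → IsIndefinite a b

SubsetQ : Set₁
SubsetQ = Quat → Set

record IsOrder (a b : ℚ) (O : SubsetQ) : Set where
  field
    basis      : Fin 4 → Quat
    spans      : ∀ x → ∃ λ (r : Fin 4 → ℚ) → x ≡ lincomb r basis
    independent : ∀ (r : Fin 4 → ℚ) → lincomb r basis ≡ zeroQ → ∀ i → r i ≡ 0ℚ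
    lattice    : ∀ x → O x ⇔ (∃ λ (c : Fin 4 → ℤ) → x ≡ lincomb (λ i → ℤtoℚ (c i)) basis)
    has-one    : O oneQ
    mul-closed : ∀ x y → O x → O y → O (mulQ a b x y)

record IsMaximalOrder (a b : ℚ) (O : SubsetQ) : Set₁ where
  field
    isOrder : IsOrder a b O
    maximal : ∀ (O' : SubsetQ) → IsOrder a b O' → (∀ x → O x → O' x) → ∀ x → O' x → O x

-- Ring automorphisms of O (given by a map on B, only its values on O matter)

record IsRingAut (a b : ℚ) (O : SubsetQ) (σ : Quat → Quat) : Set where
  field
    preserves : ∀ x → O x → O (σ x)
    additive  : ∀ x y → O x → O y → σ (x +Q y) ≡ σ x +Q σ y
    multiplicative : ∀ x y → O x → O y → σ (mulQ a b x y) ≡ mulQ a b (σ x) (σ y)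
    unital    : σ oneQ ≡ oneQ
    injective : ∀ x y → O x → O y → σ x ≡ σ y → x ≡ y
    surjective : ∀ y → O y → ∃ λ x → O x × σ x ≡ y

-- The dihedral group D_n of order 2n: elements r^k s^e, k ∈ ℤ/n, e ∈ {0,1}
-- with s r s⁻¹ = r⁻¹, i.e. (k₁,e₁)(k₂,e₂) = (k₁ + (-1)^{e₁} k₂, e₁ xor e₂).

module _ (n : ℕ) .{{_ : NonZero n}} where

  modn : ℕ → Fin n
  modn m = fromℕ< (m%n<n m n)

  Dih : Set
  Dih = Fin n × Bool

  dih-e : Dih
  dih-e = modn 0 , false

  dih-mul : Dih → Dih → Dih
  dih-mul (k₁ , false) (k₂ , e₂) = modn (toℕ k₁ ℕ.+ toℕ k₂) , e₂
  dih-mul (k₁ , true)  (k₂ , e₂) = modn (toℕ k₁ ℕ.+ (n ℕ.∸ toℕ k₂)) , (true xor e₂)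

-- G ⊆ Aut(O) with G ≅ D_n: an injective group homomorphism D_n → Aut(O)
-- (G is its image).
record IsDihedralSubgroup (a b : ℚ) (O : SubsetQ) (n : ℕ) .{{_ : NonZero n}}
       (φ : Dih n → Quat → Quat) : Set where
  field
    aut     : ∀ g → IsRingAut a b O (φ g)
    hom-e   : ∀ x → O x → φ (dih-e n) x ≡ x
    hom-mul : ∀ g h x → O x → φ (dih-mul n g h) x ≡ φ g (φ h x)
    faithful : ∀ g h → (∀ x → O x → φ g x ≡ φ h x) → g ≡ h

InNO : (O : SubsetQ) (N : ℕ) → Quat → Set
InNO O N x = ∃ λ y → O y × x ≡ ℤtoℚ (+ N) ·Q y

FixedModN : (O : SubsetQ) (N : ℕ) {D : Set} (φ : D → Quat → Quat) → Quat → Set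
FixedModN O N φ x = ∀ g → InNO O N (φ g x -Q x)

-- (O/NO)^G ≅ (ℤ/Nℤ)^m as abelian groups, witnessed by a homomorphism
-- f : ℤ^m → (O/NO)^G which is surjective with kernel exactly N ℤ^m.
addℤv : {m : ℕ} → (Fin m → ℤ) → (Fin m → ℤ) → Fin m → ℤ
addℤv v w i = v i ℤ.+ w i

record FixedIsoZmodN (O : SubsetQ) (N : ℕ) {D : Set} (φ : D → Quat → Quat) (m : ℕ) : Set where
  field
    f         : (Fin m → ℤ) → Quat
    f-in-O    : ∀ v → O (f v)
    f-fixed   : ∀ v → FixedModN O N φ (f v)
    f-hom     : ∀ v w → InNO O N (f (addℤv v w) -Q (f v +Q f w))
    f-surj    : ∀ x → O x → FixedModN O N φ x → ∃ λ v → InNO O N (x -Q f v)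
    f-kernel  : ∀ v → InNO O N (f v) ⇔ (∀ i → (+ N) ℤD.∣ v i)

{-# OPTIONS --safe #-}
-- Every automorphism of O extends to B and is conjugation by some β (Skolem–Noether).
-- An involution has fixed algebra ℚ + ℚβ, and two commuting involutions, or an element of
-- order 3 and an involution inverting it, have fixed algebra ℚ. When |G| is invertible modulo
-- N, averaging over G identifies (O/N)^G with (O^G)/N, which settles (a); in (b) the
-- subgroups C₂ and C₂ × C₂ suffice. Modulo 2 the rank is at least two for C₂ and C₂ × C₂ by
-- counting, since Σ_g gx = 2 tr x is even, and the remaining bounds come from maximality:
-- * if C₂ × C₂ acted trivially on O/2, then O = ℤ + ℤu₁ + ℤu₂ + ℤu₃ with anticommuting uᵢ,
--   which is properly contained in a larger order;
-- * a rotation r of order 3 is conjugation by ω with ω² + ω + 1 = 0, one of order 4 is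
--   conjugation by 1 + i with i² = −1, and O + Oω, O + Oi are orders, so ω, i ∈ O;
-- * for D₄, if r − 1 had rank at most one on O/2, a larger order would again exist.
module Submission where

open import Defs
open import Algebra.Structures using (IsRing)
open import Data.Bool using (Bool; true; false; _∧_; _xor_; not; if_then_else_; T)
open import Data.Empty using (⊥; ⊥-elim)
open import Data.Fin using (Fin; zero; suc; toℕ; fromℕ<; combine; finToFun; funToFin)
import Data.Fin as Fin
import Data.Fin.Properties as FinP
open import Data.Fin.Properties using (all?; any?; toℕ-fromℕ<; pigeonhole; combine-injectiveˡ; combine-injectiveʳ; funToFin-finToFin)
open import Data.Integer using (ℤ; +_; -[1+_]; 0ℤ; 1ℤ)
import Data.Integer as ℤ
open import Data.Integer.DivMod using (_/ℕ_; _%ℕ_; n%ℕd<d; a≡a%ℕn+[a/ℕn]*n)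
import Data.Integer.Divisibility.Signed as ℤS
open import Data.Integer.Divisibility.Signed using (divides; _∣?_; ∣⇒∣ᵤ; ∣ᵤ⇒∣)
import Data.Integer.Properties as ℤP
open import Data.List using (List; []; _∷_; _++_; map; foldr; replicate)
open import Data.Nat using (ℕ; zero; suc; NonZero; _≥_; _≤_; _≡ᵇ_; _≤ᵇ_; z≤n; s≤s)
import Data.Nat as ℕ
open import Data.Nat.Coprimality using (Coprime; coprime-Bézout)
import Data.Nat.Divisibility as ℕD
open import Data.Nat.GCD using (module Bézout; module GCD)
import Data.Nat.Properties as ℕP
open import Data.Product using (Σ; ∃; ∃₂; _×_; _,_; proj₁; proj₂)
open import Data.Rational using (ℚ; 0ℚ; 1ℚ; mkℚ; toℚᵘ)
import Data.Rational as ℚ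
import Data.Rational.Properties as ℚP
import Data.Rational.Unnormalised as ℚᵘ
import Data.Rational.Unnormalised.Properties as ℚᵘP
open import Data.Sum using (_⊎_; inj₁; inj₂; [_,_]′)
import Data.Sum as Sum
open import Data.Unit using (tt)
open import Data.Vec using (Vec; []; _∷_; lookup)
import Data.Vec as Vec
open import Data.Vec.Properties using (∷-injective)
open import Function using (_⇔_; mk⇔; Equivalence)
open import Relation.Binary.Definitions using (DecidableEquality)
open import Relation.Binary.PropositionalEquality hiding (J)
open import Relation.Nullary using (¬_; Dec; yes; no; contradiction)

-- What shapes the argument is that integrality of traces and norms has to come from the group
-- itself. A rational element of O is an integer, as its action on a basis vector of O shows, so
-- every rational orbit sum is an integer. For C₂ × C₂ this yields 2 tr x ∈ ℤ, and the square of
-- that integer turns out to be even; hence tr x ∈ ℤ and O is stable under conjugation. This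
-- stability is what allows an overlattice O + ℤv to be recognised as an order by left
-- multiplications alone. For D₃ the trace of an element y of O commuting with ω is read off as y +
-- s y.
--
-- The fixed space modulo a prime is a decidable subspace, so its dimension is produced by Gaussian
-- elimination and the work lies in excluding ranks.
--
-- A rational scalar is an element with a nonzero integer multiple that is an integer. Linear
-- algebra over ℚ thereby turns into noncommutative ring identities over ℤ, each certified as an
-- ideal membership.

-- Rings with propositional equality and a map from the integers.

record ℤRing : Set₁ where
  infixl 6 _+_ _-_
  infixl 7 _*_
  infix 8 -_
  field
    A : Set
    _+_ _*_ : A → A → A
    -_ : A → A
    0# 1# : A
    isRing : IsRing _≡_ _+_ _*_ -_ 0# 1#
    int : ℤ → A
    int-+ : ∀ m n → int (m ℤ.+ n) ≡ int m + int n
    int-* : ∀ m n → int (m ℤ.* n) ≡ int m * int n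
    int-1 : int 1ℤ ≡ 1#

  open IsRing isRing public
    using (+-assoc; +-comm; +-identityˡ; +-identityʳ; *-assoc; *-identityˡ; *-identityʳ;
           distribˡ; distribʳ; zeroˡ; zeroʳ; -‿inverseˡ; -‿inverseʳ)

  _-_ : A → A → A
  x - y = x + - y

  +-cancelˡ : ∀ x {y z} → x + y ≡ x + z → y ≡ z
  +-cancelˡ x {y} {z} h = begin
    y             ≡⟨ +-identityˡ y ⟨
    0# + y        ≡⟨ cong (_+ y) (-‿inverseˡ x) ⟨
    - x + x + y   ≡⟨ +-assoc _ _ _ ⟩
    - x + (x + y) ≡⟨ cong (λ w → - x + w) h ⟩
    - x + (x + z) ≡⟨ +-assoc _ _ _ ⟨
    - x + x + z   ≡⟨ cong (_+ z) (-‿inverseˡ x) ⟩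
    0# + z        ≡⟨ +-identityˡ z ⟩
    z             ∎
    where open ≡-Reasoning

  neg-unique : ∀ x {y} → x + y ≡ 0# → y ≡ - x
  neg-unique x h = +-cancelˡ x (trans h (sym (-‿inverseʳ x)))

  int-0 : int 0ℤ ≡ 0#
  int-0 = +-cancelˡ (int 0ℤ) (trans (sym (int-+ 0ℤ 0ℤ)) (sym (+-identityʳ _)))

  int-neg : ∀ n → int (ℤ.- n) ≡ - int n
  int-neg n = neg-unique (int n) (trans (sym (int-+ n (ℤ.- n))) (trans (cong int (ℤP.+-inverseʳ n)) int-0))

  neg-distribˡ : ∀ x y → - x * y ≡ - (x * y)
  neg-distribˡ x y = neg-unique (x * y) (trans (sym (distribʳ y x (- x))) (trans (cong (_* y) (-‿inverseʳ x)) (zeroˡ y)))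

  neg-distribʳ : ∀ x y → x * - y ≡ - (x * y)
  neg-distribʳ x y = neg-unique (x * y) (trans (sym (distribˡ x y (- y))) (trans (cong (x *_) (-‿inverseʳ y)) (zeroʳ x)))

  neg-involutive : ∀ x → - - x ≡ x
  neg-involutive x = sym (neg-unique (- x) (-‿inverseˡ x))

  neg-+ : ∀ x y → - (x + y) ≡ - x + - y
  neg-+ x y = sym (neg-unique (x + y) (begin
    x + y + (- x + - y)   ≡⟨ cong (λ z → x + y + z) (+-comm (- x) (- y)) ⟩
    x + y + (- y + - x)   ≡⟨ +-assoc x y _ ⟩
    x + (y + (- y + - x)) ≡⟨ cong (λ w → x + w) (+-assoc y (- y) (- x)) ⟨
    x + (y + - y + - x)   ≡⟨ cong (λ z → x + (z + - x)) (-‿inverseʳ y) ⟩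
    x + (0# + - x)        ≡⟨ cong (λ w → x + w) (+-identityˡ (- x)) ⟩
    x + - x               ≡⟨ -‿inverseʳ x ⟩
    0#                    ∎))
    where open ≡-Reasoning

  neg-0 : - 0# ≡ 0#
  neg-0 = sym (neg-unique 0# (+-identityˡ 0#))

  Central : A → Set
  Central a = ∀ x → a * x ≡ x * a

  pos-central : ∀ n → Central (int (+ n))
  pos-central zero x = trans (trans (cong (_* x) int-0) (zeroˡ x)) (sym (trans (cong (x *_) int-0) (zeroʳ x)))
  pos-central (suc n) x = begin
    int (1ℤ ℤ.+ + n) * x          ≡⟨ cong (_* x) (int-+ 1ℤ (+ n)) ⟩
    (int 1ℤ + int (+ n)) * x      ≡⟨ distribʳ x _ _ ⟩
    int 1ℤ * x + int (+ n) * x    ≡⟨ cong₂ _+_ (trans (cong (_* x) int-1) (*-identityˡ x)) (pos-central n x) ⟩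
    x + x * int (+ n)             ≡⟨ cong (_+ x * int (+ n)) (trans (cong (x *_) int-1) (*-identityʳ x)) ⟨
    x * int 1ℤ + x * int (+ n)    ≡⟨ distribˡ x _ _ ⟨
    x * (int 1ℤ + int (+ n))      ≡⟨ cong (x *_) (int-+ 1ℤ (+ n)) ⟨
    x * int (+ suc n)             ∎
    where open ≡-Reasoning

  int-central : ∀ n → Central (int n)
  int-central (+ n) = pos-central n
  int-central -[1+ n ] x = begin
    int -[1+ n ] * x        ≡⟨ cong (_* x) (int-neg (+ suc n)) ⟩
    - int (+ suc n) * x     ≡⟨ neg-distribˡ _ x ⟩
    - (int (+ suc n) * x)   ≡⟨ cong -_ (pos-central (suc n) x) ⟩
    - (x * int (+ suc n))   ≡⟨ neg-distribʳ x _ ⟨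
    x * - int (+ suc n)     ≡⟨ cong (x *_) (int-neg (+ suc n)) ⟨
    x * int -[1+ n ]        ∎
    where open ≡-Reasoning

-- A normaliser for noncommutative polynomials with central letters.

infixl 6 _⊕_ _⊖_
infixl 7 _⊗_
infix 8 ⊝_

data ℤExpr : Set where
  𝕫 : ℕ → ℤExpr
  con : ℤ → ℤExpr
  _⊕_ _⊗_ _⊖_ : ℤExpr → ℤExpr → ℤExpr
  ⊝_ : ℤExpr → ℤExpr

-- Letters 𝕩 commute with nothing, letters 𝕔 are central, ι embeds integer expressions.
data Expr : Set where
  𝕩 𝕔 : ℕ → Expr
  ι : ℤExpr → Expr
  con : ℤ → Expr
  𝟘 𝟙 : Expr
  _⊕_ _⊗_ _⊖_ : Expr → Expr → Expr
  ⊝_ : Expr → Expr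

-- A polynomial is a list of signed words, coefficients being expressed by repetition;
-- insertion cancels a word against its opposite, so a difference of equal
-- polynomials normalises to the empty list. The central part of a word is kept sorted.
Letter = Bool × ℕ
Word = List Letter × List ℕ
Mono = Bool × Word
Poly = List Mono

eqℕs : List ℕ → List ℕ → Bool
eqℕs [] [] = true
eqℕs (m ∷ ms) (n ∷ ns) = (m ≡ᵇ n) ∧ eqℕs ms ns
eqℕs _ _ = false

eqB : Bool → Bool → Bool
eqB true b = b
eqB false b = not b

eqLs : List Letter → List Letter → Bool
eqLs [] [] = true
eqLs ((b , m) ∷ ms) ((b′ , n) ∷ ns) = (m ≡ᵇ n) ∧ (eqB b b′ ∧ eqLs ms ns)
eqLs _ _ = false

eqW : Word → Word → Bool
eqW (ls , ns) (ls′ , ns′) = eqℕs ns ns′ ∧ eqLs ls ls′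

∧-true : ∀ {a b} → a ∧ b ≡ true → a ≡ true × b ≡ true
∧-true {true} {true} refl = refl , refl

≡ᵇ-true : ∀ m n → (m ≡ᵇ n) ≡ true → m ≡ n
≡ᵇ-true m n h = ℕP.≡ᵇ⇒≡ m n (subst T (sym h) tt)

eqB-sound : ∀ a b → eqB a b ≡ true → a ≡ b
eqB-sound true true _ = refl
eqB-sound false false _ = refl

eqℕs-sound : ∀ ms ns → eqℕs ms ns ≡ true → ms ≡ ns
eqℕs-sound [] [] _ = refl
eqℕs-sound (m ∷ ms) (n ∷ ns) h with h₁ , h₂ ← ∧-true h = cong₂ _∷_ (≡ᵇ-true m n h₁) (eqℕs-sound ms ns h₂)

eqLs-sound : ∀ ms ns → eqLs ms ns ≡ true → ms ≡ ns
eqLs-sound [] [] _ = refl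
eqLs-sound ((b , m) ∷ ms) ((b′ , n) ∷ ns) h with h₁ , h₂ ← ∧-true h with h₃ , h₄ ← ∧-true h₂ =
  cong₂ _∷_ (cong₂ _,_ (eqB-sound b b′ h₃) (≡ᵇ-true m n h₁)) (eqLs-sound ms ns h₄)

eqW-sound : ∀ v w → eqW v w ≡ true → v ≡ w
eqW-sound (ls , ns) (ls′ , ns′) h with h₁ , h₂ ← ∧-true h = cong₂ _,_ (eqLs-sound ls ls′ h₂) (eqℕs-sound ns ns′ h₁)

insert : Mono → Poly → Poly
-- The flags say that the two words agree and that their signs differ. Stopping at the first equal
-- word keeps copies of a word adjacent and of one sign, so that cancellation is complete.
insertIf : Bool → Bool → Mono → Mono → Poly → Poly
insert m [] = m ∷ []
insert (s , w) ((s′ , w′) ∷ p) = insertIf (eqW w w′) (s xor s′) (s , w) (s′ , w′) p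
insertIf true true m m′ p = p
insertIf true false m m′ p = m ∷ m′ ∷ p
insertIf false _ m m′ p = m′ ∷ insert m p

infixl 6 _⊞_
infixl 7 _⊠_
_⊞_ : Poly → Poly → Poly
p ⊞ q = foldr insert q p

negM : Mono → Mono
negM (s , w) = not s , w

letter≤ : Letter → Letter → Bool
letter≤ (false , m) (true , n) = true
letter≤ (true , m) (false , n) = false
letter≤ (_ , m) (_ , n) = m ≤ᵇ n

insertL : Letter → List Letter → List Letter
insertL l [] = l ∷ []
insertL l (l′ ∷ ls) = if letter≤ l l′ then l ∷ l′ ∷ ls else l′ ∷ insertL l ls

mulM : Mono → Mono → Mono
mulM (s , ls , ns) (s′ , ls′ , ns′) = s xor s′ , foldr insertL ls′ ls , ns ++ ns′

_⊠_ : Poly → Poly → Poly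
p ⊠ q = foldr (λ m r → map (mulM m) q ⊞ r) [] p

unit : Bool → Mono
unit s = s , [] , []

normCon : ℤ → Poly
normCon (+ n) = replicate n (unit false)
normCon -[1+ n ] = replicate (suc n) (unit true)

normℤ : ℤExpr → Poly
normℤ (𝕫 k) = (false , (true , k) ∷ [] , []) ∷ []
normℤ (con n) = normCon n
normℤ (e ⊕ f) = normℤ e ⊞ normℤ f
normℤ (e ⊗ f) = normℤ e ⊠ normℤ f
normℤ (e ⊖ f) = normℤ e ⊞ map negM (normℤ f)
normℤ (⊝ e) = map negM (normℤ e)

norm : Expr → Poly
norm (𝕩 k) = (false , [] , k ∷ []) ∷ []
norm (𝕔 k) = (false , (false , k) ∷ [] , []) ∷ []
norm (ι e) = normℤ e
norm (con n) = normCon n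
norm 𝟘 = []
norm 𝟙 = unit false ∷ []
norm (e ⊕ f) = norm e ⊞ norm f
norm (e ⊗ f) = norm e ⊠ norm f
norm (e ⊖ f) = norm e ⊞ map negM (norm f)
norm (⊝ e) = map negM (norm e)

module Solve (R : ℤRing) where
  open ℤRing R

  lookupOr : {B : Set} → B → List B → ℕ → B
  lookupOr d [] _ = d
  lookupOr d (b ∷ bs) zero = b
  lookupOr d (b ∷ bs) (suc k) = lookupOr d bs k

  module Env (cs : List (Σ A Central)) (zs : List ℤ) (xs : List A) where

    ⟦_⟧ℤ : ℤExpr → ℤ
    ⟦ 𝕫 k ⟧ℤ = lookupOr 0ℤ zs k
    ⟦ con n ⟧ℤ = n
    ⟦ e ⊕ f ⟧ℤ = ⟦ e ⟧ℤ ℤ.+ ⟦ f ⟧ℤ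
    ⟦ e ⊗ f ⟧ℤ = ⟦ e ⟧ℤ ℤ.* ⟦ f ⟧ℤ
    ⟦ e ⊖ f ⟧ℤ = ⟦ e ⟧ℤ ℤ.- ⟦ f ⟧ℤ
    ⟦ ⊝ e ⟧ℤ = ℤ.- ⟦ e ⟧ℤ

    ctr : ℕ → Σ A Central
    ctr = lookupOr (0# , λ y → trans (zeroˡ y) (sym (zeroʳ y))) cs

    ⟦_⟧ : Expr → A
    ⟦ 𝕩 k ⟧ = lookupOr 0# xs k
    ⟦ 𝕔 k ⟧ = proj₁ (ctr k)
    ⟦ ι e ⟧ = int ⟦ e ⟧ℤ
    ⟦ con n ⟧ = int n
    ⟦ 𝟘 ⟧ = 0#
    ⟦ 𝟙 ⟧ = 1#
    ⟦ e ⊕ f ⟧ = ⟦ e ⟧ + ⟦ f ⟧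
    ⟦ e ⊗ f ⟧ = ⟦ e ⟧ * ⟦ f ⟧
    ⟦ e ⊖ f ⟧ = ⟦ e ⟧ - ⟦ f ⟧
    ⟦ ⊝ e ⟧ = - ⟦ e ⟧

    letter : Letter → Σ A Central
    letter (false , k) = ctr k
    letter (true , k) = int (lookupOr 0ℤ zs k) , int-central _

    evalLs : List Letter → A
    evalLs [] = 1#
    evalLs (l ∷ ls) = proj₁ (letter l) * evalLs ls

    evalℕs : List ℕ → A
    evalℕs [] = 1#
    evalℕs (k ∷ ks) = lookupOr 0# xs k * evalℕs ks

    evalW : Word → A
    evalW (ls , ks) = evalLs ls * evalℕs ks

    sgn : Bool → A → A
    sgn false y = y
    sgn true y = - y

    evalM : Mono → A
    evalM (s , w) = sgn s (evalW w)

    eval : Poly → A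
    eval [] = 0#
    eval (m ∷ p) = evalM m + eval p

    open ≡-Reasoning

    swap : ∀ u v w → u + (v + w) ≡ v + (u + w)
    swap u v w = trans (sym (+-assoc u v w)) (trans (cong (_+ w) (+-comm u v)) (+-assoc v u w))

    insert-correct : ∀ m p → eval (insert m p) ≡ evalM m + eval p
    insertIf-correct : ∀ e d m m′ p → (e ≡ true → d ≡ true → evalM m + evalM m′ ≡ 0#) →
      eval (insertIf e d m m′ p) ≡ evalM m + (evalM m′ + eval p)
    cancel : ∀ s s′ w → s xor s′ ≡ true → sgn s w + sgn s′ w ≡ 0#
    cancel true false w _ = -‿inverseˡ w
    cancel false true w _ = -‿inverseʳ w
    insert-correct m [] = refl
    insert-correct (s , w) ((s′ , w′) ∷ p) =
      insertIf-correct (eqW w w′) (s xor s′) (s , w) (s′ , w′) p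
        λ e d → trans (cong (λ v → sgn s (evalW w) + sgn s′ (evalW v)) (sym (eqW-sound w w′ e))) (cancel s s′ (evalW w) d)
    insertIf-correct true true m m′ p h = begin
      eval p                         ≡⟨ +-identityˡ _ ⟨
      0# + eval p                    ≡⟨ cong (_+ eval p) (h refl refl) ⟨
      evalM m + evalM m′ + eval p    ≡⟨ +-assoc _ _ _ ⟩
      evalM m + (evalM m′ + eval p)  ∎
    insertIf-correct true false m m′ p h = refl
    insertIf-correct false _ m m′ p h = trans (cong (λ w → evalM m′ + w) (insert-correct m p)) (swap _ _ _)

    ⊞-correct : ∀ p q → eval (p ⊞ q) ≡ eval p + eval q
    ⊞-correct [] q = sym (+-identityˡ _)
    ⊞-correct (m ∷ p) q = trans (insert-correct m (p ⊞ q)) (trans (cong (λ w → evalM m + w) (⊞-correct p q)) (sym (+-assoc _ _ _)))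

    negM-correct : ∀ m → evalM (negM m) ≡ - evalM m
    negM-correct (false , w) = refl
    negM-correct (true , w) = sym (neg-involutive _)

    neg-correct : ∀ p → eval (map negM p) ≡ - eval p
    neg-correct [] = sym neg-0
    neg-correct (m ∷ p) = trans (cong₂ _+_ (negM-correct m) (neg-correct p)) (sym (neg-+ _ _))

    insertL-correct : ∀ l ls → evalLs (insertL l ls) ≡ proj₁ (letter l) * evalLs ls
    insertL-correct l [] = refl
    insertL-correct l (l′ ∷ ls) with letter≤ l l′
    ... | true = refl
    ... | false = begin
      a′ * evalLs (insertL l ls) ≡⟨ cong (a′ *_) (insertL-correct l ls) ⟩
      a′ * (a * evalLs ls)       ≡⟨ *-assoc _ _ _ ⟨
      a′ * a * evalLs ls         ≡⟨ cong (_* evalLs ls) (proj₂ (letter l) a′) ⟨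
      a * a′ * evalLs ls         ≡⟨ *-assoc _ _ _ ⟩
      a * (a′ * evalLs ls)       ∎
      where
      a = proj₁ (letter l)
      a′ = proj₁ (letter l′)

    merge-correct : ∀ ls ls′ → evalLs (foldr insertL ls′ ls) ≡ evalLs ls * evalLs ls′
    merge-correct [] ls′ = sym (*-identityˡ _)
    merge-correct (l ∷ ls) ls′ =
      trans (insertL-correct l (foldr insertL ls′ ls)) (trans (cong (_ *_) (merge-correct ls ls′)) (sym (*-assoc _ _ _)))

    ++-correct : ∀ ks ks′ → evalℕs (ks ++ ks′) ≡ evalℕs ks * evalℕs ks′
    ++-correct [] ks′ = sym (*-identityˡ _)
    ++-correct (k ∷ ks) ks′ = trans (cong (_ *_) (++-correct ks ks′)) (sym (*-assoc _ _ _))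

    evalLs-central : ∀ ls → Central (evalLs ls)
    evalLs-central [] y = trans (*-identityˡ y) (sym (*-identityʳ y))
    evalLs-central (l ∷ ls) y = begin
      a * as * y    ≡⟨ *-assoc a as y ⟩
      a * (as * y)  ≡⟨ cong (a *_) (evalLs-central ls y) ⟩
      a * (y * as)  ≡⟨ *-assoc a y as ⟨
      a * y * as    ≡⟨ cong (_* as) (proj₂ (letter l) y) ⟩
      y * a * as    ≡⟨ *-assoc y a as ⟩
      y * (a * as)  ∎
      where
      a = proj₁ (letter l)
      as = evalLs ls

    sgn-* : ∀ s s′ u v → sgn (s xor s′) (u * v) ≡ sgn s u * sgn s′ v
    sgn-* false false u v = refl
    sgn-* false true u v = sym (neg-distribʳ u v)
    sgn-* true false u v = sym (neg-distribˡ u v)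
    sgn-* true true u v = sym (trans (neg-distribˡ u (- v)) (trans (cong -_ (neg-distribʳ u v)) (neg-involutive _)))

    mulM-correct : ∀ m m′ → evalM (mulM m m′) ≡ evalM m * evalM m′
    mulM-correct (s , ls , ks) (s′ , ls′ , ks′) = trans (cong (sgn (s xor s′)) (begin
      evalLs (foldr insertL ls′ ls) * evalℕs (ks ++ ks′) ≡⟨ cong₂ _*_ (merge-correct ls ls′) (++-correct ks ks′) ⟩
      l * l′ * (k * k′)   ≡⟨ *-assoc l l′ _ ⟩
      l * (l′ * (k * k′)) ≡⟨ cong (l *_) (*-assoc l′ k k′) ⟨
      l * (l′ * k * k′)   ≡⟨ cong (λ y → l * (y * k′)) (evalLs-central ls′ k) ⟩
      l * (k * l′ * k′)   ≡⟨ cong (l *_) (*-assoc k l′ k′) ⟩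
      l * (k * (l′ * k′)) ≡⟨ *-assoc l k _ ⟨
      l * k * (l′ * k′)   ∎)) (sgn-* s s′ _ _)
      where
      l = evalLs ls
      l′ = evalLs ls′
      k = evalℕs ks
      k′ = evalℕs ks′

    mapM-correct : ∀ m p → eval (map (mulM m) p) ≡ evalM m * eval p
    mapM-correct m [] = sym (zeroʳ _)
    mapM-correct m (m′ ∷ p) = trans (cong₂ _+_ (mulM-correct m m′) (mapM-correct m p)) (sym (distribˡ _ _ _))

    ⊠-correct : ∀ p q → eval (p ⊠ q) ≡ eval p * eval q
    ⊠-correct [] q = sym (zeroˡ _)
    ⊠-correct (m ∷ p) q = begin
      eval (map (mulM m) q ⊞ p ⊠ q)        ≡⟨ ⊞-correct (map (mulM m) q) (p ⊠ q) ⟩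
      eval (map (mulM m) q) + eval (p ⊠ q) ≡⟨ cong₂ _+_ (mapM-correct m q) (⊠-correct p q) ⟩
      evalM m * eval q + eval p * eval q   ≡⟨ distribʳ _ _ _ ⟨
      (evalM m + eval p) * eval q          ∎

    eval-unit : evalW ([] , []) ≡ 1#
    eval-unit = *-identityˡ 1#

    normCon-correct : ∀ n → eval (normCon n) ≡ int n
    normCon-correct (+ zero) = sym int-0
    normCon-correct (+ suc n) =
      trans (cong₂ _+_ (trans eval-unit (sym int-1)) (normCon-correct (+ n))) (sym (int-+ 1ℤ (+ n)))
    normCon-correct -[1+ zero ] =
      trans (+-identityʳ _) (trans (cong -_ (trans eval-unit (sym int-1))) (sym (int-neg 1ℤ)))
    normCon-correct -[1+ suc n ] =
      trans (cong₂ _+_ (trans (cong -_ (trans eval-unit (sym int-1))) (sym (int-neg 1ℤ))) (normCon-correct -[1+ n ])) (sym (int-+ -[1+ 0 ] -[1+ n ]))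

    normℤ-correct : ∀ e → eval (normℤ e) ≡ int ⟦ e ⟧ℤ
    normℤ-correct (𝕫 k) = trans (+-identityʳ _) (trans (*-identityʳ _) (*-identityʳ _))
    normℤ-correct (con n) = normCon-correct n
    normℤ-correct (e ⊕ f) =
      trans (⊞-correct (normℤ e) (normℤ f)) (trans (cong₂ _+_ (normℤ-correct e) (normℤ-correct f)) (sym (int-+ _ _)))
    normℤ-correct (e ⊗ f) =
      trans (⊠-correct (normℤ e) (normℤ f)) (trans (cong₂ _*_ (normℤ-correct e) (normℤ-correct f)) (sym (int-* _ _)))
    normℤ-correct (e ⊖ f) =
      trans (⊞-correct (normℤ e) (map negM (normℤ f)))
        (trans (cong₂ _+_ (normℤ-correct e) (trans (neg-correct (normℤ f)) (trans (cong -_ (normℤ-correct f)) (sym (int-neg _)))))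
          (sym (int-+ _ _)))
    normℤ-correct (⊝ e) = trans (neg-correct (normℤ e)) (trans (cong -_ (normℤ-correct e)) (sym (int-neg _)))

    norm-correct : ∀ e → eval (norm e) ≡ ⟦ e ⟧
    norm-correct (𝕩 k) = trans (+-identityʳ _) (trans (*-identityˡ _) (*-identityʳ _))
    norm-correct (𝕔 k) = trans (+-identityʳ _) (trans (*-identityʳ _) (*-identityʳ _))
    norm-correct (ι e) = normℤ-correct e
    norm-correct (con n) = normCon-correct n
    norm-correct 𝟘 = refl
    norm-correct 𝟙 = trans (+-identityʳ _) eval-unit
    norm-correct (e ⊕ f) = trans (⊞-correct (norm e) (norm f)) (cong₂ _+_ (norm-correct e) (norm-correct f))
    norm-correct (e ⊗ f) = trans (⊠-correct (norm e) (norm f)) (cong₂ _*_ (norm-correct e) (norm-correct f))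
    norm-correct (e ⊖ f) =
      trans (⊞-correct (norm e) (map negM (norm f)))
        (cong₂ _+_ (norm-correct e) (trans (neg-correct (norm f)) (cong -_ (norm-correct f))))
    norm-correct (⊝ e) = trans (neg-correct (norm e)) (cong -_ (norm-correct e))

    -- The hypothesis l ≡ r, to be used as p * (l - r) * q.
    infix 5 _·[_≈_by_]·_
    record Hyp : Set where
      constructor _·[_≈_by_]·_
      field
        p l r : Expr
        proof : ⟦ l ⟧ ≡ ⟦ r ⟧
        q : Expr

    total : List Hyp → Expr
    total [] = 𝟘
    total ((p ·[ l ≈ r by _ ]· q) ∷ hs) = p ⊗ (l ⊖ r) ⊗ q ⊕ total hs

    total-zero : ∀ hs → ⟦ total hs ⟧ ≡ 0#
    total-zero [] = refl
    total-zero ((p ·[ l ≈ r by h ]· q) ∷ hs) = begin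
      ⟦ p ⟧ * (⟦ l ⟧ - ⟦ r ⟧) * ⟦ q ⟧ + ⟦ total hs ⟧ ≡⟨ cong₂ (λ y w → ⟦ p ⟧ * (y - ⟦ r ⟧) * ⟦ q ⟧ + w) h (total-zero hs) ⟩
      ⟦ p ⟧ * (⟦ r ⟧ - ⟦ r ⟧) * ⟦ q ⟧ + 0#           ≡⟨ +-identityʳ _ ⟩
      ⟦ p ⟧ * (⟦ r ⟧ - ⟦ r ⟧) * ⟦ q ⟧                ≡⟨ cong (λ y → ⟦ p ⟧ * y * ⟦ q ⟧) (-‿inverseʳ _) ⟩
      ⟦ p ⟧ * 0# * ⟦ q ⟧                             ≡⟨ cong (_* ⟦ q ⟧) (zeroʳ _) ⟩
      0# * ⟦ q ⟧                                     ≡⟨ zeroˡ _ ⟩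
      0#                                             ∎

    opaque
      -- A certificate of ideal membership: e - f is exhibited as Σ p (l - r) q over the hypotheses,
      -- and what remains is a polynomial identity that evaluates to the empty list. The lists of
      -- coefficients passed to `prove` are such certificates.
      prove : ∀ e f hs → norm (e ⊖ f ⊖ total hs) ≡ [] → ⟦ e ⟧ ≡ ⟦ f ⟧
      prove e f hs h = begin
        ⟦ e ⟧                     ≡⟨ neg-involutive _ ⟨
        - - ⟦ e ⟧                 ≡⟨ neg-unique (- ⟦ e ⟧) (trans (+-comm _ _) (trans e-f (-‿inverseʳ ⟦ e ⟧))) ⟨
        ⟦ f ⟧                     ∎
        where
        zero-sum : ⟦ e ⟧ - ⟦ f ⟧ - ⟦ total hs ⟧ ≡ 0#
        zero-sum = trans (sym (norm-correct (e ⊖ f ⊖ total hs))) (cong eval h)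
        e-f : ⟦ f ⟧ - ⟦ e ⟧ ≡ ⟦ e ⟧ - ⟦ e ⟧
        e-f = cong (_- ⟦ e ⟧) (sym (begin
          ⟦ e ⟧                          ≡⟨ +-identityʳ _ ⟨
          ⟦ e ⟧ + 0#                     ≡⟨ cong (λ w → ⟦ e ⟧ + w) (-‿inverseˡ ⟦ f ⟧) ⟨
          ⟦ e ⟧ + (- ⟦ f ⟧ + ⟦ f ⟧)      ≡⟨ +-assoc _ _ _ ⟨
          ⟦ e ⟧ - ⟦ f ⟧ + ⟦ f ⟧          ≡⟨ cong (_+ ⟦ f ⟧) (+-identityʳ _) ⟨
          ⟦ e ⟧ - ⟦ f ⟧ + 0# + ⟦ f ⟧     ≡⟨ cong (λ y → ⟦ e ⟧ - ⟦ f ⟧ + y + ⟦ f ⟧) (trans (cong -_ (total-zero hs)) neg-0) ⟨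
          ⟦ e ⟧ - ⟦ f ⟧ - ⟦ total hs ⟧ + ⟦ f ⟧ ≡⟨ cong (_+ ⟦ f ⟧) zero-sum ⟩
          0# + ⟦ f ⟧                     ≡⟨ +-identityˡ _ ⟩
          ⟦ f ⟧                          ∎))

x₀ x₁ x₂ x₃ x₄ x₅ c₀ c₁ c₂ c₃ : Expr
x₀ = 𝕩 0
x₁ = 𝕩 1
x₂ = 𝕩 2
x₃ = 𝕩 3
x₄ = 𝕩 4
x₅ = 𝕩 5
c₀ = 𝕔 0
c₁ = 𝕔 1
c₂ = 𝕔 2
c₃ = 𝕔 3

z₀ z₁ z₂ z₃ z₄ z₅ : ℤExpr
z₀ = 𝕫 0
z₁ = 𝕫 1
z₂ = 𝕫 2
z₃ = 𝕫 3
z₄ = 𝕫 4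
z₅ = 𝕫 5

ℤ-ℤRing : ℤRing
ℤ-ℤRing = record
  { A = ℤ ; _+_ = ℤ._+_ ; _*_ = ℤ._*_ ; -_ = ℤ.-_ ; 0# = 0ℤ ; 1# = 1ℤ
  ; isRing = ℤP.+-*-isRing ; int = λ n → n ; int-+ = λ _ _ → refl ; int-* = λ _ _ → refl ; int-1 = refl }

module ℤSolve = Solve.Env ℤ-ℤRing

-- Quaternion division algebras, axiomatised without naming ℚ.

-- Rat x says that x is a rational scalar, without mentioning ℚ: a nonzero integer
-- multiple of x is an integer.
record QuaternionDivisionAlgebra : Set₁ where
  field
    ring : ℤRing
  open ℤRing ring public
  Rat : A → Set
  Rat x = ∃₂ λ d n → d ≢ 0ℤ × int d * x ≡ int n
  infix 4 _≟_
  field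
    _≟_ : DecidableEquality A
    int-zero : ∀ n → int n ≡ 0# → n ≡ 0ℤ
    inverse : ∀ x → x ≢ 0# → ∃ λ y → x * y ≡ 1# × y * x ≡ 1#
    bar : A → A
    bar-+ : ∀ x y → bar (x + y) ≡ bar x + bar y
    bar-* : ∀ x y → bar (x * y) ≡ bar y * bar x
    bar-1 : bar 1# ≡ 1#
    trace : ∀ x → Rat (x + bar x)
    nrm : ∀ x → Rat (x * bar x)
    I J : A
    I² : Rat (I * I)
    J² : Rat (J * J)
    I≢0 : I ≢ 0#
    J≢0 : J ≢ 0#
    JI : J * I ≡ - (I * J)
    coords : ∀ x → ∃₂ λ p q → ∃₂ λ r s → Rat p × Rat q × Rat r × Rat s × x ≡ p + q * I + r * J + s * (I * J)

-- The algebra (a, b) over ℚ as an instance.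

toℚᵘ-ℤtoℚ : ∀ n → toℚᵘ (ℤtoℚ n) ℚᵘ.≃ ℚᵘ.mkℚᵘ n 0
toℚᵘ-ℤtoℚ n = ℚP.toℚᵘ-fromℚᵘ (ℚᵘ.mkℚᵘ n 0)

ℤtoℚ-+ : ∀ m n → ℤtoℚ (m ℤ.+ n) ≡ ℤtoℚ m ℚ.+ ℤtoℚ n
ℤtoℚ-+ m n = ℚP.toℚᵘ-injective (begin
  toℚᵘ (ℤtoℚ (m ℤ.+ n))                   ≈⟨ toℚᵘ-ℤtoℚ (m ℤ.+ n) ⟩
  ℚᵘ.mkℚᵘ (m ℤ.+ n) 0                     ≈⟨ ℚᵘ.*≡* (cong (ℤ._* 1ℤ) (sym (cong₂ ℤ._+_ (ℤP.*-identityʳ m) (ℤP.*-identityʳ n)))) ⟩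
  ℚᵘ.mkℚᵘ m 0 ℚᵘ.+ ℚᵘ.mkℚᵘ n 0            ≈⟨ ℚᵘP.+-cong (ℚᵘP.≃-sym (toℚᵘ-ℤtoℚ m)) (ℚᵘP.≃-sym (toℚᵘ-ℤtoℚ n)) ⟩
  toℚᵘ (ℤtoℚ m) ℚᵘ.+ toℚᵘ (ℤtoℚ n)        ≈⟨ ℚᵘP.≃-sym (ℚP.toℚᵘ-homo-+ (ℤtoℚ m) (ℤtoℚ n)) ⟩
  toℚᵘ (ℤtoℚ m ℚ.+ ℤtoℚ n)                ∎)
  where open ℚᵘP.≃-Reasoning

ℤtoℚ-* : ∀ m n → ℤtoℚ (m ℤ.* n) ≡ ℤtoℚ m ℚ.* ℤtoℚ n
ℤtoℚ-* m n = ℚP.toℚᵘ-injective (begin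
  toℚᵘ (ℤtoℚ (m ℤ.* n))                   ≈⟨ toℚᵘ-ℤtoℚ (m ℤ.* n) ⟩
  ℚᵘ.mkℚᵘ (m ℤ.* n) 0                     ≈⟨ ℚᵘ.*≡* refl ⟩
  ℚᵘ.mkℚᵘ m 0 ℚᵘ.* ℚᵘ.mkℚᵘ n 0            ≈⟨ ℚᵘP.*-cong (ℚᵘP.≃-sym (toℚᵘ-ℤtoℚ m)) (ℚᵘP.≃-sym (toℚᵘ-ℤtoℚ n)) ⟩
  toℚᵘ (ℤtoℚ m) ℚᵘ.* toℚᵘ (ℤtoℚ n)        ≈⟨ ℚᵘP.≃-sym (ℚP.toℚᵘ-homo-* (ℤtoℚ m) (ℤtoℚ n)) ⟩
  toℚᵘ (ℤtoℚ m ℚ.* ℤtoℚ n)                ∎)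
  where open ℚᵘP.≃-Reasoning

ℤtoℚ-zero : ∀ n → ℤtoℚ n ≡ 0ℚ → n ≡ 0ℤ
ℤtoℚ-zero n h with ℚᵘ.*≡* e ← ℚᵘP.≃-trans (ℚᵘP.≃-sym (toℚᵘ-ℤtoℚ n)) (ℚP.toℚᵘ-cong h) =
  trans (sym (ℤP.*-identityʳ n)) e

clear : ∀ q → ∃₂ λ d n → d ≢ 0ℤ × ℤtoℚ d ℚ.* q ≡ ℤtoℚ n
clear q@(mkℚ n d _) = ℤ.+ suc d , n , (λ ()) , ℚP.toℚᵘ-injective (begin
  toℚᵘ (ℤtoℚ (ℤ.+ suc d) ℚ.* q)           ≈⟨ ℚP.toℚᵘ-homo-* (ℤtoℚ (ℤ.+ suc d)) q ⟩
  toℚᵘ (ℤtoℚ (ℤ.+ suc d)) ℚᵘ.* toℚᵘ q     ≈⟨ ℚᵘP.*-congʳ {toℚᵘ q} (toℚᵘ-ℤtoℚ (ℤ.+ suc d)) ⟩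
  ℚᵘ.mkℚᵘ (ℤ.+ suc d) 0 ℚᵘ.* ℚᵘ.mkℚᵘ n d  ≈⟨ ℚᵘ.*≡* (trans (ℤP.*-identityʳ _) (trans (ℤP.*-comm (ℤ.+ suc d) n) (cong (λ k → n ℤ.* (ℤ.+ suc k)) (sym (ℕP.+-identityʳ d))))) ⟩
  ℚᵘ.mkℚᵘ n 0                             ≈⟨ ℚᵘP.≃-sym (toℚᵘ-ℤtoℚ n) ⟩
  toℚᵘ (ℤtoℚ n)                           ∎)
  where open ℚᵘP.≃-Reasoning

ℚ-ℤRing : ℤRing
ℚ-ℤRing = record
  { A = ℚ ; _+_ = ℚ._+_ ; _*_ = ℚ._*_ ; -_ = ℚ.-_ ; 0# = 0ℚ ; 1# = 1ℚ
  ; isRing = ℚP.+-*-isRing ; int = ℤtoℚ ; int-+ = ℤtoℚ-+ ; int-* = ℤtoℚ-* ; int-1 = refl }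

module ℚSolve (qs : List ℚ) =
  Solve.Env ℚ-ℤRing (map (λ q → q , ℚP.*-comm q) qs) [] []

record QuatExpr : Set where
  constructor quatE
  field
    e0 e1 e2 e3 : Expr

open QuatExpr

infixl 6 _+E_
infixl 7 _*E_
_+E_ _*E_ : QuatExpr → QuatExpr → QuatExpr
quatE x0 x1 x2 x3 +E quatE y0 y1 y2 y3 = quatE (x0 ⊕ y0) (x1 ⊕ y1) (x2 ⊕ y2) (x3 ⊕ y3)
quatE x0 x1 x2 x3 *E quatE y0 y1 y2 y3 = quatE
  (x0 ⊗ y0 ⊕ a ⊗ x1 ⊗ y1 ⊕ b ⊗ x2 ⊗ y2 ⊖ a ⊗ b ⊗ x3 ⊗ y3)
  (x0 ⊗ y1 ⊕ x1 ⊗ y0 ⊖ b ⊗ x2 ⊗ y3 ⊕ b ⊗ x3 ⊗ y2)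
  (x0 ⊗ y2 ⊕ x2 ⊗ y0 ⊕ a ⊗ x1 ⊗ y3 ⊖ a ⊗ x3 ⊗ y1)
  (x0 ⊗ y3 ⊕ x3 ⊗ y0 ⊕ x1 ⊗ y2 ⊖ x2 ⊗ y1)
  where
  a = 𝕔 0
  b = 𝕔 1

scalarE : Expr → QuatExpr
scalarE q = quatE q 𝟘 𝟘 𝟘

negE barE : QuatExpr → QuatExpr
negE (quatE x0 x1 x2 x3) = quatE (⊝ x0) (⊝ x1) (⊝ x2) (⊝ x3)
barE (quatE x0 x1 x2 x3) = quatE x0 (⊝ x1) (⊝ x2) (⊝ x3)

scaleE : Expr → QuatExpr → QuatExpr
scaleE q (quatE x0 x1 x2 x3) = quatE (q ⊗ x0) (q ⊗ x1) (q ⊗ x2) (q ⊗ x3)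

𝕏 𝕐 𝕎 𝕀 𝕁 : QuatExpr
𝕏 = quatE (𝕔 2) (𝕔 3) (𝕔 4) (𝕔 5)
𝕐 = quatE (𝕔 6) (𝕔 7) (𝕔 8) (𝕔 9)
𝕎 = quatE (𝕔 10) (𝕔 11) (𝕔 12) (𝕔 13)
𝕀 = quatE 𝟘 𝟙 𝟘 𝟘
𝕁 = quatE 𝟘 𝟘 𝟙 𝟘

quat≡ : ∀ {x0 x1 x2 x3 y0 y1 y2 y3} → x0 ≡ y0 → x1 ≡ y1 → x2 ≡ y2 → x3 ≡ y3 → quat x0 x1 x2 x3 ≡ quat y0 y1 y2 y3
quat≡ refl refl refl refl = refl

barQ : Quat → Quat
barQ (quat x0 x1 x2 x3) = quat x0 (ℚ.- x1) (ℚ.- x2) (ℚ.- x3)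

_≟Q_ : DecidableEquality Quat
quat x0 x1 x2 x3 ≟Q quat y0 y1 y2 y3 with x0 ℚP.≟ y0 | x1 ℚP.≟ y1 | x2 ℚP.≟ y2 | x3 ℚP.≟ y3
... | yes h0 | yes h1 | yes h2 | yes h3 = yes (quat≡ h0 h1 h2 h3)
... | no h | _ | _ | _ = no λ e → h (cong Quat.q0 e)
... | _ | no h | _ | _ = no λ e → h (cong Quat.q1 e)
... | _ | _ | no h | _ = no λ e → h (cong Quat.q2 e)
... | _ | _ | _ | no h = no λ e → h (cong Quat.q3 e)

iQ jQ : Quat
iQ = quat 0ℚ 1ℚ 0ℚ 0ℚ
jQ = quat 0ℚ 0ℚ 1ℚ 0ℚ

module QuatLaws (a b : ℚ) where

  infixl 7 _*Q_
  _*Q_ : Quat → Quat → Quat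
  _*Q_ = mulQ a b

  module _ (x y z : Quat) where
    open Quat
    open ℚSolve (a ∷ b ∷ q0 x ∷ q1 x ∷ q2 x ∷ q3 x ∷ q0 y ∷ q1 y ∷ q2 y ∷ q3 y ∷ q0 z ∷ q1 z ∷ q2 z ∷ q3 z ∷ [])

    ⟦_⟧Q : QuatExpr → Quat
    ⟦ quatE p0 p1 p2 p3 ⟧Q = quat ⟦ p0 ⟧ ⟦ p1 ⟧ ⟦ p2 ⟧ ⟦ p3 ⟧

    vanishes : (e f : QuatExpr) (p : QuatExpr → Expr) → Set
    vanishes e f p = norm (p e ⊖ p f ⊖ 𝟘) ≡ []

    -- A quaternion identity is four polynomial identities in a, b and the coordinates, each settled
    -- by the normaliser.
    law : ∀ e f → vanishes e f e0 → vanishes e f e1 → vanishes e f e2 → vanishes e f e3 → ⟦ e ⟧Q ≡ ⟦ f ⟧Q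
    law e f h0 h1 h2 h3 = quat≡ (prove (e0 e) (e0 f) [] h0) (prove (e1 e) (e1 f) [] h1)
      (prove (e2 e) (e2 f) [] h2) (prove (e3 e) (e3 f) [] h3)

  *Q-isRing : IsRing _≡_ _+Q_ _*Q_ -Q_ zeroQ oneQ
  *Q-isRing = record
    { +-isAbelianGroup = record
      { isGroup = record
        { isMonoid = record
          { isSemigroup = record
            { isMagma = record { isEquivalence = isEquivalence ; ∙-cong = cong₂ _+Q_ }
            ; assoc = λ x y z → law x y z (𝕏 +E 𝕐 +E 𝕎) (𝕏 +E (𝕐 +E 𝕎)) refl refl refl refl }
          ; identity = (λ x → law x x x (scalarE 𝟘 +E 𝕏) 𝕏 refl refl refl refl)
                     , (λ x → law x x x (𝕏 +E scalarE 𝟘) 𝕏 refl refl refl refl) }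
        ; inverse = (λ x → law x x x (negE 𝕏 +E 𝕏) (scalarE 𝟘) refl refl refl refl)
                  , (λ x → law x x x (𝕏 +E negE 𝕏) (scalarE 𝟘) refl refl refl refl)
        ; ⁻¹-cong = cong (λ x → -Q x) }
      ; comm = λ x y → law x y y (𝕏 +E 𝕐) (𝕐 +E 𝕏) refl refl refl refl }
    ; *-cong = cong₂ _*Q_
    ; *-assoc = λ x y z → law x y z (𝕏 *E 𝕐 *E 𝕎) (𝕏 *E (𝕐 *E 𝕎)) refl refl refl refl
    ; *-identity = (λ x → law x x x (scalarE 𝟙 *E 𝕏) 𝕏 refl refl refl refl)
                 , (λ x → law x x x (𝕏 *E scalarE 𝟙) 𝕏 refl refl refl refl)
    ; distrib = (λ x y z → law x y z (𝕏 *E (𝕐 +E 𝕎)) (𝕏 *E 𝕐 +E 𝕏 *E 𝕎) refl refl refl refl)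
              , (λ x y z → law y z x ((𝕏 +E 𝕐) *E 𝕎) (𝕏 *E 𝕎 +E 𝕐 *E 𝕎) refl refl refl refl) }

  fromℚ-+ : ∀ p q → fromℚ (p ℚ.+ q) ≡ fromℚ p +Q fromℚ q
  fromℚ-+ p q = law (fromℚ p) (fromℚ q) zeroQ (scalarE (𝕔 2 ⊕ 𝕔 6)) (scalarE (𝕔 2) +E scalarE (𝕔 6)) refl refl refl refl

  fromℚ-* : ∀ p q → fromℚ (p ℚ.* q) ≡ fromℚ p *Q fromℚ q
  fromℚ-* p q = law (fromℚ p) (fromℚ q) zeroQ (scalarE (𝕔 2 ⊗ 𝕔 6)) (scalarE (𝕔 2) *E scalarE (𝕔 6)) refl refl refl refl

  ·Q-scalar : ∀ r x → r ·Q x ≡ fromℚ r *Q x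
  ·Q-scalar r x = law (fromℚ r) x x (scaleE (𝕔 2) 𝕐) (scalarE (𝕔 2) *E 𝕐) refl refl refl refl

  quat-ring : ℤRing
  quat-ring = record
    { A = Quat ; _+_ = _+Q_ ; _*_ = _*Q_ ; -_ = -Q_ ; 0# = zeroQ ; 1# = oneQ
    ; isRing = *Q-isRing
    ; int = λ n → fromℚ (ℤtoℚ n)
    ; int-+ = λ m n → trans (cong fromℚ (ℤtoℚ-+ m n)) (fromℚ-+ (ℤtoℚ m) (ℤtoℚ n))
    ; int-* = λ m n → trans (cong fromℚ (ℤtoℚ-* m n)) (fromℚ-* (ℤtoℚ m) (ℤtoℚ n))
    ; int-1 = refl }

  rational : ∀ q → ∃₂ λ d n → d ≢ 0ℤ × fromℚ (ℤtoℚ d) *Q fromℚ q ≡ fromℚ (ℤtoℚ n)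
  rational q with d , n , d≢0 , h ← clear q = d , n , d≢0 , trans (sym (fromℚ-* (ℤtoℚ d) q)) (cong fromℚ h)

  quaternionAlgebra : a ≢ 0ℚ → b ≢ 0ℚ → IsDivisionAlgebra a b → QuaternionDivisionAlgebra
  quaternionAlgebra a≢0 b≢0 div = record
    { ring = quat-ring
    ; _≟_ = _≟Q_
    ; int-zero = λ n h → ℤtoℚ-zero n (cong Quat.q0 h)
    ; inverse = div
    ; bar = barQ
    ; bar-+ = λ x y → law x y y (barE (𝕏 +E 𝕐)) (barE 𝕏 +E barE 𝕐) refl refl refl refl
    ; bar-* = λ x y → law x y y (barE (𝕏 *E 𝕐)) (barE 𝕐 *E barE 𝕏) refl refl refl refl
    ; bar-1 = refl
    ; trace = λ x → subst Rational (sym (law x x x (𝕏 +E barE 𝕏) (scalarE (𝕔 2 ⊕ 𝕔 2)) refl refl refl refl)) (rational _)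
    ; nrm = λ x → subst Rational (sym (law x x x (𝕏 *E barE 𝕏) (scalarE (e0 (𝕏 *E barE 𝕏))) refl refl refl refl)) (rational _)
    ; I = iQ
    ; J = jQ
    ; I² = subst Rational (sym (law iQ iQ iQ (𝕀 *E 𝕀) (scalarE (𝕔 0)) refl refl refl refl)) (rational a)
    ; J² = subst Rational (sym (law iQ iQ iQ (𝕁 *E 𝕁) (scalarE (𝕔 1)) refl refl refl refl)) (rational b)
    ; I≢0 = λ ()
    ; J≢0 = λ ()
    ; JI = law iQ iQ iQ (𝕁 *E 𝕀) (negE (𝕀 *E 𝕁)) refl refl refl refl
    ; coords = λ x → _ , _ , _ , _ , rational (Quat.q0 x) , rational (Quat.q1 x) , rational (Quat.q2 x) , rational (Quat.q3 x)
        , law x x x 𝕏 (scalarE (𝕔 2) +E scalarE (𝕔 3) *E 𝕀 +E scalarE (𝕔 4) *E 𝕁 +E scalarE (𝕔 5) *E (𝕀 *E 𝕁)) refl refl refl refl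
    }
    where
    Rational : Quat → Set
    Rational x = ∃₂ λ d n → d ≢ 0ℤ × fromℚ (ℤtoℚ d) *Q x ≡ fromℚ (ℤtoℚ n)

-- Rational scalars, conjugation and centralizers.

module DivisionAlgebra (Q : QuaternionDivisionAlgebra) where
  open QuaternionDivisionAlgebra Q public
  open Solve ring public
  open Env public using (prove; _·[_≈_by_]·_)

  opaque
    *-cancelˡ : ∀ {x y z} → x ≢ 0# → x * y ≡ x * z → y ≡ z
    *-cancelˡ {x} {y} {z} x≢0 h with w , _ , wx≡1 ← inverse x x≢0 =
      prove [] [] (x ∷ y ∷ z ∷ w ∷ []) x₁ x₂
        ( (x₃ ·[ x₀ ⊗ x₁ ≈ x₀ ⊗ x₂ by h ]· 𝟙) ∷ (⊝ 𝟙 ·[ x₃ ⊗ x₀ ≈ 𝟙 by wx≡1 ]· x₁) ∷ (𝟙 ·[ x₃ ⊗ x₀ ≈ 𝟙 by wx≡1 ]· x₂) ∷ []) refl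

    *-cancelʳ : ∀ {x y z} → x ≢ 0# → y * x ≡ z * x → y ≡ z
    *-cancelʳ {x} {y} {z} x≢0 h with w , xw≡1 , _ ← inverse x x≢0 =
      prove [] [] (x ∷ y ∷ z ∷ w ∷ []) x₁ x₂
        ( (𝟙 ·[ x₁ ⊗ x₀ ≈ x₂ ⊗ x₀ by h ]· x₃) ∷ (⊝ x₁ ·[ x₀ ⊗ x₃ ≈ 𝟙 by xw≡1 ]· 𝟙) ∷ (x₂ ·[ x₀ ⊗ x₃ ≈ 𝟙 by xw≡1 ]· 𝟙) ∷ []) refl

    integral-domain : ∀ {x y} → x ≢ 0# → x * y ≡ 0# → y ≡ 0#
    integral-domain {x} x≢0 h = *-cancelˡ x≢0 (trans h (sym (zeroʳ x)))

    *-nonzero : ∀ {x y} → x ≢ 0# → y ≢ 0# → x * y ≢ 0#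
    *-nonzero x≢0 y≢0 h = y≢0 (integral-domain x≢0 h)

    int-nonzero : ∀ {n} → n ≢ 0ℤ → int n ≢ 0#
    int-nonzero n≢0 h = n≢0 (int-zero _ h)

    int-cancel : ∀ n {x y} → n ≢ 0ℤ → int n * x ≡ int n * y → x ≡ y
    int-cancel n n≢0 = *-cancelˡ (int-nonzero n≢0)

    halve : ∀ {x y} → int (+ 2) * x ≡ int (+ 2) * y → x ≡ y
    halve = int-cancel (+ 2) λ ()

    int-injective : ∀ {m n} → int m ≡ int n → m ≡ n
    int-injective {m} {n} h = ℤP.i-j≡0⇒i≡j m n (int-zero (m ℤ.- n)
      (prove [] (m ∷ n ∷ []) [] (ι (z₀ ⊖ z₁)) 𝟘 ((𝟙 ·[ ι z₀ ≈ ι z₁ by h ]· 𝟙) ∷ []) refl))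

    rat-int : ∀ n → Rat (int n)
    rat-int n = 1ℤ , n , (λ ()) , trans (cong (_* int n) int-1) (*-identityˡ _)

    rat-+ : ∀ {x y} → Rat x → Rat y → Rat (x + y)
    rat-+ {x} {y} (d , m , d≢0 , h) (e , n , e≢0 , k) = d ℤ.* e , e ℤ.* m ℤ.+ d ℤ.* n ,
      (λ eq → [ d≢0 , e≢0 ]′ (ℤP.i*j≡0⇒i≡0∨j≡0 d eq)) ,
      prove [] (d ∷ e ∷ m ∷ n ∷ []) (x ∷ y ∷ []) (ι (z₀ ⊗ z₁) ⊗ (x₀ ⊕ x₁)) (ι (z₁ ⊗ z₂ ⊕ z₀ ⊗ z₃))
        ((ι z₁ ·[ ι z₀ ⊗ x₀ ≈ ι z₂ by h ]· 𝟙) ∷ (ι z₀ ·[ ι z₁ ⊗ x₁ ≈ ι z₃ by k ]· 𝟙) ∷ []) refl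

    rat-* : ∀ {x y} → Rat x → Rat y → Rat (x * y)
    rat-* {x} {y} (d , m , d≢0 , h) (e , n , e≢0 , k) = d ℤ.* e , m ℤ.* n ,
      (λ eq → [ d≢0 , e≢0 ]′ (ℤP.i*j≡0⇒i≡0∨j≡0 d eq)) ,
      prove [] (d ∷ e ∷ m ∷ n ∷ []) (x ∷ y ∷ []) (ι (z₀ ⊗ z₁) ⊗ (x₀ ⊗ x₁)) (ι (z₂ ⊗ z₃))
        ((𝟙 ·[ ι z₀ ⊗ x₀ ≈ ι z₂ by h ]· (ι z₁ ⊗ x₁)) ∷ (ι z₂ ·[ ι z₁ ⊗ x₁ ≈ ι z₃ by k ]· 𝟙) ∷ []) refl

    rat-0 : Rat 0#
    rat-0 = subst Rat int-0 (rat-int 0ℤ)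

    rat-neg : ∀ {x} → Rat x → Rat (- x)
    rat-neg {x} r = subst Rat (prove [] [] (x ∷ []) (con -[1+ 0 ] ⊗ x₀) (⊝ x₀) [] refl) (rat-* (rat-int -[1+ 0 ]) r)

    -- Integers are central, and d can be cancelled from d x = n.
    rat-central : ∀ {x} → Rat x → Central x
    rat-central {x} (d , n , d≢0 , h) y = int-cancel d d≢0
      (prove [] (d ∷ n ∷ []) (x ∷ y ∷ []) (ι z₀ ⊗ (x₀ ⊗ x₁)) (ι z₀ ⊗ (x₁ ⊗ x₀))
        ((𝟙 ·[ ι z₀ ⊗ x₀ ≈ ι z₁ by h ]· x₁) ∷ (⊝ x₁ ·[ ι z₀ ⊗ x₀ ≈ ι z₁ by h ]· 𝟙) ∷ []) refl)

    rat-inverse : ∀ {x} → Rat x → x ≢ 0# → ∃ λ y → Rat y × x * y ≡ 1#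
    rat-inverse {x} (d , n , d≢0 , h) x≢0 with y , xy≡1 , _ ← inverse x x≢0 =
      y , (n , d , n≢0 , prove [] (d ∷ n ∷ []) (x ∷ y ∷ []) (ι z₁ ⊗ x₁) (ι z₀)
        ((⊝ 𝟙 ·[ ι z₀ ⊗ x₀ ≈ ι z₁ by h ]· x₁) ∷ (ι z₀ ·[ x₀ ⊗ x₁ ≈ 𝟙 by xy≡1 ]· 𝟙) ∷ []) refl) , xy≡1
      where
      n≢0 : n ≢ 0ℤ
      n≢0 n≡0 = x≢0 (integral-domain (int-nonzero d≢0) (trans h (trans (cong int n≡0) int-0)))

    rat-divide : ∀ {x y} → Rat x → x ≢ 0# → Rat (x * y) → Rat y
    rat-divide {x} {y} r x≢0 s with w , rw , xw≡1 ← rat-inverse r x≢0 = subst Rat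
      (prove ((w , rat-central rw) ∷ []) [] (x ∷ y ∷ []) (c₀ ⊗ (x₀ ⊗ x₁)) x₁ ((𝟙 ·[ x₀ ⊗ c₀ ≈ 𝟙 by xw≡1 ]· x₁) ∷ []) refl)
      (rat-* rw s)

    rat-halve : ∀ {x} → Rat (int (+ 2) * x) → Rat x
    rat-halve = rat-divide (rat-int (+ 2)) (int-nonzero λ ())

  cen : ∀ {x} → Rat x → Σ A Central
  cen {x} r = x , rat-central r

  opaque
    bar-0 : bar 0# ≡ 0#
    bar-0 = +-cancelˡ (bar 0#) (trans (sym (bar-+ 0# 0#)) (trans (cong bar (+-identityʳ 0#)) (sym (+-identityʳ _))))

    bar-neg : ∀ x → bar (- x) ≡ - bar x
    bar-neg x = neg-unique (bar x) (trans (sym (bar-+ x (- x))) (trans (cong bar (-‿inverseʳ x)) bar-0))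

    bar-int : ∀ n → bar (int n) ≡ int n
    bar-int (+ zero) = trans (cong bar int-0) (trans bar-0 (sym int-0))
    bar-int (+ suc n) = trans (cong bar (int-+ 1ℤ (+ n))) (trans (bar-+ _ _)
      (trans (cong₂ _+_ (trans (cong bar int-1) (trans bar-1 (sym int-1))) (bar-int (+ n))) (sym (int-+ 1ℤ (+ n)))))
    bar-int -[1+ zero ] = trans (cong bar (int-neg 1ℤ)) (trans (bar-neg _)
      (trans (cong -_ (trans (cong bar int-1) (trans bar-1 (sym int-1)))) (sym (int-neg 1ℤ))))
    bar-int -[1+ suc n ] = trans (cong bar (int-+ -[1+ 0 ] -[1+ n ])) (trans (bar-+ _ _)
      (trans (cong₂ _+_ (bar-int -[1+ 0 ]) (bar-int -[1+ n ])) (sym (int-+ -[1+ 0 ] -[1+ n ]))))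

    bar-rat : ∀ {x} → Rat x → bar x ≡ x
    bar-rat {x} (d , n , d≢0 , h) = int-cancel d d≢0 (begin
      int d * bar x         ≡⟨ int-central d _ ⟩
      bar x * int d         ≡⟨ cong (bar x *_) (bar-int d) ⟨
      bar x * bar (int d)   ≡⟨ bar-* _ _ ⟨
      bar (int d * x)       ≡⟨ cong bar h ⟩
      bar (int n)           ≡⟨ bar-int n ⟩
      int n                 ≡⟨ h ⟨
      int d * x             ∎)
      where open ≡-Reasoning

    -- The trace x + x̄ is rational, hence fixed by `bar`.
    bar-involutive : ∀ x → bar (bar x) ≡ x
    bar-involutive x = prove [] [] (x ∷ bar x ∷ bar (bar x) ∷ []) x₂ x₀
      ((𝟙 ·[ x₁ ⊕ x₂ ≈ x₀ ⊕ x₁ by trans (sym (bar-+ x (bar x))) (bar-rat (trace x)) ]· 𝟙) ∷ []) refl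

    bar-comm : ∀ x → bar x * x ≡ x * bar x
    bar-comm x = prove [] [] (x ∷ bar x ∷ []) (x₁ ⊗ x₀) (x₀ ⊗ x₁)
      ((𝟙 ·[ (x₀ ⊕ x₁) ⊗ x₀ ≈ x₀ ⊗ (x₀ ⊕ x₁) by rat-central (trace x) x ]· 𝟙) ∷ []) refl

  -- The pure elements δ = β - β̄ and ξ = x - x̄ commute, so ξ δ is fixed by `bar` and therefore
  -- rational, as is δ². Hence ξ is a rational multiple of δ, which is nonzero because otherwise 2 β
  -- would be the trace of β.
  centralizer : ∀ {β x} → ¬ Rat β → x * β ≡ β * x → ∃₂ λ p q → Rat p × Rat q × x ≡ p + q * β
  centralizer {β} {x} β∉ℚ comm = result
    where
    t = β + bar β
    u = x + bar x
    δ = β - bar β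
    ξ = x - bar x
    bar-diff : ∀ y → bar (y - bar y) ≡ - (y - bar y)
    bar-diff y = trans (bar-+ y (- bar y)) (trans (cong (λ w → bar y + w) (trans (bar-neg _) (cong -_ (bar-involutive y))))
      (prove [] [] (y ∷ bar y ∷ []) (x₁ ⊖ x₀) (⊝ (x₀ ⊖ x₁)) [] refl))
    δ≢0 : δ ≢ 0#
    δ≢0 h = β∉ℚ (rat-halve (subst Rat
      (prove [] [] (β ∷ bar β ∷ []) (x₀ ⊕ x₁) (con (+ 2) ⊗ x₀) ((⊝ 𝟙 ·[ x₀ ⊖ x₁ ≈ 𝟘 by h ]· 𝟙) ∷ []) refl) (trace β)))
    ξδ≡δξ : ξ * δ ≡ δ * ξ
    ξδ≡δξ = prove (cen (trace β) ∷ cen (trace x) ∷ []) [] (β ∷ bar β ∷ x ∷ bar x ∷ [])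
      ((x₂ ⊖ x₃) ⊗ (x₀ ⊖ x₁)) ((x₀ ⊖ x₁) ⊗ (x₂ ⊖ x₃))
      ( (𝟙 ·[ x₀ ⊕ x₁ ≈ c₀ by refl ]· (x₂ ⊖ x₃)) ∷ (⊝ (x₂ ⊖ x₃) ·[ x₀ ⊕ x₁ ≈ c₀ by refl ]· 𝟙)
      ∷ (con (+ 2) ⊗ x₀ ·[ x₂ ⊕ x₃ ≈ c₁ by refl ]· 𝟙) ∷ (⊝ con (+ 2) ·[ x₂ ⊕ x₃ ≈ c₁ by refl ]· x₀)
      ∷ (con (+ 4) ·[ x₂ ⊗ x₀ ≈ x₀ ⊗ x₂ by comm ]· 𝟙)
      ∷ []) refl
    ξδ-rat : Rat (ξ * δ)
    ξδ-rat = rat-halve (subst Rat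
      (prove [] [] (ξ ∷ δ ∷ bar (ξ * δ) ∷ []) (x₀ ⊗ x₁ ⊕ x₂) (con (+ 2) ⊗ (x₀ ⊗ x₁))
        ((𝟙 ·[ x₂ ≈ ⊝ x₁ ⊗ ⊝ x₀ by trans (bar-* ξ δ) (cong₂ _*_ (bar-diff β) (bar-diff x)) ]· 𝟙) ∷ (⊝ 𝟙 ·[ x₀ ⊗ x₁ ≈ x₁ ⊗ x₀ by ξδ≡δξ ]· 𝟙) ∷ []) refl)
      (trace (ξ * δ)))
    δ²-rat : Rat (δ * δ)
    δ²-rat = subst Rat (prove [] [] (δ ∷ []) (⊝ (x₀ ⊗ ⊝ x₀)) (x₀ ⊗ x₀) [] refl) (rat-neg (subst (λ w → Rat (δ * w)) (bar-diff β) (nrm δ)))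
    result : ∃₂ λ p q → Rat p × Rat q × x ≡ p + q * β
    -- With k = 1/δ² and h = 1/2, the formula is 2 x = u + ξ rewritten by ξ = ξ δ k δ and δ = 2 β -
    -- t.
    result with k , k-rat , δ²k≡1 ← rat-inverse δ²-rat (*-nonzero δ≢0 δ≢0) with h , h-rat , 2h≡1 ← rat-inverse (rat-int (+ 2)) (int-nonzero λ ()) =
      h * (u - ξ * δ * k * t) , ξ * δ * k ,
      rat-* h-rat (rat-+ (trace x) (rat-neg (rat-* (rat-* ξδ-rat k-rat) (trace β)))) , rat-* ξδ-rat k-rat ,
      prove (cen h-rat ∷ cen k-rat ∷ cen (trace β) ∷ []) [] (β ∷ bar β ∷ x ∷ bar x ∷ [])
        x₂ (c₀ ⊗ (x₂ ⊕ x₃ ⊖ (x₂ ⊖ x₃) ⊗ (x₀ ⊖ x₁) ⊗ c₁ ⊗ (x₀ ⊕ x₁)) ⊕ (x₂ ⊖ x₃) ⊗ (x₀ ⊖ x₁) ⊗ c₁ ⊗ x₀)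
        ( (⊝ x₂ ⊖ (x₂ ⊖ x₃) ⊗ (x₀ ⊖ x₁) ⊗ c₁ ⊗ ⊝ x₀ ·[ con (+ 2) ⊗ c₀ ≈ 𝟙 by 2h≡1 ]· 𝟙)
        ∷ (⊝ c₀ ⊗ (x₂ ⊖ x₃) ·[ (x₀ ⊖ x₁) ⊗ (x₀ ⊖ x₁) ⊗ c₁ ≈ 𝟙 by δ²k≡1 ]· 𝟙) ∷ []) refl

  -- Automorphisms as conjugations.

  -- No inverse is recorded: a unital ring endomorphism fixes the rational scalars, and the
  -- Skolem-Noether argument already shows it to be a conjugation.
  record Automorphism : Set where
    field
      fun : A → A
      fun-+ : ∀ x y → fun (x + y) ≡ fun x + fun y
      fun-* : ∀ x y → fun (x * y) ≡ fun x * fun y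
      fun-1 : fun 1# ≡ 1#

    fun-0 : fun 0# ≡ 0#
    fun-0 = +-cancelˡ (fun 0#) (trans (sym (fun-+ 0# 0#)) (trans (cong fun (+-identityʳ 0#)) (sym (+-identityʳ _))))

    fun-neg : ∀ x → fun (- x) ≡ - fun x
    fun-neg x = neg-unique (fun x) (trans (sym (fun-+ x (- x))) (trans (cong fun (-‿inverseʳ x)) fun-0))

    fun-pos : ∀ n → fun (int (+ n)) ≡ int (+ n)
    fun-pos zero = trans (cong fun int-0) (trans fun-0 (sym int-0))
    fun-pos (suc n) = trans (cong fun (int-+ 1ℤ (+ n))) (trans (fun-+ _ _)
      (trans (cong₂ _+_ (trans (cong fun int-1) (trans fun-1 (sym int-1))) (fun-pos n)) (sym (int-+ 1ℤ (+ n)))))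

    fun-int : ∀ n → fun (int n) ≡ int n
    fun-int (+ n) = fun-pos n
    fun-int -[1+ n ] = trans (cong fun (int-neg (+ suc n))) (trans (fun-neg _) (trans (cong -_ (fun-pos (suc n))) (sym (int-neg (+ suc n)))))

    fun-rat : ∀ {x} → Rat x → fun x ≡ x
    fun-rat {x} (d , n , d≢0 , h) = int-cancel d d≢0 (begin
      int d * fun x         ≡⟨ cong (_* fun x) (fun-int d) ⟨
      fun (int d) * fun x   ≡⟨ fun-* _ _ ⟨
      fun (int d * x)       ≡⟨ cong fun h ⟩
      fun (int n)           ≡⟨ fun-int n ⟩
      int n                 ≡⟨ h ⟨
      int d * x             ∎)
      where open ≡-Reasoning

    fun-diff : ∀ x y → fun (x - y) ≡ fun x - fun y
    fun-diff x y = trans (fun-+ x (- y)) (cong (λ w → fun x + w) (fun-neg y))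

  open Automorphism public

  -- Averaging y over 1, I, J, IJ, each unit twisted by σ on the left, gives an element
  -- intertwining σ with the identity. The averages of 1, I, J, IJ cannot all vanish, since
  -- a suitable combination of them is a nonzero scalar.
  module SkolemNoether (σ : Automorphism) where
    private
      s : A → A
      s = fun σ
      a b : A
      a = I * I
      b = J * J
      cs : List (Σ A Central)
      cs = cen I² ∷ cen J² ∷ []
      xs : List A
      xs = I ∷ J ∷ s I ∷ s J ∷ []

    -- This is a b Σ σ(e) y e⁻¹ over e = 1, I, J, IJ; the factors and the sign come from I² = a, J²
    -- = b and (IJ)² = -ab.
    average : A → A
    average y = a * b * y + b * s I * y * I + a * s J * y * J - s I * s J * y * I * J

    opaque
      σI² : s I * s I ≡ a
      σI² = trans (sym (fun-* σ I I)) (fun-rat σ I²)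

      σJ² : s J * s J ≡ b
      σJ² = trans (sym (fun-* σ J J)) (fun-rat σ J²)

      σJI : s J * s I ≡ - (s I * s J)
      σJI = trans (sym (fun-* σ J I)) (trans (cong s JI) (trans (fun-neg σ _) (cong -_ (fun-* σ I J))))

      average-I : ∀ y → s I * average y ≡ average y * I
      average-I y = prove cs [] (I ∷ J ∷ s I ∷ s J ∷ y ∷ [])
        (x₂ ⊗ (c₀ ⊗ c₁ ⊗ x₄ ⊕ c₁ ⊗ x₂ ⊗ x₄ ⊗ x₀ ⊕ c₀ ⊗ x₃ ⊗ x₄ ⊗ x₁ ⊖ x₂ ⊗ x₃ ⊗ x₄ ⊗ x₀ ⊗ x₁))
        ((c₀ ⊗ c₁ ⊗ x₄ ⊕ c₁ ⊗ x₂ ⊗ x₄ ⊗ x₀ ⊕ c₀ ⊗ x₃ ⊗ x₄ ⊗ x₁ ⊖ x₂ ⊗ x₃ ⊗ x₄ ⊗ x₀ ⊗ x₁) ⊗ x₀)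
        ( (c₁ ·[ x₂ ⊗ x₂ ≈ c₀ by σI² ]· (x₄ ⊗ x₀))
        ∷ (⊝ 𝟙 ·[ x₂ ⊗ x₂ ≈ c₀ by σI² ]· (x₃ ⊗ x₄ ⊗ x₀ ⊗ x₁))
        ∷ (⊝ (c₁ ⊗ x₂ ⊗ x₄) ·[ x₀ ⊗ x₀ ≈ c₀ by refl ]· 𝟙)
        ∷ (⊝ (c₀ ⊗ x₃ ⊗ x₄) ·[ x₁ ⊗ x₀ ≈ ⊝ (x₀ ⊗ x₁) by JI ]· 𝟙)
        ∷ ((x₂ ⊗ x₃ ⊗ x₄ ⊗ x₀) ·[ x₁ ⊗ x₀ ≈ ⊝ (x₀ ⊗ x₁) by JI ]· 𝟙)
        ∷ (⊝ (x₂ ⊗ x₃ ⊗ x₄) ·[ x₀ ⊗ x₀ ≈ c₀ by refl ]· x₁) ∷ []) refl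

      average-J : ∀ y → s J * average y ≡ average y * J
      average-J y = prove cs [] (I ∷ J ∷ s I ∷ s J ∷ y ∷ [])
        (x₃ ⊗ (c₀ ⊗ c₁ ⊗ x₄ ⊕ c₁ ⊗ x₂ ⊗ x₄ ⊗ x₀ ⊕ c₀ ⊗ x₃ ⊗ x₄ ⊗ x₁ ⊖ x₂ ⊗ x₃ ⊗ x₄ ⊗ x₀ ⊗ x₁))
        ((c₀ ⊗ c₁ ⊗ x₄ ⊕ c₁ ⊗ x₂ ⊗ x₄ ⊗ x₀ ⊕ c₀ ⊗ x₃ ⊗ x₄ ⊗ x₁ ⊖ x₂ ⊗ x₃ ⊗ x₄ ⊗ x₀ ⊗ x₁) ⊗ x₁)
        ( (c₁ ·[ x₃ ⊗ x₂ ≈ ⊝ (x₂ ⊗ x₃) by σJI ]· (x₄ ⊗ x₀))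
        ∷ (⊝ 𝟙 ·[ x₃ ⊗ x₂ ≈ ⊝ (x₂ ⊗ x₃) by σJI ]· (x₃ ⊗ x₄ ⊗ x₀ ⊗ x₁))
        ∷ (c₀ ·[ x₃ ⊗ x₃ ≈ c₁ by σJ² ]· (x₄ ⊗ x₁))
        ∷ (x₂ ·[ x₃ ⊗ x₃ ≈ c₁ by σJ² ]· (x₄ ⊗ x₀ ⊗ x₁))
        ∷ (⊝ (c₀ ⊗ x₃ ⊗ x₄) ·[ x₁ ⊗ x₁ ≈ c₁ by refl ]· 𝟙)
        ∷ ((x₂ ⊗ x₃ ⊗ x₄ ⊗ x₀) ·[ x₁ ⊗ x₁ ≈ c₁ by refl ]· 𝟙) ∷ []) refl

      average-intertwines : ∀ y x → s x * average y ≡ average y * x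
      average-intertwines y x with p , q , r , t , p∈ , q∈ , r∈ , t∈ , refl ← coords x =
        prove (cen p∈ ∷ cen q∈ ∷ cen r∈ ∷ cen t∈ ∷ []) [] (I ∷ J ∷ s I ∷ s J ∷ average y ∷ s (p + q * I + r * J + t * (I * J)) ∷ [])
          (x₅ ⊗ x₄) (x₄ ⊗ (c₀ ⊕ c₁ ⊗ x₀ ⊕ c₂ ⊗ x₁ ⊕ c₃ ⊗ (x₀ ⊗ x₁)))
          ( (𝟙 ·[ x₅ ≈ c₀ ⊕ c₁ ⊗ x₂ ⊕ c₂ ⊗ x₃ ⊕ c₃ ⊗ (x₂ ⊗ x₃) by image ]· x₄)
          ∷ (c₁ ·[ x₂ ⊗ x₄ ≈ x₄ ⊗ x₀ by average-I y ]· 𝟙)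
          ∷ (c₂ ·[ x₃ ⊗ x₄ ≈ x₄ ⊗ x₁ by average-J y ]· 𝟙)
          ∷ (c₃ ⊗ x₂ ·[ x₃ ⊗ x₄ ≈ x₄ ⊗ x₁ by average-J y ]· 𝟙)
          ∷ (c₃ ·[ x₂ ⊗ x₄ ≈ x₄ ⊗ x₀ by average-I y ]· x₁) ∷ []) refl
        where
        scalar : ∀ {u} v → Rat u → s (u * v) ≡ u * s v
        scalar {u} v u∈ = trans (fun-* σ u v) (cong (_* s v) (fun-rat σ u∈))
        image : s (p + q * I + r * J + t * (I * J)) ≡ p + q * s I + r * s J + t * (s I * s J)
        image = trans (fun-+ σ _ _) (cong₂ _+_ (trans (fun-+ σ _ _) (cong₂ _+_ (trans (fun-+ σ _ _)
          (cong₂ _+_ (fun-rat σ p∈) (scalar I q∈))) (scalar J r∈))) (trans (scalar (I * J) t∈) (cong (t *_) (fun-* σ I J))))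

      -- Collected by the left factors 1, σI, σJ, σI σJ the sum has inner coefficients `l₀`, ...,
      -- `l₃`. Orthogonality of the basis 1, I, J, IJ makes the first equal to 4ab and the others
      -- zero.
      averages-combination : a * b * average 1# + b * average I * I + a * average J * J - average (I * J) * (I * J)
        ≡ int (+ 4) * (a * b) * (a * b)
      averages-combination = prove cs [] xs
        (c₀ ⊗ c₁ ⊗ av 𝟙 ⊕ c₁ ⊗ av x₀ ⊗ x₀ ⊕ c₀ ⊗ av x₁ ⊗ x₁ ⊖ av (x₀ ⊗ x₁) ⊗ (x₀ ⊗ x₁)) (con (+ 4) ⊗ (c₀ ⊗ c₁) ⊗ (c₀ ⊗ c₁))
        ( (c₀ ⊗ c₁ ·[ l₀ ≈ con (+ 4) ⊗ (c₀ ⊗ c₁) by relation₀ ]· 𝟙)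
        ∷ (c₁ ⊗ x₂ ·[ l₁ ≈ 𝟘 by relation₁ ]· 𝟙)
        ∷ (c₀ ⊗ x₃ ·[ l₂ ≈ 𝟘 by relation₂ ]· 𝟙)
        ∷ (⊝ (x₂ ⊗ x₃) ·[ l₃ ≈ 𝟘 by relation₃ ]· 𝟙) ∷ []) refl
        where
        av : Expr → Expr
        av y = c₀ ⊗ c₁ ⊗ y ⊕ c₁ ⊗ x₂ ⊗ y ⊗ x₀ ⊕ c₀ ⊗ x₃ ⊗ y ⊗ x₁ ⊖ x₂ ⊗ x₃ ⊗ y ⊗ x₀ ⊗ x₁
        l₀ l₁ l₂ l₃ : Expr
        l₀ = c₀ ⊗ c₁ ⊕ c₁ ⊗ x₀ ⊗ x₀ ⊕ c₀ ⊗ x₁ ⊗ x₁ ⊖ x₀ ⊗ x₁ ⊗ x₀ ⊗ x₁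
        l₁ = c₀ ⊗ c₁ ⊗ x₀ ⊕ c₁ ⊗ x₀ ⊗ x₀ ⊗ x₀ ⊕ c₀ ⊗ x₁ ⊗ x₀ ⊗ x₁ ⊖ x₀ ⊗ x₁ ⊗ x₀ ⊗ x₀ ⊗ x₁
        l₂ = c₀ ⊗ c₁ ⊗ x₁ ⊕ c₁ ⊗ x₀ ⊗ x₁ ⊗ x₀ ⊕ c₀ ⊗ x₁ ⊗ x₁ ⊗ x₁ ⊖ x₀ ⊗ x₁ ⊗ x₁ ⊗ x₀ ⊗ x₁
        l₃ = c₀ ⊗ c₁ ⊗ x₀ ⊗ x₁ ⊕ c₁ ⊗ x₀ ⊗ x₀ ⊗ x₁ ⊗ x₀ ⊕ c₀ ⊗ x₁ ⊗ x₀ ⊗ x₁ ⊗ x₁ ⊖ x₀ ⊗ x₁ ⊗ x₀ ⊗ x₁ ⊗ x₀ ⊗ x₁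
        open Env cs [] xs using (⟦_⟧)
        relation₀ : ⟦ l₀ ⟧ ≡ ⟦ con (+ 4) ⊗ (c₀ ⊗ c₁) ⟧
        relation₀ = prove cs [] xs l₀ (con (+ 4) ⊗ (c₀ ⊗ c₁))
          ( (c₁ ·[ x₀ ⊗ x₀ ≈ c₀ by refl ]· 𝟙) ∷ (c₀ ·[ x₁ ⊗ x₁ ≈ c₁ by refl ]· 𝟙)
          ∷ (⊝ x₀ ·[ x₁ ⊗ x₀ ≈ ⊝ (x₀ ⊗ x₁) by JI ]· x₁)
          ∷ (𝟙 ·[ x₀ ⊗ x₀ ≈ c₀ by refl ]· (x₁ ⊗ x₁)) ∷ (c₀ ·[ x₁ ⊗ x₁ ≈ c₁ by refl ]· 𝟙) ∷ []) refl
        relation₁ : ⟦ l₁ ⟧ ≡ 0#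
        relation₁ = prove cs [] xs l₁ 𝟘
          ( (c₁ ·[ x₀ ⊗ x₀ ≈ c₀ by refl ]· x₀)
          ∷ (c₀ ·[ x₁ ⊗ x₀ ≈ ⊝ (x₀ ⊗ x₁) by JI ]· x₁) ∷ (⊝ c₀ ⊗ x₀ ·[ x₁ ⊗ x₁ ≈ c₁ by refl ]· 𝟙)
          ∷ (⊝ (x₀ ⊗ x₁) ·[ x₀ ⊗ x₀ ≈ c₀ by refl ]· x₁) ∷ (⊝ c₀ ⊗ x₀ ·[ x₁ ⊗ x₁ ≈ c₁ by refl ]· 𝟙) ∷ []) refl
        relation₂ : ⟦ l₂ ⟧ ≡ 0#
        relation₂ = prove cs [] xs l₂ 𝟘
          ( (c₁ ⊗ x₀ ·[ x₁ ⊗ x₀ ≈ ⊝ (x₀ ⊗ x₁) by JI ]· 𝟙) ∷ (⊝ c₁ ·[ x₀ ⊗ x₀ ≈ c₀ by refl ]· x₁)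
          ∷ (c₀ ⊗ x₁ ·[ x₁ ⊗ x₁ ≈ c₁ by refl ]· 𝟙)
          ∷ (⊝ x₀ ·[ x₁ ⊗ x₁ ≈ c₁ by refl ]· (x₀ ⊗ x₁)) ∷ (⊝ c₁ ·[ x₀ ⊗ x₀ ≈ c₀ by refl ]· x₁) ∷ []) refl
        relation₃ : ⟦ l₃ ⟧ ≡ 0#
        relation₃ = prove cs [] xs l₃ 𝟘
          ( (c₁ ·[ x₀ ⊗ x₀ ≈ c₀ by refl ]· (x₁ ⊗ x₀)) ∷ (c₀ ⊗ c₁ ·[ x₁ ⊗ x₀ ≈ ⊝ (x₀ ⊗ x₁) by JI ]· 𝟙)
          ∷ (c₀ ⊗ x₁ ⊗ x₀ ·[ x₁ ⊗ x₁ ≈ c₁ by refl ]· 𝟙) ∷ (c₀ ⊗ c₁ ·[ x₁ ⊗ x₀ ≈ ⊝ (x₀ ⊗ x₁) by JI ]· 𝟙)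
          ∷ (⊝ x₀ ·[ x₁ ⊗ x₀ ≈ ⊝ (x₀ ⊗ x₁) by JI ]· (x₁ ⊗ x₀ ⊗ x₁))
          ∷ (𝟙 ·[ x₀ ⊗ x₀ ≈ c₀ by refl ]· (x₁ ⊗ x₁ ⊗ x₀ ⊗ x₁)) ∷ (c₀ ·[ x₁ ⊗ x₁ ≈ c₁ by refl ]· (x₀ ⊗ x₁)) ∷ []) refl

      average-nonzero : ∃ λ y → average y ≢ 0#
      average-nonzero with average 1# ≟ 0# | average I ≟ 0# | average J ≟ 0# | average (I * J) ≟ 0#
      ... | no h | _ | _ | _ = _ , h
      ... | yes _ | no h | _ | _ = _ , h
      ... | yes _ | yes _ | no h | _ = _ , h
      ... | yes _ | yes _ | yes _ | no h = _ , h
      ... | yes h₀ | yes h₁ | yes h₂ | yes h₃ =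
        contradiction (sym (trans (sym vanish) averages-combination)) (*-nonzero (*-nonzero (int-nonzero λ ()) ab≢0) ab≢0)
        where
        ab≢0 : a * b ≢ 0#
        ab≢0 = *-nonzero (*-nonzero I≢0 I≢0) (*-nonzero J≢0 J≢0)
        vanish : a * b * average 1# + b * average I * I + a * average J * J - average (I * J) * (I * J) ≡ 0#
        vanish = prove cs [] (I ∷ J ∷ average 1# ∷ average I ∷ average J ∷ average (I * J) ∷ [])
          (c₀ ⊗ c₁ ⊗ x₂ ⊕ c₁ ⊗ x₃ ⊗ x₀ ⊕ c₀ ⊗ x₄ ⊗ x₁ ⊖ x₅ ⊗ (x₀ ⊗ x₁)) 𝟘
          ( (c₀ ⊗ c₁ ·[ x₂ ≈ 𝟘 by h₀ ]· 𝟙) ∷ (c₁ ·[ x₃ ≈ 𝟘 by h₁ ]· x₀) ∷ (c₀ ·[ x₄ ≈ 𝟘 by h₂ ]· x₁)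
          ∷ (⊝ 𝟙 ·[ x₅ ≈ 𝟘 by h₃ ]· (x₀ ⊗ x₁)) ∷ []) refl

  opaque
    skolem-noether : (σ : Automorphism) → ∃ λ β → β ≢ 0# × ∀ x → fun σ x * β ≡ β * x
    skolem-noether σ with y , h ← SkolemNoether.average-nonzero σ = _ , h , SkolemNoether.average-intertwines σ y

    -- σ is conjugation by some β, and β̄ β is a scalar, so β̄ is β⁻¹ up to a scalar; conjugation by
    -- β then commutes with `bar`.
    fun-bar : (σ : Automorphism) → ∀ x → bar (fun σ x) ≡ fun σ (bar x)
    fun-bar σ x with β , β≢0 , h ← skolem-noether σ = *-cancelʳ β≢0 (*-cancelˡ bar-β≢0
      (prove (cen (nrm β) ∷ []) [] (β ∷ bar β ∷ fun σ x ∷ bar (fun σ x) ∷ fun σ (bar x) ∷ bar x ∷ [])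
        (x₁ ⊗ (x₃ ⊗ x₀)) (x₁ ⊗ (x₄ ⊗ x₀))
        ( (𝟙 ·[ x₁ ⊗ x₃ ≈ x₅ ⊗ x₁ by trans (sym (bar-* (fun σ x) β)) (trans (cong bar (h x)) (bar-* β x)) ]· x₀)
        ∷ (x₅ ·[ x₁ ⊗ x₀ ≈ c₀ by bar-comm β ]· 𝟙)
        ∷ (⊝ x₁ ·[ x₄ ⊗ x₀ ≈ x₀ ⊗ x₅ by h (bar x) ]· 𝟙)
        ∷ (⊝ 𝟙 ·[ x₁ ⊗ x₀ ≈ c₀ by bar-comm β ]· x₅) ∷ []) refl))
      where
      bar-β≢0 : bar β ≢ 0#
      bar-β≢0 e = β≢0 (trans (sym (bar-involutive β)) (trans (cong bar e) bar-0))

    fun-trace : (σ : Automorphism) → ∀ x → fun σ x + bar (fun σ x) ≡ x + bar x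
    fun-trace σ x = trans (cong (λ y → fun σ x + y) (fun-bar σ x)) (trans (sym (fun-+ σ x (bar x))) (fun-rat σ (trace x)))

    I∉ℚ : ¬ Rat I
    I∉ℚ I∈ = *-nonzero (int-nonzero {+ 2} λ ()) (*-nonzero I≢0 J≢0)
      (prove (cen I∈ ∷ []) [] (J ∷ []) (con (+ 2) ⊗ (c₀ ⊗ x₀)) 𝟘 ((𝟙 ·[ x₀ ⊗ c₀ ≈ ⊝ (c₀ ⊗ x₀) by JI ]· 𝟙) ∷ []) refl)

    -- Commuting with I puts x in ℚ + ℚI, and commuting with J removes the multiple of I.
    center : ∀ {x} → Central x → Rat x
    center {x} h with p , q , p∈ , q∈ , refl ← centralizer I∉ℚ (h I) = subst Rat
      (prove (cen p∈ ∷ []) [] (I ∷ q ∷ []) c₀ (c₀ ⊕ x₁ ⊗ x₀) ((⊝ 𝟙 ·[ x₁ ≈ 𝟘 by q≡0 ]· x₀) ∷ []) refl) p∈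
      where
      q≡0 : q ≡ 0#
      q≡0 with q ≟ 0#
      ... | yes e = e
      ... | no q≢0 = contradiction
        (prove (cen p∈ ∷ cen q∈ ∷ []) [] (I ∷ J ∷ []) (con (+ 2) ⊗ (c₁ ⊗ (x₀ ⊗ x₁))) 𝟘
          ((𝟙 ·[ (c₀ ⊕ c₁ ⊗ x₀) ⊗ x₁ ≈ x₁ ⊗ (c₀ ⊕ c₁ ⊗ x₀) by h J ]· 𝟙) ∷ (c₁ ·[ x₁ ⊗ x₀ ≈ ⊝ (x₀ ⊗ x₁) by JI ]· 𝟙) ∷ []) refl)
        (*-nonzero (int-nonzero {+ 2} λ ()) (*-nonzero q≢0 (*-nonzero I≢0 J≢0)))

    -- The product tr(β) β = β² + β β̄ is rational, so a nonzero trace would make β rational.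
    pure : ∀ {β} → Rat (β * β) → ¬ Rat β → bar β ≡ - β
    pure {β} β²∈ β∉ with β + bar β ≟ 0#
    ... | yes e = neg-unique β e
    ... | no t≢0 = contradiction (rat-divide (trace β) t≢0 (subst Rat
      (prove [] [] (β ∷ bar β ∷ []) (x₀ ⊗ x₀ ⊕ x₀ ⊗ x₁) ((x₀ ⊕ x₁) ⊗ x₀) ((⊝ 𝟙 ·[ x₁ ⊗ x₀ ≈ x₀ ⊗ x₁ by bar-comm β ]· 𝟙) ∷ []) refl)
      (rat-+ β²∈ (nrm β)))) β∉

    -- Conjugating the equation gives -x = p - q β; subtracting eliminates p.
    pure-part : ∀ {β x p q} → bar β ≡ - β → bar x ≡ - x → Rat p → Rat q → x ≡ p + q * β → x ≡ q * β
    pure-part {β} {x} {p} {q} hβ hx p∈ q∈ e = halve (prove (cen p∈ ∷ cen q∈ ∷ []) [] (β ∷ x ∷ bar x ∷ [])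
      (con (+ 2) ⊗ x₁) (con (+ 2) ⊗ (c₁ ⊗ x₀))
      ((𝟙 ·[ x₁ ≈ c₀ ⊕ c₁ ⊗ x₀ by e ]· 𝟙) ∷ (𝟙 ·[ x₂ ≈ ⊝ x₁ by hx ]· 𝟙) ∷ (⊝ 𝟙 ·[ x₂ ≈ c₀ ⊖ c₁ ⊗ x₀ by bar-x ]· 𝟙) ∷ []) refl)
      where
      bar-x : bar x ≡ p - q * β
      bar-x = trans (cong bar e) (trans (bar-+ p (q * β)) (cong₂ _+_ (bar-rat p∈) (trans (bar-* q β)
        (trans (cong₂ _*_ hβ (bar-rat q∈)) (trans (neg-distribˡ β q) (cong -_ (sym (rat-central q∈ β))))))))

  -- Involutions and commuting pairs of involutions.

  Nontrivial : Automorphism → Set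
  Nontrivial σ = ¬ (∀ x → fun σ x ≡ x)

  conjugator∉ℚ : ∀ σ {β} → β ≢ 0# → (∀ x → fun σ x * β ≡ β * x) → Nontrivial σ → ¬ Rat β
  conjugator∉ℚ σ β≢0 h nt β∈ = nt λ x → *-cancelʳ β≢0 (trans (h x) (rat-central β∈ x))

  record Involution : Set where
    field
      σ : Automorphism
      involutive : ∀ x → fun σ (fun σ x) ≡ x
      nontrivial : Nontrivial σ
    s : A → A
    s = fun σ
    opaque
      β : A
      β = proj₁ (skolem-noether σ)
      β≢0 : β ≢ 0#
      β≢0 = proj₁ (proj₂ (skolem-noether σ))
      conj : ∀ x → s x * β ≡ β * x
      conj = proj₂ (proj₂ (skolem-noether σ))
      β∉ℚ : ¬ Rat β
      β∉ℚ = conjugator∉ℚ σ β≢0 conj nontrivial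
      -- Conjugation by β² is σ² = 1, so β² is central.
      β²∈ℚ : Rat (β * β)
      β²∈ℚ = center λ x → prove [] [] (β ∷ x ∷ s x ∷ s (s x) ∷ []) (x₀ ⊗ x₀ ⊗ x₁) (x₁ ⊗ (x₀ ⊗ x₀))
        ((𝟙 ·[ x₃ ≈ x₁ by involutive x ]· (x₀ ⊗ x₀)) ∷ (⊝ 𝟙 ·[ x₃ ⊗ x₀ ≈ x₀ ⊗ x₂ by conj (s x) ]· x₀)
        ∷ (⊝ x₀ ·[ x₂ ⊗ x₀ ≈ x₀ ⊗ x₁ by conj x ]· 𝟙) ∷ []) refl
      bar-β : bar β ≡ - β
      bar-β = pure β²∈ℚ β∉ℚ
      fix-β : s β ≡ β
      fix-β = *-cancelʳ β≢0 (conj β)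
      fixed : ∀ {x} → s x ≡ x → ∃₂ λ p q → Rat p × Rat q × x ≡ p + q * β
      fixed {x} h = centralizer β∉ℚ (trans (cong (_* β) (sym h)) (conj x))
      fixed-line : ∀ {p q} → Rat p → Rat q → s (p + q * β) ≡ p + q * β
      fixed-line p∈ q∈ = trans (fun-+ σ _ _) (cong₂ _+_ (fun-rat σ p∈) (trans (fun-* σ _ _) (cong₂ _*_ (fun-rat σ q∈) fix-β)))
      fixed-sum : ∀ x → s (x + s x) ≡ x + s x
      fixed-sum x = trans (fun-+ σ _ _) (trans (cong (λ y → s x + y) (involutive x)) (+-comm _ _))

  record KleinFour : Set where
    field
      S R : Involution
      commute : ∀ x → Involution.s S (Involution.s R x) ≡ Involution.s R (Involution.s S x)
      distinct : ¬ (∀ x → Involution.s R x ≡ Involution.s S x)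
    module S = Involution S
    module R = Involution R
    s r : A → A
    s = S.s
    r = R.s

    opaque
      -- Since r commutes with s, the element r β is again fixed by s and pure, hence r β = q β with
      -- q² = 1. If q = 1, then β is a pure element fixed by r, so a multiple of the conjugator of
      -- r, and r = s.
      anti : r S.β ≡ - S.β
      anti with p , q , p∈ , q∈ , e ← S.fixed {r S.β} (trans (commute S.β) (cong r S.fix-β))
        with e′ ← pure-part S.bar-β (trans (fun-bar R.σ S.β) (trans (cong r S.bar-β) (fun-neg R.σ S.β))) p∈ q∈ e
        with q ≟ 1#
      ... | no q≢1 = trans e′ (trans (cong (_* S.β) (neg-unique 1# (integral-domain q-1≢0 qq))) (trans (neg-distribˡ 1# S.β) (cong -_ (*-identityˡ S.β))))
        where
        q-1≢0 : q - 1# ≢ 0#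
        q-1≢0 h = q≢1 (trans (prove [] [] (q ∷ []) x₀ (x₀ ⊖ 𝟙 ⊕ 𝟙) [] refl) (trans (cong (_+ 1#) h) (+-identityˡ 1#)))
        qq : (q - 1#) * (1# + q) ≡ 0#
        qq = *-cancelʳ (*-nonzero S.β≢0 S.β≢0) (prove (cen q∈ ∷ []) [] (S.β ∷ r S.β ∷ []) ((c₀ ⊖ 𝟙) ⊗ (𝟙 ⊕ c₀) ⊗ (x₀ ⊗ x₀)) (𝟘 ⊗ (x₀ ⊗ x₀))
          ( (𝟙 ·[ x₁ ⊗ x₁ ≈ x₀ ⊗ x₀ by trans (sym (fun-* R.σ S.β S.β)) (fun-rat R.σ S.β²∈ℚ) ]· 𝟙)
          ∷ (⊝ 𝟙 ·[ x₁ ≈ c₀ ⊗ x₀ by e′ ]· x₁) ∷ (⊝ (c₀ ⊗ x₀) ·[ x₁ ≈ c₀ ⊗ x₀ by e′ ]· 𝟙) ∷ []) refl)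
      ... | yes refl with p′ , q′ , p′∈ , q′∈ , f ← R.fixed {S.β} (trans e′ (*-identityˡ _))
        with f′ ← pure-part R.bar-β S.bar-β p′∈ q′∈ f = ⊥-elim (distinct λ x → *-cancelʳ S.β≢0
          (prove (cen q′∈ ∷ []) [] (S.β ∷ R.β ∷ x ∷ s x ∷ r x ∷ []) (x₄ ⊗ x₀) (x₃ ⊗ x₀)
            ( (x₄ ·[ x₀ ≈ c₀ ⊗ x₁ by f′ ]· 𝟙) ∷ (c₀ ·[ x₄ ⊗ x₁ ≈ x₁ ⊗ x₂ by R.conj x ]· 𝟙)
            ∷ (⊝ 𝟙 ·[ x₀ ≈ c₀ ⊗ x₁ by f′ ]· x₂) ∷ (⊝ 𝟙 ·[ x₃ ⊗ x₀ ≈ x₀ ⊗ x₂ by S.conj x ]· 𝟙) ∷ []) refl))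

      anticommute : S.β * R.β ≡ - (R.β * S.β)
      anticommute = prove [] [] (S.β ∷ R.β ∷ r S.β ∷ []) (x₀ ⊗ x₁) (⊝ (x₁ ⊗ x₀))
        ((𝟙 ·[ x₂ ≈ ⊝ x₀ by anti ]· x₁) ∷ (⊝ 𝟙 ·[ x₂ ⊗ x₁ ≈ x₁ ⊗ x₀ by R.conj S.β ]· 𝟙) ∷ []) refl

      anti′ : s R.β ≡ - R.β
      anti′ = *-cancelʳ S.β≢0 (trans (S.conj R.β) (trans anticommute (sym (neg-distribˡ _ _))))

    N : A → A
    N x = x + s x + r (x + s x)

    opaque
      N-rat : ∀ x → Rat (N x)
      N-rat x with p , q , p∈ , q∈ , e ← S.fixed (S.fixed-sum x) = subst Rat (sym eq) (rat-+ p∈ p∈)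
        where
        eq : N x ≡ p + p
        eq = trans (cong (λ y → y + r y) e) (prove (cen p∈ ∷ cen q∈ ∷ []) [] (S.β ∷ r S.β ∷ r (p + q * S.β) ∷ [])
          (c₀ ⊕ c₁ ⊗ x₀ ⊕ x₂) (c₀ ⊕ c₀)
          ( (𝟙 ·[ x₂ ≈ c₀ ⊕ c₁ ⊗ x₁ by trans (fun-+ R.σ _ _) (cong₂ _+_ (fun-rat R.σ p∈) (trans (fun-* R.σ _ _) (cong (_* r S.β) (fun-rat R.σ q∈)))) ]· 𝟙)
          ∷ (c₁ ·[ x₁ ≈ ⊝ x₀ by anti ]· 𝟙) ∷ []) refl)

      -- As `N x` is rational, 2 N(x) = N(x) + N(x̄) = N(tr x) = 4 tr x.
      N-trace : ∀ x → N x ≡ int (+ 2) * (x + bar x)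
      N-trace x = halve (begin
        int (+ 2) * N x                           ≡⟨ prove [] [] (N x ∷ bar (N x) ∷ []) (con (+ 2) ⊗ x₀) (x₀ ⊕ x₁) ((⊝ 𝟙 ·[ x₁ ≈ x₀ by bar-rat (N-rat x) ]· 𝟙) ∷ []) refl ⟩
        N x + bar (N x)                           ≡⟨ cong (λ y → N x + y) (trans (bar-+ _ _) (cong₂ _+_ (trans (bar-+ _ _) (cong (λ y → bar x + y) (fun-bar S.σ x)))
                                                       (trans (fun-bar R.σ _) (cong r (trans (bar-+ _ _) (cong (λ y → bar x + y) (fun-bar S.σ x))))))) ⟩
        N x + N (bar x)                           ≡⟨ prove [] [] (x ∷ s x ∷ r (x + s x) ∷ bar x ∷ s (bar x) ∷ r (bar x + s (bar x)) ∷ [])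
                                                       (x₀ ⊕ x₁ ⊕ x₂ ⊕ (x₃ ⊕ x₄ ⊕ x₅)) (x₀ ⊕ x₃ ⊕ (x₁ ⊕ x₄) ⊕ (x₂ ⊕ x₅)) [] refl ⟩
        x + bar x + (s x + s (bar x)) + (r (x + s x) + r (bar x + s (bar x)))
                                                  ≡⟨ cong₂ (λ y w → x + bar x + y + w) s-tr (trans (sym (fun-+ R.σ _ _)) (trans (cong r rearrange) (fun-rat R.σ (rat-+ (trace x) (trace x))))) ⟩
        x + bar x + (x + bar x) + (x + bar x + (x + bar x)) ≡⟨ prove [] [] (x + bar x ∷ []) (x₀ ⊕ x₀ ⊕ (x₀ ⊕ x₀)) (con (+ 2) ⊗ (con (+ 2) ⊗ x₀)) [] refl ⟩
        int (+ 2) * (int (+ 2) * (x + bar x))     ∎)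
        where
        open ≡-Reasoning
        s-tr : s x + s (bar x) ≡ x + bar x
        s-tr = trans (sym (fun-+ S.σ _ _)) (fun-rat S.σ (trace x))
        rearrange : x + s x + (bar x + s (bar x)) ≡ x + bar x + (x + bar x)
        rearrange = trans (prove [] [] (x ∷ s x ∷ bar x ∷ s (bar x) ∷ []) (x₀ ⊕ x₁ ⊕ (x₂ ⊕ x₃)) (x₀ ⊕ x₂ ⊕ (x₁ ⊕ x₃)) [] refl) (cong (λ y → x + bar x + y) s-tr)

-- Integer vectors, contents and primitive planes.

module IntegerVectors where
  open Solve ℤ-ℤRing
  open Env using (prove; _·[_≈_by_]·_)

  infixl 6 _+ᵥ_
  infixr 7 _·ᵥ_
  _+ᵥ_ : ∀ {n} → Vec ℤ n → Vec ℤ n → Vec ℤ n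
  [] +ᵥ [] = []
  (m ∷ v) +ᵥ (n ∷ w) = m ℤ.+ n ∷ v +ᵥ w

  _·ᵥ_ : ∀ {n} → ℤ → Vec ℤ n → Vec ℤ n
  k ·ᵥ [] = []
  k ·ᵥ (n ∷ v) = k ℤ.* n ∷ k ·ᵥ v

  0ᵥ : ∀ n → Vec ℤ n
  0ᵥ zero = []
  0ᵥ (suc n) = 0ℤ ∷ 0ᵥ n

  dot : ∀ {n} → Vec ℤ n → Vec ℤ n → ℤ
  dot [] [] = 0ℤ
  dot (m ∷ v) (n ∷ w) = m ℤ.* n ℤ.+ dot v w

  dot-+ : ∀ {n} (u v w : Vec ℤ n) → dot u (v +ᵥ w) ≡ dot u v ℤ.+ dot u w
  dot-+ [] [] [] = refl
  dot-+ (k ∷ u) (m ∷ v) (n ∷ w) = prove [] (k ∷ m ∷ n ∷ dot u (v +ᵥ w) ∷ dot u v ∷ dot u w ∷ []) []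
    (ι (z₀ ⊗ (z₁ ⊕ z₂) ⊕ z₃)) (ι (z₀ ⊗ z₁ ⊕ z₄ ⊕ (z₀ ⊗ z₂ ⊕ z₅))) ((𝟙 ·[ ι z₃ ≈ ι (z₄ ⊕ z₅) by dot-+ u v w ]· 𝟙) ∷ []) refl

  dot-· : ∀ {n} k (u v : Vec ℤ n) → dot u (k ·ᵥ v) ≡ k ℤ.* dot u v
  dot-· k [] [] = sym (ℤP.*-zeroʳ k)
  dot-· k (m ∷ u) (n ∷ v) = prove [] (k ∷ m ∷ n ∷ dot u (k ·ᵥ v) ∷ dot u v ∷ []) []
    (ι (z₁ ⊗ (z₀ ⊗ z₂) ⊕ z₃)) (ι (z₀ ⊗ (z₁ ⊗ z₂ ⊕ z₄))) ((𝟙 ·[ ι z₃ ≈ ι (z₀ ⊗ z₄) by dot-· k u v ]· 𝟙) ∷ []) refl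

  dot-·ˡ : ∀ {n} k (u v : Vec ℤ n) → dot (k ·ᵥ u) v ≡ k ℤ.* dot u v
  dot-·ˡ k [] [] = sym (ℤP.*-zeroʳ k)
  dot-·ˡ k (m ∷ u) (n ∷ v) = prove [] (k ∷ m ∷ n ∷ dot (k ·ᵥ u) v ∷ dot u v ∷ []) []
    (ι (z₀ ⊗ z₁ ⊗ z₂ ⊕ z₃)) (ι (z₀ ⊗ (z₁ ⊗ z₂ ⊕ z₄))) ((𝟙 ·[ ι z₃ ≈ ι (z₀ ⊗ z₄) by dot-·ˡ k u v ]· 𝟙) ∷ []) refl

  ·ᵥ-assoc : ∀ {n} k l (v : Vec ℤ n) → k ·ᵥ l ·ᵥ v ≡ (k ℤ.* l) ·ᵥ v
  ·ᵥ-assoc k l [] = refl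
  ·ᵥ-assoc k l (m ∷ v) = cong₂ _∷_ (sym (ℤP.*-assoc k l m)) (·ᵥ-assoc k l v)

  ·ᵥ-cancel : ∀ {n} k (v w : Vec ℤ n) → k ≢ 0ℤ → k ·ᵥ v ≡ k ·ᵥ w → v ≡ w
  ·ᵥ-cancel k [] [] _ _ = refl
  ·ᵥ-cancel k (m ∷ v) (n ∷ w) k≢0 h with i , j ← ∷-injective h =
    cong₂ _∷_ (ℤP.*-cancelˡ-≡ k m n {{ℤ.≢-nonZero k≢0}} i) (·ᵥ-cancel k v w k≢0 j)

  ·ᵥ-distrib : ∀ {n} k (v w : Vec ℤ n) → k ·ᵥ (v +ᵥ w) ≡ k ·ᵥ v +ᵥ k ·ᵥ w
  ·ᵥ-distrib k [] [] = refl
  ·ᵥ-distrib k (m ∷ v) (n ∷ w) = cong₂ _∷_ (ℤP.*-distribˡ-+ k m n) (·ᵥ-distrib k v w)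

  difference-zero : ∀ {n} (v w : Vec ℤ n) → v +ᵥ -[1+ 0 ] ·ᵥ w ≡ 0ᵥ n → v ≡ w
  difference-zero [] [] _ = refl
  difference-zero (m ∷ v) (n ∷ w) h with i , j ← ∷-injective h =
    cong₂ _∷_ (ℤP.i-j≡0⇒i≡j m n (trans (cong (λ k → m ℤ.+ k) (sym (ℤP.-1*i≡-i n))) i)) (difference-zero v w j)

  +ᵥ-·ᵥ0 : ∀ {n} k (v : Vec ℤ n) → v +ᵥ k ·ᵥ 0ᵥ n ≡ v
  +ᵥ-·ᵥ0 k [] = refl
  +ᵥ-·ᵥ0 k (m ∷ v) = cong₂ _∷_ (trans (cong (λ n → m ℤ.+ n) (ℤP.*-zeroʳ k)) (ℤP.+-identityʳ m)) (+ᵥ-·ᵥ0 k v)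

  absolute : ∀ n → ∃ λ s → ℤ.+ ℤ.∣ n ∣ ≡ s ℤ.* n × n ≡ s ℤ.* ℤ.+ ℤ.∣ n ∣ × s ℤ.* s ≡ 1ℤ
  absolute (+ n) = 1ℤ , sym (ℤP.*-identityˡ _) , sym (ℤP.*-identityˡ _) , refl
  absolute -[1+ n ] = -[1+ 0 ] , sym (ℤP.-1*i≡-i -[1+ n ]) , sym (ℤP.-1*i≡-i (ℤ.+ suc n)) , refl

  nat-eq : ∀ d y n x m → d ℕ.+ y ℕ.* n ≡ x ℕ.* m → ℤ.+ d ℤ.+ ℤ.+ y ℤ.* ℤ.+ n ≡ ℤ.+ x ℤ.* ℤ.+ m
  nat-eq d y n x m h = trans (cong (λ w → ℤ.+ d ℤ.+ w) (sym (ℤP.pos-* y n))) (trans (cong (λ w → ℤ.+ w) h) (ℤP.pos-* x m))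

  opaque
    bezoutℕ : ∀ m n → ∃ λ d → ∃₂ λ q r → ∃₂ λ a b → m ≡ q ℕ.* d × n ≡ r ℕ.* d × a ℤ.* ℤ.+ m ℤ.+ b ℤ.* ℤ.+ n ≡ ℤ.+ d
    bezoutℕ m n with Bézout.lemma m n
    ... | Bézout.result d g b with ℕD.divides q qe ← GCD.gcd∣m g with ℕD.divides r re ← GCD.gcd∣n g with b
    ... | Bézout.+- x y eq = d , q , r , ℤ.+ x , ℤ.- ℤ.+ y , qe , re ,
      prove [] (ℤ.+ x ∷ ℤ.+ y ∷ ℤ.+ m ∷ ℤ.+ n ∷ ℤ.+ d ∷ []) [] (ι (z₀ ⊗ z₂ ⊕ ⊝ z₁ ⊗ z₃)) (ι z₄)
        ((⊝ 𝟙 ·[ ι (z₄ ⊕ z₁ ⊗ z₃) ≈ ι (z₀ ⊗ z₂) by nat-eq d y n x m eq ]· 𝟙) ∷ []) refl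
    ... | Bézout.-+ x y eq = d , q , r , ℤ.- ℤ.+ x , ℤ.+ y , qe , re ,
      prove [] (ℤ.+ x ∷ ℤ.+ y ∷ ℤ.+ m ∷ ℤ.+ n ∷ ℤ.+ d ∷ []) [] (ι (⊝ z₀ ⊗ z₂ ⊕ z₁ ⊗ z₃)) (ι z₄)
        ((⊝ 𝟙 ·[ ι (z₄ ⊕ z₀ ⊗ z₂) ≈ ι (z₁ ⊗ z₃) by nat-eq d x m y n eq ]· 𝟙) ∷ []) refl

    -- The Bézout relation is imposed on the cofactors so that it survives x = y = 0, where g = 0
    -- and the cofactors are taken to be 1 and 0. It gives the unimodular change of basis used when
    -- a vector is adjoined to a lattice.
    bezout : ∀ x y → ∃ λ g → ∃₂ λ x′ y′ → ∃₂ λ a b → x ≡ g ℤ.* x′ × y ≡ g ℤ.* y′ × a ℤ.* x′ ℤ.+ b ℤ.* y′ ≡ 1ℤ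
    bezout x y with d , q , r , a , b , qe , re , h ← bezoutℕ ℤ.∣ x ∣ ℤ.∣ y ∣ with s , _ , xs , s² ← absolute x with t , _ , yt , t² ← absolute y with d
    ... | zero = 0ℤ , 1ℤ , 0ℤ , 1ℤ , 0ℤ ,
      ℤP.∣i∣≡0⇒i≡0 (trans qe (ℕP.*-zeroʳ q)) , ℤP.∣i∣≡0⇒i≡0 (trans re (ℕP.*-zeroʳ r)) , refl
    ... | suc d′ = ℤ.+ suc d′ , s ℤ.* ℤ.+ q , t ℤ.* ℤ.+ r , a ℤ.* s , b ℤ.* t ,
      trans xs (trans (cong (s ℤ.*_) qe′) (prove [] (s ∷ ℤ.+ q ∷ ℤ.+ suc d′ ∷ []) [] (ι (z₀ ⊗ (z₁ ⊗ z₂))) (ι (z₂ ⊗ (z₀ ⊗ z₁))) [] refl)) ,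
      trans yt (trans (cong (t ℤ.*_) re′) (prove [] (t ∷ ℤ.+ r ∷ ℤ.+ suc d′ ∷ []) [] (ι (z₀ ⊗ (z₁ ⊗ z₂))) (ι (z₂ ⊗ (z₀ ⊗ z₁))) [] refl)) ,
      ℤP.*-cancelˡ-≡ (ℤ.+ suc d′) _ _ (prove [] (s ∷ t ∷ a ∷ b ∷ ℤ.+ q ∷ ℤ.+ r ∷ ℤ.+ suc d′ ∷ ℤ.+ ℤ.∣ x ∣ ∷ ℤ.+ ℤ.∣ y ∣ ∷ []) []
        (ι (𝕫 6 ⊗ (z₂ ⊗ z₀ ⊗ (z₀ ⊗ z₄) ⊕ z₃ ⊗ z₁ ⊗ (z₁ ⊗ z₅)))) (ι (𝕫 6 ⊗ con 1ℤ))
        ( (𝟙 ·[ ι (z₂ ⊗ 𝕫 7 ⊕ z₃ ⊗ 𝕫 8) ≈ ι (𝕫 6) by h ]· 𝟙)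
        ∷ (⊝ ι z₂ ·[ ι (𝕫 7) ≈ ι (z₄ ⊗ 𝕫 6) by qe′ ]· 𝟙) ∷ (⊝ ι z₃ ·[ ι (𝕫 8) ≈ ι (z₅ ⊗ 𝕫 6) by re′ ]· 𝟙)
        ∷ (ι (𝕫 6 ⊗ z₂ ⊗ z₄) ·[ ι (z₀ ⊗ z₀) ≈ 𝟙 by s² ]· 𝟙) ∷ (ι (𝕫 6 ⊗ z₃ ⊗ z₅) ·[ ι (z₁ ⊗ z₁) ≈ 𝟙 by t² ]· 𝟙) ∷ []) refl)
      where
      qe′ : ℤ.+ ℤ.∣ x ∣ ≡ ℤ.+ q ℤ.* ℤ.+ suc d′
      qe′ = trans (cong (λ w → ℤ.+ w) qe) (ℤP.pos-* q (suc d′))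
      re′ : ℤ.+ ℤ.∣ y ∣ ≡ ℤ.+ r ℤ.* ℤ.+ suc d′
      re′ = trans (cong (λ w → ℤ.+ w) re) (ℤP.pos-* r (suc d′))

    -- An extended gcd: d is the gcd of the entries, w the primitive part, and μ a functional
    -- attaining d on v.
    content : ∀ {n} (v : Vec ℤ n) → ∃ λ d → ∃₂ λ w μ → v ≡ d ·ᵥ w × dot μ v ≡ d
    content [] = 0ℤ , [] , [] , refl , refl
    content (x ∷ v) with d , w , μ , v≡ , μv ← content v with g , x′ , d′ , a , b , xe , de , h ← bezout x d =
      g , x′ ∷ d′ ·ᵥ w , a ∷ b ·ᵥ μ ,
      cong₂ _∷_ xe (trans v≡ (trans (cong (_·ᵥ w) de) (sym (·ᵥ-assoc g d′ w)))) ,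
      prove [] (a ∷ b ∷ x ∷ d ∷ dot (b ·ᵥ μ) v ∷ dot μ v ∷ g ∷ x′ ∷ d′ ∷ []) []
        (ι (z₀ ⊗ z₂ ⊕ z₄)) (ι (𝕫 6))
        ( (𝟙 ·[ ι z₄ ≈ ι (z₁ ⊗ z₅) by dot-·ˡ b μ v ]· 𝟙) ∷ (ι z₁ ·[ ι z₅ ≈ ι z₃ by μv ]· 𝟙)
        ∷ (ι z₀ ·[ ι z₂ ≈ ι (𝕫 6 ⊗ 𝕫 7) by xe ]· 𝟙) ∷ (ι z₁ ·[ ι z₃ ≈ ι (𝕫 6 ⊗ 𝕫 8) by de ]· 𝟙)
        ∷ (ι (𝕫 6) ·[ ι (z₀ ⊗ 𝕫 7 ⊕ z₁ ⊗ 𝕫 8) ≈ 𝟙 by h ]· 𝟙) ∷ []) refl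

  Divides : ∀ {n} → ℤ → Vec ℤ n → Set
  Divides N v = ∃ λ w → v ≡ N ·ᵥ w

  divides? : ∀ {n} N (v : Vec ℤ n) → Dec (Divides N v)
  divides? N [] = yes ([] , refl)
  divides? N (x ∷ v) with N ∣? x | divides? N v
  ... | yes (divides q e) | yes (w , f) = yes (q ∷ w , cong₂ _∷_ (trans e (ℤP.*-comm q N)) f)
  ... | no h | _ = no λ { (q ∷ w , e) → h (divides q (trans (proj₁ (∷-injective e)) (ℤP.*-comm N q))) }
  ... | _ | no h = no λ { (q ∷ w , e) → h (w , proj₂ (∷-injective e)) }

  -- On u, w the functionals λ′, μ have a unitriangular matrix with lower left entry μ·u. Thus u, w
  -- span a direct summand of ℤⁿ, and coordinates in it are read off without denominators.
  module Plane {n} (u w λ′ μ : Vec ℤ n) (λu : dot λ′ u ≡ 1ℤ) (λw : dot λ′ w ≡ 0ℤ) (μw : dot μ w ≡ 1ℤ) where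

    opaque
      first : ∀ k l → dot λ′ (k ·ᵥ u +ᵥ l ·ᵥ w) ≡ k
      first k l = trans (dot-+ λ′ _ _) (trans (cong₂ ℤ._+_ (trans (dot-· k λ′ u) (trans (cong (k ℤ.*_) λu) (ℤP.*-identityʳ k)))
        (trans (dot-· l λ′ w) (trans (cong (l ℤ.*_) λw) (ℤP.*-zeroʳ l)))) (ℤP.+-identityʳ k))

      second : ∀ k l → dot μ (k ·ᵥ u +ᵥ l ·ᵥ w) ≡ k ℤ.* dot μ u ℤ.+ l
      second k l = trans (dot-+ μ _ _) (cong₂ ℤ._+_ (dot-· k μ u) (trans (dot-· l μ w) (trans (cong (l ℤ.*_) μw) (ℤP.*-identityʳ l))))

      plane-scalar : ∀ N k l v → k ·ᵥ u +ᵥ l ·ᵥ w ≡ N ·ᵥ v → k ≡ N ℤ.* dot λ′ v × l ≡ N ℤ.* (dot μ v ℤ.- dot λ′ v ℤ.* dot μ u)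
      plane-scalar N k l v h = k≡ , prove [] (N ∷ k ∷ l ∷ dot μ u ∷ dot λ′ v ∷ dot μ v ∷ []) [] (ι z₂) (ι (z₀ ⊗ (z₅ ⊖ z₄ ⊗ z₃)))
          ((⊝ 𝟙 ·[ ι (z₀ ⊗ z₅) ≈ ι (z₁ ⊗ z₃ ⊕ z₂) by trans (sym (dot-· N μ v)) (trans (cong (dot μ) (sym h)) (second k l)) ]· 𝟙)
          ∷ (⊝ 𝟙 ·[ ι z₁ ≈ ι (z₀ ⊗ z₄) by k≡ ]· (ι z₃)) ∷ []) refl
        where
        k≡ : k ≡ N ℤ.* dot λ′ v
        k≡ = trans (sym (first k l)) (trans (cong (dot λ′) h) (dot-· N λ′ v))

      plane-coordinates : ∀ M P R v → M ≢ 0ℤ → M ·ᵥ v ≡ P ·ᵥ u +ᵥ R ·ᵥ w → ∃₂ λ k l → v ≡ k ·ᵥ u +ᵥ l ·ᵥ w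
      plane-coordinates M P R v M≢0 h with P≡ , R≡ ← plane-scalar M P R v (sym h) = _ , _ ,
        ·ᵥ-cancel M v _ M≢0 (trans h (sym (trans (·ᵥ-distrib M _ _) (cong₂ _+ᵥ_ (trans (·ᵥ-assoc M _ u) (cong (_·ᵥ u) (sym P≡))) (trans (·ᵥ-assoc M _ w) (cong (_·ᵥ w) (sym R≡)))))))

-- Lattices and their extension by a vector.

module Lattices (Q : QuaternionDivisionAlgebra) where
  open DivisionAlgebra Q
  open IntegerVectors

  lin : ∀ {n} → Vec ℤ n → Vec A n → A
  lin [] [] = 0#
  lin (k ∷ v) (e ∷ es) = int k * e + lin v es

  opaque
    lin-+ : ∀ {n} v w (es : Vec A n) → lin (v +ᵥ w) es ≡ lin v es + lin w es
    lin-+ [] [] [] = sym (+-identityˡ 0#)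
    lin-+ (m ∷ v) (n ∷ w) (e ∷ es) = prove [] (m ∷ n ∷ []) (e ∷ lin (v +ᵥ w) es ∷ lin v es ∷ lin w es ∷ [])
      (ι (z₀ ⊕ z₁) ⊗ x₀ ⊕ x₁) (ι z₀ ⊗ x₀ ⊕ x₂ ⊕ (ι z₁ ⊗ x₀ ⊕ x₃)) ((𝟙 ·[ x₁ ≈ x₂ ⊕ x₃ by lin-+ v w es ]· 𝟙) ∷ []) refl

    lin-· : ∀ {n} k v (es : Vec A n) → lin (k ·ᵥ v) es ≡ int k * lin v es
    lin-· k [] [] = sym (zeroʳ _)
    lin-· k (m ∷ v) (e ∷ es) = prove [] (k ∷ m ∷ []) (e ∷ lin (k ·ᵥ v) es ∷ lin v es ∷ [])
      (ι (z₀ ⊗ z₁) ⊗ x₀ ⊕ x₁) (ι z₀ ⊗ (ι z₁ ⊗ x₀ ⊕ x₂)) ((𝟙 ·[ x₁ ≈ ι z₀ ⊗ x₂ by lin-· k v es ]· 𝟙) ∷ []) refl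

    lin-0 : ∀ {n} (es : Vec A n) → lin (0ᵥ n) es ≡ 0#
    lin-0 [] = refl
    lin-0 (e ∷ es) = trans (cong₂ _+_ (trans (cong (_* e) int-0) (zeroˡ e)) (lin-0 es)) (+-identityˡ 0#)

  Span : ∀ {n} → Vec A n → A → Set
  Span es x = ∃ λ v → x ≡ lin v es

  Independent : ∀ {n} → Vec A n → Set
  Independent {n} es = ∀ v → lin v es ≡ 0# → v ≡ 0ᵥ n

  -- A basis of ℤv + span es with as many members as es, expressed by the two inclusions.
  Extension : ∀ {n} → Vec A n → A → Set
  Extension {n} es v = ∃ λ es′ → Independent es′ ×
    (∀ k u → Span es′ (int k * v + lin u es)) × (∀ u → ∃₂ λ k u′ → lin {n} u es′ ≡ int k * v + lin u′ es)

  opaque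
    head-independent : ∀ {n e} {es : Vec A n} → Independent (e ∷ es) → ∀ k v → int k * e + lin v es ≡ 0# → k ≡ 0ℤ
    head-independent ind k v h = proj₁ (∷-injective (ind (k ∷ v) h))

    tail-independent : ∀ {n e} {es : Vec A n} → Independent (e ∷ es) → Independent es
    tail-independent {e = e} {es} ind v h = proj₂ (∷-injective (ind (0ℤ ∷ v) (trans (cong₂ _+_ (trans (cong (_* e) int-0) (zeroˡ e)) h) (+-identityˡ 0#))))

    -- If g v = p E + ⋯ and g, p have cofactors q′, p′ with a p′ + b q′ = 1, then E and v are
    -- replaced by w = a v + b E and v″ = q′ v − p′ E, the latter being commensurable with
    -- the remaining vectors: E = q′ w − a v″ and v = p′ w + b v″.
    extend : ∀ {n} (es : Vec A n) → Independent es → ∀ v g → g ≢ 0ℤ → Span es (int g * v) →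
      Extension es v
    extend [] ind v g g≢0 ([] , gv≡0) = [] , (λ { [] _ → refl }) , (λ { k [] → [] , zero-combination k }) , (λ { [] → 0ℤ , [] , sym (zero-combination 0ℤ) })
      where
      zero-combination : ∀ k → int k * v + 0# ≡ 0#
      zero-combination k = trans (+-identityʳ _) (trans (cong (int k *_) (integral-domain (int-nonzero g≢0) gv≡0)) (zeroʳ _))
    extend {suc n} (E ∷ es) ind v g g≢0 (p ∷ u , gv)
      with h , p′ , q′ , a , b , p≡ , g≡ , ab ← bezout p g = go (extend es (tail-independent ind) v″ h h≢0 (u , hv″))
      where
      v″ w : A
      v″ = int q′ * v - int p′ * E
      w = int a * v + int b * E
      h≢0 : h ≢ 0ℤ
      h≢0 h≡0 = g≢0 (trans g≡ (trans (cong (ℤ._* q′) h≡0) (ℤP.*-zeroˡ q′)))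
      ig : int g ≡ int (h ℤ.* q′)
      ig = cong int g≡
      ip : int p ≡ int (h ℤ.* p′)
      ip = cong int p≡
      iab : int (a ℤ.* p′ ℤ.+ b ℤ.* q′) ≡ 1#
      iab = trans (cong int ab) int-1
      hv″ : int h * v″ ≡ lin u es
      hv″ = prove [] (h ∷ p ∷ g ∷ p′ ∷ q′ ∷ []) (v ∷ E ∷ lin u es ∷ []) (ι z₀ ⊗ (ι z₄ ⊗ x₀ ⊖ ι z₃ ⊗ x₁)) x₂
        ( (⊝ 𝟙 ·[ ι z₂ ≈ ι (z₀ ⊗ z₄) by ig ]· x₀) ∷ (𝟙 ·[ ι z₂ ⊗ x₀ ≈ ι z₁ ⊗ x₁ ⊕ x₂ by gv ]· 𝟙)
        ∷ (𝟙 ·[ ι z₁ ≈ ι (z₀ ⊗ z₃) by ip ]· x₁) ∷ []) refl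
      go : Extension es v″ → Extension (E ∷ es) v
      go (es′ , ind′ , sub , sup) = w ∷ es′ , independent , above , below
        where
        above : ∀ k u → Span (w ∷ es′) (int k * v + lin u (E ∷ es))
        above k (m ∷ u) with u′ , e ← sub (k ℤ.* b ℤ.- m ℤ.* a) u = (k ℤ.* p′ ℤ.+ m ℤ.* q′) ∷ u′ ,
          prove [] (a ∷ b ∷ p′ ∷ q′ ∷ k ∷ m ∷ []) (v ∷ E ∷ lin u es ∷ lin u′ es′ ∷ [])
            (ι z₄ ⊗ x₀ ⊕ (ι z₅ ⊗ x₁ ⊕ x₂)) (ι (z₄ ⊗ z₂ ⊕ z₅ ⊗ z₃) ⊗ (ι z₀ ⊗ x₀ ⊕ ι z₁ ⊗ x₁) ⊕ x₃)
            ( (𝟙 ·[ ι (z₄ ⊗ z₁ ⊖ z₅ ⊗ z₀) ⊗ (ι z₃ ⊗ x₀ ⊖ ι z₂ ⊗ x₁) ⊕ x₂ ≈ x₃ by e ]· 𝟙)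
            ∷ (⊝ 𝟙 ·[ ι (z₀ ⊗ z₂ ⊕ z₁ ⊗ z₃) ≈ 𝟙 by iab ]· (ι z₄ ⊗ x₀ ⊕ ι z₅ ⊗ x₁)) ∷ []) refl
        below : ∀ u → ∃₂ λ k u′ → lin u (w ∷ es′) ≡ int k * v + lin u′ (E ∷ es)
        below (m ∷ u) with k , u′ , e ← sup u = m ℤ.* a ℤ.+ k ℤ.* q′ , (m ℤ.* b ℤ.- k ℤ.* p′) ∷ u′ ,
          prove [] (a ∷ b ∷ p′ ∷ q′ ∷ k ∷ m ∷ []) (v ∷ E ∷ lin u es′ ∷ lin u′ es ∷ [])
            (ι z₅ ⊗ (ι z₀ ⊗ x₀ ⊕ ι z₁ ⊗ x₁) ⊕ x₂) (ι (z₅ ⊗ z₀ ⊕ z₄ ⊗ z₃) ⊗ x₀ ⊕ (ι (z₅ ⊗ z₁ ⊖ z₄ ⊗ z₂) ⊗ x₁ ⊕ x₃))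
            ((𝟙 ·[ x₂ ≈ ι z₄ ⊗ (ι z₃ ⊗ x₀ ⊖ ι z₂ ⊗ x₁) ⊕ x₃ by e ]· 𝟙) ∷ []) refl
        independent : Independent (w ∷ es′)
        independent (m ∷ c) eq with k , d , e ← sup c = cong₂ _∷_ m≡0 (ind′ c (trans (sym (trans (cong₂ _+_ (trans (cong (λ i → int i * w) m≡0) (trans (cong (_* w) int-0) (zeroˡ w))) refl) (+-identityˡ _))) eq))
          where
          mh≡0 : m ℤ.* h ≡ 0ℤ
          mh≡0 = head-independent ind (m ℤ.* h) ((a ℤ.* m ℤ.+ q′ ℤ.* k) ·ᵥ u +ᵥ (q′ ℤ.* h) ·ᵥ d)
            (prove [] (a ∷ b ∷ p′ ∷ q′ ∷ k ∷ m ∷ h ∷ []) (v ∷ E ∷ lin c es′ ∷ lin d es ∷ lin u es ∷ lin ((a ℤ.* m ℤ.+ q′ ℤ.* k) ·ᵥ u +ᵥ (q′ ℤ.* h) ·ᵥ d) es ∷ [])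
              (ι (z₅ ⊗ 𝕫 6) ⊗ x₁ ⊕ x₅) 𝟘
              ( (𝟙 ·[ x₅ ≈ ι (z₀ ⊗ z₅ ⊕ z₃ ⊗ z₄) ⊗ x₄ ⊕ ι (z₃ ⊗ 𝕫 6) ⊗ x₃ by trans (lin-+ ((a ℤ.* m ℤ.+ q′ ℤ.* k) ·ᵥ u) ((q′ ℤ.* h) ·ᵥ d) es) (cong₂ _+_ (lin-· _ u es) (lin-· _ d es)) ]· 𝟙)
              ∷ (⊝ ι (z₀ ⊗ z₅ ⊕ z₃ ⊗ z₄) ·[ ι (𝕫 6) ⊗ (ι z₃ ⊗ x₀ ⊖ ι z₂ ⊗ x₁) ≈ x₄ by hv″ ]· 𝟙)
              ∷ (⊝ ι (z₃ ⊗ 𝕫 6) ·[ x₂ ≈ ι z₄ ⊗ (ι z₃ ⊗ x₀ ⊖ ι z₂ ⊗ x₁) ⊕ x₃ by e ]· 𝟙)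
              ∷ (ι (z₃ ⊗ 𝕫 6) ·[ ι z₅ ⊗ (ι z₀ ⊗ x₀ ⊕ ι z₁ ⊗ x₁) ⊕ x₂ ≈ 𝟘 by eq ]· 𝟙)
              ∷ (⊝ ι (𝕫 6 ⊗ z₅) ·[ ι (z₀ ⊗ z₂ ⊕ z₁ ⊗ z₃) ≈ 𝟙 by iab ]· x₁) ∷ []) refl)
          m≡0 : m ≡ 0ℤ
          m≡0 with ℤP.i*j≡0⇒i≡0∨j≡0 m mh≡0
          ... | inj₁ z = z
          ... | inj₂ z = contradiction z h≢0

  record IsLattice (L : A → Set) : Set where
    field
      basis : Vec A 4
      independent : Independent basis
      member : ∀ x → L x ⇔ Span basis x
      full : ∀ x → ∃ λ d → d ≢ 0ℤ × L (int d * x)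

  opaque
    adjoin-vector : ∀ {L} → IsLattice L → ∀ v → IsLattice (λ x → ∃₂ λ k y → L y × x ≡ int k * v + y)
    adjoin-vector {L} lat v with g , g≢0 , Lgv ← IsLattice.full lat v
      with es′ , ind′ , above , below ← extend (IsLattice.basis lat) (IsLattice.independent lat) v g g≢0 (Equivalence.to (IsLattice.member lat _) Lgv) = record
      { basis = es′
      ; independent = ind′
      ; member = λ x → mk⇔
          (λ { (k , y , Ly , refl) → into k (Equivalence.to (member y) Ly) })
          (λ { (c , refl) → out (below c) })
      ; full = λ x → let d , d≢0 , Ldx = full x in d , d≢0 , 0ℤ , int d * x , Ldx ,
          prove [] [] (int d * x ∷ v ∷ []) x₀ (con 0ℤ ⊗ x₁ ⊕ x₀) [] refl }
      where
      open IsLattice lat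
      into : ∀ k {y} → Span basis y → Span es′ (int k * v + y)
      into k (u , refl) = above k u
      out : ∀ {x} → (∃₂ λ k u → x ≡ int k * v + lin u basis) → ∃₂ λ k y → L y × x ≡ int k * v + y
      out (k , u , e) = k , lin u basis , Equivalence.from (member _) (u , refl) , e

    transport-lattice : ∀ {L M} → (∀ x → L x ⇔ M x) → IsLattice L → IsLattice M
    transport-lattice eqv lat = record
      { basis = basis ; independent = independent
      ; member = λ x → mk⇔ (λ m → Equivalence.to (member x) (Equivalence.from (eqv x) m)) (λ s → Equivalence.to (eqv x) (Equivalence.from (member x) s))
      ; full = λ x → let d , d≢0 , l = full x in d , d≢0 , Equivalence.to (eqv _) l }
      where open IsLattice lat

  opaque
    extend-vectors : ∀ {n L} (vs : Vec A n) → IsLattice L → IsLattice (λ x → ∃₂ λ c y → L y × x ≡ lin c vs + y)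
    extend-vectors {L = L} [] lat = transport-lattice (λ x → mk⇔ (λ l → [] , x , l , sym (+-identityˡ x))
      (λ { ([] , y , l , refl) → subst L (sym (+-identityˡ y)) l })) lat
    extend-vectors {L = L} (v ∷ vs) lat = transport-lattice (λ x → mk⇔
      (λ { (k , _ , (c , y , l , refl) , refl) → k ∷ c , y , l , sym (+-assoc _ _ _) })
      (λ { (k ∷ c , y , l , refl) → k , _ , (c , y , l , refl) , +-assoc _ _ _ })) (adjoin-vector (extend-vectors vs lat) v)

    lin-map : ∀ {n} c (es : Vec A n) θ → lin c (Vec.map (_* θ) es) ≡ lin c es * θ
    lin-map [] [] θ = sym (zeroˡ θ)
    lin-map (k ∷ c) (e ∷ es) θ = trans (cong₂ _+_ (sym (*-assoc _ _ _)) (lin-map c es θ)) (sym (distribʳ θ _ _))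

  record MaximalOrder (O : A → Set) : Set₁ where
    field
      lattice : IsLattice O
      O-1 : O 1#
      O-* : ∀ {x y} → O x → O y → O (x * y)
      maximal : ∀ L → IsLattice L → L 1# → (∀ {x y} → L x → L y → L (x * y)) → (∀ {x} → O x → L x) → ∀ {x} → L x → O x

-- Maximal orders: divisibility, rational lines and planes, overorders.

module Orders (Q : QuaternionDivisionAlgebra) (O : QuaternionDivisionAlgebra.A Q → Set) (order : Lattices.MaximalOrder Q O) where
  open DivisionAlgebra Q public
  open IntegerVectors public
  open Lattices Q public
  open MaximalOrder order public
  open IsLattice lattice public

  infix 4 _∥_
  -- x ∈ N O
  _∥_ : ℤ → A → Set
  N ∥ x = ∃ λ y → O y × x ≡ int N * y

  opaque
    coordinates : ∀ {x} → O x → Span basis x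
    coordinates {x} = Equivalence.to (member x)

    O-lin : ∀ c → O (lin c basis)
    O-lin c = Equivalence.from (member _) (c , refl)

    O-+ : ∀ {x y} → O x → O y → O (x + y)
    O-+ {x} {y} Ox Oy with v , refl ← coordinates Ox with w , refl ← coordinates Oy = subst O (lin-+ v w basis) (O-lin (v +ᵥ w))

    O-int* : ∀ k {x} → O x → O (int k * x)
    O-int* k Ox with v , refl ← coordinates Ox = subst O (lin-· k v basis) (O-lin (k ·ᵥ v))

    O-int : ∀ k → O (int k)
    O-int k = subst O (*-identityʳ _) (O-int* k O-1)

    O-0 : O 0#
    O-0 = subst O int-0 (O-int 0ℤ)

    O-neg : ∀ {x} → O x → O (- x)
    O-neg {x} Ox = subst O (prove [] [] (x ∷ []) (con -[1+ 0 ] ⊗ x₀) (⊝ x₀) [] refl) (O-int* -[1+ 0 ] Ox)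

    O-diff : ∀ {x y} → O x → O y → O (x - y)
    O-diff Ox Oy = O-+ Ox (O-neg Oy)

    lin-injective : ∀ v w → lin v basis ≡ lin w basis → v ≡ w
    lin-injective v w h = difference-zero v w (independent (v +ᵥ -[1+ 0 ] ·ᵥ w)
      (prove [] [] (lin v basis ∷ lin w basis ∷ lin (v +ᵥ -[1+ 0 ] ·ᵥ w) basis ∷ []) x₂ 𝟘
        ( (𝟙 ·[ x₂ ≈ x₀ ⊕ con -[1+ 0 ] ⊗ x₁ by trans (lin-+ v _ basis) (cong (λ y → lin v basis + y) (lin-· _ w basis)) ]· 𝟙)
        ∷ (𝟙 ·[ x₀ ≈ x₁ by h ]· 𝟙) ∷ []) refl))

    -- Multiplication by x sends a basis vector e into O with some e-coordinate k. As d x = n,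
    -- comparing e-coordinates in d x e = n e gives n = d k.
    rational-integer : ∀ {x} → O x → Rat x → ∃ λ k → x ≡ int k
    rational-integer {x} Ox (d , n , d≢0 , dx) = go basis refl
      where
      go : ∀ es → basis ≡ es → ∃ λ k → x ≡ int k
      go (e ∷ es) eq = result (coordinates (O-* Ox Oe))
        where
        Oe : O e
        Oe = Equivalence.from (member e) (1ℤ ∷ 0ᵥ 3 , trans (sym (trans (cong₂ _+_ (trans (cong (_* e) int-1) (*-identityˡ e)) (lin-0 es)) (+-identityʳ e))) (cong (lin (1ℤ ∷ 0ᵥ 3)) (sym eq)))
        result : Span basis (x * e) → ∃ λ k → x ≡ int k
        result (k ∷ c , xe) = k , int-cancel d d≢0 (trans dx (trans (cong int n≡dk) (int-* d k)))
          where
          dxe : lin (n ∷ 0ᵥ 3) basis ≡ lin (d ·ᵥ (k ∷ c)) basis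
          dxe = trans (trans (cong (lin (n ∷ 0ᵥ 3)) eq) (cong (λ y → int n * e + y) (lin-0 es)))
            (prove [] (d ∷ n ∷ []) (x ∷ e ∷ lin (d ·ᵥ (k ∷ c)) basis ∷ lin (k ∷ c) basis ∷ []) (ι z₁ ⊗ x₁ ⊕ 𝟘) x₂
              ( (⊝ 𝟙 ·[ ι z₀ ⊗ x₀ ≈ ι z₁ by dx ]· x₁) ∷ (⊝ 𝟙 ·[ x₂ ≈ ι z₀ ⊗ x₃ by lin-· d (k ∷ c) basis ]· 𝟙)
              ∷ (ι z₀ ·[ x₀ ⊗ x₁ ≈ x₃ by xe ]· 𝟙) ∷ []) refl)
          n≡dk : n ≡ d ℤ.* k
          n≡dk = proj₁ (∷-injective (lin-injective (n ∷ 0ᵥ 3) (d ·ᵥ (k ∷ c)) dxe))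

    ∥-O : ∀ {N x} → N ∥ x → O x
    ∥-O {N} (y , Oy , refl) = O-int* N Oy

    ∥-+ : ∀ {N x y} → N ∥ x → N ∥ y → N ∥ x + y
    ∥-+ (x , Ox , refl) (y , Oy , refl) = x + y , O-+ Ox Oy , sym (distribˡ _ _ _)

    ∥-*ˡ : ∀ {N x y} → O x → N ∥ y → N ∥ x * y
    ∥-*ˡ {N} {x} Ox (y , Oy , refl) = x * y , O-* Ox Oy , prove [] (N ∷ []) (x ∷ y ∷ []) (x₀ ⊗ (ι z₀ ⊗ x₁)) (ι z₀ ⊗ (x₀ ⊗ x₁)) [] refl

    ∥-int* : ∀ {N} k {x} → N ∥ x → N ∥ int k * x
    ∥-int* k = ∥-*ˡ (O-int k)

    ∥-neg : ∀ {N x} → N ∥ x → N ∥ - x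
    ∥-neg {N} (y , Oy , refl) = - y , O-neg Oy , sym (neg-distribʳ _ _)

    ∥-diff : ∀ {N x y} → N ∥ x → N ∥ y → N ∥ x - y
    ∥-diff p q = ∥-+ p (∥-neg q)

    ∥-0 : ∀ {N} → N ∥ 0#
    ∥-0 = 0# , O-0 , sym (zeroʳ _)

    ∥-multiple : ∀ N {x} → O x → N ∥ int N * x
    ∥-multiple N Ox = _ , Ox , refl

    ∥-coordinates : ∀ {N} c → N ∥ lin c basis → Divides N c
    ∥-coordinates {N} c (y , Oy , e) with w , refl ← coordinates Oy = w , lin-injective c (N ·ᵥ w) (trans e (sym (lin-· N w basis)))

    ∥-lin : ∀ {N} c → Divides N c → N ∥ lin c basis
    ∥-lin {N} c (w , refl) = lin w basis , O-lin w , lin-· N w basis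

    ∥? : ∀ N {x} → O x → Dec (N ∥ x)
    ∥? N Ox with c , refl ← coordinates Ox with divides? N c
    ... | yes h = yes (∥-lin c h)
    ... | no h = no λ k → h (∥-coordinates c k)

    int-∥ : ∀ {N k} → N ≢ 0ℤ → N ∥ int k → ∃ λ l → k ≡ N ℤ.* l
    int-∥ {N} {k} N≢0 (y , Oy , e) with l , refl ← rational-integer Oy (N , k , N≢0 , sym e) = l , int-injective (trans e (sym (int-* N l)))

    scale-into : ∀ {β} → β ≢ 0# → ∃₂ λ d c → d ≢ 0ℤ × int d * β ≡ lin c basis
    scale-into {β} β≢0 with d , d≢0 , Odβ ← full β with c , e ← coordinates Odβ = d , c , d≢0 , e

    primitive-dot : ∀ {n} {v : Vec ℤ n} d w μ → d ≢ 0ℤ → v ≡ d ·ᵥ w → dot μ v ≡ d → dot μ w ≡ 1ℤ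
    primitive-dot d w μ d≢0 refl h = ℤP.*-cancelˡ-≡ d _ _ {{ℤ.≢-nonZero d≢0}} (trans (sym (dot-· d μ w)) (trans h (sym (ℤP.*-identityʳ d))))

    -- Divide the coordinates of an integral multiple of β by their content. The Bézout functional
    -- takes the value 1 on the resulting primitive vector and therefore reads off the multiplier of
    -- any element of O on the line.
    line-basis : ∀ β → β ≢ 0# → ∃ λ u → O u × u ≢ 0# × (∃ λ q → Rat q × u ≡ q * β) ×
      (∀ {x q} → O x → Rat q → x ≡ q * β → ∃ λ k → x ≡ int k * u)
    line-basis β β≢0 with d , c , d≢0 , dβ ← scale-into β≢0 with g , w , μ , c≡ , μc ← content c =
      lin w basis , O-lin w , u≢0 , multiple , generates
      where
      gu : int d * β ≡ int g * lin w basis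
      gu = trans dβ (trans (cong (λ v → lin v basis) c≡) (lin-· g w basis))
      g≢0 : g ≢ 0ℤ
      g≢0 refl = *-nonzero (int-nonzero d≢0) β≢0 (trans gu (trans (cong (_* lin w basis) int-0) (zeroˡ _)))
      u≢0 : lin w basis ≢ 0#
      u≢0 h = *-nonzero (int-nonzero d≢0) β≢0 (trans gu (trans (cong (int g *_) h) (zeroʳ _)))
      multiple : ∃ λ q → Rat q × lin w basis ≡ q * β
      multiple with q , q∈ , gq≡1 ← rat-inverse (rat-int g) (int-nonzero g≢0) = q * int d , rat-* q∈ (rat-int d) ,
        prove (cen q∈ ∷ []) (g ∷ d ∷ []) (β ∷ lin w basis ∷ []) x₁ (c₀ ⊗ ι z₁ ⊗ x₀)
          ((⊝ 𝟙 ·[ ι z₀ ⊗ c₀ ≈ 𝟙 by gq≡1 ]· x₁) ∷ (⊝ c₀ ·[ ι z₁ ⊗ x₀ ≈ ι z₀ ⊗ x₁ by gu ]· 𝟙) ∷ []) refl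
      generates : ∀ {x q} → O x → Rat q → x ≡ q * β → ∃ λ k → x ≡ int k * lin w basis
      generates {x} {q} Ox (m , n , m≢0 , mq) e with v , refl ← coordinates Ox = dot μ v ,
        trans (cong (λ y → lin y basis) (·ᵥ-cancel (m ℤ.* d) _ _ md≢0 v≡)) (lin-· (dot μ v) w basis)
        where
        md≢0 : m ℤ.* d ≢ 0ℤ
        md≢0 h = [ m≢0 , d≢0 ]′ (ℤP.i*j≡0⇒i≡0∨j≡0 m h)
        mdv : (m ℤ.* d) ·ᵥ v ≡ (n ℤ.* g) ·ᵥ w
        mdv = lin-injective _ _ (trans (lin-· _ v basis) (trans (prove [] (m ∷ d ∷ n ∷ g ∷ []) (lin v basis ∷ q ∷ β ∷ lin w basis ∷ [])
          (ι (z₀ ⊗ z₁) ⊗ x₀) (ι (z₂ ⊗ z₃) ⊗ x₃)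
          ( (ι (z₀ ⊗ z₁) ·[ x₀ ≈ x₁ ⊗ x₂ by e ]· 𝟙) ∷ (ι z₁ ·[ ι z₀ ⊗ x₁ ≈ ι z₂ by mq ]· x₂)
          ∷ (ι z₂ ·[ ι z₁ ⊗ x₂ ≈ ι z₃ ⊗ x₃ by gu ]· 𝟙) ∷ []) refl) (sym (lin-· _ w basis))))
        μw : dot μ w ≡ 1ℤ
        μw = primitive-dot g w μ g≢0 c≡ μc
        v≡ : (m ℤ.* d) ·ᵥ v ≡ (m ℤ.* d) ·ᵥ dot μ v ·ᵥ w
        v≡ = trans mdv (trans (cong (_·ᵥ w) ng≡) (sym (·ᵥ-assoc (m ℤ.* d) (dot μ v) w)))
          where
          ng≡ : n ℤ.* g ≡ m ℤ.* d ℤ.* dot μ v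
          ng≡ = sym (trans (sym (dot-· (m ℤ.* d) μ v)) (trans (cong (dot μ) mdv) (trans (dot-· (n ℤ.* g) μ w) (trans (cong (n ℤ.* g ℤ.*_) μw) (ℤP.*-identityʳ _)))))

    -- If d is the content of the coordinates of 1, then 1/d is a rational element of O, hence an
    -- integer. So 1 is primitive and some functional takes the value 1 on it.
    unit-functional : ∃₂ λ u λ′ → 1# ≡ lin u basis × dot λ′ u ≡ 1ℤ
    unit-functional with u , 1≡ ← coordinates O-1 with d , w , μ , u≡ , μu ← content u with 1≡dw ← trans 1≡ (trans (cong (λ v → lin v basis) u≡) (lin-· d w basis))
      with k , w≡ ← rational-integer (O-lin w) (d , 1ℤ , (λ { refl → int-nonzero {1ℤ} (λ ()) (trans int-1 (trans 1≡dw (trans (cong (_* lin w basis) int-0) (zeroˡ _)))) }) , trans (sym 1≡dw) (sym int-1)) =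
      u , k ·ᵥ μ , 1≡ , trans (dot-·ˡ k μ u) (trans (cong (k ℤ.*_) μu) (trans (ℤP.*-comm k d)
        (int-injective (trans (int-* d k) (trans (cong (int d *_) (sym w≡)) (trans (sym 1≡dw) (sym int-1)))))))

    -- Scale β into O, subtract the multiple of 1 seen by λ′, and divide by the content. Then 1 and
    -- w satisfy the hypotheses of `Plane`, which gives both generation and the divisibility
    -- criterion modulo any N.
    plane-basis : ∀ β → ¬ Rat β → ∃ λ w → O w × (∃₂ λ p q → Rat p × Rat q × w ≡ p + q * β) ×
      (∀ {x p q} → O x → Rat p → Rat q → x ≡ p + q * β → ∃₂ λ k l → x ≡ int k + int l * w) ×
      (∀ N k l → N ∥ int k + int l * w → (∃ λ k′ → k ≡ N ℤ.* k′) × (∃ λ l′ → l ≡ N ℤ.* l′))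
    plane-basis β β∉ with u , λ′ , 1≡ , λu ← unit-functional
      with d , b , d≢0 , dβ ← scale-into {β} (λ { refl → β∉ rat-0 })
      with g , w , μ , b′≡ , μb′ ← content (b +ᵥ (ℤ.- dot λ′ b) ·ᵥ u) = lin w basis , O-lin w , multiple , generates , divisible
      where
      L : ℤ
      L = dot λ′ b
      dβ′ : int d * β ≡ int L + int g * lin w basis
      dβ′ = prove [] (d ∷ L ∷ g ∷ []) (β ∷ lin b basis ∷ lin w basis ∷ lin u basis ∷ lin (b +ᵥ (ℤ.- L) ·ᵥ u) basis ∷ [])
        (ι z₀ ⊗ x₀) (ι z₁ ⊕ ι z₂ ⊗ x₂)
        ( (𝟙 ·[ ι z₀ ⊗ x₀ ≈ x₁ by dβ ]· 𝟙) ∷ (⊝ 𝟙 ·[ x₄ ≈ x₁ ⊕ ι (⊝ z₁) ⊗ x₃ by trans (lin-+ b _ basis) (cong (λ y → lin b basis + y) (lin-· _ u basis)) ]· 𝟙)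
        ∷ (𝟙 ·[ x₄ ≈ ι z₂ ⊗ x₂ by trans (cong (λ v → lin v basis) b′≡) (lin-· g w basis) ]· 𝟙)
        ∷ (⊝ ι z₁ ·[ 𝟙 ≈ x₃ by 1≡ ]· 𝟙) ∷ []) refl
      g≢0 : g ≢ 0ℤ
      g≢0 refl = β∉ (d , L , d≢0 , trans dβ′ (trans (cong (λ y → int L + y) (trans (cong (_* lin w basis) int-0) (zeroˡ _))) (+-identityʳ _)))
      μw : dot μ w ≡ 1ℤ
      μw = primitive-dot g w μ g≢0 b′≡ μb′
      λw : dot λ′ w ≡ 0ℤ
      λw = ℤP.*-cancelˡ-≡ g (dot λ′ w) 0ℤ {{ℤ.≢-nonZero g≢0}} (trans (sym (dot-· g λ′ w)) (trans (cong (dot λ′) (sym b′≡))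
        (trans (dot-+ λ′ b ((ℤ.- L) ·ᵥ u)) (trans (cong (λ y → L ℤ.+ y) (trans (dot-· (ℤ.- L) λ′ u) (trans (cong ((ℤ.- L) ℤ.*_) λu) (ℤP.*-identityʳ (ℤ.- L)))))
          (trans (ℤP.+-inverseʳ L) (sym (ℤP.*-zeroʳ g)))))))
      multiple : ∃₂ λ p q → Rat p × Rat q × lin w basis ≡ p + q * β
      multiple with q , q∈ , gq≡1 ← rat-inverse (rat-int g) (int-nonzero g≢0) = - (q * int L) , q * int d , rat-neg (rat-* q∈ (rat-int L)) , rat-* q∈ (rat-int d) ,
        prove (cen q∈ ∷ []) (g ∷ d ∷ L ∷ []) (β ∷ lin w basis ∷ []) x₁ (⊝ (c₀ ⊗ ι z₂) ⊕ c₀ ⊗ ι z₁ ⊗ x₀)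
          ((⊝ 𝟙 ·[ ι z₀ ⊗ c₀ ≈ 𝟙 by gq≡1 ]· x₁) ∷ (⊝ c₀ ·[ ι z₁ ⊗ x₀ ≈ ι z₂ ⊕ ι z₀ ⊗ x₁ by dβ′ ]· 𝟙) ∷ []) refl
      lin-plane : ∀ k l → lin (k ·ᵥ u +ᵥ l ·ᵥ w) basis ≡ int k + int l * lin w basis
      lin-plane k l = trans (lin-+ (k ·ᵥ u) (l ·ᵥ w) basis) (cong₂ _+_ (trans (lin-· k u basis) (trans (cong (int k *_) (sym 1≡)) (*-identityʳ _))) (lin-· l w basis))
      open Plane u w λ′ μ λu λw μw
      divisible : ∀ N k l → N ∥ int k + int l * lin w basis → (∃ λ k′ → k ≡ N ℤ.* k′) × (∃ λ l′ → l ≡ N ℤ.* l′)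
      divisible N k l h with v , e ← ∥-coordinates (k ·ᵥ u +ᵥ l ·ᵥ w) (subst (N ∥_) (sym (lin-plane k l)) h)
        with k≡ , l≡ ← plane-scalar N k l v e = (_ , k≡) , (_ , l≡)
      generates : ∀ {x p q} → O x → Rat p → Rat q → x ≡ p + q * β → ∃₂ λ k l → x ≡ int k + int l * lin w basis
      generates {x} {p} {q} Ox (m , n , m≢0 , mp) (m′ , n′ , m′≢0 , mq) e with v , refl ← coordinates Ox =
        conclude (plane-coordinates (m ℤ.* m′ ℤ.* d) (m′ ℤ.* d ℤ.* n ℤ.+ m ℤ.* n′ ℤ.* L) (m ℤ.* n′ ℤ.* g) v M≢0
          (lin-injective _ _ (trans (lin-· (m ℤ.* m′ ℤ.* d) v basis) (trans (prove [] (m ∷ n ∷ m′ ∷ n′ ∷ d ∷ L ∷ g ∷ []) (lin v basis ∷ p ∷ q ∷ β ∷ lin w basis ∷ [])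
          (ι (z₀ ⊗ z₂ ⊗ z₄) ⊗ x₀) (ι (z₂ ⊗ z₄ ⊗ z₁ ⊕ z₀ ⊗ z₃ ⊗ z₅) ⊕ ι (z₀ ⊗ z₃ ⊗ 𝕫 6) ⊗ x₄)
          ( (ι (z₀ ⊗ z₂ ⊗ z₄) ·[ x₀ ≈ x₁ ⊕ x₂ ⊗ x₃ by e ]· 𝟙) ∷ (ι (z₂ ⊗ z₄) ·[ ι z₀ ⊗ x₁ ≈ ι z₁ by mp ]· 𝟙)
          ∷ (ι (z₀ ⊗ z₄) ·[ ι z₂ ⊗ x₂ ≈ ι z₃ by mq ]· x₃) ∷ (ι (z₀ ⊗ z₃) ·[ ι z₄ ⊗ x₃ ≈ ι z₅ ⊕ ι (𝕫 6) ⊗ x₄ by dβ′ ]· 𝟙) ∷ []) refl)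
            (sym (lin-plane _ _))))))
        where
        M≢0 : m ℤ.* m′ ℤ.* d ≢ 0ℤ
        M≢0 h = [ (λ h′ → [ m≢0 , m′≢0 ]′ (ℤP.i*j≡0⇒i≡0∨j≡0 m h′)) , d≢0 ]′ (ℤP.i*j≡0⇒i≡0∨j≡0 (m ℤ.* m′) h)
        conclude : (∃₂ λ k l → v ≡ k ·ᵥ u +ᵥ l ·ᵥ w) → ∃₂ λ k l → lin v basis ≡ int k + int l * lin w basis
        conclude (k , l , eq) = k , l , trans (cong (λ y → lin y basis) eq) (lin-plane k l)

  -- Maximality, for the overlattice O + ℤ v.
  module Neighbour (v : A) where
    infix 4 _∈O+ℤv
    _∈O+ℤv : A → Set
    x ∈O+ℤv = ∃₂ λ k y → O y × x ≡ int k * v + y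

    opaque
      inO : ∀ {x} → O x → x ∈O+ℤv
      inO {x} Ox = 0ℤ , x , Ox , prove [] [] (x ∷ v ∷ []) x₀ (con 0ℤ ⊗ x₁ ⊕ x₀) [] refl

      inv : v ∈O+ℤv
      inv = 1ℤ , 0# , O-0 , prove [] [] (v ∷ []) x₀ (con 1ℤ ⊗ x₀ ⊕ 𝟘) [] refl

      sum∈ : ∀ {x y} → x ∈O+ℤv → y ∈O+ℤv → x + y ∈O+ℤv
      sum∈ (k , x , Ox , refl) (l , y , Oy , refl) = k ℤ.+ l , x + y , O-+ Ox Oy ,
        prove [] (k ∷ l ∷ []) (x ∷ y ∷ v ∷ []) (ι z₀ ⊗ x₂ ⊕ x₀ ⊕ (ι z₁ ⊗ x₂ ⊕ x₁)) (ι (z₀ ⊕ z₁) ⊗ x₂ ⊕ (x₀ ⊕ x₁)) [] refl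

      int*∈ : ∀ k {x} → x ∈O+ℤv → int k * x ∈O+ℤv
      int*∈ k (l , x , Ox , refl) = k ℤ.* l , int k * x , O-int* k Ox ,
        prove [] (k ∷ l ∷ []) (x ∷ v ∷ []) (ι z₀ ⊗ (ι z₁ ⊗ x₁ ⊕ x₀)) (ι (z₀ ⊗ z₁) ⊗ x₁ ⊕ ι z₀ ⊗ x₀) [] refl

      neighbour : (∀ {x} → O x → v * x ∈O+ℤv) → (∀ {x} → O x → x * v ∈O+ℤv) → v * v ∈O+ℤv → O v
      neighbour vO Ov vv = maximal _∈O+ℤv (adjoin-vector lattice v) (inO O-1) closed inO inv
        where
        closed : ∀ {x y} → x ∈O+ℤv → y ∈O+ℤv → x * y ∈O+ℤv
        closed (k , x , Ox , refl) (l , y , Oy , refl) = subst _∈O+ℤv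
          (prove [] (k ∷ l ∷ []) (v ∷ x ∷ y ∷ []) (ι (z₀ ⊗ z₁) ⊗ (x₀ ⊗ x₀) ⊕ ι z₀ ⊗ (x₀ ⊗ x₂) ⊕ ι z₁ ⊗ (x₁ ⊗ x₀) ⊕ x₁ ⊗ x₂)
            ((ι z₀ ⊗ x₀ ⊕ x₁) ⊗ (ι z₁ ⊗ x₀ ⊕ x₂)) [] refl)
          (sum∈ (sum∈ (sum∈ (int*∈ (k ℤ.* l) vv) (int*∈ k (vO Oy))) (int*∈ l (Ov Ox))) (inO (O-* Ox Oy)))

      -- Conjugation turns left products into right products: v̄ = t - v keeps O + ℤv stable under
      -- `bar`, and x v is the conjugate of v̄ x̄. The square is v² = t v - n.
      integral-neighbour : (∀ {x} → O x → O (bar x)) → ∀ t n → v + bar v ≡ int t → v * bar v ≡ int n →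
        (∀ {x} → O x → v * x ∈O+ℤv) → O v
      integral-neighbour O-bar t n tr nm vO = neighbour vO Ov vv
        where
        bar∈ : ∀ {x} → x ∈O+ℤv → bar x ∈O+ℤv
        bar∈ (k , x , Ox , refl) = ℤ.- k , bar x + int (k ℤ.* t) , O-+ (O-bar Ox) (O-int _) ,
          prove [] (k ∷ t ∷ []) (v ∷ bar v ∷ bar x ∷ bar (int k * v + x) ∷ []) x₃ (ι (⊝ z₀) ⊗ x₀ ⊕ (x₂ ⊕ ι (z₀ ⊗ z₁)))
            ( (𝟙 ·[ x₃ ≈ x₁ ⊗ ι z₀ ⊕ x₂ by trans (bar-+ _ _) (cong (_+ bar x) (trans (bar-* _ _) (cong (bar v *_) (bar-int k)))) ]· 𝟙)
            ∷ (ι z₀ ·[ x₀ ⊕ x₁ ≈ ι z₁ by tr ]· 𝟙) ∷ []) refl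
        Ov : ∀ {x} → O x → x * v ∈O+ℤv
        Ov {x} Ox = subst _∈O+ℤv (trans (bar-+ _ _) (prove [] (t ∷ []) (v ∷ x ∷ bar v ∷ bar (- (v * bar x)) ∷ bar (int t * bar x) ∷ []) (x₄ ⊕ x₃) (x₁ ⊗ x₀)
            ( (𝟙 ·[ x₃ ≈ ⊝ (x₁ ⊗ x₂) by trans (bar-neg _) (cong -_ (trans (bar-* _ _) (cong (_* bar v) (bar-involutive x)))) ]· 𝟙)
            ∷ (𝟙 ·[ x₄ ≈ x₁ ⊗ ι z₀ by trans (bar-* _ _) (cong₂ _*_ (bar-involutive x) (bar-int t)) ]· 𝟙)
            ∷ (⊝ x₁ ·[ x₀ ⊕ x₂ ≈ ι z₀ by tr ]· 𝟙) ∷ []) refl))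
          (bar∈ (sum∈ (inO (O-int* t (O-bar Ox))) (neg∈ (vO (O-bar Ox)))))
          where
          neg∈ : ∀ {x} → x ∈O+ℤv → - x ∈O+ℤv
          neg∈ {x} h = subst _∈O+ℤv (prove [] [] (x ∷ []) (con -[1+ 0 ] ⊗ x₀) (⊝ x₀) [] refl) (int*∈ -[1+ 0 ] h)
        vv : v * v ∈O+ℤv
        vv = t , int (ℤ.- n) , O-int _ , prove [] (t ∷ n ∷ []) (v ∷ bar v ∷ []) (x₀ ⊗ x₀) (ι z₀ ⊗ x₀ ⊕ ι (⊝ z₁))
          ((x₀ ·[ x₀ ⊕ x₁ ≈ ι z₀ by tr ]· 𝟙) ∷ (⊝ 𝟙 ·[ x₀ ⊗ x₁ ≈ ι z₁ by nm ]· 𝟙) ∷ []) refl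

  opaque
    -- Maximality, for the overlattice O + O θ.
    normalizing-integral : ∀ θ (τ : A → A) → (∀ {x} → O x → O (τ x)) → (∀ x → θ * x ≡ τ x * θ) →
      ∀ a b → θ * θ ≡ int a + int b * θ → O θ
    normalizing-integral θ τ Oτ comm a b θ² = maximal L lat (1# , 0# , O-1 , O-0 , sym (trans (cong (λ y → 1# + y) (zeroˡ θ)) (+-identityʳ 1#))) closed
      (λ {x} Ox → x , 0# , Ox , O-0 , sym (trans (cong (λ y → x + y) (zeroˡ θ)) (+-identityʳ x)))
      (0# , 1# , O-0 , O-1 , sym (trans (+-identityˡ _) (*-identityˡ θ)))
      where
      L : A → Set
      L x = ∃₂ λ y w → O y × O w × x ≡ y + w * θ
      lat : IsLattice L
      lat = transport-lattice (λ x → mk⇔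
        (λ { (c , y , Oy , refl) → y , lin c basis , Oy , O-lin c , trans (+-comm _ _) (cong (λ w → y + w) (lin-map c basis θ)) })
        (λ { (y , w , Oy , Ow , refl) → let c , e = coordinates Ow in c , y , Oy , trans (+-comm _ _) (cong (_+ y) (trans (cong (_* θ) e) (sym (lin-map c basis θ)))) }))
        (extend-vectors (Vec.map (_* θ) basis) lattice)
      closed : ∀ {x y} → L x → L y → L (x * y)
      closed (x , x′ , Ox , Ox′ , refl) (y , y′ , Oy , Oy′ , refl) =
        x * y + int a * (x′ * τ y′) , x * y′ + x′ * τ y + int b * (x′ * τ y′) ,
        O-+ (O-* Ox Oy) (O-int* a (O-* Ox′ (Oτ Oy′))) , O-+ (O-+ (O-* Ox Oy′) (O-* Ox′ (Oτ Oy))) (O-int* b (O-* Ox′ (Oτ Oy′))) ,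
        prove [] (a ∷ b ∷ []) (x ∷ x′ ∷ y ∷ y′ ∷ τ y ∷ τ y′ ∷ θ ∷ []) ((x₀ ⊕ x₁ ⊗ t) ⊗ (x₂ ⊕ x₃ ⊗ t))
          (x₀ ⊗ x₂ ⊕ ι z₀ ⊗ (x₁ ⊗ x₅) ⊕ (x₀ ⊗ x₃ ⊕ x₁ ⊗ x₄ ⊕ ι z₁ ⊗ (x₁ ⊗ x₅)) ⊗ t)
          ( (x₁ ·[ t ⊗ x₂ ≈ x₄ ⊗ t by comm y ]· 𝟙) ∷ (x₁ ·[ t ⊗ x₃ ≈ x₅ ⊗ t by comm y′ ]· t)
          ∷ (x₁ ⊗ x₅ ·[ t ⊗ t ≈ ι z₀ ⊕ ι z₁ ⊗ t by θ² ]· 𝟙) ∷ []) refl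
        where
        t : Expr
        t = 𝕩 6

-- Gaussian elimination modulo p on predicates over ℤⁿ.

module Subspaces (p : ℕ) .{{_ : NonZero p}} (invertible : ∀ k → (∃ λ l → k ≡ ℤ.+ p ℤ.* l) ⊎ (∃₂ λ m l → m ℤ.* k ≡ 1ℤ ℤ.+ ℤ.+ p ℤ.* l)) where
  open IntegerVectors
  open ℤSolve

  private
    q : ℤ
    q = ℤ.+ p

  -- A subspace of the reduction of ℤⁿ modulo p, represented by its decidable preimage in ℤⁿ.
  record Subspace {n} (P : Vec ℤ n → Set) : Set where
    field
      add : ∀ {v w} → P v → P w → P (v +ᵥ w)
      scale : ∀ k {v} → P v → P (k ·ᵥ v)
      multiple : ∀ v → P (q ·ᵥ v)
      dec : ∀ v → Dec (P v)

  opaque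
    -- R is periodic modulo p, so trying the residues 0, ..., p - 1 in each coordinate is
    -- exhaustive.
    search : ∀ n (R : Vec ℤ n → Set) → (∀ v → Dec (R v)) → (∀ v d → R v → R (v +ᵥ q ·ᵥ d)) → Dec (∃ R)
    search zero R dec per with dec []
    ... | yes r = yes ([] , r)
    ... | no h = no λ { ([] , r) → h r }
    search (suc n) R dec per with any? {n = p} (λ i → search n (λ w → R (ℤ.+ toℕ i ∷ w)) (λ w → dec _)
      (λ v d r → subst (λ k → R (k ∷ v +ᵥ q ·ᵥ d)) (trans (cong (λ k → ℤ.+ toℕ i ℤ.+ k) (ℤP.*-zeroʳ q)) (ℤP.+-identityʳ _)) (per _ (0ℤ ∷ d) r)))
    ... | yes (i , w , r) = yes (_ , r)
    ... | no h = no λ { (k ∷ w , r) → h (fromℕ< (n%ℕd<d k p) , w , subst₂ (λ j v → R (j ∷ v))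
        (trans (prove [] (k ∷ k /ℕ p ∷ q ∷ ℤ.+ (k %ℕ p) ∷ []) [] (ι (z₀ ⊕ z₂ ⊗ (⊝ z₁))) (ι z₃)
          ((𝟙 ·[ ι z₀ ≈ ι (z₃ ⊕ z₁ ⊗ z₂) by a≡a%ℕn+[a/ℕn]*n k p ]· 𝟙) ∷ []) refl) (cong ℤ.+_ (sym (toℕ-fromℕ< (n%ℕd<d k p)))))
        (+ᵥ-·ᵥ0 q w) (per (k ∷ w) ((ℤ.- (k /ℕ p)) ∷ 0ᵥ n) r)) }

  -- `f` induces an isomorphism from (ℤ/p)^rank onto P modulo pℤⁿ. The last two fields record what
  -- an extreme rank says: rank n leaves nothing outside P, and rank n - 1 leaves everything within
  -- P + ℤu for one vector u.
  record Classification {n} (P : Vec ℤ n → Set) : Set where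
    field
      rank : ℕ
      rank≤ : rank ≤ n
      f : (Fin rank → ℤ) → Vec ℤ n
      f∈ : ∀ c → P (f c)
      f-+ : ∀ c d → f (λ i → c i ℤ.+ d i) ≡ f c +ᵥ f d
      f-surjective : ∀ {v} → P v → ∃₂ λ c d → v ≡ f c +ᵥ q ·ᵥ d
      f-kernel : ∀ {c d} → f c ≡ q ·ᵥ d → ∀ i → ∃ λ l → c i ≡ q ℤ.* l
      f-kernel⁻¹ : ∀ c → (∀ i → ∃ λ l → c i ≡ q ℤ.* l) → ∃ λ d → f c ≡ q ·ᵥ d
      full : rank ≡ n → ∀ v → P v
      corank-one : suc rank ≡ n → ∃ λ u → ∀ v → ∃ λ k → P (v +ᵥ (ℤ.- k) ·ᵥ u)

  opaque
    reduce : ∀ {n} k (v w : Vec ℤ n) → k ·ᵥ w +ᵥ (v +ᵥ (ℤ.- k) ·ᵥ w) ≡ v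
    reduce k [] [] = refl
    reduce k (m ∷ v) (n ∷ w) = cong₂ _∷_ (prove [] (k ∷ m ∷ n ∷ []) [] (ι (z₀ ⊗ z₂ ⊕ (z₁ ⊕ ⊝ z₀ ⊗ z₂))) (ι z₁) [] refl) (reduce k v w)

    +ᵥ-assoc : ∀ {n} (u v w : Vec ℤ n) → u +ᵥ (v +ᵥ w) ≡ u +ᵥ v +ᵥ w
    +ᵥ-assoc [] [] [] = refl
    +ᵥ-assoc (k ∷ u) (m ∷ v) (n ∷ w) = cong₂ _∷_ (sym (ℤP.+-assoc k m n)) (+ᵥ-assoc u v w)

    interchange : ∀ {n} k l (w u v : Vec ℤ n) → (k ℤ.+ l) ·ᵥ w +ᵥ (u +ᵥ v) ≡ k ·ᵥ w +ᵥ u +ᵥ (l ·ᵥ w +ᵥ v)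
    interchange k l [] [] [] = refl
    interchange k l (m ∷ w) (n ∷ u) (o ∷ v) = cong₂ _∷_
      (prove [] (k ∷ l ∷ m ∷ n ∷ o ∷ []) [] (ι ((z₀ ⊕ z₁) ⊗ z₂ ⊕ (z₃ ⊕ z₄))) (ι (z₀ ⊗ z₂ ⊕ z₃ ⊕ (z₁ ⊗ z₂ ⊕ z₄))) [] refl) (interchange k l w u v)

    isolate : ∀ {n} l (w a d : Vec ℤ n) → (q ℤ.* l) ·ᵥ w +ᵥ a ≡ q ·ᵥ d → a ≡ q ·ᵥ (d +ᵥ (ℤ.- l) ·ᵥ w)
    isolate l [] [] [] _ = refl
    isolate l (m ∷ w) (n ∷ a) (o ∷ d) h with h₁ , h₂ ← ∷-injective h = cong₂ _∷_
      (prove [] (q ∷ l ∷ m ∷ n ∷ o ∷ []) [] (ι z₃) (ι (z₀ ⊗ (z₄ ⊕ ⊝ z₁ ⊗ z₂))) ((𝟙 ·[ ι (z₀ ⊗ z₁ ⊗ z₂ ⊕ z₃) ≈ ι (z₀ ⊗ z₄) by h₁ ]· 𝟙) ∷ []) refl)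
      (isolate l w a d h₂)

    -- Induction on the first coordinate. A vector of P beginning with 1 serves as pivot and clears
    -- the first coordinate of the others; if there is none, all first coordinates in P are
    -- divisible by p.
    classify : ∀ {n} (P : Vec ℤ n → Set) → Subspace P → Classification P
    classify {zero} P S = record
      { rank = 0 ; rank≤ = z≤n ; f = λ _ → [] ; f∈ = λ _ → Subspace.multiple S [] ; f-+ = λ _ _ → refl
      ; f-surjective = λ { {[]} _ → (λ ()) , [] , refl } ; f-kernel = λ _ () ; f-kernel⁻¹ = λ _ _ → [] , refl
      ; full = λ { _ [] → Subspace.multiple S [] } ; corank-one = λ () }
    classify {suc n} P S = byPivot (search n (λ w → P (1ℤ ∷ w)) (λ w → dec _) (λ v d r →
        subst (λ k → P (k ∷ v +ᵥ q ·ᵥ d)) (trans (cong (λ k → 1ℤ ℤ.+ k) (ℤP.*-zeroʳ q)) refl) (add r (multiple (0ℤ ∷ d)))))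
      where
      open Subspace S
      tail : Vec ℤ n → Set
      tail w = P (0ℤ ∷ w)
      tailSubspace : Subspace tail
      tailSubspace = record
        { add = add
        ; scale = λ k {v} r → subst (λ j → P (j ∷ k ·ᵥ v)) (ℤP.*-zeroʳ k) (scale k r)
        ; multiple = λ v → subst (λ j → P (j ∷ q ·ᵥ v)) (ℤP.*-zeroʳ q) (multiple (0ℤ ∷ v))
        ; dec = λ v → dec _ }
      module T = Classification (classify tail tailSubspace)
      cons : ∀ {m} → ℤ → (Fin m → ℤ) → Fin (suc m) → ℤ
      cons k c zero = k
      cons k c (suc i) = c i
      byPivot : Dec (∃ λ w → P (1ℤ ∷ w)) → Classification P
      byPivot (yes (w , Pw)) = record
        { rank = suc T.rank
        ; rank≤ = s≤s T.rank≤
        ; f = F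
        ; f∈ = λ c → add (scale (c zero) Pw) (T.f∈ _)
        ; f-+ = λ c d → trans (cong (λ v → (c zero ℤ.+ d zero) ·ᵥ (1ℤ ∷ w) +ᵥ (0ℤ ∷ v)) (T.f-+ (λ i → c (suc i)) (λ i → d (suc i))))
            (interchange (c zero) (d zero) (1ℤ ∷ w) (0ℤ ∷ T.f _) (0ℤ ∷ T.f _))
        ; f-surjective = surj
        ; f-kernel = ker
        ; f-kernel⁻¹ = ker⁻¹
        ; full = λ e v → all (T.full (ℕP.suc-injective e)) v
        ; corank-one = λ e → let u , h = T.corank-one (ℕP.suc-injective e) in 0ℤ ∷ u , corank u h }
        where
        F : (Fin (suc T.rank) → ℤ) → Vec ℤ (suc n)
        F c = c zero ·ᵥ (1ℤ ∷ w) +ᵥ (0ℤ ∷ T.f (λ i → c (suc i)))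
        clear-head : ∀ {k v} → P (k ∷ v) → P (0ℤ ∷ v +ᵥ (ℤ.- k) ·ᵥ w)
        clear-head {k} {v} r = subst (λ j → P (j ∷ v +ᵥ (ℤ.- k) ·ᵥ w))
          (prove [] (k ∷ []) [] (ι (z₀ ⊕ ⊝ z₀ ⊗ con 1ℤ)) (ι (con 0ℤ)) [] refl) (add r (scale (ℤ.- k) Pw))
        surj : ∀ {v} → P v → ∃₂ λ c d → v ≡ F c +ᵥ q ·ᵥ d
        surj {k ∷ v} r with c , d , e ← T.f-surjective (clear-head r) = cons k c , 0ℤ ∷ d , cong₂ _∷_
          (prove [] (k ∷ q ∷ []) [] (ι z₀) (ι (z₀ ⊗ con 1ℤ ⊕ con 0ℤ ⊕ z₁ ⊗ con 0ℤ)) [] refl)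
          (trans (sym (reduce k v w)) (trans (cong (k ·ᵥ w +ᵥ_) e) (+ᵥ-assoc _ _ _)))
        ker : ∀ {c d} → F c ≡ q ·ᵥ d → ∀ i → ∃ λ l → c i ≡ q ℤ.* l
        ker {c} {l ∷ d} h = λ { zero → l , head ; (suc i) → T.f-kernel (isolate l w _ d
            (trans (cong (λ k → k ·ᵥ w +ᵥ T.f (λ i → c (suc i))) (sym head)) (proj₂ (∷-injective h)))) i }
          where
          head : c zero ≡ q ℤ.* l
          head = trans (prove [] (c zero ∷ []) [] (ι z₀) (ι (z₀ ⊗ con 1ℤ ⊕ con 0ℤ)) [] refl) (proj₁ (∷-injective h))
        ker⁻¹ : ∀ c → (∀ i → ∃ λ l → c i ≡ q ℤ.* l) → ∃ λ d → F c ≡ q ·ᵥ d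
        ker⁻¹ c h with l , e ← h zero with d , e′ ← T.f-kernel⁻¹ (λ i → c (suc i)) (λ i → h (suc i)) = l ∷ (l ·ᵥ w +ᵥ d) , cong₂ _∷_
          (trans (sym (prove [] (c zero ∷ []) [] (ι z₀) (ι (z₀ ⊗ con 1ℤ ⊕ con 0ℤ)) [] refl)) e)
          (trans (cong₂ (λ k v → k ·ᵥ w +ᵥ v) e e′) (trans (cong (_+ᵥ q ·ᵥ d) (sym (·ᵥ-assoc q l w))) (sym (·ᵥ-distrib q (l ·ᵥ w) d))))
        all : (∀ v → tail v) → ∀ v → P v
        all h (k ∷ v) = subst P (cong₂ _∷_ (prove [] (k ∷ []) [] (ι (z₀ ⊗ con 1ℤ ⊕ con 0ℤ)) (ι z₀) [] refl) (reduce k v w)) (add (scale k Pw) (h (v +ᵥ (ℤ.- k) ·ᵥ w)))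
        corank : ∀ u → (∀ v → ∃ λ k → tail (v +ᵥ (ℤ.- k) ·ᵥ u)) → ∀ v → ∃ λ k → P (v +ᵥ (ℤ.- k) ·ᵥ (0ℤ ∷ u))
        corank u h (m ∷ v) with k , r ← h (v +ᵥ (ℤ.- m) ·ᵥ w) = k , subst P (cong₂ _∷_
          (prove [] (k ∷ m ∷ []) [] (ι (z₁ ⊗ con 1ℤ ⊕ con 0ℤ)) (ι (z₁ ⊕ ⊝ z₀ ⊗ con 0ℤ)) [] refl)
          (trans (+ᵥ-assoc _ _ _) (cong (_+ᵥ (ℤ.- k) ·ᵥ u) (reduce m v w)))) (add (scale m Pw) r)
      byPivot (no noPivot) = record
        { rank = T.rank
        ; rank≤ = ℕP.m≤n⇒m≤1+n T.rank≤
        ; f = λ c → 0ℤ ∷ T.f c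
        ; f∈ = T.f∈
        ; f-+ = λ c d → cong (0ℤ ∷_) (T.f-+ c d)
        ; f-surjective = surj
        ; f-kernel = λ { {c} {l ∷ d} h → T.f-kernel (proj₂ (∷-injective h)) }
        ; f-kernel⁻¹ = λ c h → let d , e = T.f-kernel⁻¹ c h in 0ℤ ∷ d , cong₂ _∷_ (sym (ℤP.*-zeroʳ q)) e
        ; full = λ e → contradiction T.rank≤ (ℕP.<⇒≱ (subst (ℕ._≤ T.rank) e ℕP.≤-refl))
        ; corank-one = λ e → 1ℤ ∷ 0ᵥ n , λ { (k ∷ v) → k , subst (λ j → P (j ∷ v +ᵥ (ℤ.- k) ·ᵥ 0ᵥ n))
            (prove [] (k ∷ []) [] (ι (con 0ℤ)) (ι (z₀ ⊕ ⊝ z₀ ⊗ con 1ℤ)) [] refl) (T.full (ℕP.suc-injective e) _) } }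
        where
        head-multiple : ∀ {k v} → P (k ∷ v) → ∃ λ l → k ≡ q ℤ.* l
        head-multiple {k} {v} r with invertible k
        ... | inj₁ h = h
        -- A first coordinate invertible modulo p could be scaled and shifted to 1, producing a
        -- pivot.
        ... | inj₂ (m , l , e) = contradiction (_ , subst (λ j → P (j ∷ m ·ᵥ v +ᵥ q ·ᵥ 0ᵥ n))
          (prove [] (m ∷ k ∷ q ∷ l ∷ []) [] (ι (z₀ ⊗ z₁ ⊕ z₂ ⊗ ⊝ z₃)) (ι (con 1ℤ)) ((𝟙 ·[ ι (z₀ ⊗ z₁) ≈ ι (con 1ℤ ⊕ z₂ ⊗ z₃) by e ]· 𝟙) ∷ []) refl)
          (add (scale m r) (multiple ((ℤ.- l) ∷ 0ᵥ n)))) noPivot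
        surj : ∀ {v} → P v → ∃₂ λ c d → v ≡ (0ℤ ∷ T.f c) +ᵥ q ·ᵥ d
        surj {k ∷ v} r with l , refl ← head-multiple r
          with c , d , e ← T.f-surjective (subst₂ (λ j u → P (j ∷ u)) (prove [] (q ∷ l ∷ []) [] (ι (z₀ ⊗ z₁ ⊕ z₀ ⊗ ⊝ z₁)) (ι (con 0ℤ)) [] refl) (+ᵥ-·ᵥ0 q v)
            (add r (multiple ((ℤ.- l) ∷ 0ᵥ n)))) = c , l ∷ d , cong₂ _∷_ (sym (ℤP.+-identityˡ _)) e

-- Residues modulo 2 and 3.

module Parity where
  open ℤSolve

  opaque
    two-not-unit : ∀ k → ℤ.+ 2 ℤ.* k ≢ 1ℤ
    two-not-unit k h = ℕP.even≢odd ℤ.∣ k ∣ 0 (trans (sym (ℤP.abs-* (ℤ.+ 2) k)) (cong ℤ.∣_∣ h))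

    four-not-unit : ∀ k → ℤ.+ 4 ℤ.* k ≢ 1ℤ
    four-not-unit k h = two-not-unit (ℤ.+ 2 ℤ.* k) (trans (sym (ℤP.*-assoc (ℤ.+ 2) (ℤ.+ 2) k)) h)

    parity : ∀ k → (∃ λ l → k ≡ ℤ.+ 2 ℤ.* l) ⊎ (∃ λ l → k ≡ 1ℤ ℤ.+ ℤ.+ 2 ℤ.* l)
    parity k with k %ℕ 2 | n%ℕd<d k 2 | a≡a%ℕn+[a/ℕn]*n k 2
    ... | 0 | _ | e = inj₁ (k /ℕ 2 , trans e (trans (ℤP.+-identityˡ _) (ℤP.*-comm (k /ℕ 2) (ℤ.+ 2))))
    ... | 1 | _ | e = inj₂ (k /ℕ 2 , trans e (cong (λ l → 1ℤ ℤ.+ l) (ℤP.*-comm (k /ℕ 2) (ℤ.+ 2))))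
    ... | suc (suc _) | s≤s (s≤s ()) | _

    even-not-odd : ∀ {k l m} → k ≡ ℤ.+ 2 ℤ.* l → k ≢ 1ℤ ℤ.+ ℤ.+ 2 ℤ.* m
    even-not-odd {k} {l} {m} e o = two-not-unit (l ℤ.- m) (prove [] (k ∷ l ∷ m ∷ []) [] (ι (con (ℤ.+ 2) ⊗ (z₁ ⊖ z₂))) (ι (con 1ℤ))
      ((⊝ 𝟙 ·[ ι z₀ ≈ ι (con (ℤ.+ 2) ⊗ z₁) by e ]· 𝟙) ∷ (𝟙 ·[ ι z₀ ≈ ι (con 1ℤ ⊕ con (ℤ.+ 2) ⊗ z₂) by o ]· 𝟙) ∷ []) refl)

    even-square : ∀ k l → k ℤ.* k ≡ ℤ.+ 2 ℤ.* l → ∃ λ m → k ≡ ℤ.+ 2 ℤ.* m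
    even-square k l h with parity k
    ... | inj₁ e = e
    ... | inj₂ (m , refl) = ⊥-elim (even-not-odd {m = ℤ.+ 2 ℤ.* m ℤ.+ ℤ.+ 2 ℤ.* (m ℤ.* m)} h
      (prove [] (m ∷ []) [] (ι ((con 1ℤ ⊕ con (ℤ.+ 2) ⊗ z₀) ⊗ (con 1ℤ ⊕ con (ℤ.+ 2) ⊗ z₀)))
        (ι (con 1ℤ ⊕ con (ℤ.+ 2) ⊗ (con (ℤ.+ 2) ⊗ z₀ ⊕ con (ℤ.+ 2) ⊗ (z₀ ⊗ z₀)))) [] refl))

    invertible₂ : ∀ k → (∃ λ l → k ≡ ℤ.+ 2 ℤ.* l) ⊎ (∃₂ λ m l → m ℤ.* k ≡ 1ℤ ℤ.+ ℤ.+ 2 ℤ.* l)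
    invertible₂ k with parity k
    ... | inj₁ e = inj₁ e
    ... | inj₂ (l , e) = inj₂ (1ℤ , l , trans (ℤP.*-identityˡ k) e)

    invertible₃ : ∀ k → (∃ λ l → k ≡ ℤ.+ 3 ℤ.* l) ⊎ (∃₂ λ m l → m ℤ.* k ≡ 1ℤ ℤ.+ ℤ.+ 3 ℤ.* l)
    invertible₃ k with k %ℕ 3 | n%ℕd<d k 3 | a≡a%ℕn+[a/ℕn]*n k 3
    ... | 0 | _ | e = inj₁ (k /ℕ 3 , trans e (trans (ℤP.+-identityˡ _) (ℤP.*-comm (k /ℕ 3) (ℤ.+ 3))))
    ... | 1 | _ | e = inj₂ (1ℤ , k /ℕ 3 , trans (ℤP.*-identityˡ k) (trans e (cong (λ l → 1ℤ ℤ.+ l) (ℤP.*-comm (k /ℕ 3) (ℤ.+ 3)))))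
    ... | 2 | _ | e = inj₂ (-[1+ 0 ] , -[1+ 0 ] ℤ.+ ℤ.- (k /ℕ 3) , prove [] (k ∷ k /ℕ 3 ∷ []) []
      (ι (con -[1+ 0 ] ⊗ z₀)) (ι (con 1ℤ ⊕ con (ℤ.+ 3) ⊗ (con -[1+ 0 ] ⊕ ⊝ z₁))) ((con -[1+ 0 ] ·[ ι z₀ ≈ ι (con (ℤ.+ 2) ⊕ z₁ ⊗ con (ℤ.+ 3)) by e ]· 𝟙) ∷ []) refl)
    ... | suc (suc (suc _)) | s≤s (s≤s (s≤s ())) | _

-- Fixed points modulo N: averaging, charts, one involution.

module Actions (Q : QuaternionDivisionAlgebra) (O : QuaternionDivisionAlgebra.A Q → Set) (order : Lattices.MaximalOrder Q O) where
  open Orders Q O order public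

  record FixedIso (N : ℤ) (P : A → Set) (m : ℕ) : Set where
    field
      f : (Fin m → ℤ) → A
      f-O : ∀ c → O (f c)
      f-P : ∀ c → P (f c)
      f-+ : ∀ c d → N ∥ f (λ i → c i ℤ.+ d i) - (f c + f d)
      f-surjective : ∀ {x} → O x → P x → ∃ λ c → N ∥ x - f c
      f-kernel : ∀ c → N ∥ f c → ∀ i → ∃ λ l → c i ≡ N ℤ.* l
      f-kernel⁻¹ : ∀ c → (∀ i → ∃ λ l → c i ≡ N ℤ.* l) → N ∥ f c

  InverseMod : ℤ → ℤ → Set
  InverseMod N k = ∃₂ λ m l → m ℤ.* k ℤ.+ l ℤ.* N ≡ 1ℤ

  opaque
    ∥-equal : ∀ {N x y} → x ≡ y → N ∥ x - y
    ∥-equal {N} {x} refl = subst (N ∥_) (sym (-‿inverseʳ x)) ∥-0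

    units : ∀ {N P} → N ≢ 0ℤ → (∀ k → P (int k)) → (∀ {x} → O x → P x → ∃ λ k → N ∥ x - int k) → FixedIso N P 1
    units N≢0 P-int cover = record
      { f = λ c → int (c zero)
      ; f-O = λ c → O-int _
      ; f-P = λ c → P-int _
      ; f-+ = λ c d → ∥-equal (int-+ _ _)
      ; f-surjective = λ Ox Px → let k , h = cover Ox Px in (λ _ → k) , h
      ; f-kernel = λ { c h zero → int-∥ N≢0 h }
      ; f-kernel⁻¹ = λ c h → let l , e = h zero in int l , O-int l , trans (cong int e) (int-* _ l) }

    divide-mod : ∀ {N k x y} → InverseMod N k → O x → N ∥ y - int k * x → ∃ λ m → N ∥ x - int m * y
    divide-mod {N} {k} {x} {y} (m , l , e) Ox h = m , subst (N ∥_)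
      (prove [] (N ∷ k ∷ m ∷ l ∷ []) (x ∷ y ∷ []) (ι z₀ ⊗ (ι z₃ ⊗ x₀) ⊖ ι z₂ ⊗ (x₁ ⊖ ι z₁ ⊗ x₀)) (x₀ ⊖ ι z₂ ⊗ x₁)
        ((𝟙 ·[ ι (z₂ ⊗ z₁ ⊕ z₃ ⊗ z₀) ≈ 𝟙 by trans (cong int e) int-1 ]· x₀) ∷ []) refl)
      (∥-diff (∥-multiple N (O-int* l Ox)) (∥-int* m h))

    -- Here k is the order of a group and the integer a an orbit sum of x, so that a ≡ k x for fixed
    -- x; inverting k makes x itself an integer modulo N.
    units-by-averaging : ∀ {N P k} → N ≢ 0ℤ → InverseMod N k → (∀ k → P (int k)) →
      (∀ {x} → O x → P x → ∃ λ a → N ∥ int a - int k * x) → FixedIso N P 1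
    units-by-averaging {N} N≢0 inv P-int cover = units N≢0 P-int λ {x} Ox Px →
      let a , h = cover Ox Px ; m , h′ = divide-mod inv Ox h in m ℤ.* a , subst (λ y → N ∥ x - y) (sym (int-* m a)) h′

  record ModSubspace (N : ℤ) (P : A → Set) : Set where
    field
      add : ∀ {x y} → O x → O y → P x → P y → P (x + y)
      scale : ∀ k {x} → O x → P x → P (int k * x)
      multiple : ∀ {x} → N ∥ x → P x
      dec : ∀ {x} → O x → Dec (P x)

  -- The vectors es have only to be independent modulo p and to cover P. The basis of O serves
  -- modulo 2; the pair 1, w spanning the fixed ring of s serves for D₃ modulo 3, where it bounds
  -- the rank by two.
  module Chart (p : ℕ) .{{_ : NonZero p}} (inv : ∀ k → (∃ λ l → k ≡ ℤ.+ p ℤ.* l) ⊎ (∃₂ λ m l → m ℤ.* k ≡ 1ℤ ℤ.+ ℤ.+ p ℤ.* l))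
    {P : A → Set} (S : ModSubspace (ℤ.+ p) P) {n} (es : Vec A n) (es-O : ∀ v → O (lin v es))
    (es-independent : ∀ v → ℤ.+ p ∥ lin v es → Divides (ℤ.+ p) v)
    (cover : ∀ {x} → O x → P x → ∃ λ v → ℤ.+ p ∥ x - lin v es) where
    private module S = ModSubspace S
    module Sub = Subspaces p inv

    opaque
      subspace : Sub.Subspace (λ v → P (lin v es))
      subspace = record
        { add = λ {v} {w} r s → subst P (sym (lin-+ v w es)) (S.add (es-O v) (es-O w) r s)
        ; scale = λ k {v} r → subst P (sym (lin-· k v es)) (S.scale k (es-O v) r)
        ; multiple = λ v → subst P (sym (lin-· (ℤ.+ p) v es)) (S.multiple (∥-multiple (ℤ.+ p) (es-O v)))
        ; dec = λ v → S.dec (es-O v) }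

    classification : Sub.Classification (λ v → P (lin v es))
    classification = Sub.classify _ subspace
    module C = Sub.Classification classification

    opaque
      iso : FixedIso (ℤ.+ p) P C.rank
      iso = record
        { f = λ c → lin (C.f c) es
        ; f-O = λ c → es-O (C.f c)
        ; f-P = C.f∈
        ; f-+ = λ c d → ∥-equal (trans (cong (λ v → lin v es) (C.f-+ c d)) (lin-+ (C.f c) (C.f d) es))
        ; f-surjective = surj
        ; f-kernel = λ c h → let d , e = es-independent (C.f c) h in C.f-kernel {d = d} e
        ; f-kernel⁻¹ = λ c h → let d , e = C.f-kernel⁻¹ c h in lin d es , es-O d , trans (cong (λ v → lin v es) e) (lin-· (ℤ.+ p) d es) }
        where
        surj : ∀ {x} → O x → P x → ∃ λ c → ℤ.+ p ∥ x - lin (C.f c) es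
        surj {x} Ox Px with v , h ← cover Ox Px with c , d , e ← C.f-surjective {v} (subst P
            (prove [] [] (x ∷ lin v es ∷ []) (x₀ ⊕ con -[1+ 0 ] ⊗ (x₀ ⊖ x₁)) x₁ [] refl)
            (S.add Ox (O-int* -[1+ 0 ] (∥-O h)) Px (S.scale -[1+ 0 ] (∥-O h) (S.multiple h)))) =
          c , subst (ℤ.+ p ∥_) (prove [] [] (x ∷ lin v es ∷ lin (C.f c) es ∷ int (ℤ.+ p) * lin d es ∷ []) (x₀ ⊖ x₁ ⊕ x₃) (x₀ ⊖ x₂)
            ((⊝ 𝟙 ·[ x₁ ≈ x₂ ⊕ x₃ by trans (cong (λ u → lin u es) e) (trans (lin-+ (C.f c) _ es) (cong (λ y → lin (C.f c) es + y) (lin-· (ℤ.+ p) d es))) ]· 𝟙) ∷ []) refl)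
            (∥-+ h (∥-multiple (ℤ.+ p) (es-O d)))

  Preserves : Automorphism → Set
  Preserves σ = ∀ {x} → O x → O (fun σ x)

  opaque
    ∥-fun : ∀ {N} σ → Preserves σ → ∀ {x} → N ∥ x → N ∥ fun σ x
    ∥-fun {N} σ pres (y , Oy , refl) = fun σ y , pres Oy , trans (fun-* σ _ _) (cong (_* fun σ y) (fun-int σ N))

    fixed-twice : ∀ {N} σ τ → Preserves σ → ∀ {x} → N ∥ fun σ x - x → N ∥ fun τ x - x → N ∥ fun σ (fun τ x) - x
    fixed-twice {N} σ τ pres {x} h k = subst (N ∥_)
      (prove [] [] (x ∷ fun σ x ∷ fun τ x ∷ fun σ (fun τ x) ∷ fun σ (fun τ x - x) ∷ []) (x₄ ⊕ (x₁ ⊖ x₀)) (x₃ ⊖ x₀)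
        ((𝟙 ·[ x₄ ≈ x₃ ⊖ x₁ by fun-diff σ _ _ ]· 𝟙) ∷ []) refl)
      (∥-+ (∥-fun σ pres k) h)

  module OneInvolution (S : Involution) (S-O : Preserves (Involution.σ S)) where
    open Involution S

    opaque
      plane : ∃ λ w → O w × s w ≡ w × (∀ {x} → O x → s x ≡ x → ∃₂ λ k l → x ≡ int k + int l * w) ×
        (∀ N k l → N ∥ int k + int l * w → (∃ λ k′ → k ≡ N ℤ.* k′) × (∃ λ l′ → l ≡ N ℤ.* l′))
      plane with w , Ow , (p , q , p∈ , q∈ , e) , generates , divisible ← plane-basis β β∉ℚ =
        w , Ow , trans (cong s e) (trans (fixed-line p∈ q∈) (sym e)) ,
        (λ Ox h → let p , q , p∈ , q∈ , e = fixed h in generates Ox p∈ q∈ e) , divisible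

    w : A
    w = proj₁ plane

    pair : Vec A 2
    pair = 1# ∷ w ∷ []

    opaque
      O-w : O w
      O-w = proj₁ (proj₂ plane)

      lin-pair : ∀ k l → lin (k ∷ l ∷ []) pair ≡ int k + int l * w
      lin-pair k l = cong₂ _+_ (*-identityʳ _) (+-identityʳ _)

      fix-pair : ∀ v → s (lin v pair) ≡ lin v pair
      fix-pair (k ∷ l ∷ []) = trans (cong s (lin-pair k l)) (trans (fun-+ σ _ _) (trans (cong₂ _+_ (fun-int σ k)
        (trans (fun-* σ _ _) (cong₂ _*_ (fun-int σ l) (proj₁ (proj₂ (proj₂ plane)))))) (sym (lin-pair k l))))

      O-pair : ∀ v → O (lin v pair)
      O-pair (k ∷ l ∷ []) = subst O (sym (lin-pair k l)) (O-+ (O-int k) (O-int* l O-w))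

      pair-independent : ∀ N v → N ∥ lin v pair → Divides N v
      pair-independent N (k ∷ l ∷ []) h with (k′ , e) , (l′ , e′) ← proj₂ (proj₂ (proj₂ (proj₂ plane))) N k l (subst (N ∥_) (lin-pair k l) h) =
        k′ ∷ l′ ∷ [] , cong₂ _∷_ e (cong (_∷ []) e′)

      -- Averaging over 1 and s: the element 2 x is congruent to x + s x, which is fixed by s and so
      -- lies in ℤ + ℤw.
      pair-cover : ∀ {N x} → InverseMod N (ℤ.+ 2) → O x → N ∥ s x - x → ∃ λ v → N ∥ x - lin v pair
      pair-cover {N} {x} inv Ox h
        with k , l , e ← proj₁ (proj₂ (proj₂ (proj₂ plane))) (O-+ Ox (S-O Ox)) (fixed-sum x)
        with m , h′ ← divide-mod inv Ox (subst (N ∥_) (prove [] [] (x ∷ s x ∷ []) (x₁ ⊖ x₀) (x₀ ⊕ x₁ ⊖ con (ℤ.+ 2) ⊗ x₀) [] refl) h) =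
        m ·ᵥ (k ∷ l ∷ []) , subst (λ y → N ∥ x - y) (sym (trans (lin-· m (k ∷ l ∷ []) pair) (cong (int m *_) (trans (lin-pair k l) (sym e))))) h′

      odd-modulus : ∀ {N P} → InverseMod N (ℤ.+ 2) → (∀ {x} → P x → N ∥ s x - x) → (∀ {x} → s x ≡ x → P x) → FixedIso N P 2
      odd-modulus {N} {P} inv only fixed⇒P = record
        { f = F
        ; f-O = λ c → O-pair (vec c)
        ; f-P = λ c → fixed⇒P (fix-pair (vec c))
        ; f-+ = λ c d → ∥-equal (lin-+ (vec c) (vec d) pair)
        ; f-surjective = λ {x} Ox Px → surj Ox (pair-cover inv Ox (only Px))
        ; f-kernel = λ c h → ker c (pair-independent N (vec c) h)
        ; f-kernel⁻¹ = λ c h → let k , e = h zero ; l , e′ = h (suc zero) in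
            lin (k ∷ l ∷ []) pair , O-pair (k ∷ l ∷ []) , trans (cong (λ v → lin v pair) (cong₂ _∷_ e (cong (_∷ []) e′))) (lin-· N (k ∷ l ∷ []) pair) }
        where
        vec : (Fin 2 → ℤ) → Vec ℤ 2
        vec c = c zero ∷ c (suc zero) ∷ []
        F : (Fin 2 → ℤ) → A
        F c = lin (vec c) pair
        surj : ∀ {x} → O x → (∃ λ v → N ∥ x - lin v pair) → ∃ λ c → N ∥ x - F c
        surj Ox (k ∷ l ∷ [] , h) = (λ { zero → k ; (suc _) → l }) , h
        ker : ∀ c → Divides N (vec c) → ∀ i → ∃ λ l → c i ≡ N ℤ.* l
        ker c (k ∷ l ∷ [] , e) zero = k , proj₁ (∷-injective e)
        ker c (k ∷ l ∷ [] , e) (suc zero) = l , proj₁ (∷-injective (proj₂ (∷-injective e)))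

  -- A rotation of order 3 inverted by an involution.

  record DihedralThree : Set where
    field
      S : Involution
      S-O : Preserves (Involution.σ S)
      ρ : Automorphism
      ρ-O : Preserves ρ
      cube : ∀ x → fun ρ (fun ρ (fun ρ x)) ≡ x
      nontrivial : Nontrivial ρ
      inverts : ∀ x → Involution.s S (fun ρ x) ≡ fun ρ (fun ρ (Involution.s S x))
    open Involution S using (s; σ; involutive)
    r : A → A
    r = fun ρ

    opaque
      -- Let b conjugate by r, with trace t and norm n. Since r³ = 1, the element b³ = (t² - n) b -
      -- t n is central, and b is not rational, so t² = n. Then t ≠ 0, since otherwise b² = 0, and ω
      -- = -b/t satisfies ω² = -1 - ω.
      cube-root : ∃ λ ω → (∀ x → ω * x ≡ r x * ω) × ω * ω ≡ int -[1+ 0 ] + int -[1+ 0 ] * ω × ¬ Rat ω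
      cube-root with b , b≢0 , h ← skolem-noether ρ = result
        where
        t n : A
        t = b + bar b
        n = b * bar b
        b∉ℚ : ¬ Rat b
        b∉ℚ = conjugator∉ℚ ρ b≢0 h nontrivial
        b²≡ : b * b ≡ t * b - n
        b²≡ = prove [] [] (b ∷ bar b ∷ []) (x₀ ⊗ x₀) ((x₀ ⊕ x₁) ⊗ x₀ ⊖ x₀ ⊗ x₁) ((⊝ 𝟙 ·[ x₁ ⊗ x₀ ≈ x₀ ⊗ x₁ by bar-comm b ]· 𝟙) ∷ []) refl
        b³∈ℚ : Rat (b * b * b)
        b³∈ℚ = center λ x → prove [] [] (b ∷ x ∷ r x ∷ r (r x) ∷ []) (x₀ ⊗ x₀ ⊗ x₀ ⊗ x₁) (x₁ ⊗ (x₀ ⊗ x₀ ⊗ x₀))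
          ( (⊝ (x₀ ⊗ x₀) ·[ x₂ ⊗ x₀ ≈ x₀ ⊗ x₁ by h x ]· 𝟙) ∷ (⊝ x₀ ·[ x₃ ⊗ x₀ ≈ x₀ ⊗ x₂ by h (r x) ]· x₀)
          ∷ (⊝ 𝟙 ·[ x₁ ⊗ x₀ ≈ x₀ ⊗ x₃ by trans (cong (_* b) (sym (cube x))) (h (r (r x))) ]· (x₀ ⊗ x₀)) ∷ []) refl
        t²≡n : t * t - n ≡ 0#
        t²≡n with t * t - n ≟ 0#
        ... | yes e = e
        ... | no ne = ⊥-elim (b∉ℚ (rat-divide (rat-+ (rat-* (trace b) (trace b)) (rat-neg (nrm b))) ne (subst Rat
          (prove (cen (trace b) ∷ cen (nrm b) ∷ []) [] (b ∷ []) (x₀ ⊗ x₀ ⊗ x₀ ⊕ c₀ ⊗ c₁) ((c₀ ⊗ c₀ ⊖ c₁) ⊗ x₀)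
            ((𝟙 ·[ x₀ ⊗ x₀ ≈ c₀ ⊗ x₀ ⊖ c₁ by b²≡ ]· x₀) ∷ (c₀ ·[ x₀ ⊗ x₀ ≈ c₀ ⊗ x₀ ⊖ c₁ by b²≡ ]· 𝟙) ∷ []) refl)
          (rat-+ b³∈ℚ (rat-* (trace b) (nrm b))))))
        t≢0 : t ≢ 0#
        t≢0 e = *-nonzero b≢0 b≢0 (prove (cen (nrm b) ∷ []) [] (b ∷ t ∷ []) (x₀ ⊗ x₀) 𝟘
          ( (𝟙 ·[ x₀ ⊗ x₀ ≈ x₁ ⊗ x₀ ⊖ c₀ by b²≡ ]· 𝟙) ∷ (𝟙 ·[ x₁ ≈ 𝟘 by e ]· x₀)
          ∷ (⊝ 𝟙 ·[ x₁ ≈ 𝟘 by e ]· x₁) ∷ (𝟙 ·[ x₁ ⊗ x₁ ⊖ c₀ ≈ 𝟘 by t²≡n ]· 𝟙) ∷ []) refl)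
        result : ∃ λ ω → (∀ x → ω * x ≡ r x * ω) × ω * ω ≡ int -[1+ 0 ] + int -[1+ 0 ] * ω × ¬ Rat ω
        result with k , k∈ , tk≡1 ← rat-inverse (trace b) t≢0 = - (k * b) ,
          (λ x → prove (cen k∈ ∷ []) [] (b ∷ x ∷ r x ∷ []) (⊝ (c₀ ⊗ x₀) ⊗ x₁) (x₂ ⊗ ⊝ (c₀ ⊗ x₀)) ((c₀ ·[ x₂ ⊗ x₀ ≈ x₀ ⊗ x₁ by h x ]· 𝟙) ∷ []) refl) ,
          prove (cen k∈ ∷ cen (trace b) ∷ cen (nrm b) ∷ []) [] (b ∷ []) (⊝ (c₀ ⊗ x₀) ⊗ ⊝ (c₀ ⊗ x₀)) (con -[1+ 0 ] ⊕ con -[1+ 0 ] ⊗ ⊝ (c₀ ⊗ x₀))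
            ( (c₀ ⊗ c₀ ·[ x₀ ⊗ x₀ ≈ c₁ ⊗ x₀ ⊖ c₂ by b²≡ ]· 𝟙) ∷ (c₀ ·[ c₁ ⊗ c₀ ≈ 𝟙 by tk≡1 ]· x₀)
            ∷ (c₀ ⊗ c₀ ·[ c₁ ⊗ c₁ ⊖ c₂ ≈ 𝟘 by t²≡n ]· 𝟙) ∷ (⊝ (𝟙 ⊕ c₁ ⊗ c₀) ·[ c₁ ⊗ c₀ ≈ 𝟙 by tk≡1 ]· 𝟙) ∷ []) refl ,
          (λ r → b∉ℚ (subst Rat (prove (cen k∈ ∷ []) [] (b ∷ t ∷ []) (⊝ (x₁ ⊗ ⊝ (c₀ ⊗ x₀))) x₀ ((𝟙 ·[ x₁ ⊗ c₀ ≈ 𝟙 by tk≡1 ]· x₀) ∷ []) refl)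
            (rat-neg (rat-* (trace b) r))))

    ω : A
    ω = proj₁ cube-root

    opaque
      ω-comm : ∀ x → ω * x ≡ r x * ω
      ω-comm = proj₁ (proj₂ cube-root)

      ω² : ω * ω ≡ int -[1+ 0 ] + int -[1+ 0 ] * ω
      ω² = proj₁ (proj₂ (proj₂ cube-root))

      ω∉ℚ : ¬ Rat ω
      ω∉ℚ = proj₂ (proj₂ (proj₂ cube-root))

      ω≢0 : ω ≢ 0#
      ω≢0 e = ω∉ℚ (subst Rat (sym e) rat-0)

      O-ω : O ω
      O-ω = normalizing-integral ω r ρ-O ω-comm -[1+ 0 ] -[1+ 0 ] ω²

      r-ω : r ω ≡ ω
      r-ω = *-cancelʳ ω≢0 (sym (ω-comm ω))

      r-fixed : ∀ {x} → r x ≡ x → ∃₂ λ p q → Rat p × Rat q × x ≡ p + q * ω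
      r-fixed {x} e = centralizer ω∉ℚ (trans (cong (_* ω) (sym e)) (sym (ω-comm x)))

      -- If s fixed ω it would commute with conjugation by ω, that is, with r. Together with s r =
      -- r² s this gives r² = r, hence r = 1.
      s-ω≢ω : s ω ≢ ω
      s-ω≢ω e = nontrivial λ x → trans (cong r (sym (cube x))) (trans (cong (λ y → r (r y)) (r²≡r x)) (cube x))
        where
        commutes : ∀ x → s (r x) ≡ r (s x)
        commutes x = *-cancelʳ ω≢0 (begin
          s (r x) * ω   ≡⟨ cong (s (r x) *_) e ⟨
          s (r x) * s ω ≡⟨ fun-* σ _ _ ⟨
          s (r x * ω)   ≡⟨ cong s (ω-comm x) ⟨
          s (ω * x)     ≡⟨ fun-* σ _ _ ⟩
          s ω * s x     ≡⟨ cong (_* s x) e ⟩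
          ω * s x       ≡⟨ ω-comm (s x) ⟩
          r (s x) * ω   ∎)
          where open ≡-Reasoning
        r²≡r : ∀ x → r (r x) ≡ r x
        r²≡r x = trans (cong (λ y → r (r y)) (sym (involutive x))) (trans (sym (inverts (s x))) (trans (commutes (s x)) (cong r (involutive x))))

      -- From s r = r² s, the element s ω is fixed by r and so commutes with ω. Both are roots of X²
      -- + X + 1, so (s ω - ω)(s ω + ω + 1) = 0.
      s-ω : s ω ≡ - 1# - ω
      s-ω with s ω ≟ ω
      ... | yes e = ⊥-elim (s-ω≢ω e)
      ... | no ne = prove [] [] (ω ∷ s ω ∷ []) x₁ (⊝ 𝟙 ⊖ x₀)
          ((𝟙 ·[ x₁ ⊕ x₀ ⊕ 𝟙 ≈ 𝟘 by integral-domain difference≢0 product ]· 𝟙) ∷ []) refl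
        where
        difference≢0 : s ω - ω ≢ 0#
        difference≢0 h = ne (prove [] [] (ω ∷ s ω ∷ []) x₁ x₀ ((𝟙 ·[ x₁ ⊖ x₀ ≈ 𝟘 by h ]· 𝟙) ∷ []) refl)
        r-sω : r (s ω) ≡ s ω
        r-sω = trans (cong r (trans (cong s (sym r-ω)) (inverts ω))) (cube (s ω))
        sω² : s ω * s ω ≡ int -[1+ 0 ] + int -[1+ 0 ] * s ω
        sω² = trans (sym (fun-* σ ω ω)) (trans (cong s ω²) (trans (fun-+ σ _ _) (cong₂ _+_ (fun-int σ _) (trans (fun-* σ _ _) (cong (_* s ω) (fun-int σ _))))))
        product : (s ω - ω) * (s ω + ω + 1#) ≡ 0#
        product = prove [] [] (ω ∷ s ω ∷ []) ((x₁ ⊖ x₀) ⊗ (x₁ ⊕ x₀ ⊕ 𝟙)) 𝟘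
          ( (𝟙 ·[ x₁ ⊗ x₁ ≈ con -[1+ 0 ] ⊕ con -[1+ 0 ] ⊗ x₁ by sω² ]· 𝟙) ∷ (⊝ 𝟙 ·[ x₀ ⊗ x₀ ≈ con -[1+ 0 ] ⊕ con -[1+ 0 ] ⊗ x₀ by ω² ]· 𝟙)
          ∷ (⊝ 𝟙 ·[ x₀ ⊗ x₁ ≈ x₁ ⊗ x₀ by trans (ω-comm (s ω)) (cong (_* ω) r-sω) ]· 𝟙) ∷ []) refl

      s-line : ∀ {p q} → Rat p → Rat q → s (p + q * ω) ≡ p + q * (- 1# - ω)
      s-line p∈ q∈ = trans (fun-+ σ _ _) (cong₂ _+_ (fun-rat σ p∈) (trans (fun-* σ _ _) (cong₂ _*_ (fun-rat σ q∈) s-ω)))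

    Y : A → A
    Y x = x + r x + r (r x)

    opaque
      O-Y : ∀ {x} → O x → O (Y x)
      O-Y Ox = O-+ (O-+ Ox (ρ-O Ox)) (ρ-O (ρ-O Ox))

      r-Y : ∀ x → r (Y x) ≡ Y x
      r-Y x = prove [] [] (x ∷ r x ∷ r (r x) ∷ r (Y x) ∷ []) x₃ (x₀ ⊕ x₁ ⊕ x₂)
        ((𝟙 ·[ x₃ ≈ x₁ ⊕ x₂ ⊕ x₀ by trans (fun-+ ρ _ _) (cong₂ _+_ (fun-+ ρ _ _) (cube x)) ]· 𝟙) ∷ []) refl

      -- 2 p - q is the trace of y = p + q ω; because s sends ω to its conjugate, it equals y + s y
      -- and so lies in O.
      integral-trace : ∀ {p q} → Rat p → Rat q → O (p + q * ω) → ∃ λ k → p + p - q ≡ int k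
      integral-trace {p} {q} p∈ q∈ h = rational-integer (subst O
        (prove (cen p∈ ∷ cen q∈ ∷ []) [] (ω ∷ s (p + q * ω) ∷ []) (c₀ ⊕ c₁ ⊗ x₀ ⊕ x₁) (c₀ ⊕ c₀ ⊖ c₁)
          ((𝟙 ·[ x₁ ≈ c₀ ⊕ c₁ ⊗ (⊝ 𝟙 ⊖ x₀) by s-line p∈ q∈ ]· 𝟙) ∷ []) refl) (O-+ h (S-O h))) (rat-+ (rat-+ p∈ p∈) (rat-neg q∈))

      Y-congruent : ∀ {N x} → N ∥ r x - x → N ∥ Y x - int (ℤ.+ 3) * x
      Y-congruent {N} {x} h = subst (N ∥_) (prove [] [] (x ∷ r x ∷ r (r x) ∷ []) (x₁ ⊖ x₀ ⊕ (x₂ ⊖ x₀)) (x₀ ⊕ x₁ ⊕ x₂ ⊖ con (ℤ.+ 3) ⊗ x₀) [] refl)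
        (∥-+ h (fixed-twice ρ ρ ρ-O h h))

      -- `Y x + s (Y x)` is the orbit sum over the six elements of D₃; it is the trace of `Y x`,
      -- hence an integer.
      average : ∀ {N x} → O x → N ∥ r x - x → N ∥ s x - x → ∃ λ k → N ∥ int k - int (ℤ.+ 6) * x
      average {N} {x} Ox hr hs with p , q , p∈ , q∈ , e ← r-fixed (r-Y x)
        with k , e′ ← integral-trace p∈ q∈ (subst O e (O-Y Ox)) = k , subst (N ∥_)
          (prove (cen p∈ ∷ cen q∈ ∷ []) (k ∷ []) (x ∷ s x ∷ Y x ∷ s (Y x) ∷ ω ∷ s (Y x - int (ℤ.+ 3) * x) ∷ [])
            (x₂ ⊖ con (ℤ.+ 3) ⊗ x₀ ⊕ x₅ ⊕ con (ℤ.+ 3) ⊗ (x₁ ⊖ x₀)) (ι z₀ ⊖ con (ℤ.+ 6) ⊗ x₀)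
            ( (𝟙 ·[ x₅ ≈ x₃ ⊖ con (ℤ.+ 3) ⊗ x₁ by trans (fun-diff σ _ _) (cong (λ y → s (Y x) - y) (trans (fun-* σ _ _) (cong (_* s x) (fun-int σ _)))) ]· 𝟙)
            ∷ (𝟙 ·[ x₂ ≈ c₀ ⊕ c₁ ⊗ x₄ by e ]· 𝟙) ∷ (𝟙 ·[ x₃ ≈ c₀ ⊕ c₁ ⊗ (⊝ 𝟙 ⊖ x₄) by trans (cong s e) (s-line p∈ q∈) ]· 𝟙)
            ∷ (𝟙 ·[ c₀ ⊕ c₀ ⊖ c₁ ≈ ι z₀ by e′ ]· 𝟙) ∷ []) refl)
          (∥-+ (∥-+ (Y-congruent hr) (∥-fun σ S-O (Y-congruent hr))) (∥-int* (ℤ.+ 3) hs))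

      -- 3 Y x = P + R ω with P, R ∈ ℤ, and x ≡ 3 Y x modulo 2.
      mod-two : ∀ {x} → O x → ℤ.+ 2 ∥ r x - x → ℤ.+ 2 ∥ s x - x → ∃ λ k → ℤ.+ 2 ∥ x - int k
      mod-two {x} Ox hr hs with p , q , p∈ , q∈ , e ← r-fixed (r-Y x) = result
        where
        Oy : O (p + q * ω)
        Oy = subst O e (O-Y Ox)
        ωy : ω * (p + q * ω) ≡ - q + (p - q) * ω
        ωy = prove (cen p∈ ∷ cen q∈ ∷ []) [] (ω ∷ []) (x₀ ⊗ (c₀ ⊕ c₁ ⊗ x₀)) (⊝ c₁ ⊕ (c₀ ⊖ c₁) ⊗ x₀)
          ((c₁ ·[ x₀ ⊗ x₀ ≈ con -[1+ 0 ] ⊕ con -[1+ 0 ] ⊗ x₀ by ω² ]· 𝟙) ∷ []) refl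
        result : ∃ λ k → ℤ.+ 2 ∥ x - int k
        result with a , ea ← integral-trace p∈ q∈ Oy
          with b , eb ← integral-trace (rat-neg q∈) (rat-+ p∈ (rat-neg q∈)) (subst O ωy (O-* O-ω Oy)) = even (int-∥ (λ ()) int-R)
          where
          -- a = 2p - q and b = -p - q are the traces of y = p + q ω and of ω y, so that P = 3p and
          -- R = 3q.
          P R : ℤ
          P = a ℤ.- b
          R = ℤ.- (a ℤ.+ ℤ.+ 2 ℤ.* b)
          3y : int (ℤ.+ 3) * Y x ≡ int P + int R * ω
          3y = prove (cen p∈ ∷ cen q∈ ∷ []) (a ∷ b ∷ []) (ω ∷ Y x ∷ []) (con (ℤ.+ 3) ⊗ x₁) (ι (z₀ ⊖ z₁) ⊕ ι (⊝ (z₀ ⊕ con (ℤ.+ 2) ⊗ z₁)) ⊗ x₀)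
            ( (con (ℤ.+ 3) ·[ x₁ ≈ c₀ ⊕ c₁ ⊗ x₀ by e ]· 𝟙)
            ∷ (𝟙 ·[ c₀ ⊕ c₀ ⊖ c₁ ≈ ι z₀ by ea ]· (𝟙 ⊖ x₀))
            ∷ (⊝ 𝟙 ·[ ⊝ c₁ ⊕ ⊝ c₁ ⊖ (c₀ ⊖ c₁) ≈ ι z₁ by eb ]· (𝟙 ⊕ con (ℤ.+ 2) ⊗ x₀)) ∷ []) refl
          x≡3y : ℤ.+ 2 ∥ x - (int P + int R * ω)
          x≡3y = subst (ℤ.+ 2 ∥_) (prove [] (P ∷ R ∷ []) (x ∷ Y x ∷ ω ∷ [])
            (con -[1+ 2 ] ⊗ (x₁ ⊖ con (ℤ.+ 3) ⊗ x₀) ⊕ con (ℤ.+ 2) ⊗ (con -[1+ 3 ] ⊗ x₀)) (x₀ ⊖ (ι z₀ ⊕ ι z₁ ⊗ x₂))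
            ((⊝ 𝟙 ·[ con (ℤ.+ 3) ⊗ x₁ ≈ ι z₀ ⊕ ι z₁ ⊗ x₂ by 3y ]· 𝟙) ∷ []) refl)
            (∥-+ (∥-int* -[1+ 2 ] (Y-congruent hr)) (∥-multiple (ℤ.+ 2) (O-int* -[1+ 3 ] Ox)))
          s-diff : s (x - (int P + int R * ω)) ≡ s x - (int P + int R * (- 1# - ω))
          s-diff = trans (fun-diff σ _ _) (cong (λ y → s x - y) (s-line (rat-int P) (rat-int R)))
          -- Comparing x ≡ P + R ω with its image under s gives R (1 + 2 ω) ≡ 0, so R is even and
          -- the term R ω disappears modulo 2.
          int-R : ℤ.+ 2 ∥ int R
          int-R = subst (ℤ.+ 2 ∥_) (prove [] (P ∷ R ∷ []) (x ∷ s x ∷ ω ∷ s (x - (int P + int R * ω)) ∷ [])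
            (x₃ ⊖ (x₀ ⊖ (ι z₀ ⊕ ι z₁ ⊗ x₂)) ⊖ (x₁ ⊖ x₀) ⊖ con (ℤ.+ 2) ⊗ (ι z₁ ⊗ x₂)) (ι z₁)
            ((𝟙 ·[ x₃ ≈ x₁ ⊖ (ι z₀ ⊕ ι z₁ ⊗ (⊝ 𝟙 ⊖ x₂)) by s-diff ]· 𝟙) ∷ []) refl)
            (∥-diff (∥-diff (∥-diff (∥-fun σ S-O x≡3y) x≡3y) hs) (∥-multiple (ℤ.+ 2) (O-int* R O-ω)))
          even : (∃ λ l → R ≡ ℤ.+ 2 ℤ.* l) → ∃ λ k → ℤ.+ 2 ∥ x - int k
          even (l , R≡) = P , subst (ℤ.+ 2 ∥_) (prove [] (P ∷ R ∷ l ∷ []) (x ∷ ω ∷ [])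
            (x₀ ⊖ (ι z₀ ⊕ ι z₁ ⊗ x₁) ⊕ con (ℤ.+ 2) ⊗ (ι z₂ ⊗ x₁)) (x₀ ⊖ ι z₀)
            ((⊝ 𝟙 ·[ ι z₁ ≈ ι (con (ℤ.+ 2) ⊗ z₂) by cong int R≡ ]· x₁) ∷ []) refl)
            (∥-+ x≡3y (∥-multiple (ℤ.+ 2) (O-int* l O-ω)))

-- Lower bounds for the rank modulo 2.

module ModTwo (Q : QuaternionDivisionAlgebra) (O : QuaternionDivisionAlgebra.A Q → Set) (order : Lattices.MaximalOrder Q O) where
  open Actions Q O order public
  open Parity

  opaque
    non-unit : ∀ p l → 2 ≤ p → ℤ.+ p ℤ.* l ≢ 1ℤ
    non-unit p l 2≤p h = ℕP.<⇒≢ 2≤p (sym (ℕP.m*n≡1⇒m≡1 p ℤ.∣ l ∣ (trans (sym (ℤP.abs-* (ℤ.+ p) l)) (cong ℤ.∣_∣ h))))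

    ∤1 : ∀ p → 2 ≤ p → ¬ (ℤ.+ p ∥ 1#)
    ∤1 (suc p) 2≤p h with l , e ← int-∥ {k = 1ℤ} (λ ()) (subst (ℤ.+ suc p ∥_) (sym int-1) h) = non-unit (suc p) l 2≤p (sym e)

    2∤1 : ¬ (ℤ.+ 2 ∥ 1#)
    2∤1 = ∤1 2 ℕP.≤-refl

    rank-zero : ∀ {p P} → 2 ≤ p → P 1# → ¬ FixedIso (ℤ.+ p) P 0
    rank-zero {p} 2≤p P1 F with c , h ← FixedIso.f-surjective F O-1 P1 = ∤1 p 2≤p (subst (ℤ.+ p ∥_)
      (prove [] [] (FixedIso.f F c ∷ []) (𝟙 ⊖ x₀ ⊕ x₀) 𝟙 [] refl) (∥-+ h (FixedIso.f-kernel⁻¹ F c λ ())))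

  Small : (A → Set) → Set
  Small P = ∀ {x} → O x → P x → ℤ.+ 2 ∥ x ⊎ ℤ.+ 2 ∥ x - 1#

  opaque
    -- A space of two elements that contains the nonzero class of 1 consists of 0 and 1.
    rank-one-small : ∀ {P} → P 1# → FixedIso (ℤ.+ 2) P 1 → Small P
    rank-one-small P1 F {x} Ox Px with FixedIso.f-surjective F Ox Px | FixedIso.f-surjective F O-1 P1
    ... | c , h | d , h₁ with parity (c zero) | parity (d zero)
    ... | _ | inj₁ e = ⊥-elim (2∤1 (subst (ℤ.+ 2 ∥_) (prove [] [] (FixedIso.f F d ∷ []) (𝟙 ⊖ x₀ ⊕ x₀) 𝟙 [] refl) (∥-+ h₁ (FixedIso.f-kernel⁻¹ F d λ { zero → e }))))
    ... | inj₁ e | _ = inj₁ (subst (ℤ.+ 2 ∥_) (prove [] [] (x ∷ FixedIso.f F c ∷ []) (x₀ ⊖ x₁ ⊕ x₁) x₀ [] refl) (∥-+ h (FixedIso.f-kernel⁻¹ F c λ { zero → e })))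
    ... | inj₂ (k , e) | inj₂ (l , e′) = inj₂ (subst (ℤ.+ 2 ∥_)
      (prove [] [] (x ∷ FixedIso.f F c ∷ FixedIso.f F d ∷ FixedIso.f F (λ i → c i ℤ.+ d i) ∷ [])
        (x₀ ⊖ x₁ ⊕ (𝟙 ⊖ x₂) ⊖ (x₃ ⊖ (x₁ ⊕ x₂)) ⊕ x₃ ⊖ con (ℤ.+ 2) ⊗ 𝟙) (x₀ ⊖ 𝟙) [] refl)
      (∥-diff (∥-+ (∥-diff (∥-+ h h₁) (FixedIso.f-+ F c d)) (FixedIso.f-kernel⁻¹ F _ λ { zero → 1ℤ ℤ.+ k ℤ.+ l , sum })) (∥-multiple (ℤ.+ 2) O-1)))
      where
      sum : c zero ℤ.+ d zero ≡ ℤ.+ 2 ℤ.* (1ℤ ℤ.+ k ℤ.+ l)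
      sum = trans (cong₂ ℤ._+_ e e′) (ℤSolve.prove [] (k ∷ l ∷ []) [] (ι (con 1ℤ ⊕ con (ℤ.+ 2) ⊗ z₀ ⊕ (con 1ℤ ⊕ con (ℤ.+ 2) ⊗ z₁))) (ι (con (ℤ.+ 2) ⊗ (con 1ℤ ⊕ z₀ ⊕ z₁))) [] refl)

  bits : ∀ {n} → (Fin n → Fin 2) → Vec ℤ n
  bits {zero} f = []
  bits {suc n} f = ℤ.+ toℕ (f zero) ∷ bits (λ i → f (suc i))

  opaque
    bit-injective : ∀ (a b : Fin 2) l → ℤ.+ toℕ a ℤ.+ -[1+ 0 ] ℤ.* ℤ.+ toℕ b ≡ ℤ.+ 2 ℤ.* l → a ≡ b
    bit-injective zero zero l _ = refl
    bit-injective (suc zero) (suc zero) l _ = refl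
    bit-injective (suc zero) zero l h = contradiction (sym h) (two-not-unit l)
    bit-injective zero (suc zero) l h = contradiction (trans (sym (ℤP.neg-distribʳ-* (ℤ.+ 2) l)) (cong ℤ.-_ (sym h))) (two-not-unit (ℤ.- l))

    bits-injective : ∀ {n} (f g : Fin n → Fin 2) → Divides (ℤ.+ 2) (bits f +ᵥ -[1+ 0 ] ·ᵥ bits g) → ∀ i → f i ≡ g i
    bits-injective {suc n} f g (k ∷ d , h) zero = bit-injective (f zero) (g zero) k (proj₁ (∷-injective h))
    bits-injective {suc n} f g (k ∷ d , h) (suc i) = bits-injective (λ i → f (suc i)) (λ i → g (suc i)) (d , proj₂ (∷-injective h)) i

    funToFin-cong : ∀ {m n} {f g : Fin m → Fin n} → (∀ i → f i ≡ g i) → funToFin f ≡ funToFin g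
    funToFin-cong {zero} h = refl
    funToFin-cong {suc m} h = cong₂ combine (h zero) (funToFin-cong (λ i → h (suc i)))

  label : {X Y : Set} → X ⊎ Y → Fin 2
  label (inj₁ _) = zero
  label (inj₂ _) = suc zero

  -- Modulo 2 each of α, γ takes at most two values, so their common kernel contains at least four
  -- of the sixteen classes of O/2, too many for {0, 1}. A single involution is treated by taking γ
  -- = 0.
  module SmallKernel (α γ : A → A) (α-diff : ∀ x y → α (x - y) ≡ α x - α y) (γ-diff : ∀ x y → γ (x - y) ≡ γ x - γ y)
    (α-small : ∀ {x} → O x → ℤ.+ 2 ∥ α x ⊎ ℤ.+ 2 ∥ α x - 1#) (γ-small : ∀ {x} → O x → ℤ.+ 2 ∥ γ x ⊎ ℤ.+ 2 ∥ γ x - 1#)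
    (kernel-small : Small (λ x → ℤ.+ 2 ∥ α x × ℤ.+ 2 ∥ γ x)) where

    opaque
      same-label : ∀ {δ : A → A} {x y} → (δ (x - y) ≡ δ x - δ y) → (d : ℤ.+ 2 ∥ δ x ⊎ ℤ.+ 2 ∥ δ x - 1#) (e : ℤ.+ 2 ∥ δ y ⊎ ℤ.+ 2 ∥ δ y - 1#) →
        label d ≡ label e → ℤ.+ 2 ∥ δ (x - y)
      same-label diff (inj₁ h) (inj₁ k) _ = subst (ℤ.+ 2 ∥_) (sym diff) (∥-diff h k)
      same-label {δ} {x} {y} diff (inj₂ h) (inj₂ k) _ = subst (ℤ.+ 2 ∥_)
        (trans (prove [] [] (δ x ∷ δ y ∷ []) (x₀ ⊖ 𝟙 ⊖ (x₁ ⊖ 𝟙)) (x₀ ⊖ x₁) [] refl) (sym diff)) (∥-diff h k)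

      same-parity : ∀ {k l} → label (parity k) ≡ label (parity l) → ∃ λ m → k ℤ.+ -[1+ 0 ] ℤ.* l ≡ ℤ.+ 2 ℤ.* m
      same-parity {k} {l} h with parity k | parity l
      ... | inj₁ (i , refl) | inj₁ (j , refl) = i ℤ.- j , ℤSolve.prove [] (i ∷ j ∷ []) []
        (ι (con (ℤ.+ 2) ⊗ z₀ ⊕ con -[1+ 0 ] ⊗ (con (ℤ.+ 2) ⊗ z₁))) (ι (con (ℤ.+ 2) ⊗ (z₀ ⊖ z₁))) [] refl
      ... | inj₂ (i , refl) | inj₂ (j , refl) = i ℤ.- j , ℤSolve.prove [] (i ∷ j ∷ []) []
        (ι (con 1ℤ ⊕ con (ℤ.+ 2) ⊗ z₀ ⊕ con -[1+ 0 ] ⊗ (con 1ℤ ⊕ con (ℤ.+ 2) ⊗ z₁))) (ι (con (ℤ.+ 2) ⊗ (z₀ ⊖ z₁))) [] refl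

      -- Sixteen residue classes carry eight labels, the last one separating 0 from 1.
      absurd : ⊥
      absurd with u , λ′ , 1≡ , λu ← unit-functional = collide (pigeonhole {8} {16} (ℕP.≤ᵇ⇒≤ 9 16 tt) labels)
        where
        vec : Fin 16 → Vec ℤ 4
        vec c = bits (finToFun {2} {4} c)
        elt : Fin 16 → A
        elt c = lin (vec c) basis
        O-elt : ∀ c → O (elt c)
        O-elt c = O-lin (vec c)
        αl γl πl : Fin 16 → Fin 2
        αl c = label (α-small (O-elt c))
        γl c = label (γ-small (O-elt c))
        πl c = label (parity (dot λ′ (vec c)))
        αγl : Fin 16 → Fin 4
        αγl c = combine {2} {2} (αl c) (γl c)
        labels : Fin 16 → Fin 8
        labels c = combine {4} {2} (αγl c) (πl c)
        collide : (∃₂ λ i j → i Fin.< j × labels i ≡ labels j) → ⊥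
        collide (i , j , i<j , eq) = finish (kernel-small O-d
            ( same-label {α} (α-diff _ _) (α-small (O-elt i)) (α-small (O-elt j)) (combine-injectiveˡ (αl i) (γl i) (αl j) (γl j) eq′)
            , same-label {γ} (γ-diff _ _) (γ-small (O-elt i)) (γ-small (O-elt j)) (combine-injectiveʳ (αl i) (γl i) (αl j) (γl j) eq′)))
          where
          eq′ : αγl i ≡ αγl j
          eq′ = combine-injectiveˡ (αγl i) (πl i) (αγl j) (πl j) eq
          eq″ : πl i ≡ πl j
          eq″ = combine-injectiveʳ (αγl i) (πl i) (αγl j) (πl j) eq
          d : Vec ℤ 4
          d = vec i +ᵥ -[1+ 0 ] ·ᵥ vec j
          d≡ : lin d basis ≡ elt i - elt j
          d≡ = trans (lin-+ (vec i) (-[1+ 0 ] ·ᵥ vec j) basis) (trans (cong (λ y → elt i + y) (lin-· _ (vec j) basis)) (prove [] [] (elt i ∷ elt j ∷ []) (x₀ ⊕ con -[1+ 0 ] ⊗ x₁) (x₀ ⊖ x₁) [] refl))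
          O-d : O (elt i - elt j)
          O-d = O-diff (O-elt i) (O-elt j)
          finish : ℤ.+ 2 ∥ elt i - elt j ⊎ ℤ.+ 2 ∥ elt i - elt j - 1# → ⊥
          finish (inj₁ h) = FinP.<⇒≢ i<j (trans (sym (funToFin-finToFin {4} {2} i)) (trans (funToFin-cong
            (bits-injective (finToFun {2} {4} i) (finToFun {2} {4} j) (∥-coordinates d (subst (ℤ.+ 2 ∥_) (sym d≡) h)))) (funToFin-finToFin {4} {2} j)))
          -- The difference lies in the class of 1, where λ′ is odd, whereas equal parity labels
          -- make λ′ even on it.
          finish (inj₂ h) with w , e ← ∥-coordinates (d +ᵥ -[1+ 0 ] ·ᵥ u) (subst (ℤ.+ 2 ∥_) (sym (trans (lin-+ d (-[1+ 0 ] ·ᵥ u) basis) (trans (cong₂ _+_ d≡ (trans (lin-· _ u basis) (cong (int -[1+ 0 ] *_) (sym 1≡))))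
              (prove [] [] (elt i - elt j ∷ []) (x₀ ⊕ con -[1+ 0 ] ⊗ 𝟙) (x₀ ⊖ 𝟙) [] refl)))) h)
            with m , e′ ← same-parity {dot λ′ (vec i)} {dot λ′ (vec j)} eq″ = two-not-unit (m ℤ.- dot λ′ w)
              (ℤSolve.prove [] (dot λ′ d ∷ m ∷ dot λ′ w ∷ dot λ′ (d +ᵥ -[1+ 0 ] ·ᵥ u) ∷ dot λ′ (vec i) ℤ.+ -[1+ 0 ] ℤ.* dot λ′ (vec j) ∷ dot λ′ u ∷ []) []
                (ι (con (ℤ.+ 2) ⊗ (z₁ ⊖ z₂))) (ι (con 1ℤ))
                ( (⊝ 𝟙 ℤSolve.·[ ι z₄ ≈ ι (con (ℤ.+ 2) ⊗ z₁) by e′ ]· 𝟙)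
                ∷ (𝟙 ℤSolve.·[ ι z₄ ≈ ι z₀ by sym (trans (dot-+ λ′ (vec i) (-[1+ 0 ] ·ᵥ vec j)) (cong (λ y → dot λ′ (vec i) ℤ.+ y) (dot-· -[1+ 0 ] λ′ (vec j)))) ]· 𝟙)
                ∷ (⊝ 𝟙 ℤSolve.·[ ι z₃ ≈ ι (z₀ ⊕ con -[1+ 0 ] ⊗ z₅) by trans (dot-+ λ′ d (-[1+ 0 ] ·ᵥ u)) (cong (λ y → dot λ′ d ℤ.+ y) (dot-· -[1+ 0 ] λ′ u)) ]· 𝟙)
                ∷ (𝟙 ℤSolve.·[ ι z₃ ≈ ι (con (ℤ.+ 2) ⊗ z₂) by trans (cong (dot λ′) e) (dot-· (ℤ.+ 2) λ′ w) ]· 𝟙)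
                ∷ (𝟙 ℤSolve.·[ ι z₅ ≈ ι (con 1ℤ) by λu ]· 𝟙) ∷ []) refl)

  opaque
    -- Since (s - 1)² = -2 (s - 1), the image of s - 1 modulo 2 lies in its own kernel. A kernel
    -- within {0, 1} would make the image equally small.
    involution-not-small : (S : Involution) → Preserves (Involution.σ S) → ¬ Small (λ x → ℤ.+ 2 ∥ Involution.s S x - x)
    involution-not-small S S-O small = SmallKernel.absurd (λ x → s x - x) (λ _ → 0#)
      (λ x y → trans (cong (_- (x - y)) (fun-diff σ x y)) (prove [] [] (x ∷ y ∷ s x ∷ s y ∷ []) (x₂ ⊖ x₃ ⊖ (x₀ ⊖ x₁)) (x₂ ⊖ x₀ ⊖ (x₃ ⊖ x₁)) [] refl))
      (λ _ _ → sym (-‿inverseʳ 0#))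
      (λ {x} Ox → small (O-diff (S-O Ox) Ox) (subst (ℤ.+ 2 ∥_)
        (prove [] [] (x ∷ s x ∷ s (s x - x) ∷ []) (con -[1+ 1 ] ⊗ (x₁ ⊖ x₀)) (x₂ ⊖ (x₁ ⊖ x₀))
          ((⊝ 𝟙 ·[ x₂ ≈ x₀ ⊖ x₁ by trans (fun-diff σ _ _) (cong (_- s x) (involutive x)) ]· 𝟙) ∷ []) refl)
        (subst (ℤ.+ 2 ∥_) (prove [] [] (s x - x ∷ []) (con (ℤ.+ 2) ⊗ (con -[1+ 0 ] ⊗ x₀)) (con -[1+ 1 ] ⊗ x₀) [] refl) (∥-multiple (ℤ.+ 2) (O-int* -[1+ 0 ] (O-diff (S-O Ox) Ox))))))
      (λ _ → inj₁ ∥-0)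
      (λ Ox (h , _) → small Ox h)
      where open Involution S

-- Orders spanned by 1 and three anticommuting pure quaternions.

module Klein (Q : QuaternionDivisionAlgebra) (O : QuaternionDivisionAlgebra.A Q → Set) (order : Lattices.MaximalOrder Q O) where
  open ModTwo Q O order public
  open Parity

  half : ∀ x → ∃ λ v → int (ℤ.+ 2) * v ≡ x
  half x with h , _ , 2h≡1 ← rat-inverse (rat-int (ℤ.+ 2)) (int-nonzero λ ()) = h * x , trans (sym (*-assoc _ _ _)) (trans (cong (_* x) 2h≡1) (*-identityˡ x))

  -- An order spanned by 1 and three anticommuting pure quaternions is not maximal:
  -- depending on the parities of the structure constants one may adjoin
  -- (1 + u₁ + u₂ + u₃) / 2, (uᵢ + uⱼ) / 2 or uᵢ / 2.
  record Frame : Set where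
    field
      u₁ u₂ u₃ : A
      k₁ k₂ k₃ : ℤ
      u₁u₂ : u₁ * u₂ ≡ int k₁ * u₃
      u₂u₃ : u₂ * u₃ ≡ int k₂ * u₁
      u₃u₁ : u₃ * u₁ ≡ int k₃ * u₂
      u₂u₁ : u₂ * u₁ ≡ - (u₁ * u₂)
      u₃u₂ : u₃ * u₂ ≡ - (u₂ * u₃)
      u₁u₃ : u₁ * u₃ ≡ - (u₃ * u₁)
      bar₁ : bar u₁ ≡ - u₁
      bar₂ : bar u₂ ≡ - u₂
      bar₃ : bar u₃ ≡ - u₃
      O₁ : O u₁
      O₂ : O u₂
      O₃ : O u₃
      spans : ∀ {x} → O x → ∃₂ λ a b → ∃₂ λ c d → x ≡ int a + int b * u₁ + int c * u₂ + int d * u₃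
      free : ∀ a b c d → int a + int b * u₁ + int c * u₂ + int d * u₃ ≡ 0# → a ≡ 0ℤ × b ≡ 0ℤ × c ≡ 0ℤ × d ≡ 0ℤ
      O-bar : ∀ {x} → O x → O (bar x)

  -- The cyclic symmetry of the three directions reduces the eight parity patterns of k₁, k₂, k₃ to
  -- three constructions.
  rotate : Frame → Frame
  rotate F = record
    { u₁ = u₂ ; u₂ = u₃ ; u₃ = u₁ ; k₁ = k₂ ; k₂ = k₃ ; k₃ = k₁
    ; u₁u₂ = u₂u₃ ; u₂u₃ = u₃u₁ ; u₃u₁ = u₁u₂ ; u₂u₁ = u₃u₂ ; u₃u₂ = u₁u₃ ; u₁u₃ = u₂u₁
    ; bar₁ = bar₂ ; bar₂ = bar₃ ; bar₃ = bar₁ ; O₁ = O₂ ; O₂ = O₃ ; O₃ = O₁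
    ; spans = λ {x} Ox → let a , b , c , d , e = spans Ox in a , c , d , b , trans e (shuffle a b c d)
    ; free = λ a c d b e → let p , q , r , t = free a b c d (trans (shuffle a b c d) e) in p , r , t , q
    ; O-bar = O-bar }
    where
    open Frame F
    shuffle : ∀ a b c d → int a + int b * u₁ + int c * u₂ + int d * u₃ ≡ int a + int c * u₂ + int d * u₃ + int b * u₁
    shuffle a b c d = prove [] (a ∷ b ∷ c ∷ d ∷ []) (u₁ ∷ u₂ ∷ u₃ ∷ [])
      (ι z₀ ⊕ ι z₁ ⊗ x₀ ⊕ ι z₂ ⊗ x₁ ⊕ ι z₃ ⊗ x₂) (ι z₀ ⊕ ι z₂ ⊗ x₁ ⊕ ι z₃ ⊗ x₂ ⊕ ι z₁ ⊗ x₀) [] refl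

  module FrameLemmas (F : Frame) where
    open Frame F

    opaque
      u₂≢0 : u₂ ≢ 0#
      u₂≢0 e with () ← proj₁ (proj₂ (proj₂ (free 0ℤ 0ℤ 1ℤ 0ℤ (prove [] [] (u₁ ∷ u₂ ∷ u₃ ∷ [])
        (con 0ℤ ⊕ con 0ℤ ⊗ x₀ ⊕ con 1ℤ ⊗ x₁ ⊕ con 0ℤ ⊗ x₂) 𝟘 ((𝟙 ·[ x₁ ≈ 𝟘 by e ]· 𝟙) ∷ []) refl))))

      -- u₁ (u₁ u₂) = k₁ u₁ u₃ = -k₁ k₃ u₂, and u₂ can be cancelled.
      square₁ : u₁ * u₁ ≡ - int (k₁ ℤ.* k₃)
      square₁ = *-cancelʳ u₂≢0 (prove [] (k₁ ∷ k₂ ∷ k₃ ∷ []) (u₁ ∷ u₂ ∷ u₃ ∷ []) (x₀ ⊗ x₀ ⊗ x₁) (⊝ ι (z₀ ⊗ z₂) ⊗ x₁)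
        ( (x₀ ·[ x₀ ⊗ x₁ ≈ ι z₀ ⊗ x₂ by u₁u₂ ]· 𝟙) ∷ (ι z₀ ·[ x₀ ⊗ x₂ ≈ ⊝ (x₂ ⊗ x₀) by u₁u₃ ]· 𝟙)
        ∷ (⊝ ι z₀ ·[ x₂ ⊗ x₀ ≈ ι z₂ ⊗ x₁ by u₃u₁ ]· 𝟙) ∷ []) refl)

  module FrameNeighbour (F : Frame) where
    open Frame F
    private
      square₁ : u₁ * u₁ ≡ - int (k₁ ℤ.* k₃)
      square₁ = FrameLemmas.square₁ F
      square₂ : u₂ * u₂ ≡ - int (k₂ ℤ.* k₁)
      square₂ = FrameLemmas.square₁ (rotate F)
      square₃ : u₃ * u₃ ≡ - int (k₃ ℤ.* k₂)
      square₃ = FrameLemmas.square₁ (rotate (rotate F))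
      us : List A
      us = u₁ ∷ u₂ ∷ u₃ ∷ []

    open Neighbour using (inO; inv; sum∈; int*∈; integral-neighbour) renaming (_∈O+ℤv to Near)

    opaque
      from-generators : ∀ v → Near v v → Near v (v * u₁) → Near v (v * u₂) → Near v (v * u₃) → ∀ {x} → O x → Near v (v * x)
      from-generators v n₀ n₁ n₂ n₃ Ox with a , b , c , d , refl ← spans Ox = subst (Near v)
        (prove [] (a ∷ b ∷ c ∷ d ∷ []) (u₁ ∷ u₂ ∷ u₃ ∷ v ∷ [])
          (ι z₀ ⊗ x₃ ⊕ ι z₁ ⊗ (x₃ ⊗ x₀) ⊕ ι z₂ ⊗ (x₃ ⊗ x₁) ⊕ ι z₃ ⊗ (x₃ ⊗ x₂)) (x₃ ⊗ (ι z₀ ⊕ ι z₁ ⊗ x₀ ⊕ ι z₂ ⊗ x₁ ⊕ ι z₃ ⊗ x₂)) [] refl)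
        (sum∈ v (sum∈ v (sum∈ v (int*∈ v a n₀) (int*∈ v b n₁)) (int*∈ v c n₂)) (int*∈ v d n₃))

      -- Each vector v to be adjoined has u₂-coefficient 1 in 2 v, while elements of 2 O have only
      -- even coefficients.
      not-half : ∀ v a b d → O v → int (ℤ.+ 2) * v ≡ int a + int b * u₁ + u₂ + int d * u₃ → ⊥
      not-half v a b d Ov e with a′ , b′ , c′ , d′ , refl ← spans Ov = two-not-unit c′ (ℤP.i-j≡0⇒i≡j _ _ (proj₁ (proj₂ (proj₂
        (free (ℤ.+ 2 ℤ.* a′ ℤ.- a) (ℤ.+ 2 ℤ.* b′ ℤ.- b) (ℤ.+ 2 ℤ.* c′ ℤ.- 1ℤ) (ℤ.+ 2 ℤ.* d′ ℤ.- d)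
          (prove [] (a ∷ b ∷ d ∷ a′ ∷ b′ ∷ c′ ∷ d′ ∷ []) us
            (ι (con (ℤ.+ 2) ⊗ z₃ ⊖ z₀) ⊕ ι (con (ℤ.+ 2) ⊗ z₄ ⊖ z₁) ⊗ x₀ ⊕ ι (con (ℤ.+ 2) ⊗ z₅ ⊖ con 1ℤ) ⊗ x₁ ⊕ ι (con (ℤ.+ 2) ⊗ 𝕫 6 ⊖ z₂) ⊗ x₂) 𝟘
            ((𝟙 ·[ con (ℤ.+ 2) ⊗ (ι z₃ ⊕ ι z₄ ⊗ x₀ ⊕ ι z₅ ⊗ x₁ ⊕ ι (𝕫 6) ⊗ x₂) ≈ ι z₀ ⊕ ι z₁ ⊗ x₀ ⊕ x₁ ⊕ ι z₂ ⊗ x₂ by e ]· 𝟙) ∷ []) refl))))))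

      bar-half : ∀ {v w} → int (ℤ.+ 2) * v ≡ w → int (ℤ.+ 2) * bar v ≡ bar w
      bar-half {v} refl = sym (trans (bar-* _ _) (trans (cong (bar v *_) (bar-int (ℤ.+ 2))) (sym (int-central (ℤ.+ 2) _))))

      -- For k₁ = k₂ = k₃ = 1 this is the passage from the Lipschitz to the Hurwitz quaternions.
      all-odd : ∀ a b c → k₁ ≡ 1ℤ ℤ.+ ℤ.+ 2 ℤ.* a → k₂ ≡ 1ℤ ℤ.+ ℤ.+ 2 ℤ.* b → k₃ ≡ 1ℤ ℤ.+ ℤ.+ 2 ℤ.* c → ⊥
      all-odd a b c refl refl refl with v , 2v ← half (1# + u₁ + u₂ + u₃) =
        not-half v 1ℤ 1ℤ 1ℤ Ov (trans 2v (prove [] [] us (𝟙 ⊕ x₀ ⊕ x₁ ⊕ x₂) (con 1ℤ ⊕ con 1ℤ ⊗ x₀ ⊕ x₁ ⊕ con 1ℤ ⊗ x₂) [] refl))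
        where
        zs : List ℤ
        zs = a ∷ b ∷ c ∷ []
        a′ b′ c′ : ℤExpr
        a′ = con 1ℤ ⊕ con (ℤ.+ 2) ⊗ z₀
        b′ = con 1ℤ ⊕ con (ℤ.+ 2) ⊗ z₁
        c′ = con 1ℤ ⊕ con (ℤ.+ 2) ⊗ z₂
        bar-v : int (ℤ.+ 2) * bar v ≡ 1# - u₁ - u₂ - u₃
        bar-v = trans (bar-half 2v) (trans (bar-+ _ _) (cong₂ _+_ (trans (bar-+ _ _) (cong₂ _+_ (trans (bar-+ _ _) (cong₂ _+_ bar-1 bar₁)) bar₂)) bar₃))
        vu₁ : v * u₁ ≡ int 1ℤ * v + (int (ℤ.- (ℤ.+ 2 ℤ.* (a ℤ.* c) ℤ.+ a ℤ.+ c ℤ.+ 1ℤ)) + int c * u₂ + int (ℤ.- (a ℤ.+ 1ℤ)) * u₃)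
        vu₁ = halve (prove [] zs (u₁ ∷ u₂ ∷ u₃ ∷ v ∷ []) (con (ℤ.+ 2) ⊗ (x₃ ⊗ x₀))
          (con (ℤ.+ 2) ⊗ (con 1ℤ ⊗ x₃ ⊕ (ι (⊝ (con (ℤ.+ 2) ⊗ (z₀ ⊗ z₂) ⊕ z₀ ⊕ z₂ ⊕ con 1ℤ)) ⊕ ι z₂ ⊗ x₁ ⊕ ι (⊝ (z₀ ⊕ con 1ℤ)) ⊗ x₂)))
          ( (𝟙 ·[ con (ℤ.+ 2) ⊗ x₃ ≈ 𝟙 ⊕ x₀ ⊕ x₁ ⊕ x₂ by 2v ]· (x₀ ⊖ 𝟙)) ∷ (𝟙 ·[ x₀ ⊗ x₀ ≈ ⊝ ι (a′ ⊗ c′) by square₁ ]· 𝟙)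
          ∷ (𝟙 ·[ x₁ ⊗ x₀ ≈ ⊝ (x₀ ⊗ x₁) by u₂u₁ ]· 𝟙) ∷ (⊝ 𝟙 ·[ x₀ ⊗ x₁ ≈ ι a′ ⊗ x₂ by u₁u₂ ]· 𝟙) ∷ (𝟙 ·[ x₂ ⊗ x₀ ≈ ι c′ ⊗ x₁ by u₃u₁ ]· 𝟙) ∷ []) refl)
        vu₂ : v * u₂ ≡ int 1ℤ * v + (int (ℤ.- (ℤ.+ 2 ℤ.* (b ℤ.* a) ℤ.+ b ℤ.+ a ℤ.+ 1ℤ)) + int a * u₃ + int (ℤ.- (b ℤ.+ 1ℤ)) * u₁)
        vu₂ = halve (prove [] zs (u₁ ∷ u₂ ∷ u₃ ∷ v ∷ []) (con (ℤ.+ 2) ⊗ (x₃ ⊗ x₁))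
          (con (ℤ.+ 2) ⊗ (con 1ℤ ⊗ x₃ ⊕ (ι (⊝ (con (ℤ.+ 2) ⊗ (z₁ ⊗ z₀) ⊕ z₁ ⊕ z₀ ⊕ con 1ℤ)) ⊕ ι z₀ ⊗ x₂ ⊕ ι (⊝ (z₁ ⊕ con 1ℤ)) ⊗ x₀)))
          ( (𝟙 ·[ con (ℤ.+ 2) ⊗ x₃ ≈ 𝟙 ⊕ x₀ ⊕ x₁ ⊕ x₂ by 2v ]· (x₁ ⊖ 𝟙)) ∷ (𝟙 ·[ x₁ ⊗ x₁ ≈ ⊝ ι (b′ ⊗ a′) by square₂ ]· 𝟙)
          ∷ (𝟙 ·[ x₂ ⊗ x₁ ≈ ⊝ (x₁ ⊗ x₂) by u₃u₂ ]· 𝟙) ∷ (⊝ 𝟙 ·[ x₁ ⊗ x₂ ≈ ι b′ ⊗ x₀ by u₂u₃ ]· 𝟙) ∷ (𝟙 ·[ x₀ ⊗ x₁ ≈ ι a′ ⊗ x₂ by u₁u₂ ]· 𝟙) ∷ []) refl)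
        vu₃ : v * u₃ ≡ int 1ℤ * v + (int (ℤ.- (ℤ.+ 2 ℤ.* (c ℤ.* b) ℤ.+ c ℤ.+ b ℤ.+ 1ℤ)) + int b * u₁ + int (ℤ.- (c ℤ.+ 1ℤ)) * u₂)
        vu₃ = halve (prove [] zs (u₁ ∷ u₂ ∷ u₃ ∷ v ∷ []) (con (ℤ.+ 2) ⊗ (x₃ ⊗ x₂))
          (con (ℤ.+ 2) ⊗ (con 1ℤ ⊗ x₃ ⊕ (ι (⊝ (con (ℤ.+ 2) ⊗ (z₂ ⊗ z₁) ⊕ z₂ ⊕ z₁ ⊕ con 1ℤ)) ⊕ ι z₁ ⊗ x₀ ⊕ ι (⊝ (z₂ ⊕ con 1ℤ)) ⊗ x₁)))
          ( (𝟙 ·[ con (ℤ.+ 2) ⊗ x₃ ≈ 𝟙 ⊕ x₀ ⊕ x₁ ⊕ x₂ by 2v ]· (x₂ ⊖ 𝟙)) ∷ (𝟙 ·[ x₂ ⊗ x₂ ≈ ⊝ ι (c′ ⊗ b′) by square₃ ]· 𝟙)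
          ∷ (𝟙 ·[ x₀ ⊗ x₂ ≈ ⊝ (x₂ ⊗ x₀) by u₁u₃ ]· 𝟙) ∷ (⊝ 𝟙 ·[ x₂ ⊗ x₀ ≈ ι c′ ⊗ x₁ by u₃u₁ ]· 𝟙) ∷ (𝟙 ·[ x₁ ⊗ x₂ ≈ ι b′ ⊗ x₀ by u₂u₃ ]· 𝟙) ∷ []) refl)
        -- This is (1 + k₁ k₃ + k₂ k₁ + k₃ k₂) / 4, integral because all three kᵢ are odd.
        n : ℤ
        n = a ℤ.* c ℤ.+ b ℤ.* a ℤ.+ c ℤ.* b ℤ.+ a ℤ.+ b ℤ.+ c ℤ.+ 1ℤ
        norm-v : v * bar v ≡ int n
        norm-v = halve (halve (prove [] zs (u₁ ∷ u₂ ∷ u₃ ∷ v ∷ bar v ∷ []) (con (ℤ.+ 2) ⊗ (con (ℤ.+ 2) ⊗ (x₃ ⊗ x₄)))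
          (con (ℤ.+ 2) ⊗ (con (ℤ.+ 2) ⊗ ι (z₀ ⊗ z₂ ⊕ z₁ ⊗ z₀ ⊕ z₂ ⊗ z₁ ⊕ z₀ ⊕ z₁ ⊕ z₂ ⊕ con 1ℤ)))
          ( (con (ℤ.+ 2) ⊗ x₃ ·[ con (ℤ.+ 2) ⊗ x₄ ≈ 𝟙 ⊖ x₀ ⊖ x₁ ⊖ x₂ by bar-v ]· 𝟙) ∷ (𝟙 ·[ con (ℤ.+ 2) ⊗ x₃ ≈ 𝟙 ⊕ x₀ ⊕ x₁ ⊕ x₂ by 2v ]· (𝟙 ⊖ x₀ ⊖ x₁ ⊖ x₂))
          ∷ (⊝ 𝟙 ·[ x₀ ⊗ x₀ ≈ ⊝ ι (a′ ⊗ c′) by square₁ ]· 𝟙) ∷ (⊝ 𝟙 ·[ x₁ ⊗ x₁ ≈ ⊝ ι (b′ ⊗ a′) by square₂ ]· 𝟙) ∷ (⊝ 𝟙 ·[ x₂ ⊗ x₂ ≈ ⊝ ι (c′ ⊗ b′) by square₃ ]· 𝟙)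
          ∷ (⊝ 𝟙 ·[ x₁ ⊗ x₀ ≈ ⊝ (x₀ ⊗ x₁) by u₂u₁ ]· 𝟙) ∷ (⊝ 𝟙 ·[ x₂ ⊗ x₁ ≈ ⊝ (x₁ ⊗ x₂) by u₃u₂ ]· 𝟙) ∷ (⊝ 𝟙 ·[ x₀ ⊗ x₂ ≈ ⊝ (x₂ ⊗ x₀) by u₁u₃ ]· 𝟙) ∷ []) refl))
        Ov : O v
        Ov = integral-neighbour v O-bar 1ℤ n
          (halve (prove [] [] (u₁ ∷ u₂ ∷ u₃ ∷ v ∷ bar v ∷ []) (con (ℤ.+ 2) ⊗ (x₃ ⊕ x₄)) (con (ℤ.+ 2) ⊗ con 1ℤ)
            ((𝟙 ·[ con (ℤ.+ 2) ⊗ x₃ ≈ 𝟙 ⊕ x₀ ⊕ x₁ ⊕ x₂ by 2v ]· 𝟙) ∷ (𝟙 ·[ con (ℤ.+ 2) ⊗ x₄ ≈ 𝟙 ⊖ x₀ ⊖ x₁ ⊖ x₂ by bar-v ]· 𝟙) ∷ []) refl))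
          norm-v
          (from-generators v (inv v)
            (1ℤ , _ , O-+ (O-+ (O-int _) (O-int* c O₂)) (O-int* _ O₃) , vu₁)
            (1ℤ , _ , O-+ (O-+ (O-int _) (O-int* a O₃)) (O-int* _ O₁) , vu₂)
            (1ℤ , _ , O-+ (O-+ (O-int _) (O-int* b O₁)) (O-int* _ O₂) , vu₃))

      -- The norm of (u₁ + u₂)/2 is k₁ (k₂ + k₃) / 4; both factors are even.
      one-even : ∀ a b → k₁ ≡ ℤ.+ 2 ℤ.* a → k₂ ≡ k₃ ℤ.+ ℤ.+ 2 ℤ.* b → ⊥
      one-even a b e₁ e₂ with v , 2v ← half (u₁ + u₂) =
        not-half v 0ℤ 1ℤ 0ℤ Ov (trans 2v (prove [] [] us (x₀ ⊕ x₁) (con 0ℤ ⊕ con 1ℤ ⊗ x₀ ⊕ x₁ ⊕ con 0ℤ ⊗ x₂) [] refl))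
        where
        zs : List ℤ
        zs = a ∷ b ∷ k₃ ∷ k₁ ∷ k₂ ∷ []
        e₁′ : int k₁ ≡ int (ℤ.+ 2 ℤ.* a)
        e₁′ = cong int e₁
        e₂′ : int k₂ ≡ int (k₃ ℤ.+ ℤ.+ 2 ℤ.* b)
        e₂′ = cong int e₂
        bar-v : int (ℤ.+ 2) * bar v ≡ - u₁ - u₂
        bar-v = trans (bar-half 2v) (trans (bar-+ _ _) (cong₂ _+_ bar₁ bar₂))
        xs : List A
        xs = u₁ ∷ u₂ ∷ u₃ ∷ v ∷ bar v ∷ []
        vu₁ : v * u₁ ≡ int (ℤ.- (a ℤ.* k₃)) + int (ℤ.- a) * u₃
        vu₁ = halve (prove [] zs xs (con (ℤ.+ 2) ⊗ (x₃ ⊗ x₀)) (con (ℤ.+ 2) ⊗ (ι (⊝ (z₀ ⊗ z₂)) ⊕ ι (⊝ z₀) ⊗ x₂))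
          ( (𝟙 ·[ con (ℤ.+ 2) ⊗ x₃ ≈ x₀ ⊕ x₁ by 2v ]· x₀) ∷ (𝟙 ·[ x₀ ⊗ x₀ ≈ ⊝ ι (z₃ ⊗ z₂) by square₁ ]· 𝟙)
          ∷ (𝟙 ·[ x₁ ⊗ x₀ ≈ ⊝ (x₀ ⊗ x₁) by u₂u₁ ]· 𝟙) ∷ (⊝ 𝟙 ·[ x₀ ⊗ x₁ ≈ ι z₃ ⊗ x₂ by u₁u₂ ]· 𝟙)
          ∷ (⊝ 𝟙 ·[ ι z₃ ≈ ι (con (ℤ.+ 2) ⊗ z₀) by e₁′ ]· (ι z₂ ⊕ x₂)) ∷ []) refl)
        vu₂ : v * u₂ ≡ int (ℤ.- (k₂ ℤ.* a)) + int a * u₃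
        vu₂ = halve (prove [] zs xs (con (ℤ.+ 2) ⊗ (x₃ ⊗ x₁)) (con (ℤ.+ 2) ⊗ (ι (⊝ (z₄ ⊗ z₀)) ⊕ ι z₀ ⊗ x₂))
          ( (𝟙 ·[ con (ℤ.+ 2) ⊗ x₃ ≈ x₀ ⊕ x₁ by 2v ]· x₁) ∷ (𝟙 ·[ x₁ ⊗ x₁ ≈ ⊝ ι (z₄ ⊗ z₃) by square₂ ]· 𝟙)
          ∷ (𝟙 ·[ x₀ ⊗ x₁ ≈ ι z₃ ⊗ x₂ by u₁u₂ ]· 𝟙)
          ∷ (𝟙 ·[ ι z₃ ≈ ι (con (ℤ.+ 2) ⊗ z₀) by e₁′ ]· (x₂ ⊖ ι z₄)) ∷ []) refl)
        vu₃ : v * u₃ ≡ int k₃ * v + (int b * u₁ + int (ℤ.- k₃) * u₂)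
        vu₃ = halve (prove [] zs xs (con (ℤ.+ 2) ⊗ (x₃ ⊗ x₂)) (con (ℤ.+ 2) ⊗ (ι z₂ ⊗ x₃ ⊕ (ι z₁ ⊗ x₀ ⊕ ι (⊝ z₂) ⊗ x₁)))
          ( (𝟙 ·[ con (ℤ.+ 2) ⊗ x₃ ≈ x₀ ⊕ x₁ by 2v ]· (x₂ ⊖ ι z₂)) ∷ (𝟙 ·[ x₀ ⊗ x₂ ≈ ⊝ (x₂ ⊗ x₀) by u₁u₃ ]· 𝟙)
          ∷ (⊝ 𝟙 ·[ x₂ ⊗ x₀ ≈ ι z₂ ⊗ x₁ by u₃u₁ ]· 𝟙) ∷ (𝟙 ·[ x₁ ⊗ x₂ ≈ ι z₄ ⊗ x₀ by u₂u₃ ]· 𝟙)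
          ∷ (𝟙 ·[ ι z₄ ≈ ι (z₂ ⊕ con (ℤ.+ 2) ⊗ z₁) by e₂′ ]· x₀) ∷ []) refl)
        norm-v : v * bar v ≡ int (a ℤ.* (k₃ ℤ.+ b))
        norm-v = halve (halve (prove [] zs xs (con (ℤ.+ 2) ⊗ (con (ℤ.+ 2) ⊗ (x₃ ⊗ x₄))) (con (ℤ.+ 2) ⊗ (con (ℤ.+ 2) ⊗ ι (z₀ ⊗ (z₂ ⊕ z₁))))
          ( (con (ℤ.+ 2) ⊗ x₃ ·[ con (ℤ.+ 2) ⊗ x₄ ≈ ⊝ x₀ ⊖ x₁ by bar-v ]· 𝟙) ∷ (𝟙 ·[ con (ℤ.+ 2) ⊗ x₃ ≈ x₀ ⊕ x₁ by 2v ]· (⊝ x₀ ⊖ x₁))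
          ∷ (⊝ 𝟙 ·[ x₀ ⊗ x₀ ≈ ⊝ ι (z₃ ⊗ z₂) by square₁ ]· 𝟙) ∷ (⊝ 𝟙 ·[ x₁ ⊗ x₁ ≈ ⊝ ι (z₄ ⊗ z₃) by square₂ ]· 𝟙)
          ∷ (⊝ 𝟙 ·[ x₁ ⊗ x₀ ≈ ⊝ (x₀ ⊗ x₁) by u₂u₁ ]· 𝟙) ∷ (𝟙 ·[ ι z₃ ≈ ι (con (ℤ.+ 2) ⊗ z₀) by e₁′ ]· (ι z₂ ⊕ ι z₄))
          ∷ (con (ℤ.+ 2) ⊗ ι z₀ ·[ ι z₄ ≈ ι (z₂ ⊕ con (ℤ.+ 2) ⊗ z₁) by e₂′ ]· 𝟙) ∷ []) refl))
        Ov : O v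
        Ov = integral-neighbour v O-bar 0ℤ (a ℤ.* (k₃ ℤ.+ b))
          (halve (prove [] [] xs (con (ℤ.+ 2) ⊗ (x₃ ⊕ x₄)) (con (ℤ.+ 2) ⊗ con 0ℤ)
            ((𝟙 ·[ con (ℤ.+ 2) ⊗ x₃ ≈ x₀ ⊕ x₁ by 2v ]· 𝟙) ∷ (𝟙 ·[ con (ℤ.+ 2) ⊗ x₄ ≈ ⊝ x₀ ⊖ x₁ by bar-v ]· 𝟙) ∷ []) refl))
          norm-v
          (from-generators v (inv v) (inO v (subst O (sym vu₁) (O-+ (O-int _) (O-int* _ O₃)))) (inO v (subst O (sym vu₂) (O-+ (O-int _) (O-int* a O₃))))
            (k₃ , _ , O-+ (O-int* b O₁) (O-int* _ O₂) , vu₃))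

      -- The norm of u₂/2 is k₁ k₂ / 4.
      two-even : ∀ a b → k₁ ≡ ℤ.+ 2 ℤ.* a → k₂ ≡ ℤ.+ 2 ℤ.* b → ⊥
      two-even a b e₁ e₂ with v , 2v ← half u₂ =
        not-half v 0ℤ 0ℤ 0ℤ Ov (trans 2v (prove [] [] us x₁ (con 0ℤ ⊕ con 0ℤ ⊗ x₀ ⊕ x₁ ⊕ con 0ℤ ⊗ x₂) [] refl))
        where
        zs : List ℤ
        zs = a ∷ b ∷ k₁ ∷ k₂ ∷ []
        e₁′ : int k₁ ≡ int (ℤ.+ 2 ℤ.* a)
        e₁′ = cong int e₁
        e₂′ : int k₂ ≡ int (ℤ.+ 2 ℤ.* b)
        e₂′ = cong int e₂
        bar-v : int (ℤ.+ 2) * bar v ≡ - u₂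
        bar-v = trans (bar-half 2v) bar₂
        xs : List A
        xs = u₁ ∷ u₂ ∷ u₃ ∷ v ∷ bar v ∷ []
        vu₁ : v * u₁ ≡ int (ℤ.- a) * u₃
        vu₁ = halve (prove [] zs xs (con (ℤ.+ 2) ⊗ (x₃ ⊗ x₀)) (con (ℤ.+ 2) ⊗ (ι (⊝ z₀) ⊗ x₂))
          ( (𝟙 ·[ con (ℤ.+ 2) ⊗ x₃ ≈ x₁ by 2v ]· x₀) ∷ (𝟙 ·[ x₁ ⊗ x₀ ≈ ⊝ (x₀ ⊗ x₁) by u₂u₁ ]· 𝟙)
          ∷ (⊝ 𝟙 ·[ x₀ ⊗ x₁ ≈ ι z₂ ⊗ x₂ by u₁u₂ ]· 𝟙) ∷ (⊝ 𝟙 ·[ ι z₂ ≈ ι (con (ℤ.+ 2) ⊗ z₀) by e₁′ ]· x₂) ∷ []) refl)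
        vu₂ : v * u₂ ≡ int (ℤ.- (k₂ ℤ.* a))
        vu₂ = halve (prove [] zs xs (con (ℤ.+ 2) ⊗ (x₃ ⊗ x₁)) (con (ℤ.+ 2) ⊗ ι (⊝ (z₃ ⊗ z₀)))
          ( (𝟙 ·[ con (ℤ.+ 2) ⊗ x₃ ≈ x₁ by 2v ]· x₁) ∷ (𝟙 ·[ x₁ ⊗ x₁ ≈ ⊝ ι (z₃ ⊗ z₂) by square₂ ]· 𝟙)
          ∷ (⊝ ι z₃ ·[ ι z₂ ≈ ι (con (ℤ.+ 2) ⊗ z₀) by e₁′ ]· 𝟙) ∷ []) refl)
        vu₃ : v * u₃ ≡ int b * u₁
        vu₃ = halve (prove [] zs xs (con (ℤ.+ 2) ⊗ (x₃ ⊗ x₂)) (con (ℤ.+ 2) ⊗ (ι z₁ ⊗ x₀))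
          ( (𝟙 ·[ con (ℤ.+ 2) ⊗ x₃ ≈ x₁ by 2v ]· x₂) ∷ (𝟙 ·[ x₁ ⊗ x₂ ≈ ι z₃ ⊗ x₀ by u₂u₃ ]· 𝟙)
          ∷ (𝟙 ·[ ι z₃ ≈ ι (con (ℤ.+ 2) ⊗ z₁) by e₂′ ]· x₀) ∷ []) refl)
        norm-v : v * bar v ≡ int (b ℤ.* a)
        norm-v = halve (halve (prove [] zs xs (con (ℤ.+ 2) ⊗ (con (ℤ.+ 2) ⊗ (x₃ ⊗ x₄))) (con (ℤ.+ 2) ⊗ (con (ℤ.+ 2) ⊗ ι (z₁ ⊗ z₀)))
          ( (con (ℤ.+ 2) ⊗ x₃ ·[ con (ℤ.+ 2) ⊗ x₄ ≈ ⊝ x₁ by bar-v ]· 𝟙) ∷ (𝟙 ·[ con (ℤ.+ 2) ⊗ x₃ ≈ x₁ by 2v ]· (⊝ x₁))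
          ∷ (⊝ 𝟙 ·[ x₁ ⊗ x₁ ≈ ⊝ ι (z₃ ⊗ z₂) by square₂ ]· 𝟙) ∷ (ι z₃ ·[ ι z₂ ≈ ι (con (ℤ.+ 2) ⊗ z₀) by e₁′ ]· 𝟙)
          ∷ (con (ℤ.+ 2) ⊗ ι z₀ ·[ ι z₃ ≈ ι (con (ℤ.+ 2) ⊗ z₁) by e₂′ ]· 𝟙) ∷ []) refl))
        Ov : O v
        Ov = integral-neighbour v O-bar 0ℤ (b ℤ.* a)
          (halve (prove [] [] xs (con (ℤ.+ 2) ⊗ (x₃ ⊕ x₄)) (con (ℤ.+ 2) ⊗ con 0ℤ)
            ((𝟙 ·[ con (ℤ.+ 2) ⊗ x₃ ≈ x₁ by 2v ]· 𝟙) ∷ (𝟙 ·[ con (ℤ.+ 2) ⊗ x₄ ≈ ⊝ x₁ by bar-v ]· 𝟙) ∷ []) refl))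
          norm-v
          (from-generators v (inv v) (inO v (subst O (sym vu₁) (O-int* _ O₃))) (inO v (subst O (sym vu₂) (O-int _))) (inO v (subst O (sym vu₃) (O-int* b O₁))))

  opaque
    same-parity-diff : ∀ {k l} a b → k ≡ 1ℤ ℤ.+ ℤ.+ 2 ℤ.* a → l ≡ 1ℤ ℤ.+ ℤ.+ 2 ℤ.* b → k ≡ l ℤ.+ ℤ.+ 2 ℤ.* (a ℤ.- b)
    same-parity-diff a b refl refl = ℤSolve.prove [] (a ∷ b ∷ []) [] (ι (con 1ℤ ⊕ con (ℤ.+ 2) ⊗ z₀)) (ι (con 1ℤ ⊕ con (ℤ.+ 2) ⊗ z₁ ⊕ con (ℤ.+ 2) ⊗ (z₀ ⊖ z₁))) [] refl

    no-frame : ¬ Frame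
    no-frame F with parity (Frame.k₁ F) | parity (Frame.k₂ F) | parity (Frame.k₃ F)
    ... | inj₂ (a , e₁) | inj₂ (b , e₂) | inj₂ (c , e₃) = FrameNeighbour.all-odd F a b c e₁ e₂ e₃
    ... | inj₁ (a , e₁) | inj₂ (b , e₂) | inj₂ (c , e₃) = FrameNeighbour.one-even F a (b ℤ.- c) e₁ (same-parity-diff b c e₂ e₃)
    ... | inj₂ (a , e₁) | inj₁ (b , e₂) | inj₂ (c , e₃) = FrameNeighbour.one-even (rotate F) b (c ℤ.- a) e₂ (same-parity-diff c a e₃ e₁)
    ... | inj₂ (a , e₁) | inj₂ (b , e₂) | inj₁ (c , e₃) = FrameNeighbour.one-even (rotate (rotate F)) c (a ℤ.- b) e₃ (same-parity-diff a b e₁ e₂)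
    ... | inj₁ (a , e₁) | inj₁ (b , e₂) | _ = FrameNeighbour.two-even F a b e₁ e₂
    ... | inj₂ _ | inj₁ (b , e₂) | inj₁ (c , e₃) = FrameNeighbour.two-even (rotate F) b c e₂ e₃
    ... | inj₁ (a , e₁) | inj₂ _ | inj₁ (c , e₃) = FrameNeighbour.two-even (rotate (rotate F)) c a e₃ e₁

  -- C₂ × C₂ acting on O: integral traces and the bounds on the rank.

  module KleinAction (K : KleinFour) (S-O : Preserves (Involution.σ (KleinFour.S K))) (R-O : Preserves (Involution.σ (KleinFour.R K))) where
    open KleinFour K

    opaque
      O-N : ∀ {x} → O x → O (N x)
      O-N Ox = O-+ (O-+ Ox (S-O Ox)) (R-O (O-+ Ox (S-O Ox)))

      -- N x = 2 tr x is an integer T, and T² = 2 N(x²) + 4·(2 nrd x), so T is even.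
      integral-trace : ∀ {x} → O x → ∃ λ t → x + bar x ≡ int t
      integral-trace {x} Ox
        with T , eT ← rational-integer (O-N Ox) (N-rat x)
        with T₂ , eT₂ ← rational-integer (O-N (O-* Ox Ox)) (N-rat (x * x))
        with M , eM ← rational-integer {int T * x - int (ℤ.+ 2) * (x * x)} (O-diff (O-int* T Ox) (O-int* (ℤ.+ 2) (O-* Ox Ox)))
          (subst Rat (prove [] (T ∷ []) (x ∷ bar x ∷ N x ∷ []) (con (ℤ.+ 2) ⊗ (x₀ ⊗ x₁)) (ι z₀ ⊗ x₀ ⊖ con (ℤ.+ 2) ⊗ (x₀ ⊗ x₀))
            ( (𝟙 ·[ x₂ ≈ ι z₀ by eT ]· x₀) ∷ (⊝ 𝟙 ·[ x₂ ≈ con (ℤ.+ 2) ⊗ (x₀ ⊕ x₁) by N-trace x ]· x₀)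
            ∷ (⊝ con (ℤ.+ 2) ·[ x₁ ⊗ x₀ ≈ x₀ ⊗ x₁ by bar-comm x ]· 𝟙) ∷ []) refl) (rat-* (rat-int (ℤ.+ 2)) (nrm x)))
        with T′ , refl ← even-square T (T₂ ℤ.+ ℤ.+ 2 ℤ.* M) (int-injective (prove [] (T ∷ T₂ ∷ M ∷ []) (x ∷ bar x ∷ N x ∷ N (x * x) ∷ bar (x * x) ∷ [])
          (ι (z₀ ⊗ z₀)) (ι (con (ℤ.+ 2) ⊗ (z₁ ⊕ con (ℤ.+ 2) ⊗ z₂)))
          ( (⊝ 𝟙 ·[ x₂ ≈ ι z₀ by eT ]· (ι z₀)) ∷ (𝟙 ·[ x₂ ≈ con (ℤ.+ 2) ⊗ (x₀ ⊕ x₁) by N-trace x ]· (ι z₀))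
          ∷ (⊝ con (ℤ.+ 2) ⊗ (x₀ ⊕ x₁) ·[ x₂ ≈ ι z₀ by eT ]· 𝟙) ∷ (con (ℤ.+ 2) ⊗ (x₀ ⊕ x₁) ·[ x₂ ≈ con (ℤ.+ 2) ⊗ (x₀ ⊕ x₁) by N-trace x ]· 𝟙)
          ∷ (con (ℤ.+ 2) ·[ x₃ ≈ ι z₁ by eT₂ ]· 𝟙) ∷ (⊝ con (ℤ.+ 2) ·[ x₃ ≈ con (ℤ.+ 2) ⊗ (x₀ ⊗ x₀ ⊕ x₄) by N-trace (x * x) ]· 𝟙)
          ∷ (⊝ con (ℤ.+ 4) ·[ x₄ ≈ x₁ ⊗ x₁ by bar-* x x ]· 𝟙)
          ∷ (con (ℤ.+ 4) ·[ ι z₀ ⊗ x₀ ⊖ con (ℤ.+ 2) ⊗ (x₀ ⊗ x₀) ≈ ι z₂ by eM ]· 𝟙)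
          ∷ (con (ℤ.+ 4) ·[ x₂ ≈ ι z₀ by eT ]· x₀) ∷ (⊝ con (ℤ.+ 4) ·[ x₂ ≈ con (ℤ.+ 2) ⊗ (x₀ ⊕ x₁) by N-trace x ]· x₀)
          ∷ (⊝ con (ℤ.+ 4) ·[ x₁ ⊗ x₀ ≈ x₀ ⊗ x₁ by bar-comm x ]· 𝟙) ∷ []) refl)) =
          T′ , halve (trans (sym (N-trace x)) (trans eT (int-* (ℤ.+ 2) T′)))

      O-bar : ∀ {x} → O x → O (bar x)
      O-bar {x} Ox with t , e ← integral-trace Ox = subst O
        (prove [] (t ∷ []) (x ∷ bar x ∷ []) (ι z₀ ⊖ x₀) x₁ ((⊝ 𝟙 ·[ x₀ ⊕ x₁ ≈ ι z₀ by e ]· 𝟙) ∷ []) refl) (O-diff (O-int t) Ox)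

      integral-norm : ∀ {x} → O x → ∃ λ n → x * bar x ≡ int n
      integral-norm {x} Ox = rational-integer (O-* Ox (O-bar Ox)) (nrm x)

      N-congruent : ∀ {M x} → M ∥ s x - x → M ∥ r x - x → M ∥ N x - int (ℤ.+ 4) * x
      N-congruent {M} {x} hs hr = subst (M ∥_) (prove [] [] (x ∷ s x ∷ r x ∷ r (s x) ∷ r (x + s x) ∷ [])
        (x₁ ⊖ x₀ ⊕ (x₂ ⊖ x₀) ⊕ (x₃ ⊖ x₀)) (x₀ ⊕ x₁ ⊕ x₄ ⊖ con (ℤ.+ 4) ⊗ x₀) ((⊝ 𝟙 ·[ x₄ ≈ x₂ ⊕ x₃ by fun-+ R.σ _ _ ]· 𝟙) ∷ []) refl)
        (∥-+ (∥-+ hs hr) (fixed-twice R.σ S.σ R-O hr hs))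

      average : ∀ {M x} → O x → M ∥ s x - x → M ∥ r x - x → ∃ λ k → M ∥ int k - int (ℤ.+ 4) * x
      average {M} {x} Ox hs hr with k , e ← rational-integer (O-N Ox) (N-rat x) = k , subst (λ y → M ∥ y - int (ℤ.+ 4) * x) e (N-congruent hs hr)

      -- Modulo 2 the images of s - 1 and r - 1 are fixed by the whole group: (s - 1)² and (r - 1)²
      -- vanish, and (r - 1)(s - 1) x ≡ `N x` = 2 tr x ≡ 0 by integrality of the trace. Fixed points
      -- within {0, 1} then make both images small as well.
      not-small : ¬ Small (λ x → ℤ.+ 2 ∥ s x - x × ℤ.+ 2 ∥ r x - x)
      not-small small = SmallKernel.absurd (λ x → s x - x) (λ x → r x - x) (diff S.σ) (diff R.σ)
        (λ Ox → small (O-diff (S-O Ox) Ox) (squared S S-O Ox , mixed S R S-O R-O (λ x → sym (commute x)) (2∥N Ox) Ox))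
        (λ Ox → small (O-diff (R-O Ox) Ox) (mixed R S R-O S-O commute (2∥N′ Ox) Ox , squared R R-O Ox))
        small
        where
        diff : ∀ σ x y → fun σ (x - y) - (x - y) ≡ fun σ x - x - (fun σ y - y)
        diff σ x y = trans (cong (_- (x - y)) (fun-diff σ x y)) (prove [] [] (x ∷ y ∷ fun σ x ∷ fun σ y ∷ []) (x₂ ⊖ x₃ ⊖ (x₀ ⊖ x₁)) (x₂ ⊖ x₀ ⊖ (x₃ ⊖ x₁)) [] refl)
        squared : (T : Involution) → Preserves (Involution.σ T) → ∀ {x} → O x → ℤ.+ 2 ∥ Involution.s T (Involution.s T x - x) - (Involution.s T x - x)
        squared T T-O {x} Ox = subst (ℤ.+ 2 ∥_)
          (prove [] [] (x ∷ Involution.s T x ∷ Involution.s T (Involution.s T x - x) ∷ []) (con (ℤ.+ 2) ⊗ (x₀ ⊖ x₁)) (x₂ ⊖ (x₁ ⊖ x₀))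
            ((⊝ 𝟙 ·[ x₂ ≈ x₀ ⊖ x₁ by trans (fun-diff (Involution.σ T) _ _) (cong (_- Involution.s T x) (Involution.involutive T x)) ]· 𝟙) ∷ []) refl)
          (∥-multiple (ℤ.+ 2) (O-diff Ox (T-O Ox)))
        2∥N : ∀ {x} → O x → ℤ.+ 2 ∥ x + s x + (r x + r (s x))
        2∥N {x} Ox = O-tr (integral-trace Ox)
          where
          O-tr : (∃ λ t → x + bar x ≡ int t) → ℤ.+ 2 ∥ x + s x + (r x + r (s x))
          O-tr (t , e) = int t , O-int t , trans (cong (λ y → x + s x + y) (sym (fun-+ R.σ _ _))) (trans (N-trace x) (cong (int (ℤ.+ 2) *_) e))
        2∥N′ : ∀ {x} → O x → ℤ.+ 2 ∥ x + r x + (s x + s (r x))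
        2∥N′ {x} Ox = subst (ℤ.+ 2 ∥_) (prove [] [] (x ∷ s x ∷ r x ∷ r (s x) ∷ s (r x) ∷ []) (x₀ ⊕ x₁ ⊕ (x₂ ⊕ x₃)) (x₀ ⊕ x₂ ⊕ (x₁ ⊕ x₄))
          ((⊝ 𝟙 ·[ x₄ ≈ x₃ by commute x ]· 𝟙) ∷ []) refl) (2∥N Ox)
        mixed : (T U : Involution) → Preserves (Involution.σ T) → Preserves (Involution.σ U) → (∀ x → Involution.s U (Involution.s T x) ≡ Involution.s T (Involution.s U x)) →
          ∀ {x} → ℤ.+ 2 ∥ x + Involution.s T x + (Involution.s U x + Involution.s U (Involution.s T x)) → O x →
          ℤ.+ 2 ∥ Involution.s U (Involution.s T x - x) - (Involution.s T x - x)
        mixed T U T-O U-O comm {x} h Ox = subst (ℤ.+ 2 ∥_)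
          (prove [] [] (x ∷ Involution.s T x ∷ Involution.s U x ∷ Involution.s U (Involution.s T x) ∷ Involution.s U (Involution.s T x - x) ∷ [])
            (x₀ ⊕ x₁ ⊕ (x₂ ⊕ x₃) ⊖ con (ℤ.+ 2) ⊗ (x₁ ⊕ x₂)) (x₄ ⊖ (x₁ ⊖ x₀))
            ((⊝ 𝟙 ·[ x₄ ≈ x₃ ⊖ x₂ by fun-diff (Involution.σ U) _ _ ]· 𝟙) ∷ []) refl)
          (∥-diff h (∥-multiple (ℤ.+ 2) (O-+ (T-O Ox) (U-O Ox))))

      line₁ : ∀ {x} → s x ≡ x → r x ≡ - x → ∃ λ q → Rat q × x ≡ q * S.β
      line₁ {x} hs hr with p , q , p∈ , q∈ , e ← S.fixed hs = q , q∈ , halve (prove (cen p∈ ∷ cen q∈ ∷ []) [] (x ∷ r x ∷ S.β ∷ r S.β ∷ [])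
        (con (ℤ.+ 2) ⊗ x₀) (con (ℤ.+ 2) ⊗ (c₁ ⊗ x₂))
        ( (𝟙 ·[ x₀ ≈ c₀ ⊕ c₁ ⊗ x₂ by e ]· 𝟙) ∷ (𝟙 ·[ x₁ ≈ ⊝ x₀ by hr ]· 𝟙)
        ∷ (⊝ 𝟙 ·[ x₁ ≈ c₀ ⊕ c₁ ⊗ x₃ by trans (cong r e) (trans (fun-+ R.σ _ _) (cong₂ _+_ (fun-rat R.σ p∈) (trans (fun-* R.σ _ _) (cong (_* r S.β) (fun-rat R.σ q∈))))) ]· 𝟙)
        ∷ (⊝ c₁ ·[ x₃ ≈ ⊝ x₂ by anti ]· 𝟙) ∷ []) refl)

      line₂ : ∀ {x} → r x ≡ x → s x ≡ - x → ∃ λ q → Rat q × x ≡ q * R.β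
      line₂ {x} hr hs with p , q , p∈ , q∈ , e ← R.fixed hr = q , q∈ , halve (prove (cen p∈ ∷ cen q∈ ∷ []) [] (x ∷ s x ∷ R.β ∷ s R.β ∷ [])
        (con (ℤ.+ 2) ⊗ x₀) (con (ℤ.+ 2) ⊗ (c₁ ⊗ x₂))
        ( (𝟙 ·[ x₀ ≈ c₀ ⊕ c₁ ⊗ x₂ by e ]· 𝟙) ∷ (𝟙 ·[ x₁ ≈ ⊝ x₀ by hs ]· 𝟙)
        ∷ (⊝ 𝟙 ·[ x₁ ≈ c₀ ⊕ c₁ ⊗ x₃ by trans (cong s e) (trans (fun-+ S.σ _ _) (cong₂ _+_ (fun-rat S.σ p∈) (trans (fun-* S.σ _ _) (cong (_* s R.β) (fun-rat S.σ q∈))))) ]· 𝟙)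
        ∷ (⊝ c₁ ·[ x₃ ≈ ⊝ x₂ by anti′ ]· 𝟙) ∷ []) refl)

      -- Multiplication by the conjugator of r, which s negates and r fixes, moves this eigenspace
      -- onto that of `line₁`.
      line₃ : ∀ {x} → r x ≡ - x → s x ≡ - x → ∃ λ q → Rat q × x ≡ q * (S.β * R.β)
      line₃ {x} hr hs
        with q , q∈ , e ← line₁ {x * R.β} (trans (fun-* S.σ _ _) (trans (cong₂ _*_ hs anti′) (prove [] [] (x ∷ R.β ∷ []) (⊝ x₀ ⊗ ⊝ x₁) (x₀ ⊗ x₁) [] refl)))
          (trans (fun-* R.σ _ _) (trans (cong₂ _*_ hr R.fix-β) (neg-distribˡ _ _)))
        with m , m∈ , β²m≡1 ← rat-inverse R.β²∈ℚ (*-nonzero R.β≢0 R.β≢0) = q * m , rat-* q∈ m∈ ,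
          prove (cen q∈ ∷ cen m∈ ∷ []) [] (x ∷ S.β ∷ R.β ∷ []) x₀ (c₀ ⊗ c₁ ⊗ (x₁ ⊗ x₂))
            ((⊝ x₀ ·[ x₂ ⊗ x₂ ⊗ c₁ ≈ 𝟙 by β²m≡1 ]· 𝟙) ∷ (c₁ ·[ x₀ ⊗ x₂ ≈ c₀ ⊗ x₁ by e ]· x₂) ∷ []) refl

      -- Triviality modulo 2 means T x = x + 2 d with d in O, so both halves (x ± T x)/2 are
      -- integral.
      split : (T : Involution) → (∀ {x} → O x → ℤ.+ 2 ∥ Involution.s T x - x) → ∀ {x} → O x →
        ∃₂ λ y w → O y × O w × x ≡ y + w × int (ℤ.+ 2) * y ≡ x + Involution.s T x × int (ℤ.+ 2) * w ≡ x - Involution.s T x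
      split T trivial {x} Ox with d , Od , e ← trivial Ox = x + d , - d , O-+ Ox Od , O-neg Od ,
        prove [] [] (x ∷ d ∷ []) x₀ (x₀ ⊕ x₁ ⊕ ⊝ x₁) [] refl ,
        prove [] [] (x ∷ d ∷ Involution.s T x ∷ []) (con (ℤ.+ 2) ⊗ (x₀ ⊕ x₁)) (x₀ ⊕ x₂) ((⊝ 𝟙 ·[ x₂ ⊖ x₀ ≈ con (ℤ.+ 2) ⊗ x₁ by e ]· 𝟙) ∷ []) refl ,
        prove [] [] (x ∷ d ∷ Involution.s T x ∷ []) (con (ℤ.+ 2) ⊗ ⊝ x₁) (x₀ ⊖ x₂) ((𝟙 ·[ x₂ ⊖ x₀ ≈ con (ℤ.+ 2) ⊗ x₁ by e ]· 𝟙) ∷ []) refl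

      scaled : ∀ σ {y} → fun σ (int (ℤ.+ 2) * y) ≡ int (ℤ.+ 2) * fun σ y
      scaled σ = trans (fun-* σ _ _) (cong (_* _) (fun-int σ (ℤ.+ 2)))

      eigen₊ : ∀ σ {y w} → int (ℤ.+ 2) * y ≡ w → fun σ w ≡ w → fun σ y ≡ y
      eigen₊ σ {y} refl h = halve (trans (sym (scaled σ)) h)

      eigen₋ : ∀ σ {y w} → int (ℤ.+ 2) * y ≡ w → fun σ w ≡ - w → fun σ y ≡ - y
      eigen₋ σ {y} refl h = halve (trans (sym (scaled σ)) (trans h (sym (neg-distribʳ _ y))))

      difference-anti : (T : Involution) → ∀ x → Involution.s T (x - Involution.s T x) ≡ - (x - Involution.s T x)
      difference-anti T x = trans (fun-diff (Involution.σ T) _ _) (trans (cong (λ y → Involution.s T x - y) (Involution.involutive T x))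
        (prove [] [] (x ∷ Involution.s T x ∷ []) (x₁ ⊖ x₀) (⊝ (x₀ ⊖ x₁)) [] refl))

      -- The projections onto the four characters of C₂ × C₂ halve twice, and triviality modulo 2
      -- clears each denominator.
      components : (∀ {x} → O x → ℤ.+ 2 ∥ s x - x) → (∀ {x} → O x → ℤ.+ 2 ∥ r x - x) → ∀ {x} → O x →
        ∃₂ λ a b → ∃₂ λ c d → O a × O b × O c × O d × x ≡ a + b + c + d ×
          (s a ≡ a × r a ≡ a) × (s b ≡ b × r b ≡ - b) × (s c ≡ - c × r c ≡ c) × (s d ≡ - d × r d ≡ - d)
      components ts tr {x} Ox
        with y , w , Oy , Ow , e , 2y , 2w ← split S ts Ox
        with a , b , Oa , Ob , e′ , 2a , 2b ← split R tr Oy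
        with c , d , Oc , Od , e″ , 2c , 2d ← split R tr Ow =
        a , b , c , d , Oa , Ob , Oc , Od , trans e (trans (cong₂ _+_ e′ e″) (sym (+-assoc _ _ _))) ,
        (eigen₊ S.σ 2a (plus-fixed sy) , eigen₊ R.σ 2a (R.fixed-sum y)) ,
        (eigen₊ S.σ 2b (minus-fixed sy) , eigen₋ R.σ 2b (difference-anti R y)) ,
        (eigen₋ S.σ 2c (trans (fun-+ S.σ _ _) (trans (cong₂ _+_ sw (trans (commute w) (trans (cong r sw) (fun-neg R.σ w)))) (sym (neg-+ _ _)))) , eigen₊ R.σ 2c (R.fixed-sum w)) ,
        (eigen₋ S.σ 2d (trans (fun-diff S.σ _ _) (trans (cong₂ _-_ sw (trans (commute w) (trans (cong r sw) (fun-neg R.σ w)))) (sym (neg-+ _ _)))) , eigen₋ R.σ 2d (difference-anti R w))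
        where
        sy : s y ≡ y
        sy = eigen₊ S.σ 2y (S.fixed-sum x)
        sw : s w ≡ - w
        sw = eigen₋ S.σ 2w (difference-anti S x)
        plus-fixed : s y ≡ y → s (y + r y) ≡ y + r y
        plus-fixed h = trans (fun-+ S.σ _ _) (cong₂ _+_ h (trans (commute y) (cong r h)))
        minus-fixed : s y ≡ y → s (y - r y) ≡ y - r y
        minus-fixed h = trans (fun-diff S.σ _ _) (cong₂ _-_ h (trans (commute y) (cong r h)))

      fixed-rat : ∀ {a} → s a ≡ a → r a ≡ a → Rat a
      fixed-rat {a} hs hr = rat-divide (rat-int (ℤ.+ 4)) (int-nonzero λ ()) (subst Rat
        (prove [] [] (a ∷ s a ∷ r (a + s a) ∷ r a ∷ r (s a) ∷ []) (x₀ ⊕ x₁ ⊕ x₂) (con (ℤ.+ 4) ⊗ x₀)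
          ( (𝟙 ·[ x₁ ≈ x₀ by hs ]· 𝟙) ∷ (𝟙 ·[ x₂ ≈ x₃ ⊕ x₄ by fun-+ R.σ _ _ ]· 𝟙) ∷ (𝟙 ·[ x₄ ≈ x₃ by cong r hs ]· 𝟙)
          ∷ (con (ℤ.+ 2) ·[ x₃ ≈ x₀ by hr ]· 𝟙) ∷ []) refl) (N-rat a))

      -- Orthogonality of characters: the four images of the relation under 1, s, r, rs, weighted by
      -- the signs of one character, add up to four times a single term.
      independent-lines : ∀ {u₁ u₂ u₃} → u₁ ≢ 0# → u₂ ≢ 0# → u₃ ≢ 0# →
        s u₁ ≡ u₁ → r u₁ ≡ - u₁ → s u₂ ≡ - u₂ → r u₂ ≡ u₂ → s u₃ ≡ - u₃ → r u₃ ≡ - u₃ →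
        ∀ a b c d → int a + int b * u₁ + int c * u₂ + int d * u₃ ≡ 0# → a ≡ 0ℤ × b ≡ 0ℤ × c ≡ 0ℤ × d ≡ 0ℤ
      independent-lines {u₁} {u₂} {u₃} n₁ n₂ n₃ s₁ r₁ s₂ r₂ s₃ r₃ a b c d e =
        coefficient a (λ h → int-nonzero {1ℤ} (λ ()) (trans int-1 h)) (extract 0 (con 1ℤ) (con 1ℤ) (con 1ℤ) (con 1ℤ) 𝟙 refl) ,
        coefficient b n₁ (extract 1 (con 1ℤ) (con 1ℤ) (con -[1+ 0 ]) (con -[1+ 0 ]) x₀ refl) ,
        coefficient c n₂ (extract 2 (con 1ℤ) (con -[1+ 0 ]) (con 1ℤ) (con -[1+ 0 ]) x₁ refl) ,
        coefficient d n₃ (extract 3 (con 1ℤ) (con -[1+ 0 ]) (con -[1+ 0 ]) (con 1ℤ) x₂ refl)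
        where
        coefficient : ∀ k {u} → u ≢ 0# → int (ℤ.+ 4) * (int k * u) ≡ 0# → k ≡ 0ℤ
        coefficient k {u} n h = int-zero k (*-cancelʳ n (trans (integral-domain (int-nonzero λ ()) h) (sym (zeroˡ u))))
        image : ∀ σ {v₁ v₂ v₃} → fun σ u₁ ≡ v₁ → fun σ u₂ ≡ v₂ → fun σ u₃ ≡ v₃ → int a + int b * v₁ + int c * v₂ + int d * v₃ ≡ 0#
        image σ refl refl refl = trans (sym (trans (fun-+ σ _ _) (cong₂ _+_ (trans (fun-+ σ _ _) (cong₂ _+_ (trans (fun-+ σ _ _)
          (cong₂ _+_ (fun-int σ a) (scalar b u₁))) (scalar c u₂))) (scalar d u₃)))) (trans (cong (fun σ) e) (fun-0 σ))
          where
          scalar : ∀ k u → fun σ (int k * u) ≡ int k * fun σ u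
          scalar k u = trans (fun-* σ _ _) (cong (_* fun σ u) (fun-int σ k))
        xs : List A
        xs = u₁ ∷ u₂ ∷ u₃ ∷ []
        zs : List ℤ
        zs = a ∷ b ∷ c ∷ d ∷ []
        open Env [] zs xs using (⟦_⟧; Hyp; total)
        e₀ e₁ e₂ e₃ : Expr
        e₀ = ι z₀ ⊕ ι z₁ ⊗ x₀ ⊕ ι z₂ ⊗ x₁ ⊕ ι z₃ ⊗ x₂
        e₁ = ι z₀ ⊕ ι z₁ ⊗ x₀ ⊕ ι z₂ ⊗ ⊝ x₁ ⊕ ι z₃ ⊗ ⊝ x₂
        e₂ = ι z₀ ⊕ ι z₁ ⊗ ⊝ x₀ ⊕ ι z₂ ⊗ x₁ ⊕ ι z₃ ⊗ ⊝ x₂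
        e₃ = ι z₀ ⊕ ι z₁ ⊗ ⊝ x₀ ⊕ ι z₂ ⊗ ⊝ x₁ ⊕ ι z₃ ⊗ x₂
        rs : ∀ {y v w} → s y ≡ v → r v ≡ w → r (s y) ≡ w
        rs refl h = h
        hyps : Expr → Expr → Expr → Expr → List Hyp
        hyps f₀ f₁ f₂ f₃ = (f₀ ·[ e₀ ≈ 𝟘 by e ]· 𝟙) ∷ (f₁ ·[ e₁ ≈ 𝟘 by image S.σ s₁ s₂ s₃ ]· 𝟙) ∷ (f₂ ·[ e₂ ≈ 𝟘 by image R.σ r₁ r₂ r₃ ]· 𝟙)
          ∷ (f₃ ·[ e₃ ≈ 𝟘 by image′ ]· 𝟙) ∷ []
          where
          image′ : ⟦ e₃ ⟧ ≡ 0#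
          image′ = image (record { fun = λ x → r (s x) ; fun-+ = λ x y → trans (cong r (fun-+ S.σ x y)) (fun-+ R.σ _ _)
            ; fun-* = λ x y → trans (cong r (fun-* S.σ x y)) (fun-* R.σ _ _) ; fun-1 = trans (cong r (fun-1 S.σ)) (fun-1 R.σ) })
            (rs s₁ r₁) (rs s₂ (trans (fun-neg R.σ u₂) (cong -_ r₂))) (rs s₃ (trans (fun-neg R.σ u₃) (trans (cong -_ r₃) (neg-involutive u₃))))
        extract : ∀ k f₀ f₁ f₂ f₃ t → norm (con (ℤ.+ 4) ⊗ (ι (𝕫 k) ⊗ t) ⊖ 𝟘 ⊖ total (hyps f₀ f₁ f₂ f₃)) ≡ [] → ⟦ con (ℤ.+ 4) ⊗ (ι (𝕫 k) ⊗ t) ⟧ ≡ 0#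
        extract k f₀ f₁ f₂ f₃ t h = prove [] zs xs (con (ℤ.+ 4) ⊗ (ι (𝕫 k) ⊗ t)) 𝟘 (hyps f₀ f₁ f₂ f₃) h

      -- u₁, u₂, u₃ generate the intersections of O with the three nontrivial eigenlines. A product
      -- of two lies in O and on the third line, so it is an integer multiple of the third
      -- generator; this is where k₁, k₂, k₃ come from.
      frame : (∀ {x} → O x → ℤ.+ 2 ∥ s x - x) → (∀ {x} → O x → ℤ.+ 2 ∥ r x - x) → Frame
      frame ts tr
        with u₁ , O₁ , n₁ , (q₁ , q₁∈ , e₁) , g₁ ← line-basis S.β S.β≢0
        with u₂ , O₂ , n₂ , (q₂ , q₂∈ , e₂) , g₂ ← line-basis R.β R.β≢0
        with u₃ , O₃ , n₃ , (q₃ , q₃∈ , e₃) , g₃ ← line-basis (S.β * R.β) (*-nonzero S.β≢0 R.β≢0)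
        with k₁ , f₁ ← g₃ (O-* O₁ O₂) (rat-* q₁∈ q₂∈) (prove (cen q₁∈ ∷ cen q₂∈ ∷ []) [] (u₁ ∷ u₂ ∷ S.β ∷ R.β ∷ []) (x₀ ⊗ x₁) (c₀ ⊗ c₁ ⊗ (x₂ ⊗ x₃))
          ((𝟙 ·[ x₀ ≈ c₀ ⊗ x₂ by e₁ ]· x₁) ∷ (c₀ ⊗ x₂ ·[ x₁ ≈ c₁ ⊗ x₃ by e₂ ]· 𝟙) ∷ []) refl)
        with k₂ , f₂ ← g₁ (O-* O₂ O₃) (rat-neg (rat-* (rat-* q₂∈ q₃∈) R.β²∈ℚ)) (prove (cen q₂∈ ∷ cen q₃∈ ∷ cen R.β²∈ℚ ∷ []) [] (u₂ ∷ u₃ ∷ S.β ∷ R.β ∷ []) (x₀ ⊗ x₁) (⊝ (c₀ ⊗ c₁ ⊗ c₂) ⊗ x₂)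
          ( (𝟙 ·[ x₀ ≈ c₀ ⊗ x₃ by e₂ ]· x₁) ∷ (c₀ ⊗ x₃ ·[ x₁ ≈ c₁ ⊗ (x₂ ⊗ x₃) by e₃ ]· 𝟙)
          ∷ (c₀ ⊗ c₁ ⊗ x₃ ·[ x₂ ⊗ x₃ ≈ ⊝ (x₃ ⊗ x₂) by anticommute ]· 𝟙) ∷ (⊝ (c₀ ⊗ c₁) ·[ x₃ ⊗ x₃ ≈ c₂ by refl ]· x₂) ∷ []) refl)
        with k₃ , f₃ ← g₂ (O-* O₃ O₁) (rat-neg (rat-* (rat-* q₃∈ q₁∈) S.β²∈ℚ)) (prove (cen q₃∈ ∷ cen q₁∈ ∷ cen S.β²∈ℚ ∷ []) [] (u₃ ∷ u₁ ∷ S.β ∷ R.β ∷ []) (x₀ ⊗ x₁) (⊝ (c₀ ⊗ c₁ ⊗ c₂) ⊗ x₃)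
          ( (𝟙 ·[ x₀ ≈ c₀ ⊗ (x₂ ⊗ x₃) by e₃ ]· x₁) ∷ (c₀ ⊗ (x₂ ⊗ x₃) ·[ x₁ ≈ c₁ ⊗ x₂ by e₁ ]· 𝟙)
          ∷ (c₀ ⊗ c₁ ·[ x₂ ⊗ x₃ ≈ ⊝ (x₃ ⊗ x₂) by anticommute ]· x₂) ∷ (⊝ (c₀ ⊗ c₁) ⊗ x₃ ·[ x₂ ⊗ x₂ ≈ c₂ by refl ]· 𝟙)
          ∷ []) refl) = record
        { u₁ = u₁ ; u₂ = u₂ ; u₃ = u₃ ; k₁ = k₁ ; k₂ = k₂ ; k₃ = k₃ ; u₁u₂ = f₁ ; u₂u₃ = f₂ ; u₃u₁ = f₃
        ; u₂u₁ = prove (cen q₁∈ ∷ cen q₂∈ ∷ []) [] (u₁ ∷ u₂ ∷ S.β ∷ R.β ∷ []) (x₁ ⊗ x₀) (⊝ (x₀ ⊗ x₁))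
            ( (𝟙 ·[ x₀ ≈ c₀ ⊗ x₂ by e₁ ]· x₁) ∷ (c₀ ⊗ x₂ ·[ x₁ ≈ c₁ ⊗ x₃ by e₂ ]· 𝟙) ∷ (x₁ ·[ x₀ ≈ c₀ ⊗ x₂ by e₁ ]· 𝟙) ∷ (𝟙 ·[ x₁ ≈ c₁ ⊗ x₃ by e₂ ]· (c₀ ⊗ x₂))
            ∷ (c₀ ⊗ c₁ ·[ x₂ ⊗ x₃ ≈ ⊝ (x₃ ⊗ x₂) by anticommute ]· 𝟙) ∷ []) refl
        ; u₃u₂ = prove (cen q₂∈ ∷ cen q₃∈ ∷ []) [] (u₂ ∷ u₃ ∷ S.β ∷ R.β ∷ []) (x₁ ⊗ x₀) (⊝ (x₀ ⊗ x₁))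
            ( (𝟙 ·[ x₀ ≈ c₀ ⊗ x₃ by e₂ ]· x₁) ∷ (c₀ ⊗ x₃ ·[ x₁ ≈ c₁ ⊗ (x₂ ⊗ x₃) by e₃ ]· 𝟙) ∷ (x₁ ·[ x₀ ≈ c₀ ⊗ x₃ by e₂ ]· 𝟙) ∷ (𝟙 ·[ x₁ ≈ c₁ ⊗ (x₂ ⊗ x₃) by e₃ ]· (c₀ ⊗ x₃))
            ∷ (c₀ ⊗ c₁ ·[ x₂ ⊗ x₃ ≈ ⊝ (x₃ ⊗ x₂) by anticommute ]· x₃) ∷ []) refl
        ; u₁u₃ = prove (cen q₁∈ ∷ cen q₃∈ ∷ []) [] (u₁ ∷ u₃ ∷ S.β ∷ R.β ∷ []) (x₀ ⊗ x₁) (⊝ (x₁ ⊗ x₀))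
            ( (𝟙 ·[ x₀ ≈ c₀ ⊗ x₂ by e₁ ]· x₁) ∷ (c₀ ⊗ x₂ ·[ x₁ ≈ c₁ ⊗ (x₂ ⊗ x₃) by e₃ ]· 𝟙) ∷ (x₁ ·[ x₀ ≈ c₀ ⊗ x₂ by e₁ ]· 𝟙) ∷ (𝟙 ·[ x₁ ≈ c₁ ⊗ (x₂ ⊗ x₃) by e₃ ]· (c₀ ⊗ x₂))
            ∷ (c₀ ⊗ c₁ ⊗ x₂ ·[ x₂ ⊗ x₃ ≈ ⊝ (x₃ ⊗ x₂) by anticommute ]· 𝟙) ∷ []) refl
        ; bar₁ = pure-multiple q₁∈ S.bar-β e₁
        ; bar₂ = pure-multiple q₂∈ R.bar-β e₂
        ; bar₃ = pure-multiple q₃∈ (trans (bar-* _ _) (trans (cong₂ _*_ R.bar-β S.bar-β) (trans (prove [] [] (S.β ∷ R.β ∷ []) (⊝ x₁ ⊗ ⊝ x₀) (⊝ (x₀ ⊗ x₁)) ((𝟙 ·[ x₀ ⊗ x₁ ≈ ⊝ (x₁ ⊗ x₀) by anticommute ]· 𝟙) ∷ []) refl) refl))) e₃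
        ; O₁ = O₁ ; O₂ = O₂ ; O₃ = O₃
        ; spans = λ Ox → let a , b , c , d , Oa , Ob , Oc , Od , e , (sa , ra) , (sb , rb) , (sc , rc) , (sd , rd) = components ts tr Ox
                             i , ei = rational-integer Oa (fixed-rat sa ra)
                             _ , l₁ , h₁ = line₁ sb rb ; j , ej = g₁ Ob l₁ h₁
                             _ , l₂ , h₂ = line₂ rc sc ; k , ek = g₂ Oc l₂ h₂
                             _ , l₃ , h₃ = line₃ rd sd ; l , el = g₃ Od l₃ h₃
                         in i , j , k , l , trans e (cong₂ _+_ (cong₂ _+_ (cong₂ _+_ ei ej) ek) el)
        ; free = independent-lines n₁ n₂ n₃ (multiple S.σ q₁∈ S.fix-β e₁) (multiple₋ R.σ q₁∈ anti e₁) (multiple₋ S.σ q₂∈ anti′ e₂) (multiple R.σ q₂∈ R.fix-β e₂)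
            (multiple₋ S.σ q₃∈ (trans (fun-* S.σ _ _) (trans (cong₂ _*_ S.fix-β anti′) (neg-distribʳ _ _))) e₃)
            (multiple₋ R.σ q₃∈ (trans (fun-* R.σ _ _) (trans (cong₂ _*_ anti R.fix-β) (neg-distribˡ _ _))) e₃)
        ; O-bar = O-bar }
        where
        pure-multiple : ∀ {u q β} → Rat q → bar β ≡ - β → u ≡ q * β → bar u ≡ - u
        pure-multiple {q = q} {β} q∈ h refl = trans (bar-* _ _) (trans (cong₂ _*_ h (bar-rat q∈)) (trans (neg-distribˡ β q) (cong -_ (sym (rat-central q∈ β)))))
        multiple : ∀ σ {u q β} → Rat q → fun σ β ≡ β → u ≡ q * β → fun σ u ≡ u
        multiple σ q∈ h refl = trans (fun-* σ _ _) (cong₂ _*_ (fun-rat σ q∈) h)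
        multiple₋ : ∀ σ {u q β} → Rat q → fun σ β ≡ - β → u ≡ q * β → fun σ u ≡ - u
        multiple₋ σ q∈ h refl = trans (fun-* σ _ _) (trans (cong₂ _*_ (fun-rat σ q∈) h) (neg-distribʳ _ _))

      not-trivial : ¬ (∀ {x} → O x → ℤ.+ 2 ∥ s x - x × ℤ.+ 2 ∥ r x - x)
      not-trivial h = no-frame (frame (λ Ox → proj₁ (h Ox)) (λ Ox → proj₂ (h Ox)))

-- A rotation of order 4: Gaussian integers inside O.

module DihedralFourAction (Q : QuaternionDivisionAlgebra) (O : QuaternionDivisionAlgebra.A Q → Set) (order : Lattices.MaximalOrder Q O) where
  open Klein Q O order public
  open Parity

  opaque
    sum-of-squares : ∀ p q n → p ℤ.* p ℤ.+ q ℤ.* q ≡ ℤ.+ 4 ℤ.* n → (∃ λ p′ → p ≡ ℤ.+ 2 ℤ.* p′) × (∃ λ q′ → q ≡ ℤ.+ 2 ℤ.* q′)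
    sum-of-squares p q n h = go (even-square (p ℤ.+ q) (ℤ.+ 2 ℤ.* n ℤ.+ p ℤ.* q)
      (ℤSolve.prove [] (p ∷ q ∷ n ∷ []) [] (ι ((z₀ ⊕ z₁) ⊗ (z₀ ⊕ z₁))) (ι (con (ℤ.+ 2) ⊗ (con (ℤ.+ 2) ⊗ z₂ ⊕ z₀ ⊗ z₁)))
        ((𝟙 ℤSolve.·[ ι (z₀ ⊗ z₀ ⊕ z₁ ⊗ z₁) ≈ ι (con (ℤ.+ 4) ⊗ z₂) by h ]· 𝟙) ∷ []) refl))
      where
      go : (∃ λ k → p ℤ.+ q ≡ ℤ.+ 2 ℤ.* k) → (∃ λ p′ → p ≡ ℤ.+ 2 ℤ.* p′) × (∃ λ q′ → q ≡ ℤ.+ 2 ℤ.* q′)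
      go (k , e) with p′ , p≡ ← even-square p (n ℤ.+ ℤ.- (k ℤ.* k) ℤ.+ p ℤ.* k) (ℤP.*-cancelˡ-≡ (ℤ.+ 2) _ _
          (ℤSolve.prove [] (p ∷ q ∷ n ∷ k ∷ []) [] (ι (con (ℤ.+ 2) ⊗ (z₀ ⊗ z₀))) (ι (con (ℤ.+ 2) ⊗ (con (ℤ.+ 2) ⊗ (z₂ ⊕ ⊝ (z₃ ⊗ z₃) ⊕ z₀ ⊗ z₃))))
            ( (𝟙 ℤSolve.·[ ι (z₀ ⊗ z₀ ⊕ z₁ ⊗ z₁) ≈ ι (con (ℤ.+ 4) ⊗ z₂) by h ]· 𝟙)
            ∷ (ι z₀ ⊖ ι z₁ ⊖ con (ℤ.+ 2) ⊗ ι z₃ ℤSolve.·[ ι (z₀ ⊕ z₁) ≈ ι (con (ℤ.+ 2) ⊗ z₃) by e ]· 𝟙) ∷ []) refl)) =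
        (p′ , p≡) , (k ℤ.- p′ , ℤSolve.prove [] (p ∷ q ∷ p′ ∷ k ∷ []) [] (ι z₁) (ι (con (ℤ.+ 2) ⊗ (z₃ ⊖ z₂)))
          ((𝟙 ℤSolve.·[ ι (z₀ ⊕ z₁) ≈ ι (con (ℤ.+ 2) ⊗ z₃) by e ]· 𝟙) ∷ (⊝ 𝟙 ℤSolve.·[ ι z₀ ≈ ι (con (ℤ.+ 2) ⊗ z₂) by p≡ ]· 𝟙) ∷ []) refl)

  record DihedralFour : Set where
    field
      S : Involution
      S-O : Preserves (Involution.σ S)
      ρ : Automorphism
      ρ-O : Preserves ρ
      fourth : ∀ x → fun ρ (fun ρ (fun ρ (fun ρ x))) ≡ x
      square-nontrivial : ¬ (∀ x → fun ρ (fun ρ x) ≡ x)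
      inverts : ∀ x → Involution.s S (fun ρ x) ≡ fun ρ (fun ρ (fun ρ (Involution.s S x)))
      distinct : ¬ (∀ x → fun ρ (fun ρ x) ≡ Involution.s S x)
    open Involution S using (s; σ)
    r : A → A
    r = fun ρ

    ρ² : Automorphism
    ρ² = record { fun = λ x → r (r x) ; fun-+ = λ x y → trans (cong r (fun-+ ρ x y)) (fun-+ ρ _ _)
                ; fun-* = λ x y → trans (cong r (fun-* ρ x y)) (fun-* ρ _ _) ; fun-1 = trans (cong r (fun-1 ρ)) (fun-1 ρ) }

    klein : KleinFour
    klein = record { S = S ; R = record { σ = ρ² ; involutive = fourth ; nontrivial = square-nontrivial }
      ; commute = λ x → trans (inverts (r x)) (trans (cong (λ y → r (r (r y))) (inverts x)) (cong (λ y → r (r y)) (fourth (s x)))) ; distinct = distinct }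

    module K = KleinFour klein
    module KA = KleinAction klein S-O (λ Ox → ρ-O (ρ-O Ox))

    opaque
      -- ρ is conjugation by some b with tr(b)² = 2 nrd(b), that is, by 1 + i with i² = −1.
      square-root : ∃ λ i → i * i ≡ - 1# × bar i ≡ - i × (∀ x → r x * (1# + i) ≡ (1# + i) * x)
      square-root with b , b≢0 , h ← skolem-noether ρ = result
        where
        t : A
        t = b + bar b
        h² : ∀ x → r (r x) * (b * b) ≡ b * b * x
        h² x = prove [] [] (b ∷ x ∷ r x ∷ r (r x) ∷ []) (x₃ ⊗ (x₀ ⊗ x₀)) (x₀ ⊗ x₀ ⊗ x₁)
          ((𝟙 ·[ x₃ ⊗ x₀ ≈ x₀ ⊗ x₂ by h (r x) ]· x₀) ∷ (x₀ ·[ x₂ ⊗ x₀ ≈ x₀ ⊗ x₁ by h x ]· 𝟙) ∷ []) refl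
        b²∉ℚ : ¬ Rat (b * b)
        b²∉ℚ = conjugator∉ℚ ρ² (*-nonzero b≢0 b≢0) h² square-nontrivial
        b⁴∈ℚ : Rat (b * b * (b * b))
        b⁴∈ℚ = center λ x → prove [] [] (b * b ∷ x ∷ r (r x) ∷ []) (x₀ ⊗ x₀ ⊗ x₁) (x₁ ⊗ (x₀ ⊗ x₀))
          ((⊝ x₀ ·[ x₂ ⊗ x₀ ≈ x₀ ⊗ x₁ by h² x ]· 𝟙) ∷ (⊝ 𝟙 ·[ x₁ ⊗ x₀ ≈ x₀ ⊗ x₂ by trans (cong (_* (b * b)) (sym (fourth x))) (h² (r (r x))) ]· x₀) ∷ []) refl
        barb² : bar b * bar b ≡ - (b * b)
        barb² = trans (sym (bar-* b b)) (pure b⁴∈ℚ b²∉ℚ)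
        t²≡ : t * t ≡ int (ℤ.+ 2) * (b * bar b)
        t²≡ = prove [] [] (b ∷ bar b ∷ []) ((x₀ ⊕ x₁) ⊗ (x₀ ⊕ x₁)) (con (ℤ.+ 2) ⊗ (x₀ ⊗ x₁))
          ((𝟙 ·[ x₁ ⊗ x₁ ≈ ⊝ (x₀ ⊗ x₀) by barb² ]· 𝟙) ∷ (𝟙 ·[ x₁ ⊗ x₀ ≈ x₀ ⊗ x₁ by bar-comm b ]· 𝟙) ∷ []) refl
        t≢0 : t ≢ 0#
        t≢0 e = *-nonzero (int-nonzero {ℤ.+ 2} λ ()) (*-nonzero b≢0 λ e′ → b≢0 (trans (sym (bar-involutive b)) (trans (cong bar e′) bar-0)))
          (trans (sym t²≡) (trans (cong (_* t) e) (zeroˡ t)))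
        result : ∃ λ i → i * i ≡ - 1# × bar i ≡ - i × (∀ x → r x * (1# + i) ≡ (1# + i) * x)
        result with k , k∈ , tk≡1 ← rat-inverse (trace b) t≢0 = k * (b - bar b) ,
          prove (cen k∈ ∷ []) [] (b ∷ bar b ∷ []) (c₀ ⊗ (x₀ ⊖ x₁) ⊗ (c₀ ⊗ (x₀ ⊖ x₁))) (⊝ 𝟙)
            ( (c₀ ⊗ c₀ ·[ x₁ ⊗ x₁ ≈ ⊝ (x₀ ⊗ x₀) by barb² ]· 𝟙) ∷ (⊝ (c₀ ⊗ c₀) ·[ x₁ ⊗ x₀ ≈ x₀ ⊗ x₁ by bar-comm b ]· 𝟙)
            ∷ (c₀ ⊗ c₀ ·[ (x₀ ⊕ x₁) ⊗ (x₀ ⊕ x₁) ≈ con (ℤ.+ 2) ⊗ (x₀ ⊗ x₁) by t²≡ ]· 𝟙)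
            ∷ (⊝ ((x₀ ⊕ x₁) ⊗ c₀ ⊕ 𝟙) ·[ (x₀ ⊕ x₁) ⊗ c₀ ≈ 𝟙 by tk≡1 ]· 𝟙) ∷ []) refl ,
          trans (bar-* _ _) (trans (cong₂ _*_ (trans (bar-+ _ _) (cong (λ y → bar b + y) (trans (bar-neg _) (cong -_ (bar-involutive b))))) (bar-rat k∈))
            (prove (cen k∈ ∷ []) [] (b ∷ bar b ∷ []) ((x₁ ⊕ ⊝ x₀) ⊗ c₀) (⊝ (c₀ ⊗ (x₀ ⊖ x₁))) [] refl)) ,
          (λ x → prove (cen k∈ ∷ []) [] (b ∷ bar b ∷ x ∷ r x ∷ []) (x₃ ⊗ (𝟙 ⊕ c₀ ⊗ (x₀ ⊖ x₁))) ((𝟙 ⊕ c₀ ⊗ (x₀ ⊖ x₁)) ⊗ x₂)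
            ( (con (ℤ.+ 2) ⊗ c₀ ·[ x₃ ⊗ x₀ ≈ x₀ ⊗ x₂ by h x ]· 𝟙) ∷ (⊝ x₃ ·[ (x₀ ⊕ x₁) ⊗ c₀ ≈ 𝟙 by tk≡1 ]· 𝟙)
            ∷ (𝟙 ·[ (x₀ ⊕ x₁) ⊗ c₀ ≈ 𝟙 by tk≡1 ]· x₂) ∷ []) refl)

    i : A
    i = proj₁ square-root

    Anti : A → Set
    Anti x = r (r x) ≡ - x

    D : A → A
    D x = r x - x

    opaque
      i² : i * i ≡ - 1#
      i² = proj₁ (proj₂ square-root)

      bar-i : bar i ≡ - i
      bar-i = proj₁ (proj₂ (proj₂ square-root))

      r-conj : ∀ x → r x * (1# + i) ≡ (1# + i) * x
      r-conj = proj₂ (proj₂ (proj₂ square-root))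

      1+i≢0 : 1# + i ≢ 0#
      1+i≢0 e = int-nonzero {ℤ.+ 2} (λ ()) (prove [] [] (i ∷ []) (con (ℤ.+ 2)) 𝟘
        ((𝟙 ·[ 𝟙 ⊕ x₀ ≈ 𝟘 by e ]· (𝟙 ⊖ x₀)) ∷ (𝟙 ·[ x₀ ⊗ x₀ ≈ ⊝ 𝟙 by i² ]· 𝟙) ∷ []) refl)

      -- (1 + i)² = 2 i, so r² is conjugation by i.
      r²-conj : ∀ x → i * x ≡ r (r x) * i
      r²-conj x = halve (prove [] [] (i ∷ x ∷ r x ∷ r (r x) ∷ []) (con (ℤ.+ 2) ⊗ (x₀ ⊗ x₁)) (con (ℤ.+ 2) ⊗ (x₃ ⊗ x₀))
        ( (⊝ 𝟙 ·[ x₃ ⊗ (𝟙 ⊕ x₀) ≈ (𝟙 ⊕ x₀) ⊗ x₂ by r-conj (r x) ]· (𝟙 ⊕ x₀)) ∷ (⊝ (𝟙 ⊕ x₀) ·[ x₂ ⊗ (𝟙 ⊕ x₀) ≈ (𝟙 ⊕ x₀) ⊗ x₁ by r-conj x ]· 𝟙)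
        ∷ (⊝ 𝟙 ·[ x₀ ⊗ x₀ ≈ ⊝ 𝟙 by i² ]· x₁) ∷ (x₃ ·[ x₀ ⊗ x₀ ≈ ⊝ 𝟙 by i² ]· 𝟙) ∷ []) refl)

      r-commuting : ∀ {x} → i * x ≡ x * i → r x ≡ x
      r-commuting {x} h = *-cancelʳ 1+i≢0 (prove [] [] (i ∷ x ∷ r x ∷ []) (x₂ ⊗ (𝟙 ⊕ x₀)) (x₁ ⊗ (𝟙 ⊕ x₀))
        ((𝟙 ·[ x₂ ⊗ (𝟙 ⊕ x₀) ≈ (𝟙 ⊕ x₀) ⊗ x₁ by r-conj x ]· 𝟙) ∷ (𝟙 ·[ x₀ ⊗ x₁ ≈ x₁ ⊗ x₀ by h ]· 𝟙) ∷ []) refl)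

      r-i : r i ≡ i
      r-i = r-commuting refl

      i∉ℚ : ¬ Rat i
      i∉ℚ i∈ = int-nonzero {ℤ.+ 2} (λ ()) (prove [] [] (i ∷ bar i ∷ []) (con (ℤ.+ 2)) 𝟘
        ( (con (ℤ.+ 2) ·[ x₀ ⊗ x₀ ≈ ⊝ 𝟙 by i² ]· 𝟙) ∷ (x₀ ·[ x₁ ≈ x₀ by bar-rat i∈ ]· 𝟙) ∷ (⊝ x₀ ·[ x₁ ≈ ⊝ x₀ by bar-i ]· 𝟙) ∷ []) refl)

      -- i is pure and fixed by r², hence a rational multiple of the conjugator of r², which s
      -- negates.
      s-i : s i ≡ - i
      s-i with p , q , p∈ , q∈ , e ← K.R.fixed {i} (trans (cong r r-i) r-i) with e′ ← pure-part K.R.bar-β bar-i p∈ q∈ e =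
        trans (cong s e′) (trans (fun-* σ _ _) (trans (cong₂ _*_ (fun-rat σ q∈) K.anti′) (trans (neg-distribʳ q K.R.β) (cong -_ (sym e′)))))

      O-i : O i
      O-i = normalizing-integral i (λ x → r (r x)) (λ Ox → ρ-O (ρ-O Ox)) r²-conj -[1+ 0 ] 0ℤ
        (trans i² (prove [] [] (i ∷ []) (⊝ 𝟙) (con -[1+ 0 ] ⊕ con 0ℤ ⊗ x₀) [] refl))

      -- If i = 2 y, then 1 = nrd i = 4 nrd y, with nrd y an integer.
      i-nonzero : ¬ (ℤ.+ 2 ∥ i)
      i-nonzero (y , Oy , e) with n , e′ ← KA.integral-norm Oy = four-not-unit n (int-injective (prove [] (n ∷ []) (i ∷ bar i ∷ y ∷ bar y ∷ [])
        (ι (con (ℤ.+ 4) ⊗ z₀)) (ι (con 1ℤ))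
        ( (⊝ con (ℤ.+ 4) ·[ x₂ ⊗ x₃ ≈ ι z₀ by e′ ]· 𝟙) ∷ (⊝ 𝟙 ·[ x₀ ≈ con (ℤ.+ 2) ⊗ x₂ by e ]· (con (ℤ.+ 2) ⊗ x₃))
        ∷ (⊝ x₀ ·[ x₁ ≈ x₃ ⊗ con (ℤ.+ 2) by trans (cong bar e) (trans (bar-* _ _) (cong (bar y *_) (bar-int (ℤ.+ 2)))) ]· 𝟙)
        ∷ (x₀ ·[ x₁ ≈ ⊝ x₀ by bar-i ]· 𝟙) ∷ (⊝ 𝟙 ·[ x₀ ⊗ x₀ ≈ ⊝ 𝟙 by i² ]· 𝟙) ∷ []) refl))

      -- The norm of i - 1 is 2, which is not divisible by 4.
      i-not-one : ¬ (ℤ.+ 2 ∥ i - 1#)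
      i-not-one (y , Oy , e) with n , e′ ← KA.integral-norm Oy = two-not-unit n (ℤP.*-cancelˡ-≡ (ℤ.+ 2) (ℤ.+ 2 ℤ.* n) 1ℤ (int-injective (prove [] (n ∷ []) (i ∷ bar i ∷ y ∷ bar y ∷ [])
        (ι (con (ℤ.+ 2) ⊗ (con (ℤ.+ 2) ⊗ z₀))) (ι (con (ℤ.+ 2) ⊗ con 1ℤ))
        ( (⊝ con (ℤ.+ 4) ·[ x₂ ⊗ x₃ ≈ ι z₀ by e′ ]· 𝟙) ∷ (⊝ 𝟙 ·[ x₀ ⊖ 𝟙 ≈ con (ℤ.+ 2) ⊗ x₂ by e ]· (con (ℤ.+ 2) ⊗ x₃))
        ∷ (⊝ (x₀ ⊖ 𝟙) ·[ x₁ ⊖ 𝟙 ≈ x₃ ⊗ con (ℤ.+ 2) by trans bar-diff-1 (trans (cong bar e) (trans (bar-* _ _) (cong (bar y *_) (bar-int (ℤ.+ 2))))) ]· 𝟙)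
        ∷ (x₀ ⊖ 𝟙 ·[ x₁ ≈ ⊝ x₀ by bar-i ]· 𝟙) ∷ (⊝ 𝟙 ·[ x₀ ⊗ x₀ ≈ ⊝ 𝟙 by i² ]· 𝟙) ∷ []) refl)))
        where
        bar-diff-1 : bar i - 1# ≡ bar (i - 1#)
        bar-diff-1 = sym (trans (bar-+ _ _) (cong (λ y → bar i + y) (trans (bar-neg _) (cong -_ bar-1))))

      anti-i : ∀ {x} → Anti x → x * i ≡ - (i * x)
      anti-i {x} h = prove [] [] (i ∷ x ∷ r (r x) ∷ []) (x₁ ⊗ x₀) (⊝ (x₀ ⊗ x₁))
        ((𝟙 ·[ x₀ ⊗ x₁ ≈ x₂ ⊗ x₀ by r²-conj x ]· 𝟙) ∷ (𝟙 ·[ x₂ ≈ ⊝ x₁ by h ]· x₀) ∷ []) refl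

      -- When x anticommutes with i, i x (1 + i) = (1 + i) x, so r acts on such x as left
      -- multiplication by i.
      r-anti : ∀ {x} → Anti x → r x ≡ i * x
      r-anti {x} h = *-cancelʳ 1+i≢0 (prove [] [] (i ∷ x ∷ r x ∷ []) (x₂ ⊗ (𝟙 ⊕ x₀)) (x₀ ⊗ x₁ ⊗ (𝟙 ⊕ x₀))
        ((𝟙 ·[ x₂ ⊗ (𝟙 ⊕ x₀) ≈ (𝟙 ⊕ x₀) ⊗ x₁ by r-conj x ]· 𝟙) ∷ (⊝ x₀ ·[ x₁ ⊗ x₀ ≈ ⊝ (x₀ ⊗ x₁) by anti-i h ]· 𝟙) ∷ (𝟙 ·[ x₀ ⊗ x₀ ≈ ⊝ 𝟙 by i² ]· x₁) ∷ []) refl)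

      D-+ : ∀ x y → D (x + y) ≡ D x + D y
      D-+ x y = trans (cong (_- (x + y)) (fun-+ ρ x y)) (prove [] [] (x ∷ y ∷ r x ∷ r y ∷ []) (x₂ ⊕ x₃ ⊖ (x₀ ⊕ x₁)) (x₂ ⊖ x₀ ⊕ (x₃ ⊖ x₁)) [] refl)

      D-diff : ∀ x y → D (x - y) ≡ D x - D y
      D-diff x y = trans (cong (_- (x - y)) (fun-diff ρ x y)) (prove [] [] (x ∷ y ∷ r x ∷ r y ∷ []) (x₂ ⊖ x₃ ⊖ (x₀ ⊖ x₁)) (x₂ ⊖ x₀ ⊖ (x₃ ⊖ x₁)) [] refl)

      D-int* : ∀ k x → D (int k * x) ≡ int k * D x
      D-int* k x = trans (cong (_- int k * x) (trans (fun-* ρ _ _) (cong (_* r x) (fun-int ρ k)))) (prove [] (k ∷ []) (x ∷ r x ∷ []) (ι z₀ ⊗ x₁ ⊖ ι z₀ ⊗ x₀) (ι z₀ ⊗ (x₁ ⊖ x₀)) [] refl)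

      O-D : ∀ {x} → O x → O (D x)
      O-D Ox = O-diff (ρ-O Ox) Ox

      ∥-D : ∀ {x} → ℤ.+ 2 ∥ x → ℤ.+ 2 ∥ D x
      ∥-D h = ∥-diff (∥-fun ρ ρ-O h) h

      D-congruent : ∀ {x y} → ℤ.+ 2 ∥ x - y → ℤ.+ 2 ∥ D y → ℤ.+ 2 ∥ D x
      D-congruent {x} {y} h k = subst (ℤ.+ 2 ∥_) (trans (sym (D-+ (x - y) y)) (cong D (prove [] [] (x ∷ y ∷ []) (x₀ ⊖ x₁ ⊕ x₁) x₀ [] refl))) (∥-+ (∥-D h) k)

      -- Here D x = (i - 1) x and (1 + i)(i - 1) = -2, so y = D x / 2 recovers x as -(1 + i) y.
      divide-1+i : ∀ {x} → Anti x → ℤ.+ 2 ∥ D x → ∃ λ y → O y × x ≡ - ((1# + i) * y) × Anti y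
      divide-1+i {x} h (y , Oy , e) = y , Oy ,
        halve (prove [] [] (i ∷ x ∷ y ∷ r x ∷ []) (con (ℤ.+ 2) ⊗ x₁) (con (ℤ.+ 2) ⊗ ⊝ ((𝟙 ⊕ x₀) ⊗ x₂))
          ((⊝ (𝟙 ⊕ x₀) ·[ x₃ ⊖ x₁ ≈ con (ℤ.+ 2) ⊗ x₂ by e ]· 𝟙) ∷ (𝟙 ⊕ x₀ ·[ x₃ ≈ x₀ ⊗ x₁ by r-anti h ]· 𝟙) ∷ (𝟙 ·[ x₀ ⊗ x₀ ≈ ⊝ 𝟙 by i² ]· x₁) ∷ []) refl) ,
        KA.eigen₋ ρ² (sym e) (trans (fun-diff ρ² (r x) x) (prove [] [] (x ∷ r x ∷ r (r x) ∷ r (r (r x)) ∷ []) (x₃ ⊖ x₂) (⊝ (x₁ ⊖ x₀))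
          ((𝟙 ·[ x₃ ≈ ⊝ x₁ by trans (cong r h) (fun-neg ρ x) ]· 𝟙) ∷ (⊝ 𝟙 ·[ x₂ ≈ ⊝ x₀ by h ]· 𝟙) ∷ []) refl))

      -- The generator w of O on the line of the conjugator of s is negated by r², so it can be
      -- divided by 1 + i twice. As (1 + i)² = 2 i, this puts w/2 into O and contradicts
      -- primitivity.
      r-not-trivial : ¬ (∀ {x} → O x → ℤ.+ 2 ∥ D x)
      r-not-trivial trivial
        with w , Ow , w≢0 , (q , q∈ , e) , generates ← line-basis K.S.β K.S.β≢0
        with aw ← trans (cong (λ y → r (r y)) e) (trans (fun-* ρ² _ _) (trans (cong₂ _*_ (fun-rat ρ² q∈) K.anti) (trans (neg-distribʳ q K.S.β) (cong -_ (sym e)))))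
        with y , Oy , e₁ , ay ← divide-1+i aw (trivial Ow)
        with y′ , Oy′ , e₂ , _ ← divide-1+i ay (trivial Oy)
        with h , h∈ , 2h≡1 ← rat-inverse (rat-int (ℤ.+ 2)) (int-nonzero λ ())
        with 2w ← prove [] [] (i ∷ w ∷ y ∷ y′ ∷ []) x₁ (con (ℤ.+ 2) ⊗ (x₀ ⊗ x₃))
            ((𝟙 ·[ x₁ ≈ ⊝ ((𝟙 ⊕ x₀) ⊗ x₂) by e₁ ]· 𝟙) ∷ (⊝ (𝟙 ⊕ x₀) ·[ x₂ ≈ ⊝ ((𝟙 ⊕ x₀) ⊗ x₃) by e₂ ]· 𝟙) ∷ (𝟙 ·[ x₀ ⊗ x₀ ≈ ⊝ 𝟙 by i² ]· x₃) ∷ []) refl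
        with k , e₃ ← generates (O-* O-i Oy′) (rat-* h∈ q∈) (prove (cen h∈ ∷ cen q∈ ∷ []) [] (i ∷ w ∷ y′ ∷ K.S.β ∷ []) (x₀ ⊗ x₂) (c₀ ⊗ c₁ ⊗ x₃)
            ((⊝ 𝟙 ·[ con (ℤ.+ 2) ⊗ c₀ ≈ 𝟙 by 2h≡1 ]· (x₀ ⊗ x₂)) ∷ (⊝ c₀ ·[ x₁ ≈ con (ℤ.+ 2) ⊗ (x₀ ⊗ x₂) by 2w ]· 𝟙) ∷ (c₀ ·[ x₁ ≈ c₁ ⊗ x₃ by e ]· 𝟙) ∷ []) refl) =
        two-not-unit k (int-injective (*-cancelʳ w≢0 (prove [] (k ∷ []) (i ∷ w ∷ y′ ∷ []) (ι (con (ℤ.+ 2) ⊗ z₀) ⊗ x₁) (con 1ℤ ⊗ x₁)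
          ((⊝ 𝟙 ·[ x₁ ≈ con (ℤ.+ 2) ⊗ (x₀ ⊗ x₂) by 2w ]· 𝟙) ∷ (⊝ con (ℤ.+ 2) ·[ x₀ ⊗ x₂ ≈ ι z₀ ⊗ x₁ by e₃ ]· 𝟙) ∷ []) refl)))

      -- x = p + q i has integral P = 2p = tr x and R = -2q = tr(i x), and P² + R² = 4 nrd x forces
      -- both to be even. This is the integral closedness of ℤ[i].
      gaussian : ∀ {x} → O x → r (r x) ≡ x → ∃₂ λ a b → x ≡ int a + int b * i
      gaussian {x} Ox h
        with p , q , p∈ , q∈ , e ← centralizer i∉ℚ (trans (cong (_* i) (sym h)) (sym (r²-conj x)))
        with P , eP ← KA.integral-trace Ox
        with R , eR ← KA.integral-trace (O-* O-i Ox)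
        with n , en ← KA.integral-norm Ox = conclude (sum-of-squares P R n (int-injective (prove (cen p∈ ∷ cen q∈ ∷ []) (P ∷ R ∷ n ∷ []) (i ∷ x ∷ bar x ∷ bar (i * x) ∷ [])
          (ι (z₀ ⊗ z₀ ⊕ z₁ ⊗ z₁)) (ι (con (ℤ.+ 4) ⊗ z₂))
          ( (ι z₀ ⊕ con (ℤ.+ 2) ⊗ c₀ ·[ ι z₀ ≈ con (ℤ.+ 2) ⊗ c₀ by P≡ ]· 𝟙) ∷ (ι z₁ ⊖ con (ℤ.+ 2) ⊗ c₁ ·[ ι z₁ ≈ ⊝ con (ℤ.+ 2) ⊗ c₁ by R≡ ]· 𝟙)
          ∷ (con (ℤ.+ 4) ·[ x₁ ⊗ x₂ ≈ ι z₂ by en ]· 𝟙) ∷ (⊝ con (ℤ.+ 4) ⊗ x₁ ·[ x₂ ≈ c₀ ⊖ c₁ ⊗ x₀ by bx ]· 𝟙) ∷ (⊝ con (ℤ.+ 4) ·[ x₁ ≈ c₀ ⊕ c₁ ⊗ x₀ by e ]· (c₀ ⊖ c₁ ⊗ x₀))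
          ∷ (con (ℤ.+ 4) ⊗ c₁ ⊗ c₁ ·[ x₀ ⊗ x₀ ≈ ⊝ 𝟙 by i² ]· 𝟙) ∷ []) refl)))
        where
        bx : bar x ≡ p - q * i
        bx = trans (cong bar e) (trans (bar-+ _ _) (cong₂ _+_ (bar-rat p∈) (trans (bar-* _ _) (trans (cong₂ _*_ bar-i (bar-rat q∈)) (trans (neg-distribˡ i q) (cong -_ (sym (rat-central q∈ i))))))))
        P≡ : int P ≡ int (ℤ.+ 2) * p
        P≡ = prove (cen p∈ ∷ cen q∈ ∷ []) (P ∷ []) (i ∷ x ∷ bar x ∷ []) (ι z₀) (con (ℤ.+ 2) ⊗ c₀)
          ((⊝ 𝟙 ·[ x₁ ⊕ x₂ ≈ ι z₀ by eP ]· 𝟙) ∷ (𝟙 ·[ x₁ ≈ c₀ ⊕ c₁ ⊗ x₀ by e ]· 𝟙) ∷ (𝟙 ·[ x₂ ≈ c₀ ⊖ c₁ ⊗ x₀ by bx ]· 𝟙) ∷ []) refl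
        R≡ : int R ≡ - int (ℤ.+ 2) * q
        R≡ = prove (cen p∈ ∷ cen q∈ ∷ []) (R ∷ []) (i ∷ x ∷ bar x ∷ bar (i * x) ∷ bar i ∷ []) (ι z₀) (⊝ con (ℤ.+ 2) ⊗ c₁)
          ( (⊝ 𝟙 ·[ x₀ ⊗ x₁ ⊕ x₃ ≈ ι z₀ by eR ]· 𝟙) ∷ (𝟙 ·[ x₃ ≈ x₂ ⊗ x₄ by bar-* i x ]· 𝟙) ∷ (x₂ ·[ x₄ ≈ ⊝ x₀ by bar-i ]· 𝟙)
          ∷ (⊝ 𝟙 ·[ x₂ ≈ c₀ ⊖ c₁ ⊗ x₀ by bx ]· x₀) ∷ (x₀ ·[ x₁ ≈ c₀ ⊕ c₁ ⊗ x₀ by e ]· 𝟙) ∷ (con (ℤ.+ 2) ⊗ c₁ ·[ x₀ ⊗ x₀ ≈ ⊝ 𝟙 by i² ]· 𝟙) ∷ []) refl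
        conclude : (∃ λ p′ → P ≡ ℤ.+ 2 ℤ.* p′) × (∃ λ q′ → R ≡ ℤ.+ 2 ℤ.* q′) → ∃₂ λ a b → x ≡ int a + int b * i
        conclude ((p′ , eP′) , (q′ , eR′)) = p′ , ℤ.- q′ , halve (prove (cen p∈ ∷ cen q∈ ∷ []) (P ∷ R ∷ p′ ∷ q′ ∷ []) (i ∷ x ∷ [])
          (con (ℤ.+ 2) ⊗ x₁) (con (ℤ.+ 2) ⊗ (ι z₂ ⊕ ι (⊝ z₃) ⊗ x₀))
          ( (con (ℤ.+ 2) ·[ x₁ ≈ c₀ ⊕ c₁ ⊗ x₀ by e ]· 𝟙) ∷ (⊝ 𝟙 ·[ ι z₀ ≈ con (ℤ.+ 2) ⊗ c₀ by P≡ ]· 𝟙) ∷ (𝟙 ·[ ι z₁ ≈ ⊝ con (ℤ.+ 2) ⊗ c₁ by R≡ ]· x₀)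
          ∷ (𝟙 ·[ ι z₀ ≈ ι (con (ℤ.+ 2) ⊗ z₂) by cong int eP′ ]· 𝟙) ∷ (⊝ 𝟙 ·[ ι z₁ ≈ ι (con (ℤ.+ 2) ⊗ z₃) by cong int eR′ ]· x₀) ∷ []) refl)

    -- If r − 1 has rank one modulo 2 then, being nilpotent, it has square zero; hence O splits
    -- into its ±1-eigenspaces for r², and (1 + i)(δ + u)/2 with u² ≡ δ can be adjoined, where
    -- u is an anticommuting element not fixed by r modulo 2.
    module CorankOne (u₀ : A) (Ou₀ : O u₀) (not-fixed : ¬ (ℤ.+ 2 ∥ D u₀)) (dichotomy₀ : ∀ {x} → O x → ℤ.+ 2 ∥ D x ⊎ ℤ.+ 2 ∥ D (x - u₀)) where

      opaque
        -- In the remaining case D(D x) and D x are both congruent to D u₀. Then r (D x) = D(D x) +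
        -- D x ≡ 2 D x ≡ 0, and D x ≡ 0 since r is invertible.
        D² : ∀ {x} → O x → ℤ.+ 2 ∥ D (D x)
        D² {x} Ox with dichotomy₀ (O-D Ox)
        ... | inj₁ h = h
        ... | inj₂ h with dichotomy₀ Ox
        ... | inj₁ k = ∥-D k
        ... | inj₂ k = ∥-D (subst (ℤ.+ 2 ∥_) (fourth (D x)) (∥-fun ρ ρ-O (∥-fun ρ ρ-O (∥-fun ρ ρ-O (subst (ℤ.+ 2 ∥_)
          (prove [] [] (D x ∷ D u₀ ∷ r (D x) ∷ D (D x - u₀) ∷ D (x - u₀) ∷ []) (x₃ ⊖ x₄ ⊕ con (ℤ.+ 2) ⊗ x₀) x₂
            ((𝟙 ·[ x₃ ≈ x₂ ⊖ x₀ ⊖ x₁ by D-diff (D x) u₀ ]· 𝟙) ∷ (⊝ 𝟙 ·[ x₄ ≈ x₀ ⊖ x₁ by D-diff x u₀ ]· 𝟙) ∷ []) refl)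
          (∥-+ (∥-diff h k) (∥-multiple (ℤ.+ 2) (O-D Ox))))))))

        split-anti : ∀ {x} → O x → ∃₂ λ α γ → O α × O γ × x ≡ α + γ × r (r α) ≡ α × Anti γ
        split-anti {x} Ox with y , Oy , e ← D² Ox = x + w , - w , O-+ Ox Ow , O-neg Ow , prove [] [] (x ∷ w ∷ []) x₀ (x₀ ⊕ x₁ ⊕ ⊝ x₁) [] refl ,
          trans (fun-+ ρ² x w) (prove [] [] (x ∷ w ∷ r (r x) ∷ r (r w) ∷ []) (x₂ ⊕ x₃) (x₀ ⊕ x₁)
            ((𝟙 ·[ x₃ ≈ ⊝ x₁ by aw ]· 𝟙) ∷ (⊝ 𝟙 ·[ con (ℤ.+ 2) ⊗ x₁ ≈ x₂ ⊖ x₀ by 2w ]· 𝟙) ∷ []) refl) ,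
          trans (fun-neg ρ² w) (cong -_ aw)
          where
          -- From D² x = 2 y one gets r² x - x = 2 (y + r x - x). Thus x + w and -w are the halves
          -- of x ± r² x.
          w : A
          w = y + r x - x
          Ow : O w
          Ow = O-diff (O-+ Oy (ρ-O Ox)) Ox
          2w : int (ℤ.+ 2) * w ≡ r (r x) - x
          2w = prove [] [] (x ∷ y ∷ r x ∷ r (r x) ∷ r (r x - x) ∷ []) (con (ℤ.+ 2) ⊗ (x₁ ⊕ x₂ ⊖ x₀)) (x₃ ⊖ x₀)
            ((⊝ 𝟙 ·[ x₄ ⊖ (x₂ ⊖ x₀) ≈ con (ℤ.+ 2) ⊗ x₁ by e ]· 𝟙) ∷ (𝟙 ·[ x₄ ≈ x₃ ⊖ x₂ by fun-diff ρ (r x) x ]· 𝟙) ∷ []) refl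
          aw : Anti w
          aw = KA.eigen₋ ρ² 2w (trans (fun-diff ρ² (r (r x)) x) (prove [] [] (x ∷ r (r x) ∷ r (r (r (r x))) ∷ []) (x₂ ⊖ x₁) (⊝ (x₁ ⊖ x₀)) ((𝟙 ·[ x₂ ≈ x₀ by fourth x ]· 𝟙) ∷ []) refl))

        D-fixed : ∀ {α} → r (r α) ≡ α → D α ≡ 0#
        D-fixed {α} h = trans (cong (_- α) (r-commuting (trans (r²-conj α) (cong (_* i) h)))) (-‿inverseʳ α)

      opaque
        contradictory : ⊥
        -- Replacing u₀ by its anticommuting component u changes nothing, since D vanishes on what
        -- r² fixes.
        contradictory with α₀ , u , _ , Ou , e₀ , fα₀ , au ← split-anti Ou₀ = go
          where
          Du : D u₀ ≡ D u
          Du = trans (cong D e₀) (trans (D-+ α₀ u) (trans (cong (_+ D u) (D-fixed fα₀)) (+-identityˡ _)))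
          dichotomy : ∀ {x} → O x → ℤ.+ 2 ∥ D x ⊎ ℤ.+ 2 ∥ D (x - u)
          dichotomy {x} Ox with dichotomy₀ Ox
          ... | inj₁ h = inj₁ h
          ... | inj₂ h = inj₂ (subst (ℤ.+ 2 ∥_) (trans (D-diff x u₀) (trans (cong (λ y → D x - y) Du) (sym (D-diff x u)))) h)
          bar-u : bar u ≡ - u
          bar-u = neg-unique u (halve (trans (prove [] [] (u ∷ bar u ∷ []) (con (ℤ.+ 2) ⊗ (x₀ ⊕ x₁)) (x₀ ⊕ x₁ ⊖ (⊝ x₀ ⊕ ⊝ x₁)) [] refl)
            (trans (cong (λ y → u + bar u - y) traces) (trans (-‿inverseʳ _) (sym (zeroʳ _))))))
            where
            traces : - u + - bar u ≡ u + bar u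
            traces = trans (cong₂ _+_ (sym au) (trans (sym (bar-neg u)) (cong bar (sym au)))) (fun-trace ρ² u)
          u²∈ℚ : Rat (u * u)
          u²∈ℚ = subst Rat (prove [] [] (u ∷ []) (⊝ (x₀ ⊗ ⊝ x₀)) (x₀ ⊗ x₀) [] refl) (rat-neg (subst (λ y → Rat (u * y)) bar-u (nrm u)))
          -- δ is the residue of m = u² modulo 2, chosen so that the norm (δ² - u²)/2 of v becomes
          -- the integer -m′; δ² = δ is used repeatedly.
          decompose : ∀ m → ∃₂ λ δ m′ → m ≡ δ ℤ.+ ℤ.+ 2 ℤ.* m′ × δ ℤ.* δ ≡ δ
          decompose m with parity m
          ... | inj₁ (l , e) = 0ℤ , l , trans e (sym (ℤP.+-identityˡ _)) , refl
          ... | inj₂ (l , e) = 1ℤ , l , e , refl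
          go : ⊥
          go with m , em ← rational-integer (O-* Ou Ou) u²∈ℚ with δ , m′ , m≡ , δ² ← decompose m with v , 2v ← half ((1# + i) * (int δ + u)) =
            not-fixed (subst (ℤ.+ 2 ∥_) (trans (neg-involutive _) (sym Du)) (∥-neg (subst (ℤ.+ 2 ∥_) DDv (D² Ov))))
            where
            open Neighbour v
            u²≡ : u * u ≡ int (δ ℤ.+ ℤ.+ 2 ℤ.* m′)
            u²≡ = trans em (cong int m≡)
            zs : List ℤ
            zs = δ ∷ m′ ∷ []
            xs : List A
            xs = i ∷ u ∷ v ∷ bar v ∷ []
            bar-v : int (ℤ.+ 2) * bar v ≡ (int δ - u) * (1# - i)
            bar-v = trans (int-central (ℤ.+ 2) (bar v)) (trans (cong (bar v *_) (sym (bar-int (ℤ.+ 2)))) (trans (sym (bar-* _ _)) (trans (cong bar 2v)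
              (trans (bar-* _ _) (cong₂ _*_ (trans (bar-+ _ _) (cong₂ _+_ (bar-int δ) bar-u)) (trans (bar-+ _ _) (cong₂ _+_ bar-1 bar-i)))))))
            ui : u * i ≡ - (i * u)
            ui = anti-i au
            trace-v : v + bar v ≡ int δ
            trace-v = halve (prove [] zs xs (con (ℤ.+ 2) ⊗ (x₂ ⊕ x₃)) (con (ℤ.+ 2) ⊗ ι z₀)
              ( (𝟙 ·[ con (ℤ.+ 2) ⊗ x₂ ≈ (𝟙 ⊕ x₀) ⊗ (ι z₀ ⊕ x₁) by 2v ]· 𝟙) ∷ (𝟙 ·[ con (ℤ.+ 2) ⊗ x₃ ≈ (ι z₀ ⊖ x₁) ⊗ (𝟙 ⊖ x₀) by bar-v ]· 𝟙)
              ∷ (𝟙 ·[ x₁ ⊗ x₀ ≈ ⊝ (x₀ ⊗ x₁) by ui ]· 𝟙) ∷ []) refl)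
            int-δ² : int (δ ℤ.* δ) ≡ int δ
            int-δ² = cong int δ²
            norm-v : v * bar v ≡ int (ℤ.- m′)
            norm-v = halve (halve (prove [] zs xs (con (ℤ.+ 2) ⊗ (con (ℤ.+ 2) ⊗ (x₂ ⊗ x₃))) (con (ℤ.+ 2) ⊗ (con (ℤ.+ 2) ⊗ ι (⊝ z₁)))
              ( (con (ℤ.+ 2) ⊗ x₂ ·[ con (ℤ.+ 2) ⊗ x₃ ≈ (ι z₀ ⊖ x₁) ⊗ (𝟙 ⊖ x₀) by bar-v ]· 𝟙)
              ∷ (𝟙 ·[ con (ℤ.+ 2) ⊗ x₂ ≈ (𝟙 ⊕ x₀) ⊗ (ι z₀ ⊕ x₁) by 2v ]· ((ι z₀ ⊖ x₁) ⊗ (𝟙 ⊖ x₀)))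
              ∷ (⊝ (𝟙 ⊕ x₀) ·[ x₁ ⊗ x₁ ≈ ι (z₀ ⊕ con (ℤ.+ 2) ⊗ z₁) by u²≡ ]· (𝟙 ⊖ x₀))
              ∷ (con (ℤ.+ 2) ·[ ι (z₀ ⊗ z₀) ≈ ι z₀ by int-δ² ]· 𝟙)
              ∷ (⊝ (ι (z₀ ⊗ z₀) ⊖ ι (z₀ ⊕ con (ℤ.+ 2) ⊗ z₁)) ·[ x₀ ⊗ x₀ ≈ ⊝ 𝟙 by i² ]· 𝟙) ∷ []) refl))
            vi : v * i ≡ int -[1+ 0 ] * v + (i * int δ + u)
            vi = halve (prove [] zs xs (con (ℤ.+ 2) ⊗ (x₂ ⊗ x₀)) (con (ℤ.+ 2) ⊗ (con -[1+ 0 ] ⊗ x₂ ⊕ (x₀ ⊗ ι z₀ ⊕ x₁)))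
              ( (𝟙 ·[ con (ℤ.+ 2) ⊗ x₂ ≈ (𝟙 ⊕ x₀) ⊗ (ι z₀ ⊕ x₁) by 2v ]· (x₀ ⊕ 𝟙)) ∷ (𝟙 ⊕ x₀ ·[ x₁ ⊗ x₀ ≈ ⊝ (x₀ ⊗ x₁) by ui ]· 𝟙)
              ∷ (𝟙 ·[ x₀ ⊗ x₀ ≈ ⊝ 𝟙 by i² ]· (ι z₀ ⊖ x₁)) ∷ []) refl)
            vu : v * u ≡ int δ * v + int m′ * (1# + i)
            vu = halve (prove [] zs xs (con (ℤ.+ 2) ⊗ (x₂ ⊗ x₁)) (con (ℤ.+ 2) ⊗ (ι z₀ ⊗ x₂ ⊕ ι z₁ ⊗ (𝟙 ⊕ x₀)))
              ( (𝟙 ·[ con (ℤ.+ 2) ⊗ x₂ ≈ (𝟙 ⊕ x₀) ⊗ (ι z₀ ⊕ x₁) by 2v ]· (x₁ ⊖ ι z₀)) ∷ (𝟙 ⊕ x₀ ·[ x₁ ⊗ x₁ ≈ ι (z₀ ⊕ con (ℤ.+ 2) ⊗ z₁) by u²≡ ]· 𝟙)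
              ∷ (⊝ (𝟙 ⊕ x₀) ·[ ι (z₀ ⊗ z₀) ≈ ι z₀ by int-δ² ]· 𝟙) ∷ []) refl)
            -- (1 + i) δ (1 + i) = 2 i δ and (1 + i) u (1 + i) = (1 + i)(1 - i) u = 2 u. The factor
            -- 1 + i thus absorbs the denominator of v, which settles the γ divisible by 1 + i.
            v1+i : ∀ y → v * ((1# + i) * y) ≡ i * int δ * y + u * y
            v1+i y = halve (prove [] zs (i ∷ u ∷ v ∷ y ∷ []) (con (ℤ.+ 2) ⊗ (x₂ ⊗ ((𝟙 ⊕ x₀) ⊗ x₃))) (con (ℤ.+ 2) ⊗ (x₀ ⊗ ι z₀ ⊗ x₃ ⊕ x₁ ⊗ x₃))
              ( (𝟙 ·[ con (ℤ.+ 2) ⊗ x₂ ≈ (𝟙 ⊕ x₀) ⊗ (ι z₀ ⊕ x₁) by 2v ]· ((𝟙 ⊕ x₀) ⊗ x₃)) ∷ (𝟙 ⊕ x₀ ·[ x₁ ⊗ x₀ ≈ ⊝ (x₀ ⊗ x₁) by ui ]· x₃)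
              ∷ (𝟙 ·[ x₀ ⊗ x₀ ≈ ⊝ 𝟙 by i² ]· ((ι z₀ ⊖ x₁) ⊗ x₃)) ∷ []) refl)
            O-1+i : O (1# + i)
            O-1+i = O-+ O-1 O-i
            near-divisible : ∀ {γ} → Anti γ → ℤ.+ 2 ∥ D γ → v * γ ∈O+ℤv
            near-divisible aγ h with y , Oy , e , _ ← divide-1+i aγ h = inO (subst O (sym (trans (cong (v *_) e) (trans (neg-distribʳ v _) (cong -_ (v1+i y)))))
              (O-neg (O-+ (O-* (O-* O-i (O-int δ)) Oy) (O-* Ou Oy))))
            near-u : v * u ∈O+ℤv
            near-u = δ , int m′ * (1# + i) , O-int* m′ O-1+i , vu
            near-anti : ∀ {γ} → O γ → Anti γ → v * γ ∈O+ℤv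
            near-anti {γ} Oγ aγ with dichotomy Oγ
            ... | inj₁ h = near-divisible aγ h
            ... | inj₂ h = subst _∈O+ℤv (prove [] [] (v ∷ γ ∷ u ∷ []) (x₀ ⊗ (x₁ ⊖ x₂) ⊕ x₀ ⊗ x₂) (x₀ ⊗ x₁) [] refl)
              (sum∈ (near-divisible (trans (fun-diff ρ² γ u) (trans (cong₂ _-_ aγ au) (sym (neg-+ γ (- u))))) h) near-u)
            near : ∀ {x} → O x → v * x ∈O+ℤv
            near {x} Ox with α , γ , Oα , Oγ , refl , fα , aγ ← split-anti Ox with a , b , refl ← gaussian Oα fα = subst _∈O+ℤv
              (prove [] (a ∷ b ∷ []) (i ∷ v ∷ γ ∷ []) (ι z₀ ⊗ x₁ ⊕ ι z₁ ⊗ (x₁ ⊗ x₀) ⊕ x₁ ⊗ x₂) (x₁ ⊗ (ι z₀ ⊕ ι z₁ ⊗ x₀ ⊕ x₂)) [] refl)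
              (sum∈ (sum∈ (int*∈ a inv) (int*∈ b (-[1+ 0 ] , i * int δ + u , O-+ (O-* O-i (O-int δ)) Ou , vi))) (near-anti Oγ aγ))
            Ov : O v
            Ov = integral-neighbour KA.O-bar δ (ℤ.- m′) trace-v norm-v near
            -- Once v lies in O, D² v = -D u is divisible by 2, contrary to the choice of u₀.
            Dv : D v ≡ - u
            Dv = halve (prove [] (δ ∷ []) (i ∷ u ∷ v ∷ r v ∷ r ((1# + i) * (int δ + u)) ∷ []) (con (ℤ.+ 2) ⊗ (x₃ ⊖ x₂)) (con (ℤ.+ 2) ⊗ ⊝ x₁)
              ( (𝟙 ·[ con (ℤ.+ 2) ⊗ x₃ ≈ x₄ by trans (sym (KA.scaled ρ)) (cong r 2v) ]· 𝟙) ∷ (⊝ 𝟙 ·[ con (ℤ.+ 2) ⊗ x₂ ≈ (𝟙 ⊕ x₀) ⊗ (ι z₀ ⊕ x₁) by 2v ]· 𝟙)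
              ∷ (𝟙 ·[ x₄ ≈ (𝟙 ⊕ x₀) ⊗ (ι z₀ ⊕ x₀ ⊗ x₁) by trans (fun-* ρ _ _) (cong₂ _*_ (trans (fun-+ ρ _ _) (cong₂ _+_ (fun-1 ρ) r-i)) (trans (fun-+ ρ _ _) (cong₂ _+_ (fun-int ρ δ) (r-anti au)))) ]· 𝟙)
              ∷ (𝟙 ·[ x₀ ⊗ x₀ ≈ ⊝ 𝟙 by i² ]· x₁) ∷ []) refl)
            DDv : D (D v) ≡ - D u
            DDv = trans (cong D Dv) (trans (cong (_- (- u)) (fun-neg ρ u)) (sym (neg-+ (r u) (- u))))

    opaque
      -- If u₀ is itself fixed by r modulo 2, then r is trivial there; otherwise only the parity of
      -- k matters, which gives the dichotomy for `CorankOne`.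
      not-corank-one : ∀ u₀ → O u₀ → ¬ (∀ {x} → O x → ∃ λ k → ℤ.+ 2 ∥ D (x - int k * u₀))
      not-corank-one u₀ Ou₀ h with ∥? (ℤ.+ 2) (O-D Ou₀)
      ... | yes fixed = r-not-trivial λ {x} Ox → let k , h′ = h Ox in subst (ℤ.+ 2 ∥_)
        (trans (cong (λ y → D (x - int k * u₀) + y) (sym (D-int* k u₀))) (trans (sym (D-+ _ _)) (cong D (prove [] (k ∷ []) (x ∷ u₀ ∷ []) (x₀ ⊖ ι z₀ ⊗ x₁ ⊕ ι z₀ ⊗ x₁) x₀ [] refl))))
        (∥-+ h′ (∥-int* k fixed))
      ... | no not-fixed = CorankOne.contradictory u₀ Ou₀ not-fixed dichotomy
        where
        dichotomy : ∀ {x} → O x → ℤ.+ 2 ∥ D x ⊎ ℤ.+ 2 ∥ D (x - u₀)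
        dichotomy {x} Ox with h Ox
        ... | k , h′ with parity k
        ... | inj₁ (l , refl) = inj₁ (D-congruent (l′ , O-int* l Ou₀ , prove [] (l ∷ []) (x ∷ u₀ ∷ []) (x₀ ⊖ (x₀ ⊖ ι (con (ℤ.+ 2) ⊗ z₀) ⊗ x₁)) (con (ℤ.+ 2) ⊗ (ι z₀ ⊗ x₁)) [] refl) h′)
          where
          l′ : A
          l′ = int l * u₀
        ... | inj₂ (l , refl) = inj₂ (D-congruent (l′ , O-int* l Ou₀ , prove [] (l ∷ []) (x ∷ u₀ ∷ []) (x₀ ⊖ x₁ ⊖ (x₀ ⊖ ι (con 1ℤ ⊕ con (ℤ.+ 2) ⊗ z₀) ⊗ x₁)) (con (ℤ.+ 2) ⊗ (ι z₀ ⊗ x₁)) [] refl) h′)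
          where
          l′ : A
          l′ = int l * u₀

-- Extension to the algebra and actions of dihedral groups.

module Representations (Q : QuaternionDivisionAlgebra) (O : QuaternionDivisionAlgebra.A Q → Set) (order : Lattices.MaximalOrder Q O) where
  open DihedralFourAction Q O order public
  open Parity

  -- A ring endomorphism φ of O extends to the algebra by x ↦ φ(d x) / d.
  module Extend (φ : A → A) (φ-O : ∀ {x} → O x → O (φ x)) (φ-+ : ∀ {x y} → O x → O y → φ (x + y) ≡ φ x + φ y)
    (φ-* : ∀ {x y} → O x → O y → φ (x * y) ≡ φ x * φ y) (φ-1 : φ 1# ≡ 1#) where

    opaque
      extension : A → A
      extension x = let d , d≢0 , _ = full x in proj₁ (inverse (int d) (int-nonzero d≢0)) * φ (int d * x)

      φ-pos : ∀ n → φ (int (ℤ.+ n)) ≡ int (ℤ.+ n)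
      φ-pos zero = trans (cong φ int-0) (trans (+-cancelˡ (φ 0#) (trans (sym (φ-+ O-0 O-0)) (trans (cong φ (+-identityʳ 0#)) (sym (+-identityʳ _))))) (sym int-0))
      φ-pos (suc n) = trans (cong φ (int-+ 1ℤ (ℤ.+ n))) (trans (φ-+ (O-int 1ℤ) (O-int (ℤ.+ n)))
        (trans (cong₂ _+_ (trans (cong φ int-1) (trans φ-1 (sym int-1))) (φ-pos n)) (sym (int-+ 1ℤ (ℤ.+ n)))))

      φ-int : ∀ k → φ (int k) ≡ int k
      φ-int (ℤ.+ n) = φ-pos n
      φ-int -[1+ n ] = +-cancelˡ (φ (int (ℤ.+ suc n))) (trans (sym (φ-+ (O-int (ℤ.+ suc n)) (O-int -[1+ n ])))
        (trans (cong φ zero-sum) (trans (φ-int-0) (trans (sym zero-sum) (cong (_+ int -[1+ n ]) (sym (φ-pos (suc n))))))))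
        where
        zero-sum : int (ℤ.+ suc n) + int -[1+ n ] ≡ int 0ℤ
        zero-sum = trans (sym (int-+ (ℤ.+ suc n) -[1+ n ])) (cong int (ℤP.+-inverseʳ (ℤ.+ suc n)))
        φ-int-0 : φ (int 0ℤ) ≡ int 0ℤ
        φ-int-0 = φ-pos 0

      φ-int* : ∀ k {x} → O x → φ (int k * x) ≡ int k * φ x
      φ-int* k Ox = trans (φ-* (O-int k) Ox) (cong (_* φ _) (φ-int k))

      -- The value does not depend on the denominator chosen by `full`, so a common denominator may
      -- be used for sums and products.
      scaled-extension : ∀ k {x} → O (int k * x) → int k * extension x ≡ φ (int k * x)
      scaled-extension k {x} Okx with full x
      ... | d , d≢0 , Odx with inverse (int d) (int-nonzero d≢0)
      ... | e , de≡1 , _ = int-cancel d d≢0 (begin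
        int d * (int k * (e * φ (int d * x)))   ≡⟨ prove [] (d ∷ k ∷ []) (e ∷ φ (int d * x) ∷ []) (ι z₀ ⊗ (ι z₁ ⊗ (x₀ ⊗ x₁))) (ι z₁ ⊗ x₁) ((ι z₁ ·[ ι z₀ ⊗ x₀ ≈ 𝟙 by de≡1 ]· x₁) ∷ []) refl ⟩
        int k * φ (int d * x)                   ≡⟨ φ-int* k Odx ⟨
        φ (int k * (int d * x))                 ≡⟨ cong φ (prove [] (d ∷ k ∷ []) (x ∷ []) (ι z₁ ⊗ (ι z₀ ⊗ x₀)) (ι z₀ ⊗ (ι z₁ ⊗ x₀)) [] refl) ⟩
        φ (int d * (int k * x))                 ≡⟨ φ-int* d Okx ⟩
        int d * φ (int k * x)                   ∎)
        where open ≡-Reasoning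

    opaque
      agrees : ∀ {x} → O x → extension x ≡ φ x
      agrees {x} Ox = trans (sym (trans (cong (_* extension x) int-1) (*-identityˡ _)))
        (trans (scaled-extension 1ℤ (O-int* 1ℤ Ox)) (cong φ (trans (cong (_* x) int-1) (*-identityˡ x))))

      extension-+ : ∀ x y → extension (x + y) ≡ extension x + extension y
      extension-+ x y with d , d≢0 , Odx ← full x with e , e≢0 , Oey ← full y =
        int-cancel (d ℤ.* e) (λ h → [ d≢0 , e≢0 ]′ (ℤP.i*j≡0⇒i≡0∨j≡0 d h)) (begin
          int k * extension (x + y)             ≡⟨ scaled-extension k (subst O (sym (distribˡ (int k) x y)) (O-+ Okx Oky)) ⟩
          φ (int k * (x + y))                   ≡⟨ trans (cong φ (distribˡ (int k) x y)) (φ-+ Okx Oky) ⟩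
          φ (int k * x) + φ (int k * y)         ≡⟨ cong₂ _+_ (scaled-extension k Okx) (scaled-extension k Oky) ⟨
          int k * extension x + int k * extension y ≡⟨ distribˡ _ _ _ ⟨
          int k * (extension x + extension y)   ∎)
        where
        open ≡-Reasoning
        k : ℤ
        k = d ℤ.* e
        Okx : O (int k * x)
        Okx = subst O (prove [] (d ∷ e ∷ []) (x ∷ []) (ι z₁ ⊗ (ι z₀ ⊗ x₀)) (ι (z₀ ⊗ z₁) ⊗ x₀) [] refl) (O-int* e Odx)
        Oky : O (int k * y)
        Oky = subst O (prove [] (d ∷ e ∷ []) (y ∷ []) (ι z₀ ⊗ (ι z₁ ⊗ x₀)) (ι (z₀ ⊗ z₁) ⊗ x₀) [] refl) (O-int* d Oey)

      extension-* : ∀ x y → extension (x * y) ≡ extension x * extension y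
      extension-* x y with d , d≢0 , Odx ← full x with e , e≢0 , Oey ← full y =
        int-cancel (d ℤ.* e) (λ h → [ d≢0 , e≢0 ]′ (ℤP.i*j≡0⇒i≡0∨j≡0 d h)) (begin
          int (d ℤ.* e) * extension (x * y)     ≡⟨ scaled-extension (d ℤ.* e) (subst O product (O-* Odx Oey)) ⟩
          φ (int (d ℤ.* e) * (x * y))           ≡⟨ trans (cong φ (sym product)) (φ-* Odx Oey) ⟩
          φ (int d * x) * φ (int e * y)         ≡⟨ cong₂ _*_ (scaled-extension d Odx) (scaled-extension e Oey) ⟨
          int d * extension x * (int e * extension y) ≡⟨ prove [] (d ∷ e ∷ []) (extension x ∷ extension y ∷ []) (ι z₀ ⊗ x₀ ⊗ (ι z₁ ⊗ x₁)) (ι (z₀ ⊗ z₁) ⊗ (x₀ ⊗ x₁)) [] refl ⟩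
          int (d ℤ.* e) * (extension x * extension y) ∎)
        where
        open ≡-Reasoning
        product : int d * x * (int e * y) ≡ int (d ℤ.* e) * (x * y)
        product = prove [] (d ∷ e ∷ []) (x ∷ y ∷ []) (ι z₀ ⊗ x₀ ⊗ (ι z₁ ⊗ x₁)) (ι (z₀ ⊗ z₁) ⊗ (x₀ ⊗ x₁)) [] refl

    automorphism : Automorphism
    automorphism = record { fun = extension ; fun-+ = extension-+ ; fun-* = extension-* ; fun-1 = trans (agrees O-1) φ-1 }

    opaque
      preserves : Preserves automorphism
      preserves Ox = subst O (sym (agrees Ox)) (φ-O Ox)

  opaque
    extensionality : ∀ {f g : A → A} → (∀ k x → f (int k * x) ≡ int k * f x) → (∀ k x → g (int k * x) ≡ int k * g x) →
      (∀ {x} → O x → f x ≡ g x) → ∀ x → f x ≡ g x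
    extensionality {f} {g} f-int g-int h x with d , d≢0 , Odx ← full x = int-cancel d d≢0 (trans (sym (f-int d x)) (trans (h Odx) (g-int d x)))

    fun-int* : ∀ σ k x → fun σ (int k * x) ≡ int k * fun σ x
    fun-int* σ k x = trans (fun-* σ _ _) (cong (_* fun σ x) (fun-int σ k))

  record DihedralAction (n : ℕ) .{{_ : NonZero n}} : Set where
    field
      act : Dih n → Automorphism
      act-O : ∀ g → Preserves (act g)
      act-e : ∀ x → fun (act (dih-e n)) x ≡ x
      act-* : ∀ g h x → fun (act (dih-mul n g h)) x ≡ fun (act g) (fun (act h) x)
      faithful : ∀ g h → (∀ x → fun (act g) x ≡ fun (act h) x) → g ≡ h

    Fixed : ℤ → A → Set
    Fixed N x = ∀ g → N ∥ fun (act g) x - x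

    opaque
      fixed-int : ∀ {N} k → Fixed N (int k)
      fixed-int k g = ∥-equal (fun-int (act g) k)

      fixed-1 : ∀ {N} → Fixed N 1#
      fixed-1 {N} = subst (Fixed N) int-1 (fixed-int 1ℤ)

      fixed-e : ∀ {N x} → N ∥ fun (act (dih-e n)) x - x
      fixed-e {x = x} = ∥-equal (act-e x)

      fixed-* : ∀ {N x} g h → N ∥ fun (act g) x - x → N ∥ fun (act h) x - x → N ∥ fun (act (dih-mul n g h)) x - x
      fixed-* {N} {x} g h p q = subst (λ y → N ∥ y - x) (sym (act-* g h x)) (fixed-twice (act g) (act h) (act-O g) p q)

      fixed-subspace : ∀ N → ModSubspace N (Fixed N)
      fixed-subspace N = record
        { add = λ {x} {y} _ _ p q g → subst (N ∥_) (sym (trans (cong (_- (x + y)) (fun-+ (act g) x y))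
            (prove [] [] (x ∷ y ∷ fun (act g) x ∷ fun (act g) y ∷ []) (x₂ ⊕ x₃ ⊖ (x₀ ⊕ x₁)) (x₂ ⊖ x₀ ⊕ (x₃ ⊖ x₁)) [] refl))) (∥-+ (p g) (q g))
        ; scale = λ k {x} _ p g → subst (N ∥_) (sym (trans (cong (_- int k * x) (fun-int* (act g) k x))
            (prove [] (k ∷ []) (x ∷ fun (act g) x ∷ []) (ι z₀ ⊗ x₁ ⊖ ι z₀ ⊗ x₀) (ι z₀ ⊗ (x₁ ⊖ x₀)) [] refl))) (∥-int* k (p g))
        ; multiple = λ h g → ∥-diff (∥-fun (act g) (act-O g) h) h
        ; dec = λ Ox → dec-all (λ g → ∥? N (O-diff (act-O g Ox) Ox)) }
        where
        dec-all : {P : Dih n → Set} → (∀ g → Dec (P g)) → Dec (∀ g → P g)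
        dec-all d with all? (λ i → d (i , false)) | all? (λ i → d (i , true))
        ... | yes p | yes q = yes λ { (i , false) → p i ; (i , true) → q i }
        ... | no h | _ = no λ p → h λ i → p (i , false)
        ... | _ | no h = no λ p → h λ i → p (i , true)

    involution : ∀ g → dih-mul n g g ≡ dih-e n → g ≢ dih-e n → Involution
    involution g gg≡e g≢e = record
      { σ = act g
      ; involutive = λ x → trans (sym (act-* g g x)) (trans (cong (λ h → fun (act h) x) gg≡e) (act-e x))
      ; nontrivial = λ h → g≢e (faithful g (dih-e n) λ x → trans (h x) (sym (act-e x))) }

    opaque
      act-≡ : ∀ {g h} → g ≡ h → ∀ x → fun (act g) x ≡ fun (act h) x
      act-≡ refl x = refl

      act-nontrivial : ∀ g → g ≢ dih-e n → Nontrivial (act g)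
      act-nontrivial g g≢e h = g≢e (faithful g (dih-e n) λ x → trans (h x) (sym (act-e x)))

    klein-four : ∀ g h (gg : dih-mul n g g ≡ dih-e n) (hh : dih-mul n h h ≡ dih-e n) (g≢e : g ≢ dih-e n) (h≢e : h ≢ dih-e n) →
      dih-mul n g h ≡ dih-mul n h g → h ≢ g → KleinFour
    klein-four g h gg hh g≢e h≢e gh≡hg h≢g = record
      { S = involution g gg g≢e ; R = involution h hh h≢e
      ; commute = λ x → trans (sym (act-* g h x)) (trans (act-≡ gh≡hg x) (act-* h g x))
      ; distinct = λ eq → h≢g (faithful h g eq) }

    dihedral-three : ∀ s r (ss : dih-mul n s s ≡ dih-e n) (s≢e : s ≢ dih-e n) → dih-mul n r (dih-mul n r r) ≡ dih-e n → r ≢ dih-e n →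
      dih-mul n s r ≡ dih-mul n r (dih-mul n r s) → DihedralThree
    dihedral-three s r ss s≢e rrr r≢e srs = record
      { S = involution s ss s≢e ; S-O = act-O s ; ρ = act r ; ρ-O = act-O r
      ; cube = λ x → trans (cong (fun (act r)) (sym (act-* r r x))) (trans (sym (act-* r (dih-mul n r r) x)) (trans (act-≡ rrr x) (act-e x)))
      ; nontrivial = act-nontrivial r r≢e
      ; inverts = λ x → trans (sym (act-* s r x)) (trans (act-≡ srs x) (trans (act-* r _ x) (cong (fun (act r)) (act-* r s x)))) }

    module Basis (p : ℕ) .{{_ : NonZero p}} (inv : ∀ k → (∃ λ l → k ≡ ℤ.+ p ℤ.* l) ⊎ (∃₂ λ m l → m ℤ.* k ≡ 1ℤ ℤ.+ ℤ.+ p ℤ.* l)) =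
      Chart p inv (fixed-subspace (ℤ.+ p)) basis O-lin (λ v → ∥-coordinates v) (λ Ox _ → proj₁ (coordinates Ox) , ∥-equal (proj₂ (coordinates Ox)))

    module RankTwo (not-small : ¬ Small (Fixed (ℤ.+ 2))) where
      open Basis 2 invertible₂ public

      opaque
        rank-bounds : C.rank ≡ 2 ⊎ C.rank ≡ 3 ⊎ C.rank ≡ 4
        rank-bounds = go C.rank refl
          where
          go : ∀ m → C.rank ≡ m → C.rank ≡ 2 ⊎ C.rank ≡ 3 ⊎ C.rank ≡ 4
          go 0 e = ⊥-elim (rank-zero {2} {Fixed (ℤ.+ 2)} ℕP.≤-refl fixed-1 (subst (FixedIso (ℤ.+ 2) (Fixed (ℤ.+ 2))) e iso))
          go 1 e = ⊥-elim (not-small (rank-one-small {Fixed (ℤ.+ 2)} fixed-1 (subst (FixedIso (ℤ.+ 2) (Fixed (ℤ.+ 2))) e iso)))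
          go 2 e = inj₁ e
          go 3 e = inj₂ (inj₁ e)
          go 4 e = inj₂ (inj₂ e)
          go (suc (suc (suc (suc (suc m))))) e = contradiction (subst (_≤ 4) e C.rank≤) λ { (s≤s (s≤s (s≤s (s≤s ())))) }

        iso-of-rank : ∀ {m} → C.rank ≡ m → FixedIso (ℤ.+ 2) (Fixed (ℤ.+ 2)) m
        iso-of-rank e = subst (FixedIso (ℤ.+ 2) (Fixed (ℤ.+ 2))) e iso

        all-fixed : C.rank ≡ 4 → ∀ {x} → O x → Fixed (ℤ.+ 2) x
        all-fixed e Ox with v , refl ← coordinates Ox = C.full e v

        corank-one : C.rank ≡ 3 → ∃ λ u → O u × (∀ {x} → O x → ∃ λ k → Fixed (ℤ.+ 2) (x - int k * u))
        corank-one e with u , h ← C.corank-one (cong suc e) = lin u basis , O-lin u , result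
          where
          result : ∀ {x} → O x → ∃ λ k → Fixed (ℤ.+ 2) (x - int k * lin u basis)
          result Ox with v , refl ← coordinates Ox with k , h′ ← h v = k , subst (Fixed (ℤ.+ 2))
            (trans (lin-+ v ((ℤ.- k) ·ᵥ u) basis) (trans (cong (λ y → lin v basis + y) (lin-· (ℤ.- k) u basis))
              (prove [] (k ∷ []) (lin v basis ∷ lin u basis ∷ []) (x₀ ⊕ ι (⊝ z₀) ⊗ x₁) (x₀ ⊖ ι z₀ ⊗ x₁) [] refl))) h′

  opaque
    inverse-* : ∀ {N k l} → InverseMod N k → InverseMod N l → InverseMod N (k ℤ.* l)
    -- The cofactor of N comes from (1 - i N)(1 - j N) = 1 - (i + j - i j N) N.
    inverse-* {N} {k} {l} (m , i , e) (m′ , j , e′) = m ℤ.* m′ , i ℤ.+ j ℤ.- i ℤ.* j ℤ.* N ,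
      ℤSolve.prove [] (N ∷ k ∷ l ∷ m ∷ i ∷ m′ ∷ j ∷ []) [] (ι (z₃ ⊗ z₅ ⊗ (z₁ ⊗ z₂) ⊕ (z₄ ⊕ 𝕫 6 ⊖ z₄ ⊗ 𝕫 6 ⊗ z₀) ⊗ z₀)) (ι (con 1ℤ))
        ( (ι (z₅ ⊗ z₂) ℤSolve.·[ ι (z₃ ⊗ z₁ ⊕ z₄ ⊗ z₀) ≈ ι (con 1ℤ) by e ]· 𝟙)
        ∷ (𝟙 ⊖ ι (z₄ ⊗ z₀) ℤSolve.·[ ι (z₅ ⊗ z₂ ⊕ 𝕫 6 ⊗ z₀) ≈ ι (con 1ℤ) by e′ ]· 𝟙) ∷ []) refl

    inverse-of-coprime : ∀ {N k} → Coprime N k → InverseMod (ℤ.+ N) (ℤ.+ k)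
    inverse-of-coprime {N} {k} c with coprime-Bézout c
    ... | Bézout.+- x y e = ℤ.- ℤ.+ y , ℤ.+ x , ℤSolve.prove [] (ℤ.+ N ∷ ℤ.+ k ∷ ℤ.+ x ∷ ℤ.+ y ∷ []) [] (ι (⊝ z₃ ⊗ z₁ ⊕ z₂ ⊗ z₀)) (ι (con 1ℤ))
      ((⊝ 𝟙 ℤSolve.·[ ι (con 1ℤ ⊕ z₃ ⊗ z₁) ≈ ι (z₂ ⊗ z₀) by nat-eq 1 y k x N e ]· 𝟙) ∷ []) refl
    ... | Bézout.-+ x y e = ℤ.+ y , ℤ.- ℤ.+ x , ℤSolve.prove [] (ℤ.+ N ∷ ℤ.+ k ∷ ℤ.+ x ∷ ℤ.+ y ∷ []) [] (ι (z₃ ⊗ z₁ ⊕ ⊝ z₂ ⊗ z₀)) (ι (con 1ℤ))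
      ((⊝ 𝟙 ℤSolve.·[ ι (con 1ℤ ⊕ z₂ ⊗ z₀) ≈ ι (z₃ ⊗ z₁) by nat-eq 1 x N y k e ]· 𝟙) ∷ []) refl

    inverse-2-mod-3 : InverseMod (ℤ.+ 3) (ℤ.+ 2)
    inverse-2-mod-3 = -[1+ 0 ] , 1ℤ , refl

  -- Fixed points for D₁, D₂, D₃, D₄ and D₆.

  module D₁ (X : DihedralAction 1) where
    open DihedralAction X

    S : Involution
    S = involution (zero , true) refl λ ()

    module I = Involution S

    opaque
      fixed-if : ∀ {N x} → N ∥ I.s x - x → Fixed N x
      fixed-if h (zero , false) = fixed-e
      fixed-if h (zero , true) = h

      odd : ∀ {N} → InverseMod N (ℤ.+ 2) → FixedIso N (Fixed N) 2
      odd inv = OneInvolution.odd-modulus S (act-O _) inv (λ p → p (zero , true)) (λ e → fixed-if (∥-equal e))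

      two : FixedIso (ℤ.+ 2) (Fixed (ℤ.+ 2)) 2 ⊎ FixedIso (ℤ.+ 2) (Fixed (ℤ.+ 2)) 3 ⊎ FixedIso (ℤ.+ 2) (Fixed (ℤ.+ 2)) 4
      two = Sum.map R.iso-of-rank (Sum.map R.iso-of-rank R.iso-of-rank) R.rank-bounds
        where module R = RankTwo (λ small → involution-not-small S (act-O _) λ Ox h → small Ox (fixed-if h))

  opaque
    klein-odd : ∀ {n} .{{_ : NonZero n}} (X : DihedralAction n) (K : KleinFour) →
      Preserves (Involution.σ (KleinFour.S K)) → Preserves (Involution.σ (KleinFour.R K)) → ∀ {N} → N ≢ 0ℤ → InverseMod N (ℤ.+ 2) →
      (∀ {x} → DihedralAction.Fixed X N x → N ∥ KleinFour.s K x - x × N ∥ KleinFour.r K x - x) → FixedIso N (DihedralAction.Fixed X N) 1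
    klein-odd X K S-O R-O N≢0 inv h = units-by-averaging N≢0 (inverse-* inv inv) (DihedralAction.fixed-int X)
      (λ Ox p → KleinAction.average K S-O R-O Ox (proj₁ (h p)) (proj₂ (h p)))

  module D₂ (X : DihedralAction 2) where
    open DihedralAction X

    K : KleinFour
    K = klein-four (zero , true) (suc zero , false) refl refl (λ ()) (λ ()) refl (λ ())

    opaque
      odd : ∀ {N} → N ≢ 0ℤ → InverseMod N (ℤ.+ 2) → FixedIso N (Fixed N) 1
      odd N≢0 inv = klein-odd X K (act-O _) (act-O _) N≢0 inv (λ p → p _ , p _)

      fixed-if : ∀ {N x} → N ∥ KleinFour.s K x - x × N ∥ KleinFour.r K x - x → Fixed N x
      fixed-if (s , r) (zero , false) = fixed-e
      fixed-if (s , r) (zero , true) = s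
      fixed-if (s , r) (suc zero , false) = r
      fixed-if (s , r) (suc zero , true) = fixed-* (suc zero , false) (zero , true) r s

      two : FixedIso (ℤ.+ 2) (Fixed (ℤ.+ 2)) 2 ⊎ FixedIso (ℤ.+ 2) (Fixed (ℤ.+ 2)) 3
      two = decide R.rank-bounds
        where
        module KA = KleinAction K (act-O _) (act-O _)
        module R = RankTwo (λ small → KA.not-small λ Ox h → small Ox (fixed-if h))
        decide : R.C.rank ≡ 2 ⊎ R.C.rank ≡ 3 ⊎ R.C.rank ≡ 4 → FixedIso (ℤ.+ 2) (Fixed (ℤ.+ 2)) 2 ⊎ FixedIso (ℤ.+ 2) (Fixed (ℤ.+ 2)) 3
        decide (inj₁ e) = inj₁ (R.iso-of-rank e)
        decide (inj₂ (inj₁ e)) = inj₂ (R.iso-of-rank e)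
        decide (inj₂ (inj₂ e)) = ⊥-elim (KA.not-trivial λ Ox → R.all-fixed e Ox _ , R.all-fixed e Ox _)

  module D₃ (X : DihedralAction 3) where
    open DihedralAction X

    cyclic : DihedralThree
    cyclic = dihedral-three (zero , true) (suc zero , false) refl (λ ()) refl (λ ()) refl

    opaque
      coprime-to-six : ∀ {N} → N ≢ 0ℤ → InverseMod N (ℤ.+ 2) → InverseMod N (ℤ.+ 3) → FixedIso N (Fixed N) 1
      coprime-to-six N≢0 inv₂ inv₃ = units-by-averaging N≢0 (inverse-* inv₂ inv₃) fixed-int (λ Ox p → DihedralThree.average cyclic Ox (p _) (p _))

      two : FixedIso (ℤ.+ 2) (Fixed (ℤ.+ 2)) 1
      two = units (λ ()) fixed-int (λ Ox p → DihedralThree.mod-two cyclic Ox (p _) (p _))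

      -- Modulo 3 only the reflection can be averaged. It confines the fixed space to the plane
      -- spanned by 1 and w, and the class of 1 excludes rank 0.
      three : FixedIso (ℤ.+ 3) (Fixed (ℤ.+ 3)) 1 ⊎ FixedIso (ℤ.+ 3) (Fixed (ℤ.+ 3)) 2
      three = decide Ch.C.rank refl
        where
        module OI = OneInvolution (DihedralThree.S cyclic) (act-O _)
        module Ch = Chart 3 invertible₃ (fixed-subspace (ℤ.+ 3)) OI.pair OI.O-pair (OI.pair-independent (ℤ.+ 3))
          (λ Ox p → OI.pair-cover inverse-2-mod-3 Ox (p (zero , true)))
        decide : ∀ m → Ch.C.rank ≡ m → FixedIso (ℤ.+ 3) (Fixed (ℤ.+ 3)) 1 ⊎ FixedIso (ℤ.+ 3) (Fixed (ℤ.+ 3)) 2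
        decide 0 e = ⊥-elim (rank-zero {3} {Fixed (ℤ.+ 3)} (ℕP.n≤1+n 2) fixed-1 (subst (FixedIso (ℤ.+ 3) (Fixed (ℤ.+ 3))) e Ch.iso))
        decide 1 e = inj₁ (subst (FixedIso (ℤ.+ 3) (Fixed (ℤ.+ 3))) e Ch.iso)
        decide 2 e = inj₂ (subst (FixedIso (ℤ.+ 3) (Fixed (ℤ.+ 3))) e Ch.iso)
        decide (suc (suc (suc m))) e = contradiction (subst (_≤ 2) e Ch.C.rank≤) λ { (s≤s (s≤s ())) }

  module D₄ (X : DihedralAction 4) where
    open DihedralAction X

    r s : Dih 4
    r = suc zero , false
    s = zero , true

    F : DihedralFour
    F = record
      { S = involution s refl (λ ()) ; S-O = act-O s ; ρ = act r ; ρ-O = act-O r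
      ; fourth = λ x → trans (sym (rr (fun (act r) (fun (act r) x)))) (trans (cong (fun (act r²)) (sym (rr x))) (trans (sym (act-* r² r² x)) (act-e x)))
      ; square-nontrivial = λ h → act-nontrivial r² (λ ()) λ x → trans (rr x) (h x)
      ; inverts = λ x → trans (sym (act-* s r x)) (trans (act-* r³ s x) (rrr (fun (act s) x)))
      ; distinct = λ h → contradiction (faithful r² s λ x → trans (rr x) (h x)) λ () }
      where
      r² r³ : Dih 4
      r² = suc (suc zero) , false
      r³ = suc (suc (suc zero)) , false
      rr : ∀ x → fun (act r²) x ≡ fun (act r) (fun (act r) x)
      rr x = act-* r r x
      rrr : ∀ x → fun (act r³) x ≡ fun (act r) (fun (act r) (fun (act r) x))
      rrr x = trans (act-* r r² x) (cong (fun (act r)) (rr x))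

    module F = DihedralFour F

    opaque
      odd : ∀ {N} → N ≢ 0ℤ → InverseMod N (ℤ.+ 2) → FixedIso N (Fixed N) 1
      odd N≢0 inv = klein-odd X K (act-O _) (act-O _) N≢0 inv (λ p → p _ , p _)
        where
        K : KleinFour
        K = klein-four s (suc (suc zero) , false) refl refl (λ ()) (λ ()) refl (λ ())

      fixed-if : ∀ {N x} → N ∥ fun (act r) x - x → N ∥ fun (act s) x - x → Fixed N x
      fixed-if {N} {x} hr hs = λ { (k , false) → rotation k ; (k , true) → reflection k }
        where
        r² : N ∥ fun (act (suc (suc zero) , false)) x - x
        r² = fixed-* r r hr hr
        rotation : ∀ k → N ∥ fun (act (k , false)) x - x
        rotation zero = fixed-e
        rotation (suc zero) = hr
        rotation (suc (suc zero)) = r²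
        rotation (suc (suc (suc zero))) = fixed-* r (suc (suc zero) , false) hr r²
        reflection : ∀ k → N ∥ fun (act (k , true)) x - x
        reflection zero = hs
        reflection (suc zero) = fixed-* r s hr hs
        reflection (suc (suc zero)) = fixed-* (suc (suc zero) , false) s r² hs
        reflection (suc (suc (suc zero))) = fixed-* (suc (suc (suc zero)) , false) s (rotation (suc (suc (suc zero)))) hs

      -- r fixes i, and s i = -i ≡ i modulo 2.
      fixed-i : Fixed (ℤ.+ 2) F.i
      fixed-i = fixed-if (∥-equal F.r-i) (- F.i , O-neg F.O-i , trans (cong (_- F.i) F.s-i) (prove [] [] (F.i ∷ []) (⊝ x₀ ⊖ x₀) (con (ℤ.+ 2) ⊗ ⊝ x₀) [] refl))

      -- The class of i differs from 0 and 1, so the rank is at least two. Rank three or four would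
      -- make r - 1 of rank at most one on O/2.
      two : FixedIso (ℤ.+ 2) (Fixed (ℤ.+ 2)) 2
      two = decide R.rank-bounds
        where
        module R = RankTwo (λ small → [ F.i-nonzero , F.i-not-one ]′ (small F.O-i fixed-i))
        decide : R.C.rank ≡ 2 ⊎ R.C.rank ≡ 3 ⊎ R.C.rank ≡ 4 → FixedIso (ℤ.+ 2) (Fixed (ℤ.+ 2)) 2
        decide (inj₁ e) = R.iso-of-rank e
        decide (inj₂ (inj₁ e)) = let u , Ou , h = R.corank-one e in ⊥-elim (F.not-corank-one u Ou λ Ox → let k , p = h Ox in k , p r)
        decide (inj₂ (inj₂ e)) = ⊥-elim (F.r-not-trivial λ Ox → R.all-fixed e Ox r)

  module D₆ (X : DihedralAction 6) where
    open DihedralAction X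

    -- A reflection together with the central rotation r³.
    K : KleinFour
    K = klein-four (zero , true) (suc (suc (suc zero)) , false) refl refl (λ ()) (λ ()) refl (λ ())

    -- The subgroup generated by a reflection and r² is a copy of D₃. Its upper bound suffices,
    -- since integers are fixed by all of D₆.
    cyclic : DihedralThree
    cyclic = dihedral-three (zero , true) (suc (suc zero) , false) refl (λ ()) refl (λ ()) refl

    opaque
      odd : ∀ {N} → N ≢ 0ℤ → InverseMod N (ℤ.+ 2) → FixedIso N (Fixed N) 1
      odd N≢0 inv = klein-odd X K (act-O _) (act-O _) N≢0 inv (λ p → p _ , p _)

      two : FixedIso (ℤ.+ 2) (Fixed (ℤ.+ 2)) 1
      two = units (λ ()) fixed-int (λ Ox p → DihedralThree.mod-two cyclic Ox (p _) (p _))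

-- From orders in rational coordinates to abstract lattices and back.

module Conversion (a b : ℚ) (a≢0 : a ≢ 0ℚ) (b≢0 : b ≢ 0ℚ) (div : IsDivisionAlgebra a b) where
  open QuatLaws a b using (·Q-scalar; fromℚ-*; rational)

  algebra : QuaternionDivisionAlgebra
  algebra = QuatLaws.quaternionAlgebra a b a≢0 b≢0 div

  open DivisionAlgebra algebra
  open Lattices algebra
  open IntegerVectors

  vec : (Fin 4 → Quat) → Vec Quat 4
  vec e = e zero ∷ e (suc zero) ∷ e (suc (suc zero)) ∷ e (suc (suc (suc zero))) ∷ []

  vecℤ : (Fin 4 → ℤ) → Vec ℤ 4
  vecℤ c = c zero ∷ c (suc zero) ∷ c (suc (suc zero)) ∷ c (suc (suc (suc zero))) ∷ []

  all-four : {P : Fin 4 → Set} → P zero → P (suc zero) → P (suc (suc zero)) → P (suc (suc (suc zero))) → ∀ i → P i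
  all-four p q r s zero = p
  all-four p q r s (suc zero) = q
  all-four p q r s (suc (suc zero)) = r
  all-four p q r s (suc (suc (suc zero))) = s

  combination : (Fin 4 → ℚ) → (Fin 4 → Quat) → Quat
  combination r e = (fromℚ (r zero) * e zero + fromℚ (r (suc zero)) * e (suc zero))
    + (fromℚ (r (suc (suc zero))) * e (suc (suc zero)) + fromℚ (r (suc (suc (suc zero)))) * e (suc (suc (suc zero))))

  opaque
    lincomb-combination : ∀ r e → lincomb r e ≡ combination r e
    lincomb-combination r e = cong₂ _+_ (cong₂ _+_ (scalar zero) (scalar (suc zero))) (cong₂ _+_ (scalar (suc (suc zero))) (scalar (suc (suc (suc zero)))))
      where
      scalar : ∀ i → r i ·Q e i ≡ fromℚ (r i) * e i
      scalar i = ·Q-scalar (r i) (e i)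

    reassociate : ∀ (x y z w : Quat) → x + y + (z + w) ≡ x + (y + (z + (w + 0#)))
    reassociate x y z w = prove [] [] (x ∷ y ∷ z ∷ w ∷ []) (x₀ ⊕ x₁ ⊕ (x₂ ⊕ x₃)) (x₀ ⊕ (x₁ ⊕ (x₂ ⊕ (x₃ ⊕ 𝟘)))) [] refl

    lincomb-lin : ∀ c e → lincomb (λ i → ℤtoℚ (c i)) e ≡ lin (vecℤ c) (vec e)
    lincomb-lin c e = trans (lincomb-combination (λ i → ℤtoℚ (c i)) e) (reassociate (term zero) (term (suc zero)) (term (suc (suc zero))) (term (suc (suc (suc zero)))))
      where
      term : Fin 4 → Quat
      term i = int (c i) * e i

    vecℤ-lookup : ∀ v → vecℤ (lookup v) ≡ v
    vecℤ-lookup (_ ∷ _ ∷ _ ∷ _ ∷ []) = refl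

    lin-lincomb : ∀ v e → lin v (vec e) ≡ lincomb (λ i → ℤtoℚ (lookup v i)) e
    lin-lincomb v e = sym (trans (lincomb-lin (lookup v) e) (cong (λ w → lin w (vec e)) (vecℤ-lookup v)))

    vec-lookup : ∀ (es : Vec Quat 4) → vec (lookup es) ≡ es
    vec-lookup (_ ∷ _ ∷ _ ∷ _ ∷ []) = refl

    common-denominator : ∀ r e → ∃₂ λ d c → d ≢ 0ℤ × int d * lincomb r e ≡ lin (vecℤ c) (vec e) × (∀ i → ∃ λ k → k ≢ 0ℤ × int k * fromℚ (r i) ≡ int (c i))
    common-denominator r e
      with d₀ , n₀ , p₀ , h₀ ← rational (r zero) with d₁ , n₁ , p₁ , h₁ ← rational (r (suc zero))
      with d₂ , n₂ , p₂ , h₂ ← rational (r (suc (suc zero))) with d₃ , n₃ , p₃ , h₃ ← rational (r (suc (suc (suc zero)))) =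
      D , c , D≢0 , trans (cong (int D *_) (lincomb-combination r e)) (expand (fromℚ (r zero)) (fromℚ (r (suc zero))) (fromℚ (r (suc (suc zero)))) (fromℚ (r (suc (suc (suc zero))))) h₀ h₁ h₂ h₃ (e zero) (e (suc zero)) (e (suc (suc zero))) (e (suc (suc (suc zero))))) ,
      all-four (D , D≢0 , scale₀ _ h₀) (D , D≢0 , scale₁ _ h₁) (D , D≢0 , scale₂ _ h₂) (D , D≢0 , scale₃ _ h₃)
      where
      D : ℤ
      D = d₀ ℤ.* d₁ ℤ.* d₂ ℤ.* d₃
      c : Fin 4 → ℤ
      c zero = n₀ ℤ.* d₁ ℤ.* d₂ ℤ.* d₃
      c (suc zero) = d₀ ℤ.* n₁ ℤ.* d₂ ℤ.* d₃
      c (suc (suc zero)) = d₀ ℤ.* d₁ ℤ.* n₂ ℤ.* d₃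
      c (suc (suc (suc zero))) = d₀ ℤ.* d₁ ℤ.* d₂ ℤ.* n₃
      product≢0 : ∀ {k l} → k ≢ 0ℤ → l ≢ 0ℤ → k ℤ.* l ≢ 0ℤ
      product≢0 {k} p q h = [ p , q ]′ (ℤP.i*j≡0⇒i≡0∨j≡0 k h)
      D≢0 : D ≢ 0ℤ
      D≢0 = product≢0 (product≢0 (product≢0 p₀ p₁) p₂) p₃
      zs : List ℤ
      zs = d₀ ∷ d₁ ∷ d₂ ∷ d₃ ∷ n₀ ∷ n₁ ∷ n₂ ∷ n₃ ∷ []
      scale₀ : ∀ q → int d₀ * q ≡ int n₀ → int D * q ≡ int (c zero)
      scale₀ q h = prove [] zs (q ∷ []) (ι (z₀ ⊗ z₁ ⊗ z₂ ⊗ z₃) ⊗ x₀) (ι (z₄ ⊗ z₁ ⊗ z₂ ⊗ z₃)) ((ι (z₁ ⊗ z₂ ⊗ z₃) ·[ ι z₀ ⊗ x₀ ≈ ι z₄ by h ]· 𝟙) ∷ []) refl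
      scale₁ : ∀ q → int d₁ * q ≡ int n₁ → int D * q ≡ int (c (suc zero))
      scale₁ q h = prove [] zs (q ∷ []) (ι (z₀ ⊗ z₁ ⊗ z₂ ⊗ z₃) ⊗ x₀) (ι (z₀ ⊗ z₅ ⊗ z₂ ⊗ z₃)) ((ι (z₀ ⊗ z₂ ⊗ z₃) ·[ ι z₁ ⊗ x₀ ≈ ι z₅ by h ]· 𝟙) ∷ []) refl
      scale₂ : ∀ q → int d₂ * q ≡ int n₂ → int D * q ≡ int (c (suc (suc zero)))
      scale₂ q h = prove [] zs (q ∷ []) (ι (z₀ ⊗ z₁ ⊗ z₂ ⊗ z₃) ⊗ x₀) (ι (z₀ ⊗ z₁ ⊗ 𝕫 6 ⊗ z₃)) ((ι (z₀ ⊗ z₁ ⊗ z₃) ·[ ι z₂ ⊗ x₀ ≈ ι (𝕫 6) by h ]· 𝟙) ∷ []) refl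
      scale₃ : ∀ q → int d₃ * q ≡ int n₃ → int D * q ≡ int (c (suc (suc (suc zero))))
      scale₃ q h = prove [] zs (q ∷ []) (ι (z₀ ⊗ z₁ ⊗ z₂ ⊗ z₃) ⊗ x₀) (ι (z₀ ⊗ z₁ ⊗ z₂ ⊗ 𝕫 7)) ((ι (z₀ ⊗ z₁ ⊗ z₂) ·[ ι z₃ ⊗ x₀ ≈ ι (𝕫 7) by h ]· 𝟙) ∷ []) refl
      expand : ∀ q₀ q₁ q₂ q₃ → int d₀ * q₀ ≡ int n₀ → int d₁ * q₁ ≡ int n₁ → int d₂ * q₂ ≡ int n₂ → int d₃ * q₃ ≡ int n₃ → ∀ w₀ w₁ w₂ w₃ →
        int D * (q₀ * w₀ + q₁ * w₁ + (q₂ * w₂ + q₃ * w₃)) ≡ lin (vecℤ c) (w₀ ∷ w₁ ∷ w₂ ∷ w₃ ∷ [])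
      expand q₀ q₁ q₂ q₃ h₀ h₁ h₂ h₃ w₀ w₁ w₂ w₃ = trans (prove [] (D ∷ []) (q₀ * w₀ ∷ q₁ * w₁ ∷ q₂ * w₂ ∷ q₃ * w₃ ∷ [])
          (ι z₀ ⊗ (x₀ ⊕ x₁ ⊕ (x₂ ⊕ x₃))) (ι z₀ ⊗ x₀ ⊕ ι z₀ ⊗ x₁ ⊕ (ι z₀ ⊗ x₂ ⊕ ι z₀ ⊗ x₃)) [] refl)
        (trans (cong₂ _+_ (cong₂ _+_ (term {q₀} {w₀} (c zero) (scale₀ q₀ h₀)) (term {q₁} {w₁} (c (suc zero)) (scale₁ q₁ h₁))) (cong₂ _+_ (term {q₂} {w₂} (c (suc (suc zero))) (scale₂ q₂ h₂)) (term {q₃} {w₃} (c (suc (suc (suc zero)))) (scale₃ q₃ h₃)))) (reassociate (int (c zero) * w₀) (int (c (suc zero)) * w₁) (int (c (suc (suc zero))) * w₂) (int (c (suc (suc (suc zero)))) * w₃)))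
        where
        term : ∀ {q w} k → int D * q ≡ int k → int D * (q * w) ≡ int k * w
        term {q} {w} k h = trans (sym (*-assoc (int D) q w)) (cong (_* w) h)

    ℚ-inverse : ∀ d → d ≢ 0ℤ → ∃ λ q → q ℚ.* ℤtoℚ d ≡ 1ℚ
    ℚ-inverse d d≢0 = (ℚ.1/ ℤtoℚ d) {{nz}} , ℚP.*-inverseˡ (ℤtoℚ d) {{nz}}
      where
      nz : ℚ.NonZero (ℤtoℚ d)
      nz = ℚ.≢-nonZero λ h → d≢0 (ℤtoℚ-zero d h)

  order→lattice : ∀ {O} → IsOrder a b O → IsLattice O
  order→lattice {O} isO = record
    { basis = vec basis
    ; independent = ind
    ; member = λ x → mk⇔
        (λ Ox → let c , e = Equivalence.to (lattice x) Ox in vecℤ c , trans e (lincomb-lin c basis))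
        (λ { (v , e) → Equivalence.from (lattice x) (lookup v , trans e (lin-lincomb v basis)) })
    ; full = λ x → let r , e = spans x ; d , c , d≢0 , h , _ = common-denominator r basis in
        d , d≢0 , Equivalence.from (lattice _) (c , trans (cong (int d *_) e) (trans h (sym (lincomb-lin c basis)))) }
    where
    open IsOrder isO
    ind : Independent (vec basis)
    ind v h = trans (sym (vecℤ-lookup v)) (all-zero (lookup v) (λ i → ℤtoℚ-zero (lookup v i) (independent (λ i → ℤtoℚ (lookup v i)) (trans (sym (lin-lincomb v basis)) h) i)))
      where
      all-zero : ∀ c → (∀ i → c i ≡ 0ℤ) → vecℤ c ≡ 0ᵥ 4
      all-zero c h = cong₂ _∷_ (h zero) (cong₂ _∷_ (h (suc zero)) (cong₂ _∷_ (h (suc (suc zero))) (cong (_∷ []) (h (suc (suc (suc zero)))))))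

  -- Maximality quantifies over orders in rational coordinates, so each overlattice built abstractly
  -- has to be returned to that form. Independence over ℚ follows from independence over ℤ by
  -- clearing denominators.
  lattice→order : ∀ {L} → IsLattice L → L 1# → (∀ {x y} → L x → L y → L (x * y)) → IsOrder a b L
  lattice→order {L} lat L1 L* = record
    { basis = e
    ; spans = λ x → let d , d≢0 , Ldx = full x ; v , h = Equivalence.to (member _) Ldx ; q , qd = ℚ-inverse d d≢0 in
        (λ i → q ℚ.* ℤtoℚ (lookup v i)) , divide x d q v qd h
    ; independent = λ r h i → let d , c , d≢0 , h′ , k = common-denominator r e in
        cong Quat.q0 (integral-domain (int-nonzero (proj₁ (proj₂ (k i)))) (trans (proj₂ (proj₂ (k i))) (trans (cong int (zeros c (trans (sym h′) (trans (cong (int d *_) h) (zeroʳ (int d)))) i)) int-0)))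
    ; lattice = λ x → mk⇔
        (λ Lx → let v , h = Equivalence.to (member x) Lx in lookup v , trans h (trans (cong (lin v) (sym (vec-lookup basis))) (lin-lincomb v e)))
        (λ { (c , h) → Equivalence.from (member x) (vecℤ c , trans h (trans (lincomb-lin c e) (cong (lin (vecℤ c)) (vec-lookup basis)))) })
    ; has-one = L1
    ; mul-closed = λ _ _ → L* }
    where
    open IsLattice lat
    e : Fin 4 → Quat
    e = lookup basis
    zeros : ∀ c → lin (vecℤ c) (vec e) ≡ 0# → ∀ i → c i ≡ 0ℤ
    zeros c h with p , h₁ ← ∷-injective (independent (vecℤ c) (trans (cong (lin (vecℤ c)) (sym (vec-lookup basis))) h))
      with q , h₂ ← ∷-injective h₁ with r , h₃ ← ∷-injective h₂ = all-four p q r (proj₁ (∷-injective h₃))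
    opaque
      divide : ∀ x d q v → q ℚ.* ℤtoℚ d ≡ 1ℚ → int d * x ≡ lin v basis → x ≡ lincomb (λ i → q ℚ.* ℤtoℚ (lookup v i)) e
      divide x d q v qd h = trans (sym (trans (sym (*-assoc (fromℚ q) (int d) x)) (trans (cong (_* x) (trans (sym (fromℚ-* q (ℤtoℚ d))) (cong fromℚ qd))) (*-identityˡ x))))
        (trans (cong (fromℚ q *_) (trans h (trans (cong (lin v) (sym (vec-lookup basis))) (trans (lin-lincomb v e) (lincomb-combination (λ i → ℤtoℚ (lookup v i)) e)))))
          (trans (distribute (fromℚ q) (scaled zero) (scaled (suc zero)) (scaled (suc (suc zero))) (scaled (suc (suc (suc zero))))) (trans (cong₂ _+_ (cong₂ _+_ (term zero) (term (suc zero))) (cong₂ _+_ (term (suc (suc zero))) (term (suc (suc (suc zero))))))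
            (sym (lincomb-combination (λ i → q ℚ.* ℤtoℚ (lookup v i)) e)))))
        where
        scaled : Fin 4 → Quat
        scaled i = fromℚ (ℤtoℚ (lookup v i)) * e i
        distribute : ∀ (p x y z w : Quat) → p * (x + y + (z + w)) ≡ p * x + p * y + (p * z + p * w)
        distribute p x y z w = prove [] [] (p ∷ x ∷ y ∷ z ∷ w ∷ []) (x₀ ⊗ (x₁ ⊕ x₂ ⊕ (x₃ ⊕ x₄))) (x₀ ⊗ x₁ ⊕ x₀ ⊗ x₂ ⊕ (x₀ ⊗ x₃ ⊕ x₀ ⊗ x₄)) [] refl
        term : ∀ i → fromℚ q * (fromℚ (ℤtoℚ (lookup v i)) * e i) ≡ fromℚ (q ℚ.* ℤtoℚ (lookup v i)) * e i
        term i = trans (sym (*-assoc (fromℚ q) (fromℚ (ℤtoℚ (lookup v i))) (e i))) (cong (_* e i) (sym (fromℚ-* q (ℤtoℚ (lookup v i)))))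

  maximalOrder : ∀ {O} → IsMaximalOrder a b O → MaximalOrder O
  maximalOrder max = record
    { lattice = order→lattice isOrder
    ; O-1 = IsOrder.has-one isOrder
    ; O-* = λ {x} {y} → IsOrder.mul-closed isOrder x y
    ; maximal = λ L lat L1 L* sub {x} Lx → maximal L (lattice→order lat L1 L*) (λ x → sub) x Lx }
    where open IsMaximalOrder max

-- The given subgroup of Aut(O) as a dihedral action.

module Subgroup (a b : ℚ) (a≢0 : a ≢ 0ℚ) (b≢0 : b ≢ 0ℚ) (div : IsDivisionAlgebra a b) (O : SubsetQ) (max : IsMaximalOrder a b O) {n : ℕ} .{{_ : NonZero n}} (φ : Dih n → Quat → Quat) (isD : IsDihedralSubgroup a b O n φ) where
  open QuatLaws a b using (·Q-scalar)
  open Conversion a b a≢0 b≢0 div using (algebra; maximalOrder)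
  open Representations algebra O (maximalOrder max) public
  open IsDihedralSubgroup isD
  private
    module E (g : Dih n) = Extend (φ g) (λ {x} → IsRingAut.preserves (aut g) x) (λ {x} {y} → IsRingAut.additive (aut g) x y)
      (λ {x} {y} → IsRingAut.multiplicative (aut g) x y) (IsRingAut.unital (aut g))

  -- φ is controlled only on O. Every element has an integer multiple in O, so the group laws pass
  -- to the extensions, and faithfulness is detected on O.
  action : DihedralAction n
  action = record
    { act = E.automorphism
    ; act-O = λ g → E.preserves g
    ; act-e = extensionality (fun-int* (E.automorphism (dih-e n))) (λ _ _ → refl) (λ Ox → trans (E.agrees _ Ox) (hom-e _ Ox))
    ; act-* = λ g h → extensionality (fun-int* (E.automorphism (dih-mul n g h)))
        (λ k x → trans (cong (E.extension g) (fun-int* (E.automorphism h) k x)) (fun-int* (E.automorphism g) k _))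
        (λ {x} Ox → trans (E.agrees _ Ox) (trans (hom-mul g h x Ox) (sym (trans (cong (E.extension g) (E.agrees h Ox)) (E.agrees g (IsRingAut.preserves (aut h) x Ox))))))
    ; faithful = λ g h eq → faithful g h λ x Ox → trans (sym (E.agrees g Ox)) (trans (eq x) (E.agrees h Ox)) }

  opaque
    from-∥ : ∀ N {x} → ℤ.+ N ∥ x → InNO O N x
    from-∥ N (y , Oy , e) = y , Oy , trans e (sym (·Q-scalar (ℤtoℚ (ℤ.+ N)) y))

    to-∥ : ∀ N {x} → InNO O N x → ℤ.+ N ∥ x
    to-∥ N (y , Oy , e) = y , Oy , trans e (·Q-scalar (ℤtoℚ (ℤ.+ N)) y)

    isomorphism : ∀ {N m} → FixedIso (ℤ.+ N) (DihedralAction.Fixed action (ℤ.+ N)) m → FixedIsoZmodN O N φ m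
    isomorphism {N} F = record
      { f = f
      ; f-in-O = f-O
      ; f-fixed = λ c g → from-∥ N (subst (λ y → ℤ.+ N ∥ y - f c) (E.agrees g (f-O c)) (f-P c g))
      ; f-hom = λ c d → from-∥ N (f-+ c d)
      ; f-surj = λ x Ox p → let c , h = f-surjective Ox (λ g → subst (λ y → ℤ.+ N ∥ y - x) (sym (E.agrees g Ox)) (to-∥ N (p g))) in c , from-∥ N h
      ; f-kernel = λ c → mk⇔
          (λ h i → let l , e = f-kernel c (to-∥ N h) i in ∣⇒∣ᵤ (divides l (trans e (ℤP.*-comm (ℤ.+ N) l))))
          (λ h → from-∥ N (f-kernel⁻¹ c λ i → quotient∣ (∣ᵤ⇒∣ (h i)))) }
      where
      open FixedIso F
      quotient∣ : ∀ {k} → ℤ.+ N ℤS.∣ k → ∃ λ l → k ≡ ℤ.+ N ℤ.* l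
      quotient∣ (divides l e) = l , trans e (ℤP.*-comm l (ℤ.+ N))

-- The fixed rings for each admissible n.

positive-nonzero : ∀ {N} → N ≥ 1 → ℤ.+ N ≢ 0ℤ
positive-nonzero (s≤s _) ()

theorem2p6 : (a b : ℚ) → a ≢ 0ℚ → b ≢ 0ℚ →
    IsDivisionAlgebra a b → IsIndefinite a b →
    (O : SubsetQ) → IsMaximalOrder a b O →
    (n : ℕ) .{{_ : NonZero n}} →
    (n ≡ 1 ⊎ n ≡ 2 ⊎ n ≡ 3 ⊎ n ≡ 4 ⊎ n ≡ 6) →
    (φ : Dih n → Quat → Quat) → IsDihedralSubgroup a b O n φ →
    ((N : ℕ) → N ≥ 1 → Coprime N 2 → Coprime N 3 →
    (n ≡ 1 → FixedIsoZmodN O N φ 2) ×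
    (n ≡ 2 ⊎ n ≡ 3 ⊎ n ≡ 4 ⊎ n ≡ 6 → FixedIsoZmodN O N φ 1))
    × ((n ≡ 1 → FixedIsoZmodN O 3 φ 2) ×
    (n ≡ 2 ⊎ n ≡ 4 ⊎ n ≡ 6 → FixedIsoZmodN O 3 φ 1) ×
    (n ≡ 3 → FixedIsoZmodN O 3 φ 1 ⊎ FixedIsoZmodN O 3 φ 2))
    × ((n ≡ 1 → FixedIsoZmodN O 2 φ 2 ⊎ FixedIsoZmodN O 2 φ 3 ⊎ FixedIsoZmodN O 2 φ 4) ×
    (n ≡ 2 → FixedIsoZmodN O 2 φ 2 ⊎ FixedIsoZmodN O 2 φ 3) ×
    (n ≡ 4 → FixedIsoZmodN O 2 φ 2) ×
    (n ≡ 3 ⊎ n ≡ 6 → FixedIsoZmodN O 2 φ 1))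
theorem2p6 a b a≢0 b≢0 div _ O max n (inj₁ refl) φ isD =
    (λ N N≥1 c₂ c₃ → (λ _ → isomorphism (X.odd (inverse-of-coprime c₂))) ,
      λ { (inj₁ ()) ; (inj₂ (inj₁ ())) ; (inj₂ (inj₂ (inj₁ ()))) ; (inj₂ (inj₂ (inj₂ ()))) }) ,
    ((λ _ → isomorphism (X.odd inverse-2-mod-3)) , (λ { (inj₁ ()) ; (inj₂ (inj₁ ())) ; (inj₂ (inj₂ ())) }) , λ ()) ,
    ((λ _ → Sum.map isomorphism (Sum.map isomorphism isomorphism) X.two) , (λ ()) , (λ ()) , λ { (inj₁ ()) ; (inj₂ ()) })
  where
  open Subgroup a b a≢0 b≢0 div O max φ isD
  module X = D₁ action
theorem2p6 a b a≢0 b≢0 div _ O max n (inj₂ (inj₁ refl)) φ isD =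
    (λ N N≥1 c₂ c₃ → (λ ()) , λ _ → isomorphism (X.odd (positive-nonzero N≥1) (inverse-of-coprime c₂))) ,
    ((λ ()) , (λ _ → isomorphism (X.odd (λ ()) inverse-2-mod-3)) , λ ()) ,
    ((λ ()) , (λ _ → Sum.map isomorphism isomorphism X.two) , (λ ()) , λ { (inj₁ ()) ; (inj₂ ()) })
  where
  open Subgroup a b a≢0 b≢0 div O max φ isD
  module X = D₂ action
theorem2p6 a b a≢0 b≢0 div _ O max n (inj₂ (inj₂ (inj₁ refl))) φ isD =
    (λ N N≥1 c₂ c₃ → (λ ()) , λ _ → isomorphism (X.coprime-to-six (positive-nonzero N≥1) (inverse-of-coprime c₂) (inverse-of-coprime c₃))) ,
    ((λ ()) , (λ { (inj₁ ()) ; (inj₂ (inj₁ ())) ; (inj₂ (inj₂ ())) }) , λ _ → Sum.map isomorphism isomorphism X.three) ,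
    ((λ ()) , (λ ()) , (λ ()) , λ _ → isomorphism X.two)
  where
  open Subgroup a b a≢0 b≢0 div O max φ isD
  module X = D₃ action
theorem2p6 a b a≢0 b≢0 div _ O max n (inj₂ (inj₂ (inj₂ (inj₁ refl)))) φ isD =
    (λ N N≥1 c₂ c₃ → (λ ()) , λ _ → isomorphism (X.odd (positive-nonzero N≥1) (inverse-of-coprime c₂))) ,
    ((λ ()) , (λ _ → isomorphism (X.odd (λ ()) inverse-2-mod-3)) , λ ()) ,
    ((λ ()) , (λ ()) , (λ _ → isomorphism X.two) , λ { (inj₁ ()) ; (inj₂ ()) })
  where
  open Subgroup a b a≢0 b≢0 div O max φ isD
  module X = D₄ action
theorem2p6 a b a≢0 b≢0 div _ O max n (inj₂ (inj₂ (inj₂ (inj₂ refl)))) φ isD =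
    (λ N N≥1 c₂ c₃ → (λ ()) , λ _ → isomorphism (X.odd (positive-nonzero N≥1) (inverse-of-coprime c₂))) ,
    ((λ ()) , (λ _ → isomorphism (X.odd (λ ()) inverse-2-mod-3)) , λ ()) ,
    ((λ ()) , (λ ()) , (λ ()) , λ _ → isomorphism X.two)
  where
  open Subgroup a b a≢0 b≢0 div O max φ isD
  module X = D₆ action
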